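{- The set of all odd positive integers $m$ with the property that for every integer $s\ge 1$ and every even integer $a$ the residue class $a \pmod{2^s m}$ contains infinitely many totients has positive lower asymptotic density.
   Context: A totient is a value $\phi(n)$ of Euler's function for some positive integer $n$; a residue class contains infinitely many totients if infinitely many distinct totients lie in it. -}

module Defs where

open import Data.Nat using (ℕ; suc; _*_; _^_; _≤_; _<_; _≥_)
open import Data.Nat.Coprimality using (coprime?)
open import Data.Nat.Divisibility using (_∣_)
open import Data.Integer as ℤ using (ℤ; +_)
import Data.Integer.Divisibility as ℤD
open import Data.List using (List; length; filter; map; upTo)
open import Data.List.Relation.Unary.All using (All)
open import Data.List.Relation.Unary.Unique.Propositional using (Unique)
open import Data.Product using (Σ; ∃; _×_)
open import Relation.Nullary using (¬_)
open import Relation.Binary.PropositionalEquality using (_≡_)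

φ : ℕ → ℕ
φ n = length (filter (λ k → coprime? k n) (map suc (upTo n)))

IsTotient : ℕ → Set
IsTotient t = Σ ℕ λ n → 1 ≤ n × φ n ≡ t

_≡_[mod_] : ℤ → ℤ → ℕ → Set
x ≡ y [mod M ] = (+ M) ℤD.∣ (x ℤ.- y)

InfManyTotientsIn : ℤ → ℕ → Set
InfManyTotientsIn a M =
  ∀ (N : ℕ) → Σ ℕ λ t → N ≤ t × IsTotient t × ((+ t) ≡ a [mod M ])

Good : ℕ → Set
Good m = ∀ (s : ℕ) → 1 ≤ s → ∀ (a : ℤ) → (+ 2) ℤD.∣ a →
         InfManyTotientsIn a (2 ^ s * m)

Odd : ℕ → Set
Odd m = ¬ (2 ∣ m)

-- a set P ⊆ ℕ⁺ has positive lower asymptotic density: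
-- liminf_{x→∞} #{ m ≤ x : P m } / x > 0, i.e. there are a rational c = p/q > 0
-- and X₀ such that for all x ≥ X₀ there are at least c·x elements
-- of P in [1, x] (witnessed by a duplicate-free list of such elements).
PositiveLowerDensity : (ℕ → Set) → Set
PositiveLowerDensity P =
  Σ ℕ λ p → Σ ℕ λ q → 1 ≤ p × 1 ≤ q × Σ ℕ λ X₀ → ∀ (x : ℕ) → X₀ ≤ x →
    Σ (List ℕ) λ ms → Unique ms × All (λ m → 1 ≤ m × m ≤ x × P m) ms
      × p * x ≤ q * length ms

{-# OPTIONS --safe #-}

-- Only totients p^k (p - 1) of prime powers are used. To place one in the class of an even a modulo 2^s m, Dirichlet's
-- theorem supplies a prime p ≡ x, where x is a unit with x^k (x - 1) ≡ a; replacing k by k plus a multiple of the order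
-- of x gives infinitely many totients. Modulo 2^s the choice x = a + 1, k = 0 works. Modulo a prime q write q - 1 = s d
-- with s the smooth part of q - 1. If s is small, a second moment count of the incidences between lines and the subgroup
-- of order d gives an x of exact order d with (x - 1) / a in that subgroup, hence x^k (x - 1) ≡ a for some k. The Chinese
-- remainder theorem, for x modulo the prime factors of m and for k modulo their orders d, combines these solutions when m
-- is squarefree and the orders are pairwise coprime. Among the m ≡ 1 modulo Y!, those with a square factor, with a prime
-- factor q such that q - 1 has a large smooth part, or with two prime factors q, q′ such that a large prime divides both
-- q - 1 and q′ - 1, are excluded; the excluded moduli have convergent reciprocal sums, so for large Y at most half of
-- the progression is lost.
--
-- Dirichlet's theorem is proved in an ordered field, without real logarithms: log is replaced by a completely additive
-- function that approximates it up to a bound B. If the class l had no primes, Selberg's symmetry formula would force the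
-- primes into exactly one of the two cosets of an index 2 subgroup of the units, that is, χ(p) = -1 for most primes and
-- a quadratic character χ; this contradicts the lower bound for L(1, χ), obtained from a Lambert series.
module Submission where

open import Defs
open import Data.Empty using (⊥; ⊥-elim)
open import Data.List using (List; []; _∷_; _++_; length; filter; map; upTo; [_])
open import Data.List.Membership.Propositional using (_∈_)
import Data.List.Properties as LP
open import Data.List.Relation.Binary.Permutation.Propositional as Perm using (_↭_; ↭-sym; prep; swap)
open import Data.List.Relation.Binary.Permutation.Propositional.Properties using (All-resp-↭; ↭-length)
import Data.List.Relation.Binary.Permutation.Setoid.Properties as PS
open import Data.List.Relation.Unary.All as All using (All; []; _∷_)
open import Data.List.Relation.Unary.All.Properties as AllP using (++⁺)
open import Data.List.Relation.Unary.AllPairs using ([]; _∷_; AllPairs)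
open import Data.List.Relation.Unary.Any using (here; there)
open import Data.List.Relation.Unary.Unique.Propositional using (Unique)
import Data.List.Relation.Unary.Unique.Propositional.Properties as UniqueP
open import Data.Nat as ℕ using (ℕ; zero; suc; z≤n; s≤s; _≤_; _<_; _≤?_; _≟_; _*_; _+_; _/_; _^_; _∸_; NonZero; _%_; _<?_; _!)
open import Data.Nat.Base using (nonTrivial⇒n>1)
open import Data.Nat.Coprimality as CP using (Coprime; gcd≡1⇒coprime; coprime?; coprime-Bézout; 1-coprimeTo; prime⇒coprime; coprime-divisor)
import Data.Nat.DivMod as DM
open import Data.Nat.Divisibility using (_∣_; _∣?_; divides; *-monoʳ-∣; *-cancelˡ-∣; m∣m*n; ∣-trans; ∣1⇒≡1; n∣m*n; ∣-refl; %-presˡ-∣; ∣n∣m%n⇒∣m; ∣m+n∣m⇒∣n; m≤n⇒m!∣n!)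
open import Data.Nat.GCD using (gcd; gcd[m,n]∣m; gcd[m,n]∣n; gcd[m,n]≡0⇒m≡0; module Bézout; gcd-GCD)
open import Data.Nat.ListAction using (product)
open import Data.Nat.ListAction.Properties using (product-++)
open import Data.Nat.Primality using (Prime; prime⇒nonTrivial; prime⇒irreducible; euclidsLemma; ¬prime[1]; prime?; prime⇒nonZero; prime[2])
open import Data.Nat.Primality.Factorisation using (PrimeFactorisation; factors; factorise; factorisationUnique; factorisationHasAllPrimeFactors)
import Data.Nat.Properties as ℕP
open import Data.Nat.Tactic.RingSolver using (solve-∀)
open import Data.Product using (_×_; _,_; proj₁; proj₂; ∃; Σ)
open import Data.Sum using (_⊎_; inj₁; inj₂)
open import Relation.Binary using (tri<; tri≈; tri>)
open import Relation.Binary.PropositionalEquality using (_≡_; refl; sym; trans; cong; cong₂; subst; _≢_; module ≡-Reasoning; setoid)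
open import Relation.Nullary using (¬_; Dec; yes; no)
open import Relation.Nullary.Decidable using (_×-dec_; ¬?; decidable-stable)

-- The orders `q - 1` of the unit groups are never coprime in pairs: all odd `q` share the factor 2,
-- and many share other small primes. So the exponent is solved only modulo a part `d` of `q - 1`
-- free of small primes, and powers of 2 are left to the modulus `2 ^ s`. A constant smoothness
-- bound would not do. It has to grow with `q` for the pairs with a common large prime to have a
-- convergent reciprocal sum, yet slowly enough that `q - 1` rarely has a large smooth part. Hence
-- the blocks from `2 ^ (2 ^ u)` to `2 ^ (2 ^ suc u)`, each with the single bound `2 ^ (3 * u + 8)`,
-- polylogarithmic in `q`. Counting multiples of `D` inside the progression modulo `P` costs an
-- error `P` for each `D`, which is affordable for finitely many `D` only. The remaining `D` are
-- counted among all integers, which loses a factor `P`; so a second cut-off is chosen after `P`. In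
-- the proof of Dirichlet's theorem no limit is taken: two scales `x₁` and `X`, with `L X` a fixed
-- multiple of `L x₁`, take the place of asymptotics, and a class free of primes up to `X` is
-- refuted.

-- Ordered field arithmetic and certificates for inequalities.

module Field where
  open import Data.Integer as ℤ using (ℤ; +_; -[1+_])
  import Data.Integer.Properties as ℤP
  open import Data.Rational as ℚ using (ℚ; 0ℚ; 1ℚ)
  import Data.Rational.Properties as ℚP
  open import Data.Maybe using (Maybe; just; nothing)
  open import Algebra.Bundles using (CommutativeRing)
  open import Algebra.Structures using (IsCommutativeRing)
  import Algebra.Solver.Ring.AlmostCommutativeRing as ACR
  import Algebra.Solver.Ring as Solver

  infixl 6 _⊕_ _⊖_
  infixl 7 _⊗_
  infix  8 ⊝_
  infix  4 _≼_
  infix  9 #_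

  private
    ℚ-sq-cancel : ∀ {x y} → 0ℚ ℚ.≤ y → x ℚ.* x ℚ.≤ y ℚ.* y → x ℚ.≤ y
    ℚ-sq-cancel {x} {y} 0≤y h with ℚP._≤?_ x y
    ... | yes p = p
    ... | no p  = ⊥-elim (ℚP.<-irrefl refl (ℚP.<-≤-trans (ℚP.≤-<-trans
        (ℚP.*-monoˡ-≤-nonNeg y {{ℚ.nonNegative 0≤y}} (ℚP.<⇒≤ y<x)) (ℚP.*-monoˡ-<-pos x {{ℚ.positive (ℚP.≤-<-trans 0≤y y<x)}} y<x)) h))
      where
      y<x : y ℚ.< x
      y<x = ℚP.≰⇒> p

  abstract
    -- The rationals are sealed here, so that no later conversion check evaluates a fraction; what
    -- follows rests on the ordered field laws exported by this block.
    F : Set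
    F = ℚ

    _⊕_ _⊗_ : F → F → F
    _⊕_ = ℚ._+_
    _⊗_ = ℚ._*_

    ⊝_ : F → F
    ⊝_ = ℚ.-_

    _≼_ : F → F → Set
    _≼_ = ℚ._≤_

    #_ : ℕ → F
    # zero  = 0ℚ
    # suc n = 1ℚ ℚ.+ # n

    isRing : IsCommutativeRing {A = F} _≡_ _⊕_ _⊗_ ⊝_ (# 0) (# 1)
    isRing = ℚP.+-*-isCommutativeRing

    ≼-refl : ∀ {x} → x ≼ x
    ≼-refl = ℚP.≤-refl

    ≼-trans : ∀ {x y z} → x ≼ y → y ≼ z → x ≼ z
    ≼-trans = ℚP.≤-trans

    ≼-antisym : ∀ {x y} → x ≼ y → y ≼ x → x ≡ y
    ≼-antisym = ℚP.≤-antisym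

    ≼-total : ∀ x y → x ≼ y ⊎ y ≼ x
    ≼-total = ℚP.≤-total

    _≼?_ : ∀ x y → Dec (x ≼ y)
    _≼?_ = ℚP._≤?_

    ⊕-mono : ∀ {x y z w} → x ≼ y → z ≼ w → x ⊕ z ≼ y ⊕ w
    ⊕-mono = ℚP.+-mono-≤

    nn-⊗ : ∀ {x y} → # 0 ≼ x → # 0 ≼ y → # 0 ≼ x ⊗ y
    nn-⊗ {x} {y} p q = ℚP.nonNegative⁻¹ (x ℚ.* y) {{ℚP.nonNeg*nonNeg⇒nonNeg x {{ℚ.nonNegative p}} y {{ℚ.nonNegative q}}}}

    #-suc : ∀ n → # (suc n) ≡ # 1 ⊕ # n
    #-suc n = refl

    0≼1 : # 0 ≼ # 1
    0≼1 = ℚP.nonNegative⁻¹ (# 1)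

    1⋠0 : ¬ (# 1 ≼ # 0)
    1⋠0 p with ℚP.≤-antisym p 0≼1
    ... | ()

    sq-cancel : ∀ {x y} → # 0 ≼ y → x ⊗ x ≼ y ⊗ y → x ≼ y
    sq-cancel = ℚ-sq-cancel

    -- Value 0 below 1 is a default. Every denominator of the proof is at least 1, and that bound is
    -- easier to carry around than nonvanishing.
    inv : F → F
    inv x with ℚP._≤?_ 1ℚ x
    ... | yes p = ℚ.1/_ x {{ℚ.>-nonZero (ℚP.<-≤-trans (ℚP.positive⁻¹ 1ℚ) p)}}
    ... | no _  = 0ℚ

    inv-law : ∀ {x} → # 1 ≼ x → x ⊗ inv x ≡ # 1
    inv-law {x} p with ℚP._≤?_ 1ℚ x
    ... | yes q = ℚP.*-inverseʳ x {{ℚ.>-nonZero (ℚP.<-≤-trans (ℚP.positive⁻¹ 1ℚ) q)}}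
    ... | no q  = ⊥-elim (q p)

  _⊖_ : F → F → F
  x ⊖ y = x ⊕ ⊝ y

  private
    ring : CommutativeRing _ _
    ring = record { isCommutativeRing = isRing }
    module R = CommutativeRing ring
    open import Algebra.Properties.Ring R.ring using (-‿distribˡ-*; -‿distribʳ-*; -‿involutive; -0#≈0#)
    open import Algebra.Properties.AbelianGroup R.+-abelianGroup using (⁻¹-∙-comm)

  #-+ : ∀ m n → # (m ℕ.+ n) ≡ # m ⊕ # n
  #-+ zero    n = sym (R.+-identityˡ (# n))
  #-+ (suc m) n = trans (#-suc (m ℕ.+ n)) (trans (cong (# 1 ⊕_) (#-+ m n))
    (trans (sym (R.+-assoc (# 1) (# m) (# n))) (cong (_⊕ # n) (sym (#-suc m)))))

  #-* : ∀ m n → # (m ℕ.* n) ≡ # m ⊗ # n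
  #-* zero    n = sym (R.zeroˡ (# n))
  #-* (suc m) n = trans (#-+ n (m ℕ.* n)) (trans (cong (# n ⊕_) (#-* m n))
    (trans (cong (_⊕ # m ⊗ # n) (sym (R.*-identityˡ (# n))))
    (trans (sym (R.distribʳ (# n) (# 1) (# m))) (cong (_⊗ # n) (sym (#-suc m))))))

  private
    fromℤ : ℤ → F
    fromℤ (+ n)    = # n
    fromℤ -[1+ n ] = ⊝ # (suc n)

    ⊖-homo : ∀ m n → fromℤ (m ℤ.⊖ n) ≡ # m ⊖ # n
    ⊖-homo zero    zero    = trans (sym (R.-‿inverseʳ (# 0))) refl
    ⊖-homo zero    (suc n) = sym (R.+-identityˡ _)
    ⊖-homo (suc m) zero    = sym (trans (cong (# suc m ⊕_) -0#≈0#) (R.+-identityʳ _))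
    ⊖-homo (suc m) (suc n) = trans (cong fromℤ (ℤP.[1+m]⊖[1+n]≡m⊖n m n)) (trans (⊖-homo m n) (sym lemma))
      where
      lemma : # (suc m) ⊖ # (suc n) ≡ # m ⊖ # n
      lemma = trans (cong₂ _⊖_ (#-suc m) (#-suc n)) (trans (cong ((# 1 ⊕ # m) ⊕_) (sym (⁻¹-∙-comm (# 1) (# n))))
        (trans (R.+-assoc (# 1) (# m) _) (trans (cong (# 1 ⊕_) (trans (sym (R.+-assoc (# m) _ _))
        (trans (cong (_⊕ ⊝ # n) (R.+-comm (# m) (⊝ # 1))) (R.+-assoc (⊝ # 1) (# m) (⊝ # n)))))
        (trans (sym (R.+-assoc (# 1) (⊝ # 1) _)) (trans (cong (_⊕ (# m ⊖ # n)) (R.-‿inverseʳ (# 1))) (R.+-identityˡ _))))))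

    +-homo : ∀ i j → fromℤ (i ℤ.+ j) ≡ fromℤ i ⊕ fromℤ j
    +-homo (+ m)    (+ n)    = #-+ m n
    +-homo (+ m)    -[1+ n ] = ⊖-homo m (suc n)
    +-homo -[1+ m ] (+ n)    = trans (⊖-homo n (suc m)) (R.+-comm _ _)
    +-homo -[1+ m ] -[1+ n ] = trans (cong (λ t → ⊝ # t) (sym (ℕP.+-suc (suc m) n)))
      (trans (cong ⊝_ (#-+ (suc m) (suc n))) (sym (⁻¹-∙-comm _ _)))

    neg-homo : ∀ i → fromℤ (ℤ.- i) ≡ ⊝ fromℤ i
    neg-homo (+ zero)  = sym -0#≈0#
    neg-homo (+ suc n) = refl
    neg-homo -[1+ n ]  = sym (-‿involutive _)

    *-homo : ∀ i j → fromℤ (i ℤ.* j) ≡ fromℤ i ⊗ fromℤ j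
    *-homo (+ m) (+ n) = trans (cong fromℤ (sym (ℤP.pos-* m n))) (#-* m n)
    *-homo (+ m) -[1+ n ] = trans (cong fromℤ (sym (ℤP.neg-distribʳ-* (+ m) (+ suc n))))
      (trans (neg-homo (+ m ℤ.* + suc n)) (trans (cong ⊝_ (*-homo (+ m) (+ suc n))) (-‿distribʳ-* _ _)))
    *-homo -[1+ m ] (+ n) = trans (cong fromℤ (sym (ℤP.neg-distribˡ-* (+ suc m) (+ n))))
      (trans (neg-homo (+ suc m ℤ.* + n)) (trans (cong ⊝_ (*-homo (+ suc m) (+ n))) (-‿distribˡ-* _ _)))
    *-homo -[1+ m ] -[1+ n ] = trans (#-* (suc m) (suc n)) (trans (sym (-‿involutive _))
      (trans (cong ⊝_ (-‿distribʳ-* _ _)) (-‿distribˡ-* _ _)))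

    acr : ACR.AlmostCommutativeRing _ _
    acr = ACR.fromCommutativeRing ring

    morphism : ℤ.+-*-rawRing ACR.-Raw-AlmostCommutative⟶ acr
    morphism = record
      { ⟦_⟧ = fromℤ ; +-homo = +-homo ; *-homo = *-homo ; -‿homo = neg-homo ; 0-homo = refl ; 1-homo = refl }

    coeff? : ∀ i j → Maybe (fromℤ i ≡ fromℤ j)
    coeff? i j with i ℤ.≟ j
    ... | yes p = just (cong fromℤ p)
    ... | no _  = nothing

  open Solver ℤ.+-*-rawRing acr morphism coeff? public
    using (Polynomial; con; solve; _:=_; _:+_; _:*_; _:-_; :-_)

  κ : ∀ {n} → ℕ → Polynomial n
  κ n = con (+ n)

  ≡≼ : ∀ {x y} → x ≡ y → x ≼ y
  ≡≼ refl = ≼-refl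

  ≡≽ : ∀ {x y} → x ≡ y → y ≼ x
  ≡≽ refl = ≼-refl

  0≼# : ∀ n → # 0 ≼ # n
  0≼# zero    = ≼-refl
  0≼# (suc n) = ≼-trans (≡≽ (R.+-identityˡ (# 0))) (≼-trans (⊕-mono 0≼1 (0≼# n)) (≡≽ (#-suc n)))

  -- The goal l ≼ r follows when a positive multiple of r ⊖ l is a nonnegative combination of differences of hypotheses.
  infixr 5 _⊞_
  infix  6 _·_
  data Combination : Set where
    const : ℕ → Combination
    _·_   : ∀ {l r} → ℕ → l ≼ r → Combination
    _⊞_   : Combination → Combination → Combination

  multiple : ℕ → F → F
  multiple 1 x = x
  multiple n x = # n ⊗ x

  evaluate : Combination → F
  evaluate (const n)         = # n
  evaluate (_·_ {l} {r} n _) = multiple n (r ⊖ l)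
  evaluate (c ⊞ d)           = evaluate c ⊕ evaluate d

  private
    ≼⇒nn : ∀ {x y} → x ≼ y → # 0 ≼ y ⊖ x
    ≼⇒nn {x} {y} p = ≼-trans (≡≽ (R.-‿inverseʳ x)) (⊕-mono p ≼-refl)

    nn⇒≼ : ∀ {x y} → # 0 ≼ y ⊖ x → x ≼ y
    nn⇒≼ {x} {y} p = ≼-trans (≡≼ (solve 1 (λ a → a := κ 0 :+ a) refl x))
      (≼-trans (⊕-mono p ≼-refl) (≡≼ (solve 2 (λ a b → (b :- a) :+ a := b) refl x y)))

    multiple≡ : ∀ n x → multiple n x ≡ # n ⊗ x
    multiple≡ 0 x = refl
    multiple≡ 1 x = sym (R.*-identityˡ x)
    multiple≡ (suc (suc n)) x = refl

    evaluate-nn : ∀ c → # 0 ≼ evaluate c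
    evaluate-nn (const n)         = 0≼# n
    evaluate-nn (_·_ {l} {r} n p) = ≼-trans (nn-⊗ (0≼# n) (≼⇒nn p)) (≡≽ (multiple≡ n (r ⊖ l)))
    evaluate-nn (c ⊞ d)           = ≼-trans (≡≽ (R.+-identityˡ (# 0))) (⊕-mono (evaluate-nn c) (evaluate-nn d))

  -- No division by `suc k` is made: in the case `r ≼ l` the product `k (r - l)` is nonpositive, and
  -- removing it from the nonnegative `suc k (r - l)` leaves `r - l` nonnegative.
  lin : ∀ k {l r} c → multiple (suc k) (r ⊖ l) ≡ evaluate c → l ≼ r
  lin k {l} {r} c e with ≼-total l r
  ... | inj₁ q = q
  ... | inj₂ q = nn⇒≼ (≼-trans (≼-trans (evaluate-nn c) (≡≼ (trans (sym e) (multiple≡ (suc k) (r ⊖ l))))) (≼-trans (≡≼ (cong (_⊗ (r ⊖ l)) (#-suc k)))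
    (≼-trans (≡≼ (solve 3 (λ a b c → (κ 1 :+ c) :* (b :- a) := c :* (b :- a) :+ (b :- a)) refl l r (# k)))
    (≼-trans (⊕-mono kneg ≼-refl) (≡≼ (R.+-identityˡ _))))))
    where
    kneg : # k ⊗ (r ⊖ l) ≼ # 0
    kneg = nn⇒≼ (≼-trans (nn-⊗ (0≼# k) (≼⇒nn q))
      (≡≼ (solve 3 (λ a b c → c :* (a :- b) := κ 0 :- c :* (b :- a)) refl l r (# k))))

-- Finite sums, indicators and partial summation.

module Sums where
  open Field

  sub-nn : ∀ {x y} → x ≼ y → # 0 ≼ y ⊖ x
  sub-nn {x} {y} p = (lin 0 (1 · p) (solve 2 (λ a b → a :- b :- κ 0 := a :- b) refl y x))

  ⊗-monoʳ : ∀ {x y z} → # 0 ≼ z → x ≼ y → z ⊗ x ≼ z ⊗ y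
  ⊗-monoʳ {x} {y} {z} p q = (lin 0 (1 · (nn-⊗ p (sub-nn q))) (solve 3 (λ a b c → a :* c :- a :* b := a :* (c :- b) :- κ 0) refl z x y))

  ⊗-monoˡ : ∀ {x y z} → # 0 ≼ z → x ≼ y → x ⊗ z ≼ y ⊗ z
  ⊗-monoˡ {x} {y} {z} p q = (lin 0 (1 · (nn-⊗ p (sub-nn q))) (solve 3 (λ a b c → c :* b :- a :* b := b :* (c :- a) :- κ 0) refl x z y))

  ⊗-mono : ∀ {x y z w} → # 0 ≼ x → # 0 ≼ z → x ≼ y → z ≼ w → x ⊗ z ≼ y ⊗ w
  ⊗-mono p q r s = ≼-trans (⊗-monoˡ q r) (⊗-monoʳ (≼-trans p r) s)

  sq-nn : ∀ x → # 0 ≼ x ⊗ x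
  sq-nn x with ≼-total (# 0) x
  ... | inj₁ p = nn-⊗ p p
  ... | inj₂ p = (lin 0 (1 · (nn-⊗ (sub-nn p) (sub-nn p))) (solve 1 (λ a → a :* a :- κ 0 := (κ 0 :- a) :* (κ 0 :- a) :- κ 0) refl x))

  cancel : ∀ {x y z} → # 1 ≼ z → z ⊗ x ≼ z ⊗ y → x ≼ y
  cancel {x} {y} {z} p q with ≼-total x y
  ... | inj₁ r = r
  ... | inj₂ r = (lin 0 (1 · q ⊞ 1 · (nn-⊗ (sub-nn p) (sub-nn r))) (solve 3 (λ a b c → b :- a := c :* b :- c :* a :+ ((c :- κ 1) :* (a :- b) :- κ 0)) refl x y z))

  #-mono : ∀ {m n} → m ≤ n → # m ≼ # n
  #-mono {n = n} z≤n = 0≼# n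
  #-mono (s≤s {m} {n} p) = (lin 0 (1 · (#-mono p) ⊞ 1 · (≡≼ (#-suc m)) ⊞ 1 · (≡≽ (#-suc n))) (solve 4 (λ a b c d → b :- a := d :- c :+ (κ 1 :+ c :- a :+ (b :- (κ 1 :+ d)))) refl (# (suc m)) (# (suc n)) (# m) (# n)))

  #-reflect : ∀ {m n} → # m ≼ # n → m ≤ n
  #-reflect {m} {n} p with m ≤? n
  ... | yes q = q
  ... | no q  = ⊥-elim (1⋠0 (lin 0 (1 · p ⊞ 1 · (#-mono (ℕP.≰⇒> q)) ⊞ 1 · (≡≽ (#-suc n))) (solve 3 (λ a b c → κ 0 :- κ 1 := b :- a :+ (a :- c :+ (c :- (κ 1 :+ b)))) refl (# m) (# n) (# (suc n)))))

  #-injective : ∀ {m n} → # m ≡ # n → m ≡ n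
  #-injective p = ℕP.≤-antisym (#-reflect (≡≼ p)) (#-reflect (≡≽ p))

  inv-nn : ∀ {x} → # 1 ≼ x → # 0 ≼ inv x
  inv-nn {x} p = cancel p (lin 0 (1 · (≡≽ (inv-law p)) ⊞ const 1) (solve 2 (λ a b → a :* b :- a :* κ 0 := a :* b :- κ 1 :+ κ 1) refl x (inv x)))

  ⅟ : ℕ → F
  ⅟ zero    = # 0
  ⅟ (suc n) = inv (# suc n)

  ⅟-law : ∀ {n} → 1 ≤ n → # n ⊗ ⅟ n ≡ # 1
  ⅟-law {suc n} p = inv-law (#-mono p)

  ⅟-nn : ∀ n → # 0 ≼ ⅟ n
  ⅟-nn zero    = ≼-refl
  ⅟-nn (suc n) = inv-nn (#-mono (s≤s z≤n))

  ⅟-anti : ∀ {m n} → 1 ≤ m → m ≤ n → ⅟ n ≼ ⅟ m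
  ⅟-anti {m} {n} p q = cancel (#-mono p) (cancel (#-mono (ℕP.≤-trans p q))
    (lin 0 (1 · (≡≼ (cong (# m ⊗_) (⅟-law (ℕP.≤-trans p q)))) ⊞ 1 · (≡≽ (cong (# n ⊗_) (⅟-law p))) ⊞ 1 · (#-mono q)) (solve 4 (λ a b c d → a :* (b :* d) :- a :* (b :* c) := b :* κ 1 :- b :* (a :* c) :+ (a :* (b :* d) :- a :* κ 1 :+ (a :- b))) refl (# n) (# m) (⅟ n) (⅟ m))))

  ⅟-unique : ∀ {n x} → 1 ≤ n → # n ⊗ x ≡ # 1 → x ≡ ⅟ n
  ⅟-unique {n} {x} p e = (≼-antisym (lin 0 (1 · (≡≼ (cong (⅟ n ⊗_) e)) ⊞ 1 · (≡≽ (cong (x ⊗_) (⅟-law p)))) (solve 3 (λ a b c → b :- a := b :* κ 1 :- b :* (c :* a) :+ (a :* (c :* b) :- a :* κ 1)) refl x (⅟ n) (# n))) (lin 0 (1 · (≡≽ (cong (⅟ n ⊗_) e)) ⊞ 1 · (≡≼ (cong (x ⊗_) (⅟-law p)))) (solve 3 (λ a b c → a :- b := b :* (c :* a) :- b :* κ 1 :+ (a :* κ 1 :- a :* (c :* b))) refl x (⅟ n) (# n))))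

  ⅟-1 : ⅟ 1 ≡ # 1
  ⅟-1 = sym (⅟-unique (s≤s z≤n) (solve 0 (κ 1 :* κ 1 := κ 1) refl))

  ⅟-* : ∀ {m n} → 1 ≤ m → 1 ≤ n → ⅟ (m ℕ.* n) ≡ ⅟ m ⊗ ⅟ n
  ⅟-* {m} {n} p q = sym (⅟-unique (ℕP.*-mono-≤ p q)
    (trans (cong (_⊗ (⅟ m ⊗ ⅟ n)) (#-* m n)) (trans (solve 4 (λ a b c d → a :* b :* (c :* d) := a :* c :* (b :* d)) refl (# m) (# n) (⅟ m) (⅟ n))
    (trans (cong₂ _⊗_ (⅟-law p) (⅟-law q)) (solve 0 (κ 1 :* κ 1 := κ 1) refl)))))

  ⅟≼1 : ∀ n → ⅟ n ≼ # 1
  ⅟≼1 zero    = 0≼1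
  ⅟≼1 (suc n) = ≼-trans (⅟-anti (s≤s z≤n) (s≤s z≤n)) (≡≼ ⅟-1)

  infix 4 _≲_
  -- The bound |x| ≤ b, kept as two inequalities; all error terms are carried in this form.
  _≲_ : F → F → Set
  x ≲ b = (x ≼ b) × (⊝ b ≼ x)

  ≲-⊕ : ∀ {x y a b} → x ≲ a → y ≲ b → x ⊕ y ≲ a ⊕ b
  ≲-⊕ {x} {y} {a} {b} (p , q) (r , s) = (lin 0 (1 · p ⊞ 1 · r) (solve 4 (λ a b c d → c :+ d :- (a :+ b) := c :- a :+ (d :- b)) refl x y a b)) , (lin 0 (1 · q ⊞ 1 · s) (solve 4 (λ a b c d → c :+ d :- :- (a :+ b) := c :- :- a :+ (d :- :- b)) refl a b x y))

  ≲-⊗ : ∀ {x y a b} → x ≲ a → y ≲ b → x ⊗ y ≲ a ⊗ b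
  ≲-⊗ {x} {y} {a} {b} (p , q) (r , s) =
    (lin 1 (1 · (nn-⊗ (sub-nn p) (sub-nn s)) ⊞ 1 · (nn-⊗ (sub-nn q) (sub-nn r))) (solve 4 (λ a b c d → κ 2 :* (c :* d :- a :* b) := (c :- a) :* (b :- :- d) :- κ 0 :+ ((a :- :- c) :* (d :- b) :- κ 0)) refl x y a b)) ,
    (lin 1 (1 · (nn-⊗ (sub-nn p) (sub-nn r)) ⊞ 1 · (nn-⊗ (sub-nn q) (sub-nn s))) (solve 4 (λ a b c d → κ 2 :* (c :* d :- :- (a :* b)) := (a :- c) :* (b :- d) :- κ 0 :+ ((c :- :- a) :* (d :- :- b) :- κ 0)) refl a b x y))

  ≲-weaken : ∀ {x a b} → x ≲ a → a ≼ b → x ≲ b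
  ≲-weaken {x} {a} {b} (p , q) r = ≼-trans p r , (lin 0 (1 · q ⊞ 1 · r) (solve 3 (λ a b c → b :- :- a := b :- :- c :+ (a :- c)) refl b x a))

  ≲-nn : ∀ {x} → # 0 ≼ x → x ≲ x
  ≲-nn {x} p = ≼-refl , (lin 0 (2 · p) (solve 1 (λ a → a :- :- a := κ 2 :* (a :- κ 0)) refl x))

  ≲-subst : ∀ {x y b} → x ≡ y → x ≲ b → y ≲ b
  ≲-subst refl p = p

  ≲⇒nn : ∀ {x b} → x ≲ b → # 0 ≼ b
  ≲⇒nn {x} {b} (p , q) = (lin 1 (1 · p ⊞ 1 · q) (solve 2 (λ a b → κ 2 :* (a :- κ 0) := a :- b :+ (b :- :- a)) refl b x))

  -- The index runs over 1, ..., n, so that divisors and reciprocals never meet 0.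
  ∑ : ℕ → (ℕ → F) → F
  ∑ zero    f = # 0
  ∑ (suc n) f = ∑ n f ⊕ f (suc n)

  ∑-cong : ∀ n {f g : ℕ → F} → (∀ i → 1 ≤ i → i ≤ n → f i ≡ g i) → ∑ n f ≡ ∑ n g
  ∑-cong zero    h = refl
  ∑-cong (suc n) h = cong₂ _⊕_ (∑-cong n (λ i p q → h i p (ℕP.m≤n⇒m≤1+n q))) (h (suc n) (s≤s z≤n) ℕP.≤-refl)

  ∑-ext : ∀ n {f g : ℕ → F} → (∀ i → f i ≡ g i) → ∑ n f ≡ ∑ n g
  ∑-ext n h = ∑-cong n (λ i _ _ → h i)

  ∑-mono : ∀ n {f g : ℕ → F} → (∀ i → 1 ≤ i → i ≤ n → f i ≼ g i) → ∑ n f ≼ ∑ n g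
  ∑-mono zero    h = ≼-refl
  ∑-mono (suc n) h = ⊕-mono (∑-mono n (λ i p q → h i p (ℕP.m≤n⇒m≤1+n q))) (h (suc n) (s≤s z≤n) ℕP.≤-refl)

  ∑-≲ : ∀ n {f g : ℕ → F} → (∀ i → 1 ≤ i → i ≤ n → f i ≲ g i) → ∑ n f ≲ ∑ n g
  ∑-≲ zero    h = ≲-nn ≼-refl
  ∑-≲ (suc n) h = ≲-⊕ (∑-≲ n (λ i p q → h i p (ℕP.m≤n⇒m≤1+n q))) (h (suc n) (s≤s z≤n) ℕP.≤-refl)

  ∑-⊕ : ∀ n (f g : ℕ → F) → ∑ n (λ i → f i ⊕ g i) ≡ ∑ n f ⊕ ∑ n g
  ∑-⊕ zero    f g = (solve 0 (κ 0 := κ 0 :+ κ 0) refl)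
  ∑-⊕ (suc n) f g = trans (cong (_⊕ (f (suc n) ⊕ g (suc n))) (∑-⊕ n f g))
    (solve 4 (λ a b c d → a :+ b :+ (c :+ d) := a :+ c :+ (b :+ d)) refl (∑ n f) (∑ n g) (f (suc n)) (g (suc n)))

  ∑-⊗ : ∀ n c (f : ℕ → F) → ∑ n (λ i → c ⊗ f i) ≡ c ⊗ ∑ n f
  ∑-⊗ zero    c f = (solve 1 (λ a → κ 0 := a :* κ 0) refl c)
  ∑-⊗ (suc n) c f = trans (cong (_⊕ c ⊗ f (suc n)) (∑-⊗ n c f)) (solve 3 (λ a b c → a :* b :+ a :* c := a :* (b :+ c)) refl c (∑ n f) (f (suc n)))

  ∑-⊗ʳ : ∀ n c (f : ℕ → F) → ∑ n (λ i → f i ⊗ c) ≡ ∑ n f ⊗ c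
  ∑-⊗ʳ n c f = trans (∑-ext n (λ i → (solve 2 (λ a b → a :* b := b :* a) refl (f i) c))) (trans (∑-⊗ n c f) (solve 2 (λ a b → a :* b := b :* a) refl c (∑ n f)))

  ∑-⊖ : ∀ n (f g : ℕ → F) → ∑ n (λ i → f i ⊖ g i) ≡ ∑ n f ⊖ ∑ n g
  ∑-⊖ zero    f g = (solve 0 (κ 0 := κ 0 :- κ 0) refl)
  ∑-⊖ (suc n) f g = trans (cong (_⊕ (f (suc n) ⊖ g (suc n))) (∑-⊖ n f g))
    (solve 4 (λ a b c d → a :- b :+ (c :- d) := a :+ c :- (b :+ d)) refl (∑ n f) (∑ n g) (f (suc n)) (g (suc n)))

  ∑-const : ∀ n c → ∑ n (λ _ → c) ≡ # n ⊗ c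
  ∑-const zero    c = (solve 1 (λ a → κ 0 := κ 0 :* a) refl c)
  ∑-const (suc n) c = trans (cong (_⊕ c) (∑-const n c)) (trans (solve 2 (λ a b → a :* b :+ b := (κ 1 :+ a) :* b) refl (# n) c) (cong (_⊗ c) (sym (#-suc n))))

  ∑-0 : ∀ n {f : ℕ → F} → (∀ i → 1 ≤ i → i ≤ n → f i ≡ # 0) → ∑ n f ≡ # 0
  ∑-0 n h = trans (∑-cong n h) (trans (∑-const n (# 0)) (solve 1 (λ a → a :* κ 0 := κ 0) refl (# n)))

  ∑-nn : ∀ n {f : ℕ → F} → (∀ i → 1 ≤ i → i ≤ n → # 0 ≼ f i) → # 0 ≼ ∑ n f
  ∑-nn n h = ≼-trans (≡≽ (∑-0 n (λ _ _ _ → refl))) (∑-mono n h)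

  ∑-swap : ∀ m n (f : ℕ → ℕ → F) → ∑ m (λ i → ∑ n (λ j → f i j)) ≡ ∑ n (λ j → ∑ m (λ i → f i j))
  ∑-swap zero    n f = sym (∑-0 n (λ _ _ _ → refl))
  ∑-swap (suc m) n f = trans (cong (_⊕ ∑ n (f (suc m))) (∑-swap m n f)) (sym (∑-⊕ n (λ j → ∑ m (λ i → f i j)) (f (suc m))))

  ∑-+ : ∀ m n (f : ℕ → F) → ∑ (m ℕ.+ n) f ≡ ∑ m f ⊕ ∑ n (λ i → f (m ℕ.+ i))
  ∑-+ m zero    f = trans (cong (λ t → ∑ t f) (ℕP.+-identityʳ m)) (solve 1 (λ a → a := a :+ κ 0) refl (∑ m f))
  ∑-+ m (suc n) f = trans (cong (λ t → ∑ t f) (ℕP.+-suc m n)) (trans (cong₂ _⊕_ (∑-+ m n f) (cong f (sym (ℕP.+-suc m n))))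
    (solve 3 (λ a b c → a :+ b :+ c := a :+ (b :+ c)) refl (∑ m f) (∑ n (λ i → f (m ℕ.+ i))) (f (m ℕ.+ suc n))))

  ∑-grow : ∀ {m n} {f : ℕ → F} → m ≤ n → (∀ i → 1 ≤ i → i ≤ n → # 0 ≼ f i) → ∑ m f ≼ ∑ n f
  ∑-grow {m} {zero} z≤n h = ≼-refl
  ∑-grow {m} {suc n} {f} p h with m ≤? n
  ... | yes q = ≼-trans (∑-grow q (λ i a b → h i a (ℕP.m≤n⇒m≤1+n b))) (lin 0 (1 · (h (suc n) (s≤s z≤n) ℕP.≤-refl)) (solve 2 (λ a b → a :+ b :- a := b :- κ 0) refl (∑ n f) (f (suc n))))
  ... | no q  = ≡≼ (cong (λ t → ∑ t f) (ℕP.≤-antisym p (ℕP.≰⇒> q)))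

  ∑-term : ∀ {k n} {f : ℕ → F} → 1 ≤ k → k ≤ n → (∀ i → 1 ≤ i → i ≤ n → # 0 ≼ f i) → f k ≼ ∑ n f
  ∑-term {suc k} {n} {f} p q h = ≼-trans (lin 0 (1 · (∑-nn k (λ i a b → h i a (ℕP.≤-trans (ℕP.m≤n⇒m≤1+n b) q)))) (solve 2 (λ a b → b :+ a :- a := b :- κ 0) refl (f (suc k)) (∑ k f))) (∑-grow q h)

  𝟙 : {A : Set} → Dec A → F
  𝟙 (yes _) = # 1
  𝟙 (no _)  = # 0

  module _ {A : Set} where
    𝟙-yes : (d : Dec A) → A → 𝟙 d ≡ # 1
    𝟙-yes (yes _) a = refl
    𝟙-yes (no ¬a) a = ⊥-elim (¬a a)

    𝟙-no : (d : Dec A) → ¬ A → 𝟙 d ≡ # 0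
    𝟙-no (yes a) ¬a = ⊥-elim (¬a a)
    𝟙-no (no _)  ¬a = refl

    𝟙-nn : (d : Dec A) → # 0 ≼ 𝟙 d
    𝟙-nn (yes _) = 0≼1
    𝟙-nn (no _)  = ≼-refl

    𝟙≼1 : (d : Dec A) → 𝟙 d ≼ # 1
    𝟙≼1 (yes _) = ≼-refl
    𝟙≼1 (no _)  = 0≼1

    𝟙-⊗-cong : (d : Dec A) {x y : F} → (A → x ≡ y) → 𝟙 d ⊗ x ≡ 𝟙 d ⊗ y
    𝟙-⊗-cong (yes a) h = cong (# 1 ⊗_) (h a)
    𝟙-⊗-cong (no _) {x} {y} h = (solve 2 (λ a b → κ 0 :* a := κ 0 :* b) refl x y)

    𝟙-⊗-mono : (d : Dec A) {x y : F} → (A → x ≼ y) → 𝟙 d ⊗ x ≼ 𝟙 d ⊗ y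
    𝟙-⊗-mono (yes a) h = ⊗-monoʳ 0≼1 (h a)
    𝟙-⊗-mono (no _) {x} {y} h = (lin 0 (const 0) (solve 2 (λ a b → κ 0 :* b :- κ 0 :* a := κ 0) refl x y))

    𝟙-⊗≼ : (d : Dec A) {x : F} → # 0 ≼ x → 𝟙 d ⊗ x ≼ x
    𝟙-⊗≼ (yes a) {x} h = (lin 0 (const 0) (solve 1 (λ a → a :- κ 1 :* a := κ 0) refl x))
    𝟙-⊗≼ (no _) {x} h = (lin 0 (1 · h) (solve 1 (λ a → a :- κ 0 :* a := a :- κ 0) refl x))

    𝟙-cong : {B : Set} (d : Dec A) (e : Dec B) → (A → B) → (B → A) → 𝟙 d ≡ 𝟙 e
    𝟙-cong (yes a) e f g = sym (𝟙-yes′ e (f a))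
      where 𝟙-yes′ : ∀ {B : Set} (d : Dec B) → B → 𝟙 d ≡ # 1
            𝟙-yes′ (yes _) a = refl
            𝟙-yes′ (no ¬a) a = ⊥-elim (¬a a)
    𝟙-cong (no ¬a) (yes b) f g = ⊥-elim (¬a (g b))
    𝟙-cong (no ¬a) (no _)  f g = refl

    𝟙-⇒ : {B : Set} (d : Dec A) (e : Dec B) → (A → B) → 𝟙 d ≼ 𝟙 e
    𝟙-⇒ (yes a) (yes b) f = ≼-refl
    𝟙-⇒ (yes a) (no ¬b) f = ⊥-elim (¬b (f a))
    𝟙-⇒ (no _)  (yes b) f = 0≼1
    𝟙-⇒ (no _)  (no ¬b) f = ≼-refl

    𝟙-× : {B : Set} (d : Dec A) (e : Dec B) → 𝟙 d ⊗ 𝟙 e ≡ 𝟙 (d ×-dec e)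
    𝟙-× (yes a) (yes b) = (solve 0 (κ 1 :* κ 1 := κ 1) refl)
    𝟙-× (yes a) (no _)  = (solve 0 (κ 1 :* κ 0 := κ 0) refl)
    𝟙-× (no _)  (yes b) = (solve 0 (κ 0 :* κ 1 := κ 0) refl)
    𝟙-× (no _)  (no _)  = (solve 0 (κ 0 :* κ 0 := κ 0) refl)

  ∑-single : ∀ {k n} {f : ℕ → F} → 1 ≤ k → k ≤ n → (∀ i → 1 ≤ i → i ≤ n → i ≢ k → f i ≡ # 0) → ∑ n f ≡ f k
  ∑-single {k} {zero} p q h = ⊥-elim (ℕP.<⇒≱ p q)
  ∑-single {k} {suc n} {f} p q h with k ≟ suc n
  ... | yes refl = trans (cong (_⊕ f (suc n)) (∑-0 n (λ i a b → h i a (ℕP.m≤n⇒m≤1+n b) (λ e → ℕP.<⇒≢ (s≤s b) e)))) (solve 1 (λ a → κ 0 :+ a := a) refl (f (suc n)))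
  ... | no k≢ = trans (cong₂ _⊕_ (∑-single p (ℕP.≤-pred (ℕP.≤∧≢⇒< q k≢)) (λ i a b → h i a (ℕP.m≤n⇒m≤1+n b))) (h (suc n) (s≤s z≤n) ℕP.≤-refl (λ e → k≢ (sym e)))) (solve 1 (λ a → a :+ κ 0 := a) refl (f k))

  ∑-pick : ∀ {k n} (f : ℕ → F) → 1 ≤ k → k ≤ n → ∑ n (λ i → 𝟙 (i ≟ k) ⊗ f i) ≡ f k
  ∑-pick {k} {n} f p q = trans (∑-single p q (λ i _ _ i≢k → trans (cong (_⊗ f i) (𝟙-no (i ≟ k) i≢k)) (solve 1 (λ a → κ 0 :* a := κ 0) refl (f i))))
    (trans (cong (_⊗ f k) (𝟙-yes (k ≟ k) refl)) (solve 1 (λ a → κ 1 :* a := a) refl (f k)))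

  ∑-trunc : ∀ {m n} (f : ℕ → F) → m ≤ n → ∑ n (λ i → 𝟙 (i ≤? m) ⊗ f i) ≡ ∑ m f
  ∑-trunc {m} {n} f p = trans (cong (λ t → ∑ t (λ i → 𝟙 (i ≤? m) ⊗ f i)) (sym (ℕP.m+[n∸m]≡n p)))
    (trans (∑-+ m (n ℕ.∸ m) (λ i → 𝟙 (i ≤? m) ⊗ f i)) (trans (cong₂ _⊕_
      (∑-cong m (λ i _ q → trans (cong (_⊗ f i) (𝟙-yes (i ≤? m) q)) (solve 1 (λ a → κ 1 :* a := a) refl (f i))))
      (∑-0 (n ℕ.∸ m) (λ i q _ → trans (cong (_⊗ f (m ℕ.+ i)) (𝟙-no (m ℕ.+ i ≤? m) (λ r → ℕP.<⇒≱ (ℕP.m<m+n m q) r))) (solve 1 (λ a → κ 0 :* a := κ 0) refl (f (m ℕ.+ i))))))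
    (solve 1 (λ a → a :+ κ 0 := a) refl (∑ m f))))

  ∑-tele : ∀ n (g : ℕ → F) → ∑ n (λ i → g (suc i) ⊖ g i) ≡ g (suc n) ⊖ g 1
  ∑-tele zero    g = (solve 1 (λ a → κ 0 := a :- a) refl (g 1))
  ∑-tele (suc n) g = trans (cong (_⊕ (g (suc (suc n)) ⊖ g (suc n))) (∑-tele n g))
    (solve 3 (λ a b c → a :- b :+ (c :- a) := c :- b) refl (g (suc n)) (g 1) (g (suc (suc n))))

  ∑-abel : ∀ n (a w : ℕ → F) → ∑ (suc n) (λ i → a i ⊗ w i) ≡ ∑ (suc n) a ⊗ w (suc n) ⊕ ∑ n (λ i → ∑ i a ⊗ (w i ⊖ w (suc i)))
  ∑-abel zero    a w = (solve 2 (λ a b → κ 0 :+ a :* b := (κ 0 :+ a) :* b :+ κ 0) refl (a 1) (w 1))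
  ∑-abel (suc n) a w = trans (cong (_⊕ a (suc (suc n)) ⊗ w (suc (suc n))) (∑-abel n a w))
    (solve 5 (λ a b c d e → a :* b :+ c :+ d :* e := (a :+ d) :* e :+ (c :+ a :* (b :- e))) refl (∑ (suc n) a) (w (suc n)) (∑ n (λ i → ∑ i a ⊗ (w i ⊖ w (suc i)))) (a (suc (suc n))) (w (suc (suc n))))

  -- The differences `g i - f i` are nonnegative with sum 0. Counting arguments use this to turn an
  -- inclusion between sets of equal size into an equality.
  ∑-equal : ∀ n {f g : ℕ → F} → (∀ i → 1 ≤ i → i ≤ n → f i ≼ g i) → ∑ n f ≡ ∑ n g → ∀ i → 1 ≤ i → i ≤ n → f i ≡ g i
  ∑-equal n {f} {g} h e i p q = (≼-antisym (lin 0 (1 · (h i p q)) (solve 2 (λ a b → b :- a := b :- a) refl (f i) (g i))) (lin 0 (1 · (∑-term p q (λ j a b → sub-nn (h j a b))) ⊞ 1 · (≡≼ (∑-⊖ n g f)) ⊞ 1 · (≡≽ e)) (solve 5 (λ a b c d e → a :- b := c :- (b :- a) :+ (d :- e :- c :+ (e :- d))) refl (f i) (g i) (∑ n (λ j → g j ⊖ f j)) (∑ n g) (∑ n f))))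

  -- Only the partial sums of `a` enter, so cancellation in `a` survives the weights. The increments
  -- of `w` telescope to `w (suc n) - w 1`, which together with the boundary term accounts for the
  -- factor 2.
  abel-up : ∀ n (a w : ℕ → F) K → (∀ i → ∑ i a ≲ K) → # 0 ≼ w (suc n) → # 0 ≼ w 1 → (∀ i → 1 ≤ i → i ≤ n → w i ≼ w (suc i)) →
    ∑ (suc n) (λ i → a i ⊗ w i) ≲ # 2 ⊗ K ⊗ w (suc n)
  abel-up n a w K h wn w1 mono = ≲-weaken (≲-subst (sym (∑-abel n a w)) (≲-⊕ (≲-⊗ (h (suc n)) (≲-nn wn))
     (∑-≲ n (λ i p q → ≲-⊗ (h i) (neg (mono i p q))))))
     (≼-trans (≡≼ (cong (K ⊗ w (suc n) ⊕_) (trans (∑-⊗ n K (λ i → w (suc i) ⊖ w i)) (cong (K ⊗_) (∑-tele n w)))))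
     (lin 0 (1 · (nn-⊗ (≲⇒nn (h 0)) w1)) (solve 3 (λ a b c → κ 2 :* a :* b :- (a :* b :+ a :* (b :- c)) := a :* c :- κ 0) refl K (w (suc n)) (w 1))))
    where
    neg : ∀ {x y} → x ≼ y → x ⊖ y ≲ y ⊖ x
    neg {x} {y} p = (lin 0 (2 · p) (solve 2 (λ a b → b :- a :- (a :- b) := κ 2 :* (b :- a)) refl x y)) , (lin 0 (const 0) (solve 2 (λ a b → b :- a :- :- (a :- b) := κ 0) refl y x))

  -- For decreasing weights the boundary term and the telescoped decrements add up to exactly
  -- `K w 1`, whatever the length of the sum.
  abel-down : ∀ n (a w : ℕ → F) K → (∀ i → ∑ i a ≲ K) → # 0 ≼ w (suc n) → (∀ i → 1 ≤ i → i ≤ n → w (suc i) ≼ w i) →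
    ∑ (suc n) (λ i → a i ⊗ w i) ≲ K ⊗ w 1
  abel-down n a w K h wn mono = ≲-weaken (≲-subst (sym (∑-abel n a w)) (≲-⊕ (≲-⊗ (h (suc n)) (≲-nn wn))
     (∑-≲ n (λ i p q → ≲-⊗ (h i) (≲-nn (sub-nn (mono i p q)))))))
     (≡≼ (trans (cong (K ⊗ w (suc n) ⊕_) (trans (∑-⊗ n K (λ i → w i ⊖ w (suc i))) (cong (K ⊗_) tele)))
     (solve 3 (λ a b c → a :* b :+ a :* (c :- b) := a :* c) refl K (w (suc n)) (w 1))))
    where
    tele : ∑ n (λ i → w i ⊖ w (suc i)) ≡ w 1 ⊖ w (suc n)
    tele = trans (∑-ext n (λ i → (solve 2 (λ a b → a :- b := :- b :- :- a) refl (w i) (w (suc i))))) (trans (∑-tele n (λ i → ⊝ w i)) (solve 2 (λ a b → :- a :- :- b := b :- a) refl (w (suc n)) (w 1)))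

-- Floor division, divisor sums and prime factorisations.

module NumTh where
  open Field
  open Sums

  search : ∀ {P : ℕ → Set} → (∀ i → Dec (P i)) → ∀ n → (∃ λ i → P i) ⊎ (∀ i → 1 ≤ i → i ≤ n → ¬ P i)
  search d zero = inj₂ (λ i p q → ⊥-elim (ℕP.<⇒≱ p q))
  search d (suc n) with search d n | d (suc n)
  ... | inj₁ r | _ = inj₁ r
  ... | inj₂ _ | yes p = inj₁ (suc n , p)
  ... | inj₂ h | no ¬p = inj₂ λ i p q → go i p q (i ≟ suc n)
    where
    go : ∀ i → 1 ≤ i → i ≤ suc n → Dec (i ≡ suc n) → ¬ _
    go i p q (yes refl) = ¬p
    go i p q (no ne) = h i p (ℕP.≤-pred (ℕP.≤∧≢⇒< q ne))

  n<2^n : ∀ n → n < 2 ^ n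
  n<2^n zero = s≤s z≤n
  n<2^n (suc n) = ℕP.≤-trans (ℕP.+-mono-≤ (ℕP.m^n>0 2 n) (n<2^n n)) (ℕP.≤-reflexive (cong (2 ^ n +_) (sym (ℕP.+-identityʳ (2 ^ n)))))

  infixl 7 _÷_
  _÷_ : ℕ → ℕ → ℕ
  x ÷ zero  = 0
  x ÷ suc d = x / suc d

  ≤-÷ : ∀ {x k} d → 1 ≤ d → d * k ≤ x → k ≤ x ÷ d
  ≤-÷ {x} {k} (suc d) _ p = subst (_≤ x / suc d) (trans (cong (_/ suc d) (ℕP.*-comm (suc d) k)) (DM.m*n/n≡m k (suc d))) (DM./-monoˡ-≤ (suc d) p)

  ÷-≤ : ∀ {x k} d → 1 ≤ d → k ≤ x ÷ d → d * k ≤ x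
  ÷-≤ {x} {k} (suc d) _ p = ℕP.≤-trans (ℕP.*-monoʳ-≤ (suc d) p) (subst (_≤ x) (ℕP.*-comm (x / suc d) (suc d)) (DM.m/n*n≤m x (suc d)))

  ÷-unique : ∀ {x y d} → 1 ≤ d → (∀ j → d * j ≤ x → j ≤ y) → d * y ≤ x → x ÷ d ≡ y
  ÷-unique {d = d} p h q = ℕP.≤-antisym (h _ (÷-≤ d p ℕP.≤-refl)) (≤-÷ d p q)

  *÷ : ∀ d k → 1 ≤ d → (d * k) ÷ d ≡ k
  *÷ d@(suc _) k p = ÷-unique p (λ j q → ℕP.*-cancelˡ-≤ d q) ℕP.≤-refl

  ÷-÷ : ∀ x d e → 1 ≤ d → 1 ≤ e → (x ÷ d) ÷ e ≡ x ÷ (d * e)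
  ÷-÷ x d e p q = ÷-unique q
    (λ j r → ≤-÷ (d * e) (ℕP.*-mono-≤ p q) (subst (_≤ x) (sym (ℕP.*-assoc d e j)) (÷-≤ d p r)))
    (≤-÷ d p (subst (_≤ x) (ℕP.*-assoc d e _) (÷-≤ (d * e) (ℕP.*-mono-≤ p q) ℕP.≤-refl)))

  ÷-comm : ∀ x d e → 1 ≤ d → 1 ≤ e → (x ÷ d) ÷ e ≡ (x ÷ e) ÷ d
  ÷-comm x d e p q = trans (÷-÷ x d e p q) (trans (cong (x ÷_) (ℕP.*-comm d e)) (sym (÷-÷ x e d q p)))

  ÷-≤-x : ∀ x d → x ÷ d ≤ x
  ÷-≤-x x zero    = z≤n
  ÷-≤-x x (suc d) = DM.m/n≤m x (suc d)

  <-suc÷ : ∀ x d → 1 ≤ d → x < d * suc (x ÷ d)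
  <-suc÷ x d p = ℕP.≰⇒> (λ q → ℕP.<⇒≱ (ℕP.n<1+n (x ÷ d)) (≤-÷ d p q))

  1≤÷ : ∀ {x d} → 1 ≤ d → d ≤ x → 1 ≤ x ÷ d
  1≤÷ {x} {d} p q = ≤-÷ d p (subst (_≤ x) (sym (ℕP.*-identityʳ d)) q)

  ≤-factor : ∀ {d k n} → 1 ≤ n → d * k ≡ n → (1 ≤ d × d ≤ n) × (1 ≤ k × k ≤ n)
  ≤-factor {zero} p refl = ⊥-elim (ℕP.<⇒≱ p z≤n)
  ≤-factor {suc d} {zero} p refl = ⊥-elim (ℕP.<⇒≱ p (ℕP.≤-reflexive (ℕP.*-zeroʳ d)))
  ≤-factor {suc d} {suc k} p refl = (s≤s z≤n , ℕP.m≤m*n (suc d) (suc k)) , (s≤s z≤n , ℕP.m≤n*m (suc k) (suc d))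

  ∣-≤ : ∀ {d n} → 1 ≤ n → d ∣ n → 1 ≤ d × d ≤ n
  ∣-≤ {d} {n} p (divides q e) = proj₁ (≤-factor p (trans (ℕP.*-comm d q) (sym e)))

  ∑-count : ∀ {d n x} → 1 ≤ d → 1 ≤ n → n ≤ x → ∑ x (λ k → 𝟙 (n ≟ d * k)) ≡ 𝟙 (d ∣? n)
  ∑-count {d@(suc _)} {n} {x} 1≤d p q with d ∣? n
  ... | no d∤n = ∑-0 x (λ k _ _ → 𝟙-no (n ≟ d * k) (λ e → d∤n (divides k (trans e (ℕP.*-comm d k)))))
  ... | yes (divides k e) = trans (∑-single {k} (proj₁ kb) (ℕP.≤-trans (proj₂ kb) q)
          (λ i _ _ i≢k → 𝟙-no (n ≟ d * i) (λ e′ → i≢k (ℕP.*-cancelˡ-≡ i k d (trans (sym e′) e₂)))))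
          (𝟙-yes (n ≟ d * k) e₂)
    where
    e₂ : n ≡ d * k
    e₂ = trans e (ℕP.*-comm k d)
    kb : 1 ≤ k × k ≤ n
    kb = proj₂ (≤-factor {d} {k} p (sym e₂))

  ∑-≤÷ : ∀ x d (f : ℕ → F) → 1 ≤ d → ∑ x (λ k → 𝟙 (d * k ≤? x) ⊗ f k) ≡ ∑ (x ÷ d) f
  ∑-≤÷ x d f p = trans (∑-ext x (λ k → cong (_⊗ f k) (𝟙-cong (d * k ≤? x) (k ≤? x ÷ d) (≤-÷ d p) (÷-≤ d p)))) (∑-trunc f (÷-≤-x x d))

  ∑-multiples : ∀ x d (f : ℕ → F) → 1 ≤ d → ∑ x (λ n → 𝟙 (d ∣? n) ⊗ f n) ≡ ∑ (x ÷ d) (λ k → f (d * k))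
  ∑-multiples x d@(suc _) f p = begin
    ∑ x (λ n → 𝟙 (d ∣? n) ⊗ f n)                     ≡⟨ ∑-cong x (λ n a b → cong (_⊗ f n) (sym (∑-count {d} p a b))) ⟩
    ∑ x (λ n → ∑ x (λ k → 𝟙 (n ≟ d * k)) ⊗ f n)      ≡⟨ ∑-ext x (λ n → sym (∑-⊗ʳ x (f n) _)) ⟩
    ∑ x (λ n → ∑ x (λ k → 𝟙 (n ≟ d * k) ⊗ f n))      ≡⟨ ∑-swap x x _ ⟩
    ∑ x (λ k → ∑ x (λ n → 𝟙 (n ≟ d * k) ⊗ f n))      ≡⟨ ∑-cong x inner ⟩
    ∑ x (λ k → 𝟙 (d * k ≤? x) ⊗ f (d * k))           ≡⟨ ∑-≤÷ x d (λ k → f (d * k)) p ⟩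
    ∑ (x ÷ d) (λ k → f (d * k))                      ∎
    where
    open ≡-Reasoning
    inner : ∀ k → 1 ≤ k → k ≤ x → ∑ x (λ n → 𝟙 (n ≟ d * k) ⊗ f n) ≡ 𝟙 (d * k ≤? x) ⊗ f (d * k)
    inner k a b with d * k ≤? x
    ... | yes q = trans (∑-pick f (ℕP.*-mono-≤ p a) q) (solve 1 (λ a → a := κ 1 :* a) refl (f (d * k)))
    ... | no q = trans (∑-0 x (λ n _ n≤x → trans (cong (_⊗ f n) (𝟙-no (n ≟ d * k) (λ e → q (subst (_≤ x) e n≤x)))) (solve 1 (λ a → κ 0 :* a := κ 0) refl (f n)))) (solve 1 (λ a → κ 0 := κ 0 :* a) refl (f (d * k)))

  -- both sides run over the pairs (d , e) with d * e ≤ x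
  ∑-hyperbola : ∀ x (f : ℕ → ℕ → F) → ∑ x (λ d → ∑ (x ÷ d) (λ e → f d e)) ≡ ∑ x (λ e → ∑ (x ÷ e) (λ d → f d e))
  ∑-hyperbola x f = begin
    ∑ x (λ d → ∑ (x ÷ d) (f d))                                ≡⟨ ∑-cong x (λ d p _ → sym (∑-≤÷ x d (f d) p)) ⟩
    ∑ x (λ d → ∑ x (λ e → 𝟙 (d * e ≤? x) ⊗ f d e))             ≡⟨ ∑-swap x x _ ⟩
    ∑ x (λ e → ∑ x (λ d → 𝟙 (d * e ≤? x) ⊗ f d e))             ≡⟨ ∑-cong x (λ e p _ → trans (∑-ext x (λ d →
          cong (_⊗ f d e) (𝟙-cong (d * e ≤? x) (e * d ≤? x) (subst (_≤ x) (ℕP.*-comm d e)) (subst (_≤ x) (ℕP.*-comm e d))))) (∑-≤÷ x e (λ d → f d e) p)) ⟩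
    ∑ x (λ e → ∑ (x ÷ e) (λ d → f d e))                        ∎
    where open ≡-Reasoning

  conv : (ℕ → F) → (ℕ → F) → ℕ → F
  conv f g n = ∑ n (λ d → 𝟙 (d ∣? n) ⊗ (f d ⊗ g (n ÷ d)))

  ∑-extend : ∀ {m n} {f : ℕ → F} → m ≤ n → (∀ i → m < i → f i ≡ # 0) → ∑ n f ≡ ∑ m f
  ∑-extend {m} {n} {f} p h = trans (cong (λ t → ∑ t f) (sym (ℕP.m+[n∸m]≡n p))) (trans (∑-+ m (n ℕ.∸ m) f)
    (trans (cong (∑ m f ⊕_) (∑-0 (n ℕ.∸ m) (λ i q _ → h (m + i) (ℕP.m<m+n m q)))) (solve 1 (λ a → a :+ κ 0 := a) refl (∑ m f))))

  ∑-conv : ∀ x (f g h : ℕ → F) → ∑ x (λ n → h n ⊗ conv f g n) ≡ ∑ x (λ d → f d ⊗ ∑ (x ÷ d) (λ k → g k ⊗ h (d * k)))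
  ∑-conv x f g h = begin
    ∑ x (λ n → h n ⊗ conv f g n)                                          ≡⟨ ∑-cong x (λ n p q → trans (cong (h n ⊗_) (ext n p q)) (sym (∑-⊗ x (h n) _))) ⟩
    ∑ x (λ n → ∑ x (λ d → h n ⊗ (𝟙 (d ∣? n) ⊗ (f d ⊗ g (n ÷ d)))))         ≡⟨ ∑-swap x x _ ⟩
    ∑ x (λ d → ∑ x (λ n → h n ⊗ (𝟙 (d ∣? n) ⊗ (f d ⊗ g (n ÷ d)))))         ≡⟨ ∑-cong x (λ d p q → trans
        (∑-ext x (λ n → (solve 4 (λ a b c d → a :* (b :* (c :* d)) := b :* (c :* (d :* a))) refl (h n) (𝟙 (d ∣? n)) (f d) (g (n ÷ d)))))
        (trans (∑-multiples x d (λ n → f d ⊗ (g (n ÷ d) ⊗ h n)) p) (trans (∑-⊗ (x ÷ d) (f d) _)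
          (cong (f d ⊗_) (∑-ext (x ÷ d) (λ k → cong (λ t → g t ⊗ h (d * k)) (*÷ d k p))))))) ⟩
    ∑ x (λ d → f d ⊗ ∑ (x ÷ d) (λ k → g k ⊗ h (d * k)))                   ∎
    where
    open ≡-Reasoning
    ext : ∀ n → 1 ≤ n → n ≤ x → conv f g n ≡ ∑ x (λ d → 𝟙 (d ∣? n) ⊗ (f d ⊗ g (n ÷ d)))
    ext n p q = sym (∑-extend q (λ d n<d → trans (cong (_⊗ (f d ⊗ g (n ÷ d))) (𝟙-no (d ∣? n) (λ d∣n → ℕP.<⇒≱ n<d (proj₂ (∣-≤ p d∣n))))) (solve 2 (λ a b → κ 0 :* (a :* b) := κ 0) refl (f d) (g (n ÷ d)))))

  prime≥2 : ∀ {p} → Prime p → 2 ≤ p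
  prime≥2 {p} pr = nonTrivial⇒n>1 p {{prime⇒nonTrivial pr}}

  prime≥1 : ∀ {p} → Prime p → 1 ≤ p
  prime≥1 pr = ℕP.≤-trans (ℕP.n≤1+n 1) (prime≥2 pr)

  prime-∣-prime : ∀ {p q} → Prime p → Prime q → p ∣ q → p ≡ q
  prime-∣-prime pp pq d with prime⇒irreducible pq d
  ... | inj₁ refl = ⊥-elim (¬prime[1] pp)
  ... | inj₂ e = e

  fac : ℕ → List ℕ
  fac zero    = []
  fac (suc n) = factors (factorise (suc n))

  fac-prime : ∀ n → All Prime (fac n)
  fac-prime zero    = []
  fac-prime (suc n) = PrimeFactorisation.factorsPrime (factorise (suc n))

  fac-product : ∀ {n} → 1 ≤ n → product (fac n) ≡ n
  fac-product {suc n} _ = sym (PrimeFactorisation.isFactorisation (factorise (suc n)))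

  fac-↭ : ∀ {n ps} → 1 ≤ n → product ps ≡ n → All Prime ps → fac n ↭ ps
  fac-↭ {suc n} {ps} p e a = factorisationUnique (factorise (suc n)) (record { factors = ps ; isFactorisation = sym e ; factorsPrime = a })

  fac-∷ : ∀ {p e} → Prime p → 1 ≤ e → fac (p * e) ↭ p ∷ fac e
  fac-∷ {p} {e} pr 1≤e = fac-↭ (ℕP.*-mono-≤ (prime≥1 pr) 1≤e) (cong (p *_) (fac-product 1≤e)) (pr ∷ fac-prime e)

  fac-++ : ∀ {m n} → 1 ≤ m → 1 ≤ n → fac (m * n) ↭ fac m ++ fac n
  fac-++ {m} {n} a b = fac-↭ (ℕP.*-mono-≤ a b) (trans (product-++ (fac m) (fac n)) (cong₂ _*_ (fac-product a) (fac-product b))) (++⁺ (fac-prime m) (fac-prime n))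

  prime-∈-fac : ∀ {p e} → Prime p → 1 ≤ e → p ∣ e → p ∈ fac e
  prime-∈-fac {p} {e} pr 1≤e d = factorisationHasAllPrimeFactors pr (subst (p ∣_) (sym (fac-product 1≤e)) d) (fac-prime e)

  ∈-∣-product : ∀ {p ps} → p ∈ ps → p ∣ product ps
  ∈-∣-product {p} {_ ∷ ps} (here refl) = m∣m*n (product ps)
  ∈-∣-product {p} {q ∷ ps} (there i)  = ∣-trans (∈-∣-product i) (n∣m*n q)

  ∈-fac-∣ : ∀ {p e} → 1 ≤ e → p ∈ fac e → p ∣ e
  ∈-fac-∣ {p} 1≤e i = subst (p ∣_) (fac-product 1≤e) (∈-∣-product i)

  -- Follows the list of prime factors with repetition. The cofactor `e` may still contain `p`, so
  -- each use has to settle the case `p ∣ e`; `∑-divisors-prime` is shaped for this.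
  prime-induction : (P : ℕ → Set) → P 1 → (∀ p e → Prime p → 1 ≤ e → P e → P (p * e)) → ∀ n → 1 ≤ n → P n
  prime-induction P base step n 1≤n = subst P (fac-product 1≤n) (go (fac n) (fac-prime n))
    where
    pos : ∀ ps → All Prime ps → 1 ≤ product ps
    pos []       []       = ℕP.≤-refl
    pos (p ∷ ps) (a ∷ as) = ℕP.*-mono-≤ (prime≥1 a) (pos ps as)
    go : ∀ ps → All Prime ps → P (product ps)
    go []       []       = base
    go (p ∷ ps) (a ∷ as) = step p (product ps) a (pos ps as) (go ps as)

  ∃-prime-∣ : ∀ n → 2 ≤ n → ∃ λ p → Prime p × p ∣ n
  ∃-prime-∣ n 2≤n with fac n in eq | fac-prime n
  ... | []     | _      = ⊥-elim (ℕP.<⇒≢ 2≤n (trans (sym (cong product eq)) (fac-product (ℕP.≤-trans (ℕP.n≤1+n 1) 2≤n))))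
  ... | p ∷ ps | a ∷ as = p , a , ∈-fac-∣ (ℕP.≤-trans (ℕP.n≤1+n 1) 2≤n) (subst (p ∈_) (sym eq) (here refl))

  ¬coprime⇒prime : ∀ {d M} → 1 ≤ d → ¬ Coprime d M → ∃ λ p → Prime p × p ∣ d × p ∣ M
  ¬coprime⇒prime {d} {M} 1≤d nc with gcd d M in eq
  ... | zero = ⊥-elim (ℕP.<⇒≢ 1≤d (sym (gcd[m,n]≡0⇒m≡0 eq)))
  ... | suc zero = ⊥-elim (nc (gcd≡1⇒coprime eq))
  ... | g@(suc (suc _)) with ∃-prime-∣ g (s≤s (s≤s z≤n))
  ...   | p , pp , p∣g = p , pp , ∣-trans p∣g (subst (_∣ d) eq (gcd[m,n]∣m d M)) , ∣-trans p∣g (subst (_∣ M) eq (gcd[m,n]∣n d M))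

  ∑-divisors : (ℕ → F) → ℕ → F
  ∑-divisors f n = ∑ n (λ d → 𝟙 (d ∣? n) ⊗ f d)

  -- The divisors of p e are the divisors of e prime to p together with the numbers p k for k ∣ e.
  ∑-divisors-prime : ∀ {p e} (f : ℕ → F) → Prime p → 1 ≤ e →
    ∑-divisors f (p * e) ≡ ∑ e (λ d → 𝟙 (d ∣? e) ⊗ ((# 1 ⊖ 𝟙 (p ∣? d)) ⊗ f d ⊕ f (p * d)))
  ∑-divisors-prime {p} {e} f pr 1≤e = begin
    ∑ (p * e) (λ d → 𝟙 (d ∣? p * e) ⊗ f d)                                                ≡⟨ ∑-ext (p * e) split ⟩
    ∑ (p * e) (λ d → 𝟙 (p ∣? d) ⊗ (𝟙 (d ∣? p * e) ⊗ f d) ⊕ 𝟙 (d ∣? e) ⊗ ((# 1 ⊖ 𝟙 (p ∣? d)) ⊗ f d)) ≡⟨ ∑-⊕ (p * e) _ _ ⟩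
    ∑ (p * e) (λ d → 𝟙 (p ∣? d) ⊗ (𝟙 (d ∣? p * e) ⊗ f d)) ⊕ ∑ (p * e) (λ d → 𝟙 (d ∣? e) ⊗ ((# 1 ⊖ 𝟙 (p ∣? d)) ⊗ f d)) ≡⟨ cong₂ _⊕_ first second ⟩
    ∑ e (λ d → 𝟙 (d ∣? e) ⊗ f (p * d)) ⊕ ∑ e (λ d → 𝟙 (d ∣? e) ⊗ ((# 1 ⊖ 𝟙 (p ∣? d)) ⊗ f d)) ≡⟨ sym (∑-⊕ e _ _) ⟩
    ∑ e (λ d → 𝟙 (d ∣? e) ⊗ f (p * d) ⊕ 𝟙 (d ∣? e) ⊗ ((# 1 ⊖ 𝟙 (p ∣? d)) ⊗ f d))           ≡⟨ ∑-ext e (λ d → (solve 4 (λ a b c d → a :* b :+ a :* ((κ 1 :- c) :* d) := a :* ((κ 1 :- c) :* d :+ b)) refl (𝟙 (d ∣? e)) (f (p * d)) (𝟙 (p ∣? d)) (f d))) ⟩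
    ∑ e (λ d → 𝟙 (d ∣? e) ⊗ ((# 1 ⊖ 𝟙 (p ∣? d)) ⊗ f d ⊕ f (p * d)))                        ∎
    where
    open ≡-Reasoning
    coprime-case : ∀ {d} → ¬ (p ∣ d) → d ∣ p * e → d ∣ e
    coprime-case {d} p∤d (divides k eq) with euclidsLemma k d pr (subst (p ∣_) eq (m∣m*n e))
    ... | inj₂ p∣d = ⊥-elim (p∤d p∣d)
    ... | inj₁ (divides j refl) = divides j (ℕP.*-cancelˡ-≡ e (j * d) p {{ℕ.>-nonZero (prime≥1 pr)}} (trans eq (trans (cong (_* d) (ℕP.*-comm j p)) (ℕP.*-assoc p j d))))
    split : ∀ d → 𝟙 (d ∣? p * e) ⊗ f d ≡ 𝟙 (p ∣? d) ⊗ (𝟙 (d ∣? p * e) ⊗ f d) ⊕ 𝟙 (d ∣? e) ⊗ ((# 1 ⊖ 𝟙 (p ∣? d)) ⊗ f d)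
    split d with p ∣? d
    ... | yes _ = (solve 3 (λ a b c → a :* b := κ 1 :* (a :* b) :+ c :* ((κ 1 :- κ 1) :* b)) refl (𝟙 (d ∣? p * e)) (f d) (𝟙 (d ∣? e)))
    ... | no p∤d = trans (cong (_⊗ f d) (𝟙-cong (d ∣? p * e) (d ∣? e) (coprime-case p∤d) (λ q → ∣-trans q (n∣m*n p))))
           (solve 3 (λ a b c → a :* b := κ 0 :* (c :* b) :+ a :* ((κ 1 :- κ 0) :* b)) refl (𝟙 (d ∣? e)) (f d) (𝟙 (d ∣? p * e)))
    first : ∑ (p * e) (λ d → 𝟙 (p ∣? d) ⊗ (𝟙 (d ∣? p * e) ⊗ f d)) ≡ ∑ e (λ d → 𝟙 (d ∣? e) ⊗ f (p * d))
    first = trans (∑-multiples (p * e) p (λ d → 𝟙 (d ∣? p * e) ⊗ f d) (prime≥1 pr))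
      (trans (cong (λ t → ∑ t (λ k → 𝟙 (p * k ∣? p * e) ⊗ f (p * k))) (*÷ p e (prime≥1 pr)))
      (∑-ext e (λ k → cong (_⊗ f (p * k)) (𝟙-cong (p * k ∣? p * e) (k ∣? e) (*-cancelˡ-∣ p {{ℕ.>-nonZero (prime≥1 pr)}}) (*-monoʳ-∣ p)))))
    second : ∑ (p * e) (λ d → 𝟙 (d ∣? e) ⊗ ((# 1 ⊖ 𝟙 (p ∣? d)) ⊗ f d)) ≡ ∑ e (λ d → 𝟙 (d ∣? e) ⊗ ((# 1 ⊖ 𝟙 (p ∣? d)) ⊗ f d))
    second = ∑-extend (ℕP.m≤n*m e p {{ℕ.>-nonZero (prime≥1 pr)}}) (λ d e<d → trans (cong (_⊗ ((# 1 ⊖ 𝟙 (p ∣? d)) ⊗ f d)) (𝟙-no (d ∣? e) (λ d∣e → ℕP.<⇒≱ e<d (proj₂ (∣-≤ 1≤e d∣e)))))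
      (solve 2 (λ a b → κ 0 :* ((κ 1 :- a) :* b) := κ 0) refl (𝟙 (p ∣? d)) (f d)))

-- Additive functions, von Mangoldt's and Möbius' functions, Selberg's identity.

open Field
module Arith (ℓ : ℕ → F) where
  open Sums
  open NumTh
  open import Data.List.Relation.Unary.Unique.DecPropositional ℕ._≟_ using (unique?)

  sumℓ : List ℕ → F
  sumℓ []       = # 0
  sumℓ (p ∷ ps) = ℓ p ⊕ sumℓ ps

  sumℓ-++ : ∀ ps qs → sumℓ (ps ++ qs) ≡ sumℓ ps ⊕ sumℓ qs
  sumℓ-++ []       qs = (solve 1 (λ a → a := κ 0 :+ a) refl (sumℓ qs))
  sumℓ-++ (p ∷ ps) qs = trans (cong (ℓ p ⊕_) (sumℓ-++ ps qs)) (solve 3 (λ a b c → a :+ (b :+ c) := a :+ b :+ c) refl (ℓ p) (sumℓ ps) (sumℓ qs))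

  sumℓ-↭ : ∀ {ps qs} → ps ↭ qs → sumℓ ps ≡ sumℓ qs
  sumℓ-↭ Perm.refl = refl
  sumℓ-↭ (prep x p) = cong (ℓ x ⊕_) (sumℓ-↭ p)
  sumℓ-↭ (swap {xs} {ys} x y p) = trans (cong (λ t → ℓ x ⊕ (ℓ y ⊕ t)) (sumℓ-↭ p)) (solve 3 (λ a b c → a :+ (b :+ c) := b :+ (a :+ c)) refl (ℓ x) (ℓ y) (sumℓ ys))
  sumℓ-↭ (Perm.trans p q) = trans (sumℓ-↭ p) (sumℓ-↭ q)

  -- The completely additive extension of the prime values `ℓ`. Below, `ℓ` is an approximate
  -- logarithm, a weight on small primes, or the constant 1.
  L : ℕ → F
  L n = sumℓ (fac n)

  L-* : ∀ {m n} → 1 ≤ m → 1 ≤ n → L (m * n) ≡ L m ⊕ L n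
  L-* {m} {n} a b = trans (sumℓ-↭ (fac-++ a b)) (sumℓ-++ (fac m) (fac n))

  fac-[p] : ∀ {p} → Prime p → fac p ↭ p ∷ []
  fac-[p] {p} pr = fac-↭ (prime≥1 pr) (ℕP.*-identityʳ p) (pr ∷ [])

  L-prime : ∀ {p} → Prime p → L p ≡ ℓ p
  L-prime {p} pr = trans (sumℓ-↭ (fac-[p] pr)) (solve 1 (λ a → a :+ κ 0 := a) refl (ℓ p))

  -- Von Mangoldt's function attached to `ℓ`: the value `ℓ p` if all prime factors equal `p`, and 0
  -- otherwise. Reading it off the head of a list is legitimate by `Λ-list-↭`.
  Λ-list : List ℕ → F
  Λ-list []       = # 0
  Λ-list (p ∷ ps) = 𝟙 (All.all? (_≟ p) ps) ⊗ ℓ p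

  Λ : ℕ → F
  Λ n = Λ-list (fac n)

  Λ-list-↭ : ∀ {ps qs} → ps ↭ qs → Λ-list ps ≡ Λ-list qs
  Λ-list-↭ {[]} {[]} p = refl
  Λ-list-↭ {[]} {_ ∷ _} p with ↭-length p
  ... | ()
  Λ-list-↭ {_ ∷ _} {[]} p with ↭-length p
  ... | ()
  Λ-list-↭ {p ∷ ps} {q ∷ qs} r with All.all? (_≟ p) ps
  ... | yes a with All-resp-↭ r (refl ∷ a)
  ...   | refl ∷ b = sym (cong (_⊗ ℓ p) (𝟙-yes (All.all? (_≟ p) qs) b))
  Λ-list-↭ {p ∷ ps} {q ∷ qs} r | no ¬a with All.all? (_≟ q) qs
  ... | no _ = (solve 2 (λ a b → κ 0 :* a := κ 0 :* b) refl (ℓ p) (ℓ q))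
  ... | yes b with All-resp-↭ (↭-sym r) (refl ∷ b)
  ...   | refl ∷ c = ⊥-elim (¬a c)

  Λ-prime : ∀ {p} → Prime p → Λ p ≡ L p
  Λ-prime {p} pr = trans (Λ-list-↭ (fac-[p] pr)) (trans (solve 1 (λ a → κ 1 :* a := a) refl (ℓ p)) (sym (L-prime pr)))

  -- A multiple `p e` is a prime power exactly when `e` is 1 or a power of `p`. If `p ∣ e` and `e`
  -- has another prime factor, both sides vanish.
  Λ-step : ∀ {p e} → Prime p → 1 ≤ e → Λ (p * e) ≡ 𝟙 (e ≟ 1) ⊗ L p ⊕ 𝟙 (p ∣? e) ⊗ Λ e
  Λ-step {p} {e} pr 1≤e with e ≟ 1
  ... | yes refl = trans (cong Λ (ℕP.*-identityʳ p)) (trans (Λ-prime pr) (trans (solve 2 (λ a b → a := κ 1 :* a :+ κ 0 :* b) refl (L p) (Λ 1)) (cong (λ t → # 1 ⊗ L p ⊕ t ⊗ Λ 1) (sym (𝟙-no (p ∣? 1) (λ d → ¬prime[1] (subst Prime (∣1⇒≡1 d) pr)))))))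
  ... | no e≢1 = trans (Λ-list-↭ (fac-∷ pr 1≤e)) (trans main (solve 3 (λ a b c → a :* b := κ 0 :* c :+ a :* b) refl (𝟙 (p ∣? e)) (Λ e) (L p)))
    where
    main : 𝟙 (All.all? (_≟ p) (fac e)) ⊗ ℓ p ≡ 𝟙 (p ∣? e) ⊗ Λ e
    main with fac e in eq | fac-prime e
    ... | [] | _ = ⊥-elim (e≢1 (trans (sym (fac-product 1≤e)) (cong productℕ eq)))
      where open import Data.Nat.ListAction renaming (product to productℕ)
    ... | q ∷ qs | pq ∷ _ = aux (q ≟ p)
     where
     aux : Dec (q ≡ p) → 𝟙 (All.all? (_≟ p) (q ∷ qs)) ⊗ ℓ p ≡ 𝟙 (p ∣? e) ⊗ (𝟙 (All.all? (_≟ q) qs) ⊗ ℓ q)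
     aux (yes refl) = trans (cong (_⊗ ℓ q) (𝟙-cong (All.all? (_≟ q) (q ∷ qs)) (All.all? (_≟ q) qs) All.tail (refl ∷_)))
               (trans (solve 2 (λ a b → a :* b := κ 1 :* (a :* b)) refl (𝟙 (All.all? (_≟ q) qs)) (ℓ q))
               (cong (_⊗ (𝟙 (All.all? (_≟ q) qs) ⊗ ℓ q)) (sym (𝟙-yes (q ∣? e) (∈-fac-∣ 1≤e (subst (q ∈_) (sym eq) (here refl)))))))
     aux (no q≢p) = trans (cong (_⊗ ℓ p) (𝟙-no (All.all? (_≟ p) (q ∷ qs)) (λ a → q≢p (All.head a)))) (trans (solve 1 (λ a → κ 0 :* a := κ 0) refl (ℓ p)) (sym rhs))
      where
      rhs : 𝟙 (p ∣? e) ⊗ (𝟙 (All.all? (_≟ q) qs) ⊗ ℓ q) ≡ # 0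
      rhs with p ∣? e
      ... | no _ = (solve 2 (λ a b → κ 0 :* (a :* b) := κ 0) refl (𝟙 (All.all? (_≟ q) qs)) (ℓ q))
      ... | yes p∣e with subst (p ∈_) eq (prime-∈-fac pr 1≤e p∣e)
      ...   | here p≡q = ⊥-elim (q≢p (sym p≡q))
      ...   | there i = trans (cong (λ t → # 1 ⊗ (t ⊗ ℓ q)) (𝟙-no (All.all? (_≟ q) qs) (λ a → q≢p (sym (All.lookup a i))))) (solve 1 (λ a → κ 1 :* (κ 0 :* a) := κ 0) refl (ℓ q))

  signed : ℕ → F
  signed zero    = # 1
  signed (suc n) = ⊝ signed n

  μ : ℕ → F
  μ n = 𝟙 (unique? (fac n)) ⊗ signed (length (fac n))

  μ-1 : μ 1 ≡ # 1
  μ-1 = (solve 0 (κ 1 :* κ 1 := κ 1) refl)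

  signed-≲ : ∀ n → signed n ≲ # 1
  signed-≲ zero    = ≲-nn 0≼1
  signed-≲ (suc n) with signed-≲ n
  ... | p , q = (lin 0 (1 · q) (solve 1 (λ a → κ 1 :- :- a := a :- :- κ 1) refl (signed n))) , (lin 0 (1 · p) (solve 1 (λ a → :- a :- :- κ 1 := κ 1 :- a) refl (signed n)))

  μ-≲ : ∀ n → μ n ≲ # 1
  μ-≲ n = ≲-weaken (≲-⊗ (≲-weaken (≲-nn (𝟙-nn (unique? (fac n)))) (𝟙≼1 (unique? (fac n)))) (signed-≲ (length (fac n)))) (lin 0 (const 0) (solve 0 (κ 1 :- κ 1 :* κ 1 := κ 0) refl))

  μ-step : ∀ {p e} → Prime p → 1 ≤ e → μ (p * e) ≡ ⊝ ((# 1 ⊖ 𝟙 (p ∣? e)) ⊗ μ e)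
  μ-step {p} {e} pr 1≤e = trans (cong₂ _⊗_ (𝟙-cong (unique? (fac (p * e))) (unique? (p ∷ fac e)) (resp (fac-∷ pr 1≤e)) (resp (↭-sym (fac-∷ pr 1≤e)))) (cong signed (↭-length (fac-∷ pr 1≤e)))) main
    where
    resp : ∀ {xs ys} → xs ↭ ys → Unique xs → Unique ys
    resp p = PS.Unique-resp-↭ (setoid ℕ) (toSetoid p)
      where open import Data.List.Relation.Binary.Permutation.Propositional using () renaming (↭⇒↭ₛ to toSetoid)
    main : 𝟙 (unique? (p ∷ fac e)) ⊗ signed (suc (length (fac e))) ≡ ⊝ ((# 1 ⊖ 𝟙 (p ∣? e)) ⊗ (𝟙 (unique? (fac e)) ⊗ signed (length (fac e))))
    main with p ∣? e
    ... | yes p∣e = trans (cong (_⊗ signed (suc (length (fac e)))) (𝟙-no (unique? (p ∷ fac e)) (λ { (a ∷ _) → All.lookup a (prime-∈-fac pr 1≤e p∣e) refl })))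
           (solve 2 (λ a b → κ 0 :* :- a := :- ((κ 1 :- κ 1) :* (b :* a))) refl (signed (length (fac e))) (𝟙 (unique? (fac e))))
    ... | no p∤e = trans (cong (_⊗ signed (suc (length (fac e)))) (𝟙-cong (unique? (p ∷ fac e)) (unique? (fac e)) (λ { (_ ∷ u) → u }) (λ u → All.tabulate (λ {q} i p≡q → p∤e (∈-fac-∣ 1≤e (subst (_∈ fac e) (sym p≡q) i))) ∷ u)))
           (solve 2 (λ a b → a :* :- b := :- ((κ 1 :- κ 0) :* (a :* b))) refl (𝟙 (unique? (fac e))) (signed (length (fac e))))

  -- In the divisor sum of `p e`, the terms `Λ (p d)` restore by `Λ-step` what was dropped for
  -- `p ∣ d`; the extra term at `d = 1` is `L p`.
  Λ-divisors : ∀ n → 1 ≤ n → ∑-divisors Λ n ≡ L n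
  Λ-divisors = prime-induction (λ n → ∑-divisors Λ n ≡ L n) (trans (cong (λ t → # 0 ⊕ t ⊗ # 0) (𝟙-yes (1 ∣? 1) ∣-refl)) (solve 0 (κ 0 :+ κ 1 :* κ 0 := κ 0) refl))
    (λ p e pr 1≤e ih → trans (∑-divisors-prime Λ pr 1≤e) (trans (∑-cong e (λ d a b →
       trans (cong (λ t → 𝟙 (d ∣? e) ⊗ ((# 1 ⊖ 𝟙 (p ∣? d)) ⊗ Λ d ⊕ t)) (Λ-step pr a))
       (solve 5 (λ a b c d e → a :* ((κ 1 :- b) :* c :+ (d :* e :+ b :* c)) := a :* c :+ d :* (a :* e)) refl (𝟙 (d ∣? e)) (𝟙 (p ∣? d)) (Λ d) (𝟙 (d ≟ 1)) (L p))))
       (trans (∑-⊕ e _ _) (trans (cong₂ _⊕_ ih (trans (∑-pick (λ d → 𝟙 (d ∣? e) ⊗ L p) ℕP.≤-refl 1≤e) (cong (_⊗ L p) (𝟙-yes (1 ∣? e) (divides e (sym (ℕP.*-identityʳ e)))))))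
       (trans (solve 2 (λ a b → a :+ κ 1 :* b := b :+ a) refl (L e) (L p)) (sym (L-* (prime≥1 pr) 1≤e)))))))

  μ-divisors : ∀ n → 1 ≤ n → ∑-divisors μ n ≡ 𝟙 (n ≟ 1)
  μ-divisors = prime-induction (λ n → ∑-divisors μ n ≡ 𝟙 (n ≟ 1)) (trans (cong₂ (λ s t → # 0 ⊕ s ⊗ t) (𝟙-yes (1 ∣? 1) ∣-refl) μ-1) (solve 0 (κ 0 :+ κ 1 :* κ 1 := κ 1) refl))
    (λ p e pr 1≤e _ → trans (∑-divisors-prime μ pr 1≤e) (trans (∑-0 e (λ d a b →
       trans (cong (λ t → 𝟙 (d ∣? e) ⊗ ((# 1 ⊖ 𝟙 (p ∣? d)) ⊗ μ d ⊕ t)) (μ-step pr a))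
       (solve 3 (λ a b c → a :* ((κ 1 :- b) :* c :+ :- ((κ 1 :- b) :* c)) := κ 0) refl (𝟙 (d ∣? e)) (𝟙 (p ∣? d)) (μ d))))
       (sym (𝟙-no (p * e ≟ 1) (λ q → ℕP.<⇒≢ (ℕP.*-mono-≤ (prime≥2 pr) 1≤e) (sym q))))))

  -- g is the Dirichlet convolution of f with 1, in summed form
  _∗1≐_ : (ℕ → F) → (ℕ → F) → Set
  f ∗1≐ g = ∀ z (h : ℕ → F) → ∑ z (λ k → h k ⊗ g k) ≡ ∑ z (λ e → f e ⊗ ∑ (z ÷ e) (λ j → h (e * j)))

  divisors-∗1 : ∀ {f g} → (∀ n → 1 ≤ n → ∑-divisors f n ≡ g n) → f ∗1≐ g
  divisors-∗1 {f} {g} e z h = trans (∑-cong z (λ n p q → cong (h n ⊗_) (trans (sym (e n p)) (∑-ext n (λ d → cong (𝟙 (d ∣? n) ⊗_) (solve 1 (λ a → a := a :* κ 1) refl (f d)))))))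
    (trans (∑-conv z f (λ _ → # 1) h) (∑-ext z (λ d → cong (f d ⊗_) (∑-ext (z ÷ d) (λ k → (solve 1 (λ a → κ 1 :* a := a) refl (h (d * k))))))))

  Λ∗1 : Λ ∗1≐ L
  Λ∗1 = divisors-∗1 Λ-divisors

  μ∗1 : μ ∗1≐ (λ n → 𝟙 (n ≟ 1))
  μ∗1 = divisors-∗1 μ-divisors

  -- After expanding `g` and exchanging the sums, the sum over `d` is innermost and `μ∗1` leaves
  -- only the term 1. The test function `h` carries residue class conditions through the inversion.
  möbius : ∀ {f g} → f ∗1≐ g → ∀ y (h : ℕ → F) → ∑ y (λ n → h n ⊗ f n) ≡ ∑ y (λ d → μ d ⊗ ∑ (y ÷ d) (λ k → h (d * k) ⊗ g k))
  möbius {f} {g} hyp y h = sym (begin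
    ∑ y (λ d → μ d ⊗ ∑ (y ÷ d) (λ k → h (d * k) ⊗ g k)) ≡⟨ ∑-ext y (λ d → trans (cong (μ d ⊗_) (hyp (y ÷ d) (λ k → h (d * k)))) (sym (∑-⊗ (y ÷ d) (μ d) _))) ⟩
    ∑ y (λ d → ∑ (y ÷ d) (λ e → μ d ⊗ (f e ⊗ ∑ (y ÷ d ÷ e) (λ j → h (d * (e * j)))))) ≡⟨ ∑-hyperbola y _ ⟩
    ∑ y (λ e → ∑ (y ÷ e) (λ d → μ d ⊗ (f e ⊗ ∑ (y ÷ d ÷ e) (λ j → h (d * (e * j)))))) ≡⟨ ∑-cong y inner ⟩
    ∑ y (λ n → h n ⊗ f n) ∎)
    where
    open ≡-Reasoning
    inner : ∀ e → 1 ≤ e → e ≤ y → ∑ (y ÷ e) (λ d → μ d ⊗ (f e ⊗ ∑ (y ÷ d ÷ e) (λ j → h (d * (e * j))))) ≡ h e ⊗ f e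
    inner e p q = trans (∑-cong (y ÷ e) (λ d a b → trans (solve 3 (λ a b c → a :* (b :* c) := b :* (a :* c)) refl (μ d) (f e) (∑ (y ÷ d ÷ e) (λ j → h (d * (e * j)))))
        (cong (λ t → f e ⊗ (μ d ⊗ t)) (trans (cong (λ t → ∑ t (λ j → h (d * (e * j)))) (÷-comm y d e a p))
           (∑-ext (y ÷ e ÷ d) (λ j → cong h (trans (sym (ℕP.*-assoc d e j)) (trans (cong (_* j) (ℕP.*-comm d e)) (ℕP.*-assoc e d j)))))))))
      (trans (∑-⊗ (y ÷ e) (f e) _) (trans (cong (f e ⊗_) (trans (sym (μ∗1 (y ÷ e) (λ m → h (e * m))))
        (trans (∑-ext (y ÷ e) (λ m → (solve 2 (λ a b → a :* b := b :* a) refl (h (e * m)) (𝟙 (m ≟ 1))))) (trans (∑-pick (λ m → h (e * m)) ℕP.≤-refl (1≤÷ p q)) (cong h (ℕP.*-identityʳ e))))))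
      (solve 2 (λ a b → a :* b := b :* a) refl (f e) (h e))))

  Λ₂ : ℕ → F
  Λ₂ n = Λ n ⊗ L n ⊕ conv Λ Λ n

  -- `Λ∗1` is applied to `h L`; then `L (e j)` splits by additivity and `Λ∗1` is applied once more
  -- to the part with `L j`. Exact additivity of `L` makes this an identity without error term.
  Λ₂∗1 : Λ₂ ∗1≐ (λ n → L n ⊗ L n)
  Λ₂∗1 z h = begin
    ∑ z (λ k → h k ⊗ (L k ⊗ L k))                                                   ≡⟨ ∑-ext z (λ k → (solve 2 (λ a b → a :* (b :* b) := a :* b :* b) refl (h k) (L k))) ⟩
    ∑ z (λ k → h k ⊗ L k ⊗ L k)                                                     ≡⟨ Λ∗1 z (λ k → h k ⊗ L k) ⟩
    ∑ z (λ e → Λ e ⊗ ∑ (z ÷ e) (λ j → h (e * j) ⊗ L (e * j)))                       ≡⟨ ∑-cong z (λ e p q → cong (Λ e ⊗_) (trans (∑-cong (z ÷ e) (λ j a b →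
          trans (cong (h (e * j) ⊗_) (L-* p a)) (solve 3 (λ a b c → a :* (b :+ c) := b :* a :+ a :* c) refl (h (e * j)) (L e) (L j)))) (trans (∑-⊕ (z ÷ e) _ _)
          (cong₂ _⊕_ (∑-⊗ (z ÷ e) (L e) _) (Λ∗1 (z ÷ e) (λ j → h (e * j))))))) ⟩
    ∑ z (λ e → Λ e ⊗ (L e ⊗ ∑ (z ÷ e) (λ j → h (e * j)) ⊕ ∑ (z ÷ e) (λ f → Λ f ⊗ ∑ (z ÷ e ÷ f) (λ j → h (e * (f * j)))))) ≡⟨ ∑-ext z (λ e → dist (Λ e) (L e) _ _) ⟩
    ∑ z (λ e → Λ e ⊗ L e ⊗ ∑ (z ÷ e) (λ j → h (e * j)) ⊕ Λ e ⊗ ∑ (z ÷ e) (λ f → Λ f ⊗ ∑ (z ÷ e ÷ f) (λ j → h (e * (f * j))))) ≡⟨ ∑-⊕ z _ _ ⟩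
    ∑ z (λ e → Λ e ⊗ L e ⊗ ∑ (z ÷ e) (λ j → h (e * j))) ⊕ ∑ z (λ e → Λ e ⊗ ∑ (z ÷ e) (λ f → Λ f ⊗ ∑ (z ÷ e ÷ f) (λ j → h (e * (f * j))))) ≡⟨ cong (∑ z (λ e → Λ e ⊗ L e ⊗ ∑ (z ÷ e) (λ j → h (e * j))) ⊕_) (sym second) ⟩
    ∑ z (λ e → Λ e ⊗ L e ⊗ ∑ (z ÷ e) (λ j → h (e * j))) ⊕ ∑ z (λ n → ∑ (z ÷ n) (λ j → h (n * j)) ⊗ conv Λ Λ n) ≡⟨ sym (∑-⊕ z _ _) ⟩
    ∑ z (λ e → Λ e ⊗ L e ⊗ ∑ (z ÷ e) (λ j → h (e * j)) ⊕ ∑ (z ÷ e) (λ j → h (e * j)) ⊗ conv Λ Λ e) ≡⟨ ∑-ext z (λ e → col (Λ e) (L e) _ _) ⟩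
    ∑ z (λ e → Λ₂ e ⊗ ∑ (z ÷ e) (λ j → h (e * j)))                                  ∎
    where
    open ≡-Reasoning
    dist : ∀ a b c d → a ⊗ (b ⊗ c ⊕ d) ≡ a ⊗ b ⊗ c ⊕ a ⊗ d
    dist a b c d = (solve 4 (λ a b c d → a :* (b :* c :+ d) := a :* b :* c :+ a :* d) refl a b c d)
    col : ∀ a b c d → a ⊗ b ⊗ c ⊕ c ⊗ d ≡ (a ⊗ b ⊕ d) ⊗ c
    col a b c d = (solve 4 (λ a b c d → a :* b :* c :+ c :* d := (a :* b :+ d) :* c) refl a b c d)
    second : ∑ z (λ n → ∑ (z ÷ n) (λ j → h (n * j)) ⊗ conv Λ Λ n) ≡ ∑ z (λ e → Λ e ⊗ ∑ (z ÷ e) (λ f → Λ f ⊗ ∑ (z ÷ e ÷ f) (λ j → h (e * (f * j)))))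
    second = trans (∑-conv z Λ Λ (λ n → ∑ (z ÷ n) (λ j → h (n * j)))) (∑-cong z (λ e p _ → cong (Λ e ⊗_) (∑-cong (z ÷ e) (λ f q _ → cong (Λ f ⊗_)
      (trans (cong (λ t → ∑ t (λ j → h (e * f * j))) (sym (÷-÷ z e f p q))) (∑-ext (z ÷ e ÷ f) (λ j → cong h (ℕP.*-assoc e f j))))))))

-- An exactly additive approximation to the logarithm.

module Log where
  open Field
  open Sums
  open NumTh

  -- Prime values ℓ p whose completely additive extension behaves like the logarithm up to B.
  record LogLike (B : ℕ) : Set where
    field ℓ : ℕ → F
    open Arith ℓ
    field
      inc-up : ∀ n → 1 ≤ n → n < B → L (suc n) ⊖ L n ≼ # 2 ⊗ ⅟ n
      inc-lo : ∀ n → 1 ≤ n → n < B → ⅟ (suc n) ≼ # 2 ⊗ (L (suc n) ⊖ L n)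

  private
    h : ℕ → F
    h n = ∑ n ⅟

    diff : ∀ a m → h (a + m) ⊖ h a ≡ ∑ m (λ i → ⅟ (a + i))
    diff a m = (≼-antisym (lin 0 (1 · (≡≼ (∑-+ a m ⅟))) (solve 3 (λ a b c → c :- (a :- b) := b :+ c :- a) refl (h (a + m)) (h a) (∑ m (λ i → ⅟ (a + i))))) (lin 0 (1 · (≡≽ (∑-+ a m ⅟))) (solve 3 (λ a b c → a :- b :- c := a :- (b :+ c)) refl (h (a + m)) (h a) (∑ m (λ i → ⅟ (a + i))))))

    block-lo : ∀ a m → # m ⊗ ⅟ (a + m) ≼ h (a + m) ⊖ h a
    block-lo a m = ≼-trans (≡≽ (∑-const m (⅟ (a + m)))) (≼-trans (∑-mono m (λ i p q → ⅟-anti (ℕP.≤-trans p (ℕP.m≤n+m i a)) (ℕP.+-monoʳ-≤ a q))) (≡≽ (diff a m)))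

    block-up : ∀ a m → 1 ≤ a → h (a + m) ⊖ h a ≼ # m ⊗ ⅟ a
    block-up a m 1≤a = ≼-trans (≡≼ (diff a m)) (≼-trans (∑-mono m (λ i p q → ⅟-anti 1≤a (ℕP.m≤m+n a i))) (≡≼ (∑-const m (⅟ a))))

    scale : ∀ m i → 1 ≤ m → 1 ≤ i → # m ⊗ ⅟ (m * i) ≡ ⅟ i
    scale m i p q = trans (cong (# m ⊗_) (⅟-* p q)) (trans (solve 3 (λ a b c → a :* (b :* c) := a :* b :* c) refl (# m) (⅟ m) (⅟ i)) (trans (cong (_⊗ ⅟ i) (⅟-law p)) (solve 1 (λ a → κ 1 :* a := a) refl (⅟ i))))

    frac : ∀ {a b z} → 1 ≤ b → 1 ≤ z → a * b ≤ z → # a ⊗ ⅟ z ≼ ⅟ b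
    frac {a} {b} {z} p q r = cancel (#-mono p) (≼-trans (≡≼ (trans (solve 3 (λ a b c → a :* (b :* c) := b :* a :* c) refl (# b) (# a) (⅟ z)) (cong (_⊗ ⅟ z) (sym (#-* a b)))))
      (≼-trans (⊗-monoˡ (⅟-nn z) (#-mono r)) (≡≼ (trans (⅟-law q) (sym (⅟-law p))))))

  module Harmonic (Z : ℕ) (1≤Z : 1 ≤ Z) where
    -- (1 + o(1)) log n for large Z
    lg : ℕ → F
    lg n = h (n * Z) ⊖ h Z

    lg-1 : lg 1 ≡ # 0
    lg-1 = trans (cong (λ t → h t ⊖ h Z) (ℕP.*-identityˡ Z)) (solve 1 (λ a → a :- a := κ 0) refl (h Z))

    private
      1≤*Z : ∀ {n} → 1 ≤ n → 1 ≤ n * Z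
      1≤*Z p = ℕP.*-mono-≤ p 1≤Z

      step : ∀ n → lg (suc n) ⊖ lg n ≡ h (n * Z + Z) ⊖ h (n * Z)
      step n = trans (cong (λ t → h t ⊖ h Z ⊖ lg n) (ℕP.+-comm Z (n * Z))) (solve 3 (λ a b c → a :- b :- (c :- b) := a :- c) refl (h (n * Z + Z)) (h Z) (h (n * Z)))

    lg-up : ∀ n → 1 ≤ n → lg (suc n) ⊖ lg n ≼ ⅟ n
    lg-up n p = ≼-trans (≡≼ (step n)) (≼-trans (block-up (n * Z) Z (1≤*Z p)) (≡≼ (trans (cong (λ t → # Z ⊗ ⅟ t) (ℕP.*-comm n Z)) (scale Z n 1≤Z p))))

    lg-lo : ∀ n → ⅟ (suc n) ≼ lg (suc n) ⊖ lg n
    lg-lo n = ≼-trans (≡≽ (trans (cong (λ t → # Z ⊗ ⅟ t) (trans (ℕP.+-comm (n * Z) Z) (ℕP.*-comm (suc n) Z))) (scale Z (suc n) 1≤Z (s≤s z≤n)))) (≼-trans (block-lo (n * Z) Z) (≡≽ (step n)))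

    private
      D : ℕ → ℕ → F
      D m t = h (m * (Z + t)) ⊖ h (m * Z) ⊖ (h (Z + t) ⊖ h Z)

      -- `D` measures how far `lg` is from being additive. When `t` grows by 1, `m` consecutive
      -- reciprocals enter, with sum between `⅟ (suc (Z + t))` and `⅟ (Z + t)`, and
      -- `⅟ (suc (Z + t))` is subtracted; these bounds telescope.
      D-bound : ∀ m t → 1 ≤ m → (# 0 ≼ D m t) × (D m t ≼ ⅟ Z ⊖ ⅟ (Z + t))
      D-bound m zero p rewrite ℕP.+-identityʳ Z = (lin 0 (const 0) (solve 2 (λ a b → a :- a :- (b :- b) :- κ 0 := κ 0) refl (h (m * Z)) (h Z))) , (lin 0 (const 0) (solve 3 (λ a b c → c :- c :- (a :- a :- (b :- b)) := κ 0) refl (h (m * Z)) (h Z) (⅟ Z)))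
      D-bound m (suc t) p rewrite ℕP.+-suc Z t | ℕP.*-suc m (Z + t) | ℕP.+-comm m (m * (Z + t)) =
        (lin 0 (1 · (proj₁ (D-bound m t p)) ⊞ 1 · lo) (solve 6 (λ a b c d e f → a :- b :- (c :+ d :- e) :- κ 0 := f :- b :- (c :- e) :- κ 0 :+ (a :- f :- d)) refl (h (m * (Z + t) + m)) (h (m * Z)) (h (Z + t)) (⅟ (suc (Z + t))) (h Z) (h (m * (Z + t))))) ,
        (lin 0 (1 · (proj₂ (D-bound m t p)) ⊞ 1 · up) (solve 8 (λ a b c d e f g h → f :- d :- (a :- b :- (c :+ d :- e)) := f :- h :- (g :- b :- (c :- e)) :+ (h :- (a :- g))) refl (h (m * (Z + t) + m)) (h (m * Z)) (h (Z + t)) (⅟ (suc (Z + t))) (h Z) (⅟ Z) (h (m * (Z + t))) (⅟ (Z + t))))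
        where
        1≤a : 1 ≤ Z + t
        1≤a = ℕP.≤-trans 1≤Z (ℕP.m≤m+n Z t)
        lo : ⅟ (suc (Z + t)) ≼ h (m * (Z + t) + m) ⊖ h (m * (Z + t))
        lo = ≼-trans (≡≽ (trans (cong (λ u → # m ⊗ ⅟ u) (trans (ℕP.+-comm (m * (Z + t)) m) (sym (ℕP.*-suc m (Z + t))))) (scale m (suc (Z + t)) p (s≤s z≤n)))) (block-lo (m * (Z + t)) m)
        up : h (m * (Z + t) + m) ⊖ h (m * (Z + t)) ≼ ⅟ (Z + t)
        up = ≼-trans (block-up (m * (Z + t)) m (ℕP.*-mono-≤ p 1≤a)) (≡≼ (scale m (Z + t) p 1≤a))

    lg-* : ∀ m n → 1 ≤ m → 1 ≤ n → (lg m ⊕ lg n ≼ lg (m * n)) × (lg (m * n) ≼ lg m ⊕ lg n ⊕ ⅟ Z)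
    lg-* m (suc n) p _ rewrite ℕP.*-assoc m (suc n) Z =
        (lin 0 (1 · (proj₁ b)) (solve 4 (λ a b c d → d :- b :- (a :- b :+ (c :- b)) := d :- a :- (c :- b) :- κ 0) refl (h (m * Z)) (h Z) (h (Z + n * Z)) (h (m * (Z + n * Z))))) ,
        (lin 0 (1 · (proj₂ b) ⊞ 1 · (⅟-nn (Z + n * Z))) (solve 6 (λ a b c d e f → c :- b :+ (d :- b) :+ e :- (a :- b) := e :- f :- (a :- c :- (d :- b)) :+ (f :- κ 0)) refl (h (m * (Z + n * Z))) (h Z) (h (m * Z)) (h (Z + n * Z)) (⅟ Z) (⅟ (Z + n * Z))))
      where b = D-bound m (n * Z) p

    open Arith lg

    L≼lg : ∀ n → 1 ≤ n → L n ≼ lg n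
    L≼lg = prime-induction (λ n → L n ≼ lg n) (≡≽ lg-1) λ p e pr 1≤e ih →
      (lin 0 (1 · (≡≼ (L-* (prime≥1 pr) 1≤e)) ⊞ 1 · (≡≼ (L-prime pr)) ⊞ 1 · ih ⊞ 1 · (proj₁ (lg-* p e (prime≥1 pr) 1≤e))) (solve 6 (λ a b c d e f → b :- a := c :+ d :- a :+ (e :- c :+ (f :- d :+ (b :- (e :+ f))))) refl (L (p * e)) (lg (p * e)) (L p) (L e) (lg p) (lg e)))

    -- Each prime factor costs at most `⅟ Z`, and `suc e ≤ p e` gives the bound `n ⅟ Z` room for one
    -- more factor at every step.
    lg≼L : ∀ n → 1 ≤ n → lg n ≼ L n ⊕ # n ⊗ ⅟ Z
    lg≼L = prime-induction (λ n → lg n ≼ L n ⊕ # n ⊗ ⅟ Z)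
      (≼-trans (≡≼ lg-1) (lin 0 (1 · (⅟-nn Z)) (solve 1 (λ a → κ 0 :+ κ 1 :* a :- κ 0 := a :- κ 0) refl (⅟ Z)))) λ p e pr 1≤e ih →
      (lin 0 (1 · (≡≽ (L-* (prime≥1 pr) 1≤e)) ⊞ 1 · (≡≽ (L-prime pr)) ⊞ 1 · ih ⊞ 1 · (proj₂ (lg-* p e (prime≥1 pr) 1≤e)) ⊞ 1 · (nn-⊗ (⅟-nn Z) (sub-nn (≼-trans (≡≽ (#-suc e)) (#-mono (1+e≤ p e pr 1≤e)))))) (solve 9 (λ a b c d e f g h i → b :+ c :* d :- a := b :- (e :+ f) :+ (e :- g :+ (f :+ i :* d :- h :+ (g :+ h :+ d :- a :+ (d :* (c :- (κ 1 :+ i)) :- κ 0))))) refl (lg (p * e)) (L (p * e)) (# (p * e)) (⅟ Z) (L p) (L e) (lg p) (lg e) (# e)))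
      where
      1+e≤ : ∀ p e → Prime p → 1 ≤ e → suc e ≤ p * e
      1+e≤ p e pr 1≤e = ℕP.≤-trans (ℕP.≤-trans (ℕP.+-monoˡ-≤ e 1≤e) (ℕP.≤-reflexive (cong (e +_) (sym (ℕP.+-identityʳ e))))) (ℕP.*-monoˡ-≤ e (prime≥2 pr))

  logLike : ∀ B → 1 ≤ B → LogLike B
  logLike B 1≤B = record
    { ℓ = lg
    ; inc-up = λ n p q → (lin 0 (1 · (L≼lg (suc n) (s≤s z≤n)) ⊞ 1 · (lg≼L n p) ⊞ 1 · (lg-up n p) ⊞ 1 · (frac p 1≤Z (ℕP.≤-trans (ℕP.*-mono-≤ (ℕP.<⇒≤ q) (ℕP.<⇒≤ q)) (ℕP.m≤n*m (B * B) 2)))) (solve 7 (λ a b c d e f g → κ 2 :* c :- (a :- b) := d :- a :+ (b :+ f :* g :- e :+ (c :- (d :- e) :+ (c :- f :* g)))) refl (L (suc n)) (L n) (⅟ n) (lg (suc n)) (lg n) (# n) (⅟ Z)))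
    ; inc-lo = λ n p q → (lin 0 (2 · (L≼lg n p) ⊞ 2 · (lg≼L (suc n) (s≤s z≤n)) ⊞ 2 · (lg-lo n) ⊞ 1 · (frac (s≤s z≤n) 1≤Z (ℕP.≤-trans (ℕP.≤-reflexive (ℕP.*-assoc 2 (suc n) (suc n))) (ℕP.*-monoʳ-≤ 2 (ℕP.*-mono-≤ q q)))) ⊞ 1 · (≡≽ (cong (_⊗ ⅟ Z) (#-* 2 (suc n))))) (solve 8 (λ a b c d e f g h → κ 2 :* (b :- c) :- a := κ 2 :* (d :- c) :+ (κ 2 :* (b :+ f :* g :- e) :+ (κ 2 :* (e :- d :- a) :+ (a :- h :* g :+ (h :* g :- κ 2 :* f :* g))))) refl (⅟ (suc n)) (L (suc n)) (L n) (lg n) (lg (suc n)) (# (suc n)) (⅟ Z) (# (2 * suc n))))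
    }
    where
    -- With `suc n ≤ B` the error `suc n / Z` is at most half of `⅟ (suc n)`, so the increments of
    -- `L` agree with those of the logarithm up to a factor 2.
    Z = 2 * (B * B)
    1≤Z : 1 ≤ Z
    1≤Z = ℕP.≤-trans (ℕP.*-mono-≤ 1≤B 1≤B) (ℕP.m≤n*m (B * B) 2)
    open Harmonic Z 1≤Z
    open Arith lg

-- Chebyshev's and Mertens' estimates up to B.

open Log
module Mang (B : ℕ) (2≤B : 2 ℕ.≤ B) (lgB : LogLike B) where
  open Field
  open Sums
  open NumTh
  open LogLike lgB
  open Arith ℓ public

  private
    1≤B : 1 ≤ B
    1≤B = ℕP.≤-trans (ℕP.n≤1+n 1) 2≤B

  inc-nn : ∀ n → 1 ≤ n → n < B → # 0 ≼ L (suc n) ⊖ L n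
  inc-nn n p q = (lin 1 (1 · (inc-lo n p q) ⊞ 1 · (⅟-nn (suc n))) (solve 3 (λ a b c → κ 2 :* (a :- b :- κ 0) := κ 2 :* (a :- b) :- c :+ (c :- κ 0)) refl (L (suc n)) (L n) (⅟ (suc n))))

  inc-up′ : ∀ n → 1 ≤ n → n < B → # n ⊗ (L (suc n) ⊖ L n) ≼ # 2
  inc-up′ n p q = ≼-trans (⊗-monoʳ (0≼# n) (inc-up n p q)) (≡≼ (trans (solve 2 (λ a b → a :* (κ 2 :* b) := κ 2 :* (a :* b)) refl (# n) (⅟ n)) (trans (cong (# 2 ⊗_) (⅟-law p)) (solve 0 (κ 2 :* κ 1 := κ 2) refl))))

  inc≼2 : ∀ n → 1 ≤ n → n < B → L (suc n) ⊖ L n ≼ # 2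
  inc≼2 n p q = (lin 0 (1 · (inc-up n p q) ⊞ 2 · (⅟≼1 n)) (solve 3 (λ a b c → κ 2 :- (a :- b) := κ 2 :* c :- (a :- b) :+ κ 2 :* (κ 1 :- c)) refl (L (suc n)) (L n) (⅟ n)))

  L-mono : ∀ {m n} → 1 ≤ m → m ≤ n → n ≤ B → L m ≼ L n
  L-mono {m} {zero} p z≤n _ = ≼-refl
  L-mono {m} {suc n} p q r with m ≟ suc n
  ... | yes refl = ≼-refl
  ... | no m≢ = (lin 0 (1 · (L-mono p m≤n (ℕP.<⇒≤ r)) ⊞ 1 · (inc-nn n (ℕP.≤-trans p m≤n) r)) (solve 3 (λ a b c → b :- a := c :- a :+ (b :- c :- κ 0)) refl (L m) (L (suc n)) (L n)))
    where m≤n = ℕP.≤-pred (ℕP.≤∧≢⇒< q m≢)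

  L-nn : ∀ {n} → 1 ≤ n → n ≤ B → # 0 ≼ L n
  L-nn p q = L-mono ℕP.≤-refl p q

  L2≼2 : L 2 ≼ # 2
  L2≼2 = (lin 0 (1 · (inc≼2 1 ℕP.≤-refl 2≤B)) (solve 1 (λ a → κ 2 :- a := κ 2 :- (a :- κ 0)) refl (L 2)))

  1≼4L2 : # 1 ≼ # 4 ⊗ L 2
  1≼4L2 = (lin 0 (2 · (inc-lo 1 ℕP.≤-refl 2≤B) ⊞ 1 · (≡≽ (⅟-law {2} (s≤s z≤n)))) (solve 2 (λ a b → κ 4 :* a :- κ 1 := κ 2 :* (κ 2 :* (a :- κ 0) :- b) :+ (κ 2 :* b :- κ 1)) refl (L 2) (⅟ 2)))

  L≼2n-2 : ∀ n → 1 ≤ n → n ≤ B → L n ≼ # 2 ⊗ # n ⊖ # 2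
  L≼2n-2 (suc zero) _ _ = (lin 0 (const 0) (solve 0 (κ 2 :* κ 1 :- κ 2 :- κ 0 := κ 0) refl))
  L≼2n-2 (suc (suc n)) _ q = (lin 0 (1 · (L≼2n-2 (suc n) (s≤s z≤n) (ℕP.<⇒≤ q)) ⊞ 1 · (inc≼2 (suc n) (s≤s z≤n) q) ⊞ 2 · (≡≽ (#-suc (suc n)))) (solve 4 (λ a b c d → κ 2 :* b :- κ 2 :- a := κ 2 :* d :- κ 2 :- c :+ (κ 2 :- (a :- c) :+ κ 2 :* (b :- (κ 1 :+ d)))) refl (L (suc (suc n))) (# (suc (suc n))) (L (suc n)) (# (suc n))))

  Λ-nn : ∀ n → n ≤ B → # 0 ≼ Λ n
  Λ-nn zero q = ≼-refl
  Λ-nn n@(suc _) q with fac n in eq | fac-prime n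
  ... | [] | _ = ≼-refl
  ... | p ∷ ps | pr ∷ _ = nn-⊗ (𝟙-nn (All.all? (_≟ p) ps)) (≼-trans (L-nn (prime≥1 pr) (ℕP.≤-trans (proj₂ (∣-≤ (s≤s z≤n) p∣n)) q)) (≡≼ (L-prime pr)))
    where
    p∣n : p ∣ n
    p∣n = ∈-fac-∣ (s≤s z≤n) (subst (p ∈_) (sym eq) (here refl))

  θ-up : ∀ x → x ≤ B → ∑ x L ≼ # x ⊗ L x
  θ-up x q = ≼-trans (∑-mono x (λ i a b → L-mono a b q)) (≡≼ (∑-const x (L x)))

  -- A weak form of Stirling's formula, `∑ x L` being the logarithm of a factorial: in the step to
  -- `suc n` the first `n` factors lose `n (L (suc n) - L n)`, at most 2.
  θ-lo : ∀ x → x ≤ B → # x ⊗ L x ≼ ∑ x L ⊕ # 2 ⊗ # x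
  θ-lo zero q = (lin 0 (const 0) (solve 1 (λ a → κ 0 :+ κ 2 :* κ 0 :- κ 0 :* a := κ 0) refl (L 0)))
  θ-lo (suc zero) q = (lin 0 (const 2) (solve 0 (κ 0 :+ κ 0 :+ κ 2 :* κ 1 :- κ 1 :* κ 0 := κ 2) refl))
  θ-lo (suc n@(suc _)) q = (lin 0 (1 · (θ-lo n (ℕP.<⇒≤ q)) ⊞ 1 · (inc-up′ n (s≤s z≤n) q) ⊞ 2 · (≡≽ (#-suc n)) ⊞ 1 · (≡≼ (cong (_⊗ L (suc n)) (#-suc n)))) (solve 5 (λ a b c d e → c :+ b :+ κ 2 :* a :- a :* b := c :+ κ 2 :* d :- d :* e :+ (κ 2 :- d :* (b :- e) :+ (κ 2 :* (a :- (κ 1 :+ d)) :+ ((κ 1 :+ d) :* b :- a :* b)))) refl (# (suc n)) (L (suc n)) (∑ n L) (# n) (L n)))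

  θ-Λ : ∀ x → ∑ x L ≡ ∑ x (λ d → Λ d ⊗ # (x ÷ d))
  θ-Λ x = trans (∑-ext x (λ k → (solve 1 (λ a → a := κ 1 :* a) refl (L k)))) (trans (Λ∗1 x (λ _ → # 1)) (∑-ext x (λ d → cong (Λ d ⊗_) (trans (∑-const (x ÷ d) (# 1)) (solve 1 (λ a → a :* κ 1 := a) refl (# (x ÷ d)))))))

  halves : ∀ x → ∃ λ y → (x ≡ 2 * y) ⊎ (x ≡ suc (2 * y))
  halves zero = 0 , inj₁ refl
  halves (suc x) with halves x
  ... | y , inj₁ e = y , inj₂ (cong suc e)
  ... | y , inj₂ e = suc y , inj₁ (trans (cong suc e) (cong suc (sym (ℕP.+-suc y (y + 0)))))

  ÷-lo : ∀ x d → 1 ≤ d → # (x ÷ d) ≼ # x ⊗ ⅟ d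
  ÷-lo x d p = cancel (#-mono p) (≼-trans (≡≽ (#-* d (x ÷ d))) (≼-trans (#-mono (÷-≤ d p ℕP.≤-refl)) (lin 0 (1 · (≡≽ (cong (# x ⊗_) (⅟-law p)))) (solve 3 (λ a b c → b :* (a :* c) :- a := a :* (b :* c) :- a :* κ 1) refl (# x) (# d) (⅟ d)))))

  ÷-up : ∀ x d → 1 ≤ d → # x ⊗ ⅟ d ≼ # (x ÷ d) ⊕ # 1
  ÷-up x d p = cancel (#-mono p) (lin 0 (1 · (≡≼ (cong (# x ⊗_) (⅟-law p))) ⊞ 1 · (#-mono (ℕP.<⇒≤ (<-suc÷ x d p))) ⊞ 1 · (≡≼ (#-* d (suc (x ÷ d)))) ⊞ 1 · (≡≼ (cong (# d ⊗_) (#-suc (x ÷ d))))) (solve 6 (λ a b c d e f → a :* (d :+ κ 1) :- a :* (b :* c) := b :* κ 1 :- b :* (a :* c) :+ (e :- b :+ (a :* f :- e :+ (a :* (κ 1 :+ d) :- a :* f)))) refl (# d) (# x) (⅟ d) (# (x ÷ d)) (# (d * suc (x ÷ d))) (# (suc (x ÷ d)))))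

  ψ : ℕ → F
  ψ x = ∑ x Λ

  -- Chebyshev's binomial coefficient, with `y` the half of `x`: the multiplicity
  -- `x ÷ d - 2 (y ÷ d)` of `Λ d` is nonnegative, and at least 1 for `y < d ≤ x`.
  ψ-step : ∀ x y → x ≤ B → 2 * y ≤ x → x ≤ suc (2 * y) → ψ x ⊖ ψ y ≼ ∑ x L ⊖ # 2 ⊗ ∑ y L
  ψ-step x y q lo hi = ≼-trans (≡≼ e₁) (≼-trans (∑-mono x (λ d a b → ⊗-monoʳ (Λ-nn d (ℕP.≤-trans b q)) (key d a b))) (≡≼ e₂))
    where
    y≤x : y ≤ x
    y≤x = ℕP.≤-trans (ℕP.m≤n*m y 2) lo
    e₁ : ψ x ⊖ ψ y ≡ ∑ x (λ d → Λ d ⊗ (# 1 ⊖ 𝟙 (d ≤? y)))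
    e₁ = trans (cong (ψ x ⊖_) (sym (∑-trunc Λ y≤x))) (trans (sym (∑-⊖ x Λ (λ d → 𝟙 (d ≤? y) ⊗ Λ d))) (∑-ext x (λ d → (solve 2 (λ a b → a :- b :* a := a :* (κ 1 :- b)) refl (Λ d) (𝟙 (d ≤? y))))))
    y÷0 : ∀ d → 1 ≤ d → y < d → y ÷ d ≡ 0
    y÷0 d a b = ÷-unique {y} a (λ { zero _ → z≤n ; (suc j) r → ⊥-elim (ℕP.<⇒≱ b (ℕP.≤-trans (ℕP.m≤m*n d (suc j)) r)) }) (ℕP.≤-trans (ℕP.≤-reflexive (ℕP.*-zeroʳ d)) z≤n)
    e₂ : ∑ x (λ d → Λ d ⊗ (# (x ÷ d) ⊖ # 2 ⊗ # (y ÷ d))) ≡ ∑ x L ⊖ # 2 ⊗ ∑ y L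
    e₂ = trans (∑-ext x (λ d → (solve 3 (λ a b c → a :* (b :- κ 2 :* c) := a :* b :- κ 2 :* (a :* c)) refl (Λ d) (# (x ÷ d)) (# (y ÷ d)))))
      (trans (∑-⊖ x _ _) (cong₂ _⊖_ (sym (θ-Λ x)) (trans (∑-⊗ x (# 2) _) (cong (# 2 ⊗_)
      (trans (∑-extend y≤x (λ d y<d → trans (cong (λ t → Λ d ⊗ # t) (y÷0 d (ℕP.≤-trans (s≤s z≤n) y<d) y<d)) (solve 1 (λ a → a :* κ 0 := κ 0) refl (Λ d)))) (sym (θ-Λ y)))))))
    key : ∀ d → 1 ≤ d → d ≤ x → # 1 ⊖ 𝟙 (d ≤? y) ≼ # (x ÷ d) ⊖ # 2 ⊗ # (y ÷ d)
    key d a b with d ≤? y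
    ... | yes d≤y = (lin 0 (1 · (#-mono two) ⊞ 1 · (≡≽ (#-* 2 (y ÷ d)))) (solve 3 (λ a b c → a :- κ 2 :* b :- (κ 1 :- κ 1) := a :- c :+ (c :- κ 2 :* b)) refl (# (x ÷ d)) (# (y ÷ d)) (# (2 * (y ÷ d)))))
      where
      two : 2 * (y ÷ d) ≤ x ÷ d
      two = ≤-÷ d a (ℕP.≤-trans (ℕP.≤-reflexive (trans (sym (ℕP.*-assoc d 2 (y ÷ d))) (trans (cong (_* (y ÷ d)) (ℕP.*-comm d 2)) (ℕP.*-assoc 2 d (y ÷ d))))) (ℕP.≤-trans (ℕP.*-monoʳ-≤ 2 (÷-≤ d a ℕP.≤-refl)) lo))
    ... | no d≰y = ≼-trans (lin 0 (1 · (#-mono (1≤÷ a b))) (solve 1 (λ a → a :- κ 2 :* κ 0 :- (κ 1 :- κ 0) := a :- κ 1) refl (# (x ÷ d)))) (≡≼ (cong (λ t → # (x ÷ d) ⊖ # 2 ⊗ # t) (sym (y÷0 d a (ℕP.≰⇒> d≰y)))))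

  -- Induction on halving. The half contributes `12 y`, the weak Stirling bound `4 y`, the
  -- comparison of `L x` with `L y + 3` another `3 x`, and `(x - 2 y) L y` at most `2 y`. Since
  -- `2 y ≤ x`, the sum `18 y + 3 x` is at most `12 x`.
  chebyshev : ∀ x → x ≤ B → ψ x ≼ # 12 ⊗ # x
  chebyshev x = go x x ℕP.≤-refl
    where
    L-half : ∀ x y → 1 ≤ y → x ≤ B → (x ≡ 2 * y) ⊎ (x ≡ suc (2 * y)) → L x ≼ L y ⊕ # 3
    L-half x y p q (inj₁ refl) = (lin 0 (1 · (≡≼ (L-* {2} (s≤s z≤n) p)) ⊞ 1 · L2≼2 ⊞ const 1) (solve 3 (λ a b c → b :+ κ 3 :- a := c :+ b :- a :+ (κ 2 :- c :+ κ 1)) refl (L (2 * y)) (L y) (L 2)))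
    L-half x y p q (inj₂ refl) = (lin 0 (1 · (≡≼ (L-* {2} (s≤s z≤n) p)) ⊞ 1 · L2≼2 ⊞ 1 · (inc-up (2 * y) 1≤2y q) ⊞ 2 · (⅟-anti {2} (s≤s z≤n) (ℕP.*-monoʳ-≤ 2 p)) ⊞ 1 · (≡≼ (⅟-law {2} (s≤s z≤n)))) (solve 6 (λ a b c d e f → b :+ κ 3 :- a := d :+ b :- c :+ (κ 2 :- d :+ (κ 2 :* e :- (a :- c) :+ (κ 2 :* (f :- e) :+ (κ 1 :- κ 2 :* f))))) refl (L (suc (2 * y))) (L y) (L (2 * y)) (L 2) (⅟ (2 * y)) (⅟ 2)))
      where 1≤2y = ℕP.*-mono-≤ {1} {2} (s≤s z≤n) p
    go : ∀ n x → x ≤ n → x ≤ B → ψ x ≼ # 12 ⊗ # x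
    go n zero _ _ = (lin 0 (const 0) (solve 0 (κ 12 :* κ 0 :- κ 0 := κ 0) refl))
    go n (suc zero) _ _ = (lin 0 (const 12) (solve 0 (κ 12 :* κ 1 :- (κ 0 :+ κ 0) := κ 12) refl))
    go (suc n) x@(suc (suc x′)) (s≤s r) q with halves x
    ... | zero , inj₁ ()
    ... | zero , inj₂ ()
    ... | y@(suc _) , e = (lin 0 (1 · (ψ-step x y q lo (hi e)) ⊞ 1 · (go n y y≤n (ℕP.≤-trans y≤x q)) ⊞ 1 · (θ-up x q) ⊞ 2 · (θ-lo y (ℕP.≤-trans y≤x q)) ⊞ 1 · (⊗-monoʳ (0≼# x) (L-half x y (s≤s z≤n) q e)) ⊞ 1 · (⊗-monoˡ (L-nn {y} (s≤s z≤n) (ℕP.≤-trans y≤x q)) (#-mono (hi e))) ⊞ 1 · (≡≼ (cong (_⊗ L y) (trans (#-suc (2 * y)) (cong (# 1 ⊕_) (#-* 2 y))))) ⊞ 1 · (L≼2n-2 y (s≤s z≤n) (ℕP.≤-trans y≤x q)) ⊞ 9 · (#-mono lo) ⊞ 9 · (≡≽ (#-* 2 y)) ⊞ const 2) (solve 10 (λ a b c d e f g h i j → κ 12 :* b :- a := d :- κ 2 :* e :- (a :- c) :+ (κ 12 :* f :- c :+ (b :* g :- d :+ (κ 2 :* (e :+ κ 2 :* f :- f :* h) :+ (b :* (h :+ κ 3) :- b :* g :+ (i :* h :- b :* h :+ ((κ 1 :+ κ 2 :* f) :* h :- i :* h :+ (κ 2 :* f :- κ 2 :- h :+ (κ 9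 :* (b :- j) :+ (κ 9 :* (j :- κ 2 :* f) :+ κ 2)))))))))) refl (ψ x) (# x) (ψ y) (∑ x L) (∑ y L) (# y) (L x) (L y) (# (suc (2 * y))) (# (2 * y))))
      where
      hi : (x ≡ 2 * y) ⊎ (x ≡ suc (2 * y)) → x ≤ suc (2 * y)
      hi (inj₁ e) = ℕP.≤-trans (ℕP.≤-reflexive e) (ℕP.n≤1+n _)
      hi (inj₂ e) = ℕP.≤-reflexive e
      lo′ : (x ≡ 2 * y) ⊎ (x ≡ suc (2 * y)) → 2 * y ≤ x
      lo′ (inj₁ e) = ℕP.≤-reflexive (sym e)
      lo′ (inj₂ e) = ℕP.≤-trans (ℕP.n≤1+n _) (ℕP.≤-reflexive (sym e))
      lo = lo′ e
      y≤x : y ≤ x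
      y≤x = ℕP.≤-trans (ℕP.m≤n*m y 2) lo
      y≤n : y ≤ n
      y≤n = ℕP.≤-trans (ℕP.≤-pred (ℕP.≤-trans (ℕP.≤-trans (s≤s (ℕP.m≤m+n y 0)) (ℕP.+-monoˡ-≤ (y + 0) {1} (s≤s z≤n))) lo)) r

  W : ℕ → F
  W x = ∑ x (λ d → Λ d ⊗ ⅟ d)

  -- Mertens' estimate: in `θ-Λ` the floor `x ÷ d` is at most `x / d`. The reverse bound `W-up`
  -- loses up to 1 in each floor, in total `ψ x`, which Chebyshev's bound covers.
  W-lo : ∀ x → 1 ≤ x → x ≤ B → L x ≼ W x ⊕ # 2
  W-lo x p q = cancel (#-mono p) (lin 0 (1 · (θ-lo x q) ⊞ 1 · θ≼) (solve 4 (λ a b c d → a :* (c :+ κ 2) :- a :* b := d :+ κ 2 :* a :- a :* b :+ (a :* c :- d)) refl (# x) (L x) (W x) (∑ x L)))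
    where
    θ≼ : ∑ x L ≼ # x ⊗ W x
    θ≼ = ≼-trans (≡≼ (θ-Λ x)) (≼-trans (∑-mono x (λ d a b → ≼-trans (⊗-monoʳ (Λ-nn d (ℕP.≤-trans b q)) (÷-lo x d a)) (≡≼ (solve 3 (λ a b c → a :* (b :* c) := b :* (a :* c)) refl (Λ d) (# x) (⅟ d))))) (≡≼ (∑-⊗ x (# x) _)))

  W-up : ∀ x → 1 ≤ x → x ≤ B → W x ≼ L x ⊕ # 12
  W-up x p q = cancel (#-mono p) (lin 0 (1 · (θ-up x q) ⊞ 1 · (chebyshev x q) ⊞ 1 · ≼θ) (solve 5 (λ a b c d e → a :* (c :+ κ 12) :- a :* b := a :* c :- d :+ (κ 12 :* a :- e :+ (d :+ e :- a :* b))) refl (# x) (W x) (L x) (∑ x L) (ψ x)))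
    where
    ≼θ : # x ⊗ W x ≼ ∑ x L ⊕ ψ x
    ≼θ = ≼-trans (≡≽ (∑-⊗ x (# x) _)) (≼-trans (∑-mono x (λ d a b → ≼-trans (≡≼ (solve 3 (λ a b c → a :* (b :* c) := b :* (a :* c)) refl (# x) (Λ d) (⅟ d))) (≼-trans (⊗-monoʳ (Λ-nn d (ℕP.≤-trans b q)) (÷-up x d a)) (≡≼ (solve 2 (λ a b → a :* (b :+ κ 1) := a :* b :+ a) refl (Λ d) (# (x ÷ d)))))))
      (≡≼ (trans (∑-⊕ x _ _) (cong (_⊕ ψ x) (sym (θ-Λ x))))))

  L-÷-up : ∀ y d → 1 ≤ d → d ≤ y → y ≤ B → L (y ÷ d) ⊕ L d ≼ L y
  L-÷-up y d p q r = ≼-trans (lin 0 (1 · (≡≽ (L-* p (1≤÷ p q)))) (solve 3 (λ a b c → c :- (a :+ b) := c :- (b :+ a)) refl (L (y ÷ d)) (L d) (L (d * (y ÷ d))))) (L-mono (ℕP.*-mono-≤ p (1≤÷ p q)) (÷-≤ d p ℕP.≤-refl) r)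

  -- Rounding the quotient up gives the number `d (y ÷ d + 1)`, above `y` but possibly as large as
  -- `2 y`. This is the origin of the conditions `2 * x ≤ B` further on.
  L-÷-lo : ∀ y d → 1 ≤ d → d ≤ y → 2 * y ≤ B → L y ≼ L (y ÷ d) ⊕ L d ⊕ # 2
  L-÷-lo y d p q r = ≼-trans (L-mono (ℕP.≤-trans p q) (ℕP.<⇒≤ (<-suc÷ y d p)) (ℕP.≤-trans hi r))
    (lin 0 (1 · (≡≼ (L-* {d} {suc (y ÷ d)} p (s≤s z≤n))) ⊞ 1 · (inc≼2 (y ÷ d) (1≤÷ p q) lt)) (solve 4 (λ a b c d → b :+ c :+ κ 2 :- a := c :+ d :- a :+ (κ 2 :- (d :- b))) refl (L (d * suc (y ÷ d))) (L (y ÷ d)) (L d) (L (suc (y ÷ d)))))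
    where
    hi : d * suc (y ÷ d) ≤ 2 * y
    hi = ℕP.≤-trans (ℕP.≤-reflexive (ℕP.*-suc d (y ÷ d))) (ℕP.+-mono-≤ q (ℕP.≤-trans (÷-≤ d p ℕP.≤-refl) (ℕP.m≤m+n y 0)))
    lt : y ÷ d < B
    lt = ℕP.<-≤-trans (ℕP.≤-<-trans (÷-≤-x y d) (ℕP.m<m+n y (ℕP.≤-trans (ℕP.≤-trans p q) (ℕP.m≤m+n y 0)))) r

  ∑-gap : ∀ y → y ≤ B → ∑ y (λ d → L y ⊖ L d) ≼ # 2 ⊗ # y
  ∑-gap y q = (lin 0 (1 · (≡≼ (trans (∑-⊖ y (λ _ → L y) L) (cong (_⊖ ∑ y L) (∑-const y (L y))))) ⊞ 1 · (θ-lo y q)) (solve 4 (λ a b c d → κ 2 :* b :- a := b :* c :- d :- a :+ (d :+ κ 2 :* b :- b :* c)) refl (∑ y (λ d → L y ⊖ L d)) (# y) (L y) (∑ y L)))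

  -- The squares of log (y / d) have bounded mean. From `y` to `suc y`, with `Δ` the increment of
  -- `L` and `y Δ ≤ 2`, the mixed terms add at most `4 y Δ ≤ 8` and the squares `y Δ Δ ≤ 4`, hence
  -- 12.
  ∑-gap² : ∀ y → y ≤ B → ∑ y (λ d → (L y ⊖ L d) ⊗ (L y ⊖ L d)) ≼ # 12 ⊗ # y
  ∑-gap² zero q = (lin 0 (const 0) (solve 0 (κ 12 :* κ 0 :- κ 0 := κ 0) refl))
  ∑-gap² (suc zero) q = (lin 0 (const 12) (solve 0 (κ 12 :* κ 1 :- (κ 0 :+ (κ 0 :- κ 0) :* (κ 0 :- κ 0)) := κ 12) refl))
  ∑-gap² (suc y@(suc _)) q = ≼-trans (≡≼ e) (lin 0 (1 · (∑-gap² y (ℕP.<⇒≤ q)) ⊞ 2 · (⊗-monoʳ Δ≥0 (∑-gap y (ℕP.<⇒≤ q))) ⊞ 4 · (inc-up′ y (s≤s z≤n) q) ⊞ 1 · (⊗-monoʳ Δ≥0 (inc-up′ y (s≤s z≤n) q)) ⊞ 2 · (inc≼2 y (s≤s z≤n) q) ⊞ 12 · (≡≽ (#-suc y))) (solve 5 (λ a b c d e → κ 12 :* e :- (a :+ (κ 2 :* b :* c :+ d :* (b :* b))) := κ 12 :* d :- a :+ (κ 2 :* (b :* (κ 2 :* d) :- b :* c) :+ (κ 4 :* (κ 2 :- d :* b) :+ (b :* κ 2 :- b :* (d :* b) :+ (κ 2 :* (κ 2 :- b) :+ κ 12 :* (e :- (κ 1 :+ d))))))) refl (∑ y (λ d →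 (L y ⊖ L d) ⊗ (L y ⊖ L d))) Δ (∑ y (λ d → L y ⊖ L d)) (# y) (# (suc y))))
    where
    Δ = L (suc y) ⊖ L y
    Δ≥0 : # 0 ≼ Δ
    Δ≥0 = inc-nn y (s≤s z≤n) q
    sq : ∀ d → (L (suc y) ⊖ L d) ⊗ (L (suc y) ⊖ L d) ≡ (L y ⊖ L d) ⊗ (L y ⊖ L d) ⊕ (# 2 ⊗ Δ ⊗ (L y ⊖ L d) ⊕ Δ ⊗ Δ)
    sq d = (solve 3 (λ a b c → (a :- b) :* (a :- b) := (c :- b) :* (c :- b) :+ (κ 2 :* (a :- c) :* (c :- b) :+ (a :- c) :* (a :- c))) refl (L (suc y)) (L d) (L y))
    e : ∑ (suc y) (λ d → (L (suc y) ⊖ L d) ⊗ (L (suc y) ⊖ L d)) ≡ ∑ y (λ d → (L y ⊖ L d) ⊗ (L y ⊖ L d)) ⊕ (# 2 ⊗ Δ ⊗ ∑ y (λ d → L y ⊖ L d) ⊕ # y ⊗ (Δ ⊗ Δ))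
    e = trans (cong₂ _⊕_ (trans (∑-ext y sq) (trans (∑-⊕ y _ _) (cong (∑ y (λ d → (L y ⊖ L d) ⊗ (L y ⊖ L d)) ⊕_) (trans (∑-⊕ y _ _) (cong₂ _⊕_ (∑-⊗ y (# 2 ⊗ Δ) _) (∑-const y (Δ ⊗ Δ))))))) (solve 1 (λ a → (a :- a) :* (a :- a) := κ 0) refl (L (suc y))))
      (addz _)
      where addz : ∀ a → a ⊕ # 0 ≡ a
            addz a = (solve 1 (λ a → a :+ κ 0 := a) refl a)

  ∑-L÷² : ∀ y → y ≤ B → ∑ y (λ d → L (y ÷ d) ⊗ L (y ÷ d)) ≼ # 12 ⊗ # y
  ∑-L÷² y q = ≼-trans (∑-mono y (λ d a b → let l = L-nn (1≤÷ a b) (ℕP.≤-trans (÷-≤-x y d) q) ; u = up d a b in ⊗-mono l l u u)) (∑-gap² y q)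
    where
    up : ∀ d → 1 ≤ d → d ≤ y → L (y ÷ d) ≼ L y ⊖ L d
    up d a b = (lin 0 (1 · (L-÷-up y d a b q)) (solve 3 (λ a b c → b :- c :- a := b :- (a :+ c)) refl (L (y ÷ d)) (L y) (L d)))

  harmonic≼ : ∀ n → suc n ≤ B → ∑ n (λ i → ⅟ (suc i)) ≼ # 2 ⊗ L (suc n)
  harmonic≼ zero q = (lin 0 (const 0) (solve 0 (κ 2 :* κ 0 :- κ 0 := κ 0) refl))
  harmonic≼ (suc n) q = (lin 0 (1 · (harmonic≼ n (ℕP.<⇒≤ q)) ⊞ 1 · (inc-lo (suc n) (s≤s z≤n) q)) (solve 4 (λ a b c d → κ 2 :* c :- (a :+ b) := κ 2 :* d :- a :+ (κ 2 :* (c :- d) :- b)) refl (∑ n (λ i → ⅟ (suc i))) (⅟ (suc (suc n))) (L (suc (suc n))) (L (suc n))))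

-- Mass of higher prime powers and of integers not prime to the modulus.

open Log
module Mass (B : ℕ) (2≤B : 2 ℕ.≤ B) (lgB : LogLike B) where
  open Field
  open Sums
  open NumTh
  open Mang B 2≤B lgB
  open LogLike lgB

  w : ℕ → F
  w d = Λ d ⊗ ⅟ d

  w-nn : ∀ d → d ≤ B → # 0 ≼ w d
  w-nn d q = nn-⊗ (Λ-nn d q) (⅟-nn d)

  module _ {p : ℕ} (pr : Prime p) (p≤B : p ≤ B) {x : ℕ} (x≤B : x ≤ B) where
    private
      1≤p = prime≥1 pr

      pw : ∀ k → 1 ≤ k → # p ⊗ w (p * k) ≡ 𝟙 (k ≟ 1) ⊗ (L p ⊗ ⅟ k) ⊕ 𝟙 (p ∣? k) ⊗ w k
      pw k 1≤k = trans (cong₂ (λ s t → # p ⊗ (s ⊗ t)) (Λ-step pr 1≤k) (⅟-* 1≤p 1≤k))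
        (≼-antisym (lin 0 (1 · (≡≼ (cong (((𝟙 (k ≟ 1) ⊗ L p ⊕ 𝟙 (p ∣? k) ⊗ Λ k) ⊗ ⅟ k) ⊗_) (⅟-law 1≤p)))) (solve 7 (λ a b c d e f g → b :* (c :* g) :+ d :* (e :* g) :- a :* ((b :* c :+ d :* e) :* (f :* g)) := (b :* c :+ d :* e) :* g :* κ 1 :- (b :* c :+ d :* e) :* g :* (a :* f)) refl (# p) (𝟙 (k ≟ 1)) (L p) (𝟙 (p ∣? k)) (Λ k) (⅟ p) (⅟ k))) (lin 0 (1 · (≡≽ (cong (((𝟙 (k ≟ 1) ⊗ L p ⊕ 𝟙 (p ∣? k) ⊗ Λ k) ⊗ ⅟ k) ⊗_) (⅟-law 1≤p)))) (solve 7 (λ a b c d e f g → a :* ((b :* c :+ d :* e) :* (f :* g)) :- (b :* (c :* g) :+ d :* (e :* g)) := (b :* c :+ d :* e) :* g :* (a :* f) :- (b :* c :+ d :* e) :* g :* κ 1) refl (# p) (𝟙 (k ≟ 1)) (L p) (𝟙 (p ∣? k)) (Λ k) (⅟ p) (⅟ k))))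

      term-nn : ∀ d → 1 ≤ d → d ≤ x → # 0 ≼ 𝟙 (p ∣? d) ⊗ w d
      term-nn d _ q = nn-⊗ (𝟙-nn (p ∣? d)) (w-nn d (ℕP.≤-trans q x≤B))

      first≼ : ∀ z → ∑ z (λ k → 𝟙 (k ≟ 1) ⊗ (L p ⊗ ⅟ k)) ≼ L p
      first≼ zero = L-nn 1≤p p≤B
      first≼ (suc z) = ≡≼ (trans (∑-pick (λ k → L p ⊗ ⅟ k) ℕP.≤-refl (s≤s z≤n)) (trans (cong (L p ⊗_) ⅟-1) (solve 1 (λ a → a :* κ 1 := a) refl (L p))))

    multiples-mass : F
    multiples-mass = ∑ x (λ d → 𝟙 (p ∣? d) ⊗ w d)

    -- A geometric series without limits: substituting `d = p k` reproduces the sum over a shorter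
    -- range, plus the term `k = 1`.
    multiples-mass≼ : # p ⊗ multiples-mass ≼ L p ⊕ multiples-mass
    multiples-mass≼ = ≼-trans (≡≼ e) (⊕-mono (first≼ (x ÷ p)) (∑-grow (÷-≤-x x p) term-nn))
      where
      e : # p ⊗ multiples-mass ≡ ∑ (x ÷ p) (λ k → 𝟙 (k ≟ 1) ⊗ (L p ⊗ ⅟ k)) ⊕ ∑ (x ÷ p) (λ k → 𝟙 (p ∣? k) ⊗ w k)
      e = trans (cong (# p ⊗_) (∑-multiples x p w 1≤p)) (trans (sym (∑-⊗ (x ÷ p) (# p) _)) (trans (∑-cong (x ÷ p) (λ k a _ → pw k a)) (∑-⊕ (x ÷ p) _ _)))

    proper-mass : F
    proper-mass = ∑ x (λ d → 𝟙 (p ∣? d) ⊗ (𝟙 (¬? (d ≟ p)) ⊗ w d))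

    proper-mass≼ : # p ⊗ proper-mass ≼ multiples-mass
    proper-mass≼ = ≼-trans (≡≼ (trans (cong (# p ⊗_) (∑-multiples x p (λ d → 𝟙 (¬? (d ≟ p)) ⊗ w d) 1≤p)) (sym (∑-⊗ (x ÷ p) (# p) _))))
      (≼-trans (∑-mono (x ÷ p) (λ k a b → ≼-trans (≡≼ (solve 3 (λ a b c → a :* (b :* c) := b :* (a :* c)) refl (# p) (𝟙 (¬? (p * k ≟ p))) (w (p * k))))
        (≼-trans (𝟙-⊗-mono (¬? (p * k ≟ p)) (λ ne → ≡≼ (trans (pw k a) (trans (cong (λ t → t ⊗ (L p ⊗ ⅟ k) ⊕ 𝟙 (p ∣? k) ⊗ w k) (𝟙-no (k ≟ 1) (λ k≡1 → ne (trans (cong (p *_) k≡1) (ℕP.*-identityʳ p))))) (solve 4 (λ a b c d → κ 0 :* (a :* b) :+ c :* d := c :* d) refl (L p) (⅟ k) (𝟙 (p ∣? k)) (w k))))))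
        (𝟙-⊗≼ (¬? (p * k ≟ p)) (term-nn k a (ℕP.≤-trans b (÷-≤-x x p)))))))
      (∑-grow (÷-≤-x x p) term-nn))

    multiples-mass≼2 : multiples-mass ≼ # 2
    multiples-mass≼2 = go p (prime≥2 pr) multiples-mass≼ (L≼2n-2 p 1≤p p≤B)
      where
      S = multiples-mass
      go : ∀ q → 2 ≤ q → # q ⊗ S ≼ L p ⊕ S → L p ≼ # 2 ⊗ # q ⊖ # 2 → S ≼ # 2
      go (suc q) (s≤s 1≤q) h k = cancel (#-mono 1≤q) (lin 0 (1 · h ⊞ 1 · k ⊞ 1 · (≡≽ (cong (_⊗ S) (#-suc q))) ⊞ 2 · (≡≼ (#-suc q))) (solve 4 (λ a b c d → a :* κ 2 :- a :* b := d :+ b :- c :* b :+ (κ 2 :* c :- κ 2 :- d :+ (c :* b :- (κ 1 :+ a) :* b :+ κ 2 :* (κ 1 :+ a :- c)))) refl (# q) S (# (suc q)) (L p)))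

    proper-mass≼′ : proper-mass ≼ L p ⊗ ⅟ p ⊗ ⅟ (p ∸ 1)
    proper-mass≼′ = go p (prime≥2 pr) multiples-mass≼ proper-mass≼
      where
      S = multiples-mass
      S′ = proper-mass
      go : ∀ q → 2 ≤ q → # q ⊗ S ≼ L p ⊕ S → # q ⊗ S′ ≼ S → S′ ≼ L p ⊗ ⅟ q ⊗ ⅟ (q ∸ 1)
      go (suc q) (s≤s 1≤q) h k = cancel (#-mono 1≤q) (cancel (#-mono {1} {suc q} (s≤s z≤n))
        (lin 0 (1 · (⊗-monoʳ (0≼# q) k) ⊞ 1 · h ⊞ 1 · (≡≽ (cong (_⊗ S) (#-suc q))) ⊞ 1 · (≡≽ (trans (solve 5 (λ a b c d e → a :* (b :* (c :* d :* e)) := c :* (a :* d :* (b :* e))) refl (# (suc q)) (# q) (L p) (⅟ (suc q)) (⅟ q)) (trans (cong (L p ⊗_) (cong₂ _⊗_ (⅟-law {suc q} (s≤s z≤n)) (⅟-law 1≤q))) (solve 1 (λ a → a :* (κ 1 :* κ 1) := a) refl (L p)))))) (solve 7 (λ a b c d e f g → a :* (b :* (d :* e :* f)) :- a :* (b :* c) := b :* g :- b :* (a :* c) :+ (d :+ g :- a :* g :+ (a :* g :- (κ 1 :+ b) :* g :+ (a :* (b :* (d :* e :* f)) :- d)))) refl (# (suc q)) (# q) S′ (L p) (⅟ (suc q)) (⅟ q) S)))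

  ⅟-diff : ∀ n → 1 ≤ n → ⅟ n ⊖ ⅟ (suc n) ≡ ⅟ n ⊗ ⅟ (suc n)
  ⅟-diff n p = (≼-antisym (lin 0 (1 · (≡≽ (cong (⅟ n ⊗_) (⅟-law {suc n} (s≤s z≤n)))) ⊞ 1 · (≡≼ (cong (⅟ (suc n) ⊗_) (⅟-law p))) ⊞ 1 · (≡≼ (cong ((⅟ n ⊗ ⅟ (suc n)) ⊗_) (#-suc n)))) (solve 4 (λ a b c d → a :* b :- (a :- b) := a :* (c :* b) :- a :* κ 1 :+ (b :* κ 1 :- b :* (d :* a) :+ (a :* b :* (κ 1 :+ d) :- a :* b :* c))) refl (⅟ n) (⅟ (suc n)) (# (suc n)) (# n))) (lin 0 (1 · (≡≼ (cong (⅟ n ⊗_) (⅟-law {suc n} (s≤s z≤n)))) ⊞ 1 · (≡≽ (cong (⅟ (suc n) ⊗_) (⅟-law p))) ⊞ 1 · (≡≽ (cong ((⅟ n ⊗ ⅟ (suc n)) ⊗_) (#-suc n)))) (solve 4 (λ a b c d → a :- b :- a :* b := a :* κ 1 :- a :* (c :* b) :+ (b :* (d :* a) :- b :* κ 1 :+ (a :* b :* c :- a :* b :* (κ 1 :+ d)))) refl (⅟ n) (⅟ (suc n)) (# (suc n)) (# n))))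

  -- The claim is strengthened by the potential `L n / n + 2 / (n - 1)`, which falls by at least the
  -- term that is added.
  ∑-L/n² : ∀ m → suc m ≤ B → ∑ m (λ i → L (suc i) ⊗ ⅟ (suc i) ⊗ ⅟ i) ≼ # 4
  ∑-L/n² zero q = (lin 0 (const 4) (solve 0 (κ 4 :- κ 0 := κ 4) refl))
  ∑-L/n² (suc m) q = (lin 0 (1 · (go m q) ⊞ 1 · (nn-⊗ (L-nn {suc (suc m)} (s≤s z≤n) q) (⅟-nn (suc (suc m)))) ⊞ 2 · (⅟-nn (suc m))) (solve 4 (λ a b c d → κ 4 :- a := κ 4 :- (a :+ b :* c :+ κ 2 :* d) :+ (b :* c :- κ 0 :+ κ 2 :* (d :- κ 0))) refl (∑ (suc m) f) (L (suc (suc m))) (⅟ (suc (suc m))) (⅟ (suc m))))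
    where
    f : ℕ → F
    f i = L (suc i) ⊗ ⅟ (suc i) ⊗ ⅟ i
    term : ∀ i → 1 ≤ i → i < B → f i ⊕ L (suc i) ⊗ ⅟ (suc i) ≼ L i ⊗ ⅟ i ⊕ # 2 ⊗ ⅟ i ⊗ ⅟ i
    term i p q = (lin 0 (1 · (⊗-monoˡ (⅟-nn i) (inc-up i p q)) ⊞ 1 · (≡≽ (cong (L (suc i) ⊗_) (⅟-diff i p)))) (solve 4 (λ a b c d → d :* c :+ κ 2 :* c :* c :- (a :* b :* c :+ a :* b) := κ 2 :* c :* c :- (a :- d) :* c :+ (a :* (c :- b) :- a :* (c :* b))) refl (L (suc i)) (⅟ (suc i)) (⅟ i) (L i)))
    go : ∀ m → suc (suc m) ≤ B → ∑ (suc m) f ⊕ L (suc (suc m)) ⊗ ⅟ (suc (suc m)) ⊕ # 2 ⊗ ⅟ (suc m) ≼ # 4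
    go zero q = (lin 0 (1 · (term 1 ℕP.≤-refl q) ⊞ 2 · (≡≼ ⅟-1) ⊞ 2 · (≡≼ (cong₂ _⊗_ ⅟-1 ⅟-1))) (solve 4 (λ a b c d → κ 4 :- (κ 0 :+ a :+ b :* c :+ κ 2 :* d) := κ 0 :* d :+ κ 2 :* d :* d :- (a :+ b :* c) :+ (κ 2 :* (κ 1 :- d) :+ κ 2 :* (κ 1 :* κ 1 :- d :* d))) refl (f 1) (L 2) (⅟ 2) (⅟ 1)))
    go (suc m) q = (lin 0 (1 · (go m (ℕP.<⇒≤ q)) ⊞ 1 · (term (suc (suc m)) (s≤s z≤n) q) ⊞ 2 · (≡≽ (⅟-diff (suc m) (s≤s z≤n))) ⊞ 2 · (⊗-monoˡ (⅟-nn (suc (suc m))) (⅟-anti {suc m} (s≤s z≤n) (ℕP.n≤1+n (suc m))))) (solve 7 (λ a b c d e f g → κ 4 :- (a :+ b :+ c :* d :+ κ 2 :* e) := κ 4 :- (a :+ f :* e :+ κ 2 :* g) :+ (f :* e :+ κ 2 :* e :* e :- (b :+ c :* d) :+ (κ 2 :* (g :- e :- g :* e) :+ κ 2 :* (g :* e :- e :* e)))) refl (∑ (suc m) f) (f (suc (suc m))) (L (suc (suc (suc m)))) (⅟ (suc (suc (suc m)))) (⅟ (suc (suc m))) (L (suc (suc m))) (⅟ (suc m))))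

  -- A composite `d` is a proper multiple of one of its primes `p`. The proper multiples of `p`
  -- weigh at most `L p / (p (p - 1))`, a bound that is summable even over all integers.
  composite-mass : ∀ x → x ≤ B → ∑ x (λ d → (# 1 ⊖ 𝟙 (prime? d)) ⊗ w d) ≼ # 4
  composite-mass zero q = (lin 0 (const 4) (solve 0 (κ 4 :- κ 0 := κ 4) refl))
  composite-mass x@(suc m) q = ≼-trans (∑-mono x pointwise) (≼-trans (≡≼ (∑-swap x x _)) (≼-trans (∑-mono x perprime)
      (≼-trans (≡≼ (trans (∑-+ 1 m e) (trans (cong (λ t → # 0 ⊕ t ⊕ ∑ m (λ i → e (1 + i))) e1) (solve 1 (λ a → κ 0 :+ κ 0 :+ a := a) refl (∑ m (λ i → e (1 + i))))))) (∑-L/n² m q))))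
    where
    e : ℕ → F
    e n = L n ⊗ ⅟ n ⊗ ⅟ (n ∸ 1)
    e1 : e 1 ≡ # 0
    e1 = (solve 2 (λ a b → a :* b :* κ 0 := κ 0) refl (L 1) (⅟ 1))
    t : ℕ → ℕ → F
    t d p = 𝟙 (prime? p) ⊗ (𝟙 (p ∣? d) ⊗ (𝟙 (¬? (d ≟ p)) ⊗ w d))
    t-nn : ∀ d p → d ≤ x → # 0 ≼ t d p
    t-nn d p b = nn-⊗ (𝟙-nn (prime? p)) (nn-⊗ (𝟙-nn (p ∣? d)) (nn-⊗ (𝟙-nn (¬? (d ≟ p))) (w-nn d (ℕP.≤-trans b q))))
    pointwise : ∀ d → 1 ≤ d → d ≤ x → (# 1 ⊖ 𝟙 (prime? d)) ⊗ w d ≼ ∑ x (t d)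
    pointwise d a b with prime? d
    ... | yes _ = ≼-trans (≡≼ (solve 1 (λ a → (κ 1 :- κ 1) :* a := κ 0) refl (w d))) (∑-nn x (λ p _ _ → t-nn d p b))
    ... | no ¬pr with d ≟ 1
    ...   | yes refl = ≼-trans (≡≼ (solve 1 (λ a → (κ 1 :- κ 0) :* (κ 0 :* a) := κ 0) refl (⅟ 1))) (∑-nn x (λ p _ _ → t-nn 1 p b))
    ...   | no d≢1 = ≼-trans (≡≼ eq) (∑-term (prime≥1 pp) (ℕP.≤-trans (proj₂ (∣-≤ a p∣d)) b) (λ p _ _ → t-nn d p b))
      where
      ex = ∃-prime-∣ d (ℕP.≤∧≢⇒< a (λ e → d≢1 (sym e)))
      p = proj₁ ex
      pp = proj₁ (proj₂ ex)
      p∣d = proj₂ (proj₂ ex)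
      eq : (# 1 ⊖ # 0) ⊗ w d ≡ t d p
      eq = trans (solve 1 (λ a → (κ 1 :- κ 0) :* a := κ 1 :* (κ 1 :* (κ 1 :* a))) refl (w d)) (sym (cong₂ _⊗_ (𝟙-yes (prime? p) pp) (cong₂ _⊗_ (𝟙-yes (p ∣? d) p∣d) (cong (_⊗ w d) (𝟙-yes (¬? (d ≟ p)) (λ d≡p → ¬pr (subst Prime (sym d≡p) pp)))))))
    perprime : ∀ p → 1 ≤ p → p ≤ x → ∑ x (λ d → t d p) ≼ e p
    perprime p a b with prime? p
    ... | yes pp = ≼-trans (≡≼ (trans (∑-⊗ x (# 1) _) (one _))) (proper-mass≼′ pp (ℕP.≤-trans b q) q)
      where one : ∀ y → # 1 ⊗ y ≡ y
            one y = (solve 1 (λ a → κ 1 :* a := a) refl y)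
    ... | no _ = ≼-trans (≡≼ (∑-0 x (λ d _ _ → zz _))) (nn-⊗ (nn-⊗ (L-nn a (ℕP.≤-trans b q)) (⅟-nn p)) (⅟-nn (p ∸ 1)))
      where zz : ∀ y → # 0 ⊗ y ≡ # 0
            zz y = (solve 1 (λ a → κ 0 :* a := κ 0) refl y)

  -- Each prime dividing `M` accounts for a mass of at most 2, and the number of these primes is
  -- bounded by `M` itself; only independence of `x` matters later.
  noncoprime-mass : ∀ M x → 1 ≤ M → M ≤ B → x ≤ B → ∑ x (λ d → (# 1 ⊖ 𝟙 (coprime? d M)) ⊗ w d) ≼ # M ⊗ # 2
  noncoprime-mass M x 1≤M M≤B q = ≼-trans (∑-mono x pointwise) (≼-trans (≡≼ (∑-swap x M _)) (≼-trans (∑-mono M perprime) (≡≼ (∑-const M (# 2)))))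
    where
    t : ℕ → ℕ → F
    t d p = 𝟙 (prime? p) ⊗ (𝟙 (p ∣? d) ⊗ w d)
    t-nn : ∀ d p → d ≤ x → # 0 ≼ t d p
    t-nn d p b = nn-⊗ (𝟙-nn (prime? p)) (nn-⊗ (𝟙-nn (p ∣? d)) (w-nn d (ℕP.≤-trans b q)))
    pointwise : ∀ d → 1 ≤ d → d ≤ x → (# 1 ⊖ 𝟙 (coprime? d M)) ⊗ w d ≼ ∑ M (t d)
    pointwise d a b with coprime? d M
    ... | yes _ = ≼-trans (≡≼ (solve 1 (λ a → (κ 1 :- κ 1) :* a := κ 0) refl (w d))) (∑-nn M (λ p _ _ → t-nn d p b))
    ... | no nc = ≼-trans (≡≼ eq) (∑-term (prime≥1 pp) (proj₂ (∣-≤ 1≤M p∣M)) (λ p _ _ → t-nn d p b))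
      where
      ex = ¬coprime⇒prime a nc
      p = proj₁ ex
      pp = proj₁ (proj₂ ex)
      p∣d = proj₁ (proj₂ (proj₂ ex))
      p∣M = proj₂ (proj₂ (proj₂ ex))
      eq : (# 1 ⊖ # 0) ⊗ w d ≡ t d p
      eq = trans (solve 1 (λ a → (κ 1 :- κ 0) :* a := κ 1 :* (κ 1 :* a)) refl (w d)) (sym (cong₂ _⊗_ (𝟙-yes (prime? p) pp) (cong (_⊗ w d) (𝟙-yes (p ∣? d) p∣d))))
    perprime : ∀ p → 1 ≤ p → p ≤ M → ∑ x (λ d → t d p) ≼ # 2
    perprime p a b with prime? p
    ... | yes pp = ≼-trans (≡≼ (trans (∑-⊗ x (# 1) _) (one _))) (multiples-mass≼2 pp (ℕP.≤-trans b M≤B) q)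
      where one : ∀ y → # 1 ⊗ y ≡ y
            one y = (solve 1 (λ a → κ 1 :* a := a) refl y)
    ... | no _ = ≼-trans (≡≼ (∑-0 x (λ d _ _ → zz _))) (0≼# 2)
      where zz : ∀ y → # 0 ⊗ y ≡ # 0
            zz y = (solve 1 (λ a → κ 0 :* a := κ 0) refl y)

-- Residue classes and units modulo M.

module Cls (M : ℕ) {{M≢0 : NonZero M}} where
  open Field
  open Sums

  1≤M : 1 ≤ M
  1≤M = ℕ.>-nonZero⁻¹ M

  infix 4 _≈_ _≈?_
  _≈_ : ℕ → ℕ → Set
  a ≈ b = a % M ≡ b % M

  _≈?_ : ∀ a b → Dec (a ≈ b)
  a ≈? b = a % M ≟ b % M

  ≈-* : ∀ {a b c d} → a ≈ b → c ≈ d → a * c ≈ b * d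
  ≈-* {a} {b} {c} {d} p q = trans (DM.%-distribˡ-* a c M) (trans (cong₂ (λ s t → (s * t) % M) p q) (sym (DM.%-distribˡ-* b d M)))

  ≈-+ : ∀ {a b c d} → a ≈ b → c ≈ d → a + c ≈ b + d
  ≈-+ {a} {b} {c} {d} p q = trans (DM.%-distribˡ-+ a c M) (trans (cong₂ (λ s t → (s + t) % M) p q) (sym (DM.%-distribˡ-+ b d M)))

  ≈-reflexive : ∀ {a b} → a ≡ b → a ≈ b
  ≈-reflexive e = cong (_% M) e

  coprime-≈ : ∀ {a b} → a ≈ b → Coprime a M → Coprime b M
  coprime-≈ {a} {b} e c {d} (d∣b , d∣M) = c (∣n∣m%n⇒∣m d∣M (subst (d ∣_) (sym e) (%-presˡ-∣ d∣b d∣M)) , d∣M)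

  coprime-*ˡ : ∀ {a b} → Coprime (a * b) M → Coprime a M
  coprime-*ˡ {a} {b} c (d∣a , d∣M) = c (∣-trans d∣a (m∣m*n b) , d∣M)

  coprime-*ʳ : ∀ {a b} → Coprime (a * b) M → Coprime b M
  coprime-*ʳ {a} {b} c (d∣b , d∣M) = c (∣-trans d∣b (n∣m*n a) , d∣M)

  coprime-1 : Coprime 1 M
  coprime-1 = 1-coprimeTo M

  *M≈0 : ∀ a b → a + b * M ≈ a
  *M≈0 a b = DM.%-remove-+ʳ a (divides b refl)

  inverse : ∀ n → Coprime n M → ∃ λ k → n * k ≈ 1
  inverse n c with coprime-Bézout c
  ... | Bézout.+- x y eq = x , trans (≈-reflexive (trans (ℕP.*-comm n x) (sym eq))) (*M≈0 1 y)
  ... | Bézout.-+ x y eq = x * (M ∸ 1) , trans (sym (*M≈0 (n * (x * (M ∸ 1))) 1)) (trans (≈-reflexive e) (*M≈0 1 (y * (M ∸ 1))))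
    where
    e : n * (x * (M ∸ 1)) + 1 * M ≡ 1 + y * (M ∸ 1) * M
    e = begin
      n * (x * (M ∸ 1)) + 1 * M             ≡⟨ cong₂ _+_ (trans (sym (ℕP.*-assoc n x (M ∸ 1))) (cong (_* (M ∸ 1)) (ℕP.*-comm n x))) (trans (ℕP.*-identityˡ M) (sym (ℕP.m+[n∸m]≡n 1≤M))) ⟩
      x * n * (M ∸ 1) + (1 + (M ∸ 1))       ≡⟨ trans (ℕP.+-comm _ (1 + (M ∸ 1))) (ℕP.+-assoc 1 (M ∸ 1) _) ⟩
      1 + (1 + x * n) * (M ∸ 1)             ≡⟨ cong (λ t → 1 + t * (M ∸ 1)) eq ⟩
      1 + y * M * (M ∸ 1)                   ≡⟨ cong (1 +_) (trans (ℕP.*-assoc y M (M ∸ 1)) (trans (cong (y *_) (ℕP.*-comm M (M ∸ 1))) (sym (ℕP.*-assoc y (M ∸ 1) M)))) ⟩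
      1 + y * (M ∸ 1) * M                   ∎
      where open ≡-Reasoning

  inverse⇒coprime : ∀ {n k} → n * k ≈ 1 → Coprime n M
  inverse⇒coprime e = coprime-*ˡ (coprime-≈ (sym e) coprime-1)

  coprime-* : ∀ {a b} → Coprime a M → Coprime b M → Coprime (a * b) M
  coprime-* {a} {b} p q with inverse a p | inverse b q
  ... | k , e | l , f = inverse⇒coprime {a * b} {k * l} (trans (≈-reflexive (shuffle a b k l)) (≈-* e f))
    where
    shuffle : ∀ a b k l → a * b * (k * l) ≡ a * k * (b * l)
    shuffle a b k l = trans (ℕP.*-assoc a b (k * l)) (trans (cong (a *_) (trans (sym (ℕP.*-assoc b k l)) (trans (cong (_* l) (ℕP.*-comm b k)) (ℕP.*-assoc k b l)))) (sym (ℕP.*-assoc a k (b * l))))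

  abstract
    -- Value 0 off the units is a default. The definition is sealed so that Bézout coefficients are
    -- never computed.
    iv : ℕ → ℕ
    iv n with coprime? n M
    ... | yes c = proj₁ (inverse n c)
    ... | no _  = 0

    iv-law : ∀ {n} → Coprime n M → n * iv n ≈ 1
    iv-law {n} c with coprime? n M
    ... | yes c′ = proj₂ (inverse n c′)
    ... | no ¬c  = ⊥-elim (¬c c)

  -- g ⊘ n is the class g n⁻¹ (and 0 when n is not a unit)
  infixl 7 _⊘_
  _⊘_ : ℕ → ℕ → ℕ
  g ⊘ n = g * iv n

  ⊘-coprime : ∀ {g n} → Coprime g M → Coprime n M → Coprime (g ⊘ n) M
  ⊘-coprime {g} {n} p q = coprime-* p (coprime-*ʳ {n} {iv n} (coprime-≈ (sym (iv-law q)) coprime-1))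

  ⊘-solve : ∀ {m n g} → Coprime m M → m * n ≈ g → n ≈ g ⊘ m
  ⊘-solve {m} {n} {g} c e = trans (sym (≈-trans₁ n)) (≈-* e (≈-refl (iv m)))
    where
    ≈-refl : ∀ a → a ≈ a
    ≈-refl a = refl
    ≈-trans₁ : ∀ n → m * n * iv m ≈ n
    ≈-trans₁ n = trans (≈-reflexive (trans (cong (_* iv m) (ℕP.*-comm m n)) (ℕP.*-assoc n m (iv m)))) (trans (≈-* {n} {n} refl (iv-law c)) (≈-reflexive (ℕP.*-identityʳ n)))

  ⊘-cancel : ∀ {m n g} → Coprime m M → n ≈ g ⊘ m → m * n ≈ g
  ⊘-cancel {m} {n} {g} c e = trans (≈-* {m} {m} refl e) (trans (≈-reflexive (trans (sym (ℕP.*-assoc m g (iv m))) (trans (cong (_* iv m) (ℕP.*-comm m g)) (ℕP.*-assoc g m (iv m)))))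
    (trans (≈-* {g} {g} refl (iv-law c)) (≈-reflexive (ℕP.*-identityʳ g))))

  δ : ℕ → ℕ → F
  δ n g = 𝟙 (n ≈? g)

  u : ℕ → F
  u n = 𝟙 (coprime? n M)

  δ-nn : ∀ n g → # 0 ≼ δ n g
  δ-nn n g = 𝟙-nn (n ≈? g)

  u-nn : ∀ n → # 0 ≼ u n
  u-nn n = 𝟙-nn (coprime? n M)

  δ-congˡ : ∀ {a b} g → a ≈ b → δ a g ≡ δ b g
  δ-congˡ {a} {b} g e = 𝟙-cong (a ≈? g) (b ≈? g) (trans (sym e)) (trans e)

  δ-congʳ : ∀ {g h} a → g ≈ h → δ a g ≡ δ a h
  δ-congʳ {g} {h} a e = 𝟙-cong (a ≈? g) (a ≈? h) (λ p → trans p e) (λ p → trans p (sym e))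

  u-cong : ∀ {a b} → a ≈ b → u a ≡ u b
  u-cong {a} {b} e = 𝟙-cong (coprime? a M) (coprime? b M) (coprime-≈ e) (coprime-≈ (sym e))

  δ-⊘ : ∀ {m} n g → Coprime m M → δ (m * n) g ≡ δ n (g ⊘ m)
  δ-⊘ {m} n g c = 𝟙-cong (m * n ≈? g) (n ≈? g ⊘ m) (⊘-solve c) (⊘-cancel c)

  δ-nonunit : ∀ {m} n {g} → Coprime g M → ¬ Coprime m M → δ (m * n) g ≡ # 0
  δ-nonunit {m} n {g} c nc = 𝟙-no (m * n ≈? g) (λ e → nc (coprime-*ˡ (coprime-≈ (sym e) c)))

  u-*-unit : ∀ {m} n → Coprime m M → u (m * n) ≡ u n
  u-*-unit {m} n c = 𝟙-cong (coprime? (m * n) M) (coprime? n M) (coprime-*ʳ {m}) (coprime-* c)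

  u-*-nonunit : ∀ {m} n → ¬ Coprime m M → u (m * n) ≡ # 0
  u-*-nonunit {m} n nc = 𝟙-no (coprime? (m * n) M) (λ c → nc (coprime-*ˡ c))

  u-* : ∀ m n → u (m * n) ≡ u m ⊗ u n
  u-* m n with coprime? m M
  ... | yes c = trans (u-*-unit n c) (solve 1 (λ a → a := κ 1 :* a) refl (u n))
  ... | no nc = trans (u-*-nonunit n nc) (solve 1 (λ a → κ 0 := κ 0 :* a) refl (u n))

  -- The representative is taken in 1, ..., M, the range of `∑ M`, so the class of 0 is represented
  -- by `M`.
  rep : ℕ → ℕ
  rep g with g % M
  ... | zero  = M
  ... | suc r = suc r

  rep-≥1 : ∀ g → 1 ≤ rep g
  rep-≥1 g with g % M
  ... | zero  = 1≤M
  ... | suc r = s≤s z≤n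

  rep-≤M : ∀ g → rep g ≤ M
  rep-≤M g with g % M | DM.m%n<n g M
  ... | zero  | _ = ℕP.≤-refl
  ... | suc r | p = ℕP.<⇒≤ p

  rep-≈ : ∀ g → rep g ≈ g
  rep-≈ g with g % M | DM.m%n<n g M
  ... | zero  | _ = DM.n%n≡0 M
  ... | suc r | p = DM.m<n⇒m%n≡m p

  rep-unique : ∀ {a b} → 1 ≤ a → a ≤ M → 1 ≤ b → b ≤ M → a ≈ b → a ≡ b
  rep-unique {a} {b} p q r s e with a ≟ M | b ≟ M
  ... | yes refl | yes refl = refl
  ... | yes refl | no b≢M = ⊥-elim (ℕP.<⇒≢ r (trans (sym (DM.n%n≡0 M)) (trans e (DM.m<n⇒m%n≡m (ℕP.≤∧≢⇒< s b≢M)))))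
  ... | no a≢M | yes refl = ⊥-elim (ℕP.<⇒≢ p (trans (sym (DM.n%n≡0 M)) (trans (sym e) (DM.m<n⇒m%n≡m (ℕP.≤∧≢⇒< q a≢M)))))
  ... | no a≢M | no b≢M = trans (sym (DM.m<n⇒m%n≡m (ℕP.≤∧≢⇒< q a≢M))) (trans e (DM.m<n⇒m%n≡m (ℕP.≤∧≢⇒< s b≢M)))

  ∑-class : ∀ g (f : ℕ → F) → (∀ {a b} → a ≈ b → f a ≡ f b) → ∑ M (λ k → δ k g ⊗ f k) ≡ f g
  ∑-class g f hf = trans (∑-single {rep g} (rep-≥1 g) (rep-≤M g) (λ i p q ne → trans (cong (_⊗ f i) (𝟙-no (i ≈? g) (λ e → ne (rep-unique p q (rep-≥1 g) (rep-≤M g) (trans e (sym (rep-≈ g))))))) (solve 1 (λ a → κ 0 :* a := κ 0) refl (f i))))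
    (trans (cong₂ _⊗_ (𝟙-yes (rep g ≈? g) (rep-≈ g)) (hf (rep-≈ g))) (solve 1 (λ a → κ 1 :* a := a) refl (f g)))

  ∑-δ : ∀ g → ∑ M (λ k → δ k g) ≡ # 1
  ∑-δ g = trans (∑-ext M (λ k → (solve 1 (λ a → a := a :* κ 1) refl (δ k g)))) (∑-class g (λ _ → # 1) (λ _ → refl))

  δ-sym : ∀ a b → δ a b ≡ δ b a
  δ-sym a b = 𝟙-cong (a ≈? b) (b ≈? a) sym sym

  ∑-units-δ : ∀ n → ∑ M (λ b → u b ⊗ δ n b) ≡ u n
  ∑-units-δ n = trans (∑-ext M (λ b → trans (cong (u b ⊗_) (δ-sym n b)) (solve 2 (λ a b → a :* b := b :* a) refl (u b) (δ b n)))) (∑-class n u u-cong)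

  -- On unit classes b ↦ g / b is an involution: `c ≈ g ⊘ b` and `b ≈ g ⊘ c` are equivalent. Writing
  -- `f (g ⊘ b)` as a sum over all classes and exchanging the sums avoids an explicit permutation.
  ∑-units-⊘ : ∀ {g} (f : ℕ → F) → Coprime g M → (∀ {a b} → a ≈ b → f a ≡ f b) → ∑ M (λ b → u b ⊗ f (g ⊘ b)) ≡ ∑ M (λ b → u b ⊗ f b)
  ∑-units-⊘ {g} f cg hf = begin
    ∑ M (λ b → u b ⊗ f (g ⊘ b))                            ≡⟨ ∑-ext M (λ b → trans (cong (u b ⊗_) (sym (∑-class (g ⊘ b) f hf))) (sym (∑-⊗ M (u b) _))) ⟩
    ∑ M (λ b → ∑ M (λ c → u b ⊗ (δ c (g ⊘ b) ⊗ f c)))      ≡⟨ ∑-swap M M _ ⟩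
    ∑ M (λ c → ∑ M (λ b → u b ⊗ (δ c (g ⊘ b) ⊗ f c)))      ≡⟨ ∑-ext M (λ c → trans (∑-ext M (λ b → trans (solve 3 (λ a b c → a :* (b :* c) := a :* b :* c) refl (u b) (δ c (g ⊘ b)) (f c)) (trans (cong (_⊗ f c) (flip b c)) (solve 3 (λ a b c → a :* b :* c := a :* c :* b) refl (u c) (δ b (g ⊘ c)) (f c)))))
                                                                (trans (∑-⊗ M (u c ⊗ f c) _) (trans (cong ((u c ⊗ f c) ⊗_) (∑-δ (g ⊘ c))) (solve 2 (λ a b → a :* b :* κ 1 := a :* b) refl (u c) (f c))))) ⟩
    ∑ M (λ c → u c ⊗ f c)                                  ∎
    where
    open ≡-Reasoning
    flip₁ : ∀ {b c} → Coprime b M → c ≈ g ⊘ b → Coprime c M × b ≈ g ⊘ c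
    flip₁ {b} {c} cb e = cc , ⊘-solve {c} {b} {g} cc (trans (≈-reflexive (ℕP.*-comm c b)) (⊘-cancel {b} {c} {g} cb e))
      where cc = coprime-≈ (sym e) (⊘-coprime cg cb)
    flip : ∀ b c → u b ⊗ δ c (g ⊘ b) ≡ u c ⊗ δ b (g ⊘ c)
    flip b c = trans (𝟙-× (coprime? b M) (c ≈? g ⊘ b)) (trans (𝟙-cong (coprime? b M ×-dec c ≈? g ⊘ b) (coprime? c M ×-dec b ≈? g ⊘ c) (λ (x , y) → flip₁ {b} {c} x y) (λ (x , y) → flip₁ {c} {b} x y)) (sym (𝟙-× (coprime? c M) (b ≈? g ⊘ c))))

  iv-cong : ∀ {a b} → Coprime a M → a ≈ b → iv a ≈ iv b
  iv-cong {a} {b} c e = trans (⊘-solve {b} cb (trans (≈-* {b} {a} {iv a} (sym e) refl) (iv-law c))) (≈-reflexive (ℕP.*-identityˡ (iv b)))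
    where cb = coprime-≈ e c

  -- N is φ(M)
  N : F
  N = ∑ M u

  1≼N : # 1 ≼ N
  1≼N = ≼-trans (≡≽ (𝟙-yes (coprime? (rep 1) M) (coprime-≈ (sym (rep-≈ 1)) coprime-1))) (∑-term (rep-≥1 1) (rep-≤M 1) (λ i _ _ → u-nn i))

  N≼M : N ≼ # M
  N≼M = ≼-trans (∑-mono M (λ i _ _ → 𝟙≼1 (coprime? i M))) (≡≼ (trans (∑-const M (# 1)) (solve 1 (λ a → a :* κ 1 := a) refl (# M))))

  -- Complete periods contribute 0, and fewer than `M` terms remain.
  periodic-≲ : ∀ (f : ℕ → F) c → (∀ k → f (M + k) ≡ f k) → (∀ k → f k ≲ c) → ∑ M f ≡ # 0 → ∀ z → ∑ z f ≲ # M ⊗ c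
  periodic-≲ f c per bd zero-sum z = go z z ℕP.≤-refl
    where
    go : ∀ n z → z ≤ n → ∑ z f ≲ # M ⊗ c
    go n z le with M ≤? z
    go n z le | no M≰z = ≲-weaken (∑-≲ z (λ i _ _ → bd i)) (≼-trans (≡≼ (∑-const z c)) (⊗-monoˡ (≲⇒nn (bd 0)) (#-mono (ℕP.<⇒≤ (ℕP.≰⇒> M≰z)))))
    go zero z le | yes M≤z = ⊥-elim (ℕP.<⇒≱ 1≤M (ℕP.≤-trans M≤z le))
    go (suc n) z le | yes M≤z = ≲-subst (sym e) (go n (z ∸ M) (ℕP.≤-trans (ℕP.∸-monoʳ-≤ z 1≤M) (ℕP.∸-monoˡ-≤ 1 le)))
      where
      e : ∑ z f ≡ ∑ (z ∸ M) f
      e = trans (cong (λ t → ∑ t f) (sym (ℕP.m+[n∸m]≡n M≤z))) (trans (∑-+ M (z ∸ M) f) (trans (cong₂ _⊕_ zero-sum (∑-ext (z ∸ M) per)) (solve 1 (λ a → κ 0 :+ a := a) refl (∑ (z ∸ M) f))))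

  M+≈ : ∀ k → M + k ≈ k
  M+≈ k = DM.%-remove-+ˡ k ∣-refl

  d*M+≈ : ∀ d k → d * (M + k) ≈ d * k
  d*M+≈ d k = ≈-* {d} {d} refl (M+≈ k)

  -- N times the indicator of the class g, made to have mean zero on the units
  balance : ℕ → ℕ → F
  balance g n = N ⊗ δ n g ⊖ u n

  -- For a unit `d` the multiples `d k` run through all classes, so the mean over a period stays 0;
  -- for other `d` every term vanishes.
  balance-≲ : ∀ {g} → Coprime g M → ∀ d z → ∑ z (λ k → balance g (d * k)) ≲ # M ⊗ # M
  balance-≲ {g} cg d z with coprime? d M
  ... | no nc = ≲-subst (sym (∑-0 z (λ k _ _ → trans (cong₂ (λ s t → N ⊗ s ⊖ t) (δ-nonunit k cg nc) (u-*-nonunit k nc)) (solve 1 (λ a → a :* κ 0 :- κ 0 := κ 0) refl N)))) (≲-weaken (≲-nn ≼-refl) (nn-⊗ (0≼# M) (0≼# M)))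
  ... | yes c = periodic-≲ (λ k → balance g (d * k)) (# M) (λ k → cong₂ (λ s t → N ⊗ s ⊖ t) (δ-congˡ g (d*M+≈ d k)) (u-cong (d*M+≈ d k)))
        (λ k → bound (𝟙-nn (d * k ≈? g)) (𝟙≼1 (d * k ≈? g)) (𝟙-nn (coprime? (d * k) M)) (𝟙≼1 (coprime? (d * k) M))) sum0 z
    where
    bound : ∀ {a b} → # 0 ≼ a → a ≼ # 1 → # 0 ≼ b → b ≼ # 1 → N ⊗ a ⊖ b ≲ # M
    bound {a} {b} p q r s = (lin 0 (1 · (⊗-monoʳ (≼-trans 0≼1 1≼N) q) ⊞ 1 · N≼M ⊞ 1 · r) (solve 4 (λ a b c d → d :- (a :* b :- c) := a :* κ 1 :- a :* b :+ (d :- a :+ (c :- κ 0))) refl N a b (# M))) , (lin 0 (1 · (nn-⊗ (≼-trans 0≼1 1≼N) p) ⊞ 1 · s ⊞ 1 · 1≼N ⊞ 1 · N≼M) (solve 4 (λ a b c d → b :* c :- d :- :- a := b :* c :- κ 0 :+ (κ 1 :- d :+ (b :- κ 1 :+ (a :- b)))) refl (# M) N a b))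
    sum0 : ∑ M (λ k → balance g (d * k)) ≡ # 0
    sum0 = trans (∑-ext M (λ k → cong₂ (λ s t → N ⊗ s ⊖ t) (δ-⊘ k g c) (u-*-unit k c))) (trans (∑-⊖ M _ _) (trans (cong (_⊖ N) (trans (∑-⊗ M N _) (cong (N ⊗_) (∑-δ (g ⊘ d))))) (solve 1 (λ a → a :* κ 1 :- a := κ 0) refl N)))

-- Selberg's symmetry formula in arithmetic progressions.

open Log
module Selberg (B : ℕ) (2≤B : 2 ℕ.≤ B) (lgB : LogLike B) (M : ℕ) {{M≢0 : NonZero M}} (M≤B : M ℕ.≤ B) where
  open Field
  open Sums
  open NumTh
  open Mang B 2≤B lgB public
  open Mass B 2≤B lgB public
  open Cls M public
  open LogLike lgB

  m : F
  m = # M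

  1≼m : # 1 ≼ m
  1≼m = #-mono 1≤M

  -- Sums over one class, with weight `⅟ n`, of `Λ`, of `Λ L`, of `Λ ∗ Λ` and of `Λ₂ = Λ L + Λ ∗ Λ`;
  -- the subscript u marks the same sums over all units.
  R Q C V : ℕ → ℕ → F
  R b x = ∑ x (λ n → δ n b ⊗ w n)
  Q b x = ∑ x (λ n → δ n b ⊗ (w n ⊗ L n))
  C g x = ∑ x (λ n → (δ n g ⊗ ⅟ n) ⊗ conv Λ Λ n)
  V g x = ∑ x (λ n → δ n g ⊗ (Λ₂ n ⊗ ⅟ n))

  Wᵤ Qᵤ Cᵤ Vᵤ : ℕ → F
  Wᵤ x = ∑ x (λ n → u n ⊗ w n)
  Qᵤ x = ∑ x (λ n → u n ⊗ (w n ⊗ L n))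
  Cᵤ x = ∑ x (λ n → (u n ⊗ ⅟ n) ⊗ conv Λ Λ n)
  Vᵤ x = ∑ x (λ n → u n ⊗ (Λ₂ n ⊗ ⅟ n))

  private
    split : ∀ (h : ℕ → F) x → ∑ x (λ n → h n ⊗ (Λ₂ n ⊗ ⅟ n)) ≡ ∑ x (λ n → h n ⊗ (w n ⊗ L n)) ⊕ ∑ x (λ n → (h n ⊗ ⅟ n) ⊗ conv Λ Λ n)
    split h x = trans (∑-ext x (λ n → (solve 5 (λ a b c d e → a :* ((b :* c :+ d) :* e) := a :* (b :* e :* c) :+ a :* e :* d) refl (h n) (Λ n) (L n) (conv Λ Λ n) (⅟ n)))) (∑-⊕ x _ _)

  V≡Q⊕C : ∀ g x → V g x ≡ Q g x ⊕ C g x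
  V≡Q⊕C g x = split (λ n → δ n g) x

  Vᵤ≡ : ∀ x → Vᵤ x ≡ Qᵤ x ⊕ Cᵤ x
  Vᵤ≡ x = split u x

  module _ {g : ℕ} (cg : Coprime g M) where
    -- Möbius inversion of `Λ₂∗1`. The inner sums over `k` have no main term because `balance` has
    -- mean 0, so they are of the size of the square of `L (y ÷ d)`, and `∑-L÷²` makes their total
    -- linear in `y`. Comparing classes before evaluating anything avoids asymptotics for sums of
    -- `μ`.
    Λ₂-balance : ∀ y → y ≤ B → ∑ y (λ n → balance g n ⊗ Λ₂ n) ≲ # 24 ⊗ (m ⊗ m) ⊗ # y
    Λ₂-balance y q = ≲-subst (sym (möbius Λ₂∗1 y (balance g)))
      (≲-weaken (∑-≲ y (λ d a b → ≲-⊗ (μ-≲ d) (inner d (y ÷ d) (1≤÷ a b) (ℕP.≤-trans (÷-≤-x y d) q))))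
      (≼-trans (≡≼ (trans (∑-ext y (λ d → (solve 2 (λ a b → κ 1 :* (κ 2 :* (a :* a) :* (b :* b)) := κ 2 :* (a :* a) :* (b :* b)) refl m (L (y ÷ d))))) (∑-⊗ y (# 2 ⊗ (m ⊗ m)) _)))
      (≼-trans (⊗-monoʳ (nn-⊗ (0≼# 2) (nn-⊗ (0≼# M) (0≼# M))) (∑-L÷² y q)) (≡≼ (solve 2 (λ a b → κ 2 :* (a :* a) :* (κ 12 :* b) := κ 24 :* (a :* a) :* b) refl m (# y))))))
      where
      inner : ∀ d z → 1 ≤ z → z ≤ B → ∑ z (λ k → balance g (d * k) ⊗ (L k ⊗ L k)) ≲ # 2 ⊗ (m ⊗ m) ⊗ (L z ⊗ L z)
      inner d (suc z) _ r = abel-up z (λ k → balance g (d * k)) (λ k → L k ⊗ L k) (m ⊗ m) (balance-≲ cg d) (nn-⊗ (L-nn {suc z} (s≤s z≤n) r) (L-nn {suc z} (s≤s z≤n) r)) (nn-⊗ ≼-refl ≼-refl)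
        (λ i p i≤z → let l = L-nn p (ℕP.≤-trans (ℕP.m≤n⇒m≤1+n i≤z) r) ; l≼ = L-mono p (ℕP.n≤1+n i) (ℕP.≤-trans (s≤s i≤z) r) in ⊗-mono l l l≼ l≼)

    private
      K₁ : F
      K₁ = # 24 ⊗ (m ⊗ m)
      A : ℕ → F
      A y = ∑ y (λ n → balance g n ⊗ Λ₂ n)
      K₁-nn : # 0 ≼ K₁
      K₁-nn = nn-⊗ (0≼# 24) (nn-⊗ (0≼# M) (0≼# M))

    -- Partial summation from weight 1 to weight `⅟ n`: a bound linear in `y` turns into a harmonic
    -- sum, hence into one factor `L x`, below the main term `L x ⊗ L x`.
    balanced : ∀ x → 1 ≤ x → x ≤ B → N ⊗ V g x ⊖ Vᵤ x ≲ # 24 ⊗ (m ⊗ m) ⊗ (# 1 ⊕ # 2 ⊗ L x)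
    balanced (suc n) _ q = ≲-subst (sym e) (≲-subst (sym (∑-abel n (λ k → balance g k ⊗ Λ₂ k) ⅟)) (≲-weaken
        (≲-⊕ (≲-⊗ (Λ₂-balance (suc n) q) (≲-nn (⅟-nn (suc n))))
             (∑-≲ n (λ i p r → ≲-⊗ (Λ₂-balance i (ℕP.≤-trans (ℕP.m≤n⇒m≤1+n r) q)) (≲-nn (sub-nn (⅟-anti p (ℕP.n≤1+n i)))))))
        (≼-trans (≡≼ (cong₂ _⊕_ (one (suc n) (s≤s z≤n)) (trans (∑-cong n (λ i p _ → two i p)) (∑-⊗ n K₁ _))))
         (lin 0 (1 · (⊗-monoʳ K₁-nn (harmonic≼ n q))) (solve 3 (λ a b c → a :* (κ 1 :+ κ 2 :* c) :- (a :+ a :* b) := a :* (κ 2 :* c) :- a :* b) refl K₁ (∑ n (λ i → ⅟ (suc i))) (L (suc n)))))))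
      where
      one : ∀ k → 1 ≤ k → K₁ ⊗ # k ⊗ ⅟ k ≡ K₁
      one k p = trans (solve 3 (λ a b c → a :* b :* c := a :* (b :* c)) refl K₁ (# k) (⅟ k)) (trans (cong (K₁ ⊗_) (⅟-law p)) (solve 1 (λ a → a :* κ 1 := a) refl K₁))
      two : ∀ i → 1 ≤ i → K₁ ⊗ # i ⊗ (⅟ i ⊖ ⅟ (suc i)) ≡ K₁ ⊗ ⅟ (suc i)
      two i p = trans (cong (K₁ ⊗ # i ⊗_) (⅟-diff i p)) (trans (solve 4 (λ a b c d → a :* b :* (c :* d) := a :* d :* (b :* c)) refl K₁ (# i) (⅟ i) (⅟ (suc i))) (trans (cong (K₁ ⊗ ⅟ (suc i) ⊗_) (⅟-law p)) (solve 2 (λ a b → a :* b :* κ 1 := a :* b) refl K₁ (⅟ (suc i)))))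
      e : N ⊗ V g (suc n) ⊖ Vᵤ (suc n) ≡ ∑ (suc n) (λ k → (balance g k ⊗ Λ₂ k) ⊗ ⅟ k)
      e = trans (cong (_⊖ Vᵤ (suc n)) (sym (∑-⊗ (suc n) N _))) (trans (sym (∑-⊖ (suc n) _ _)) (∑-ext (suc n) (λ k → (solve 5 (λ a b c d e → a :* (b :* (c :* d)) :- e :* (c :* d) := (a :* b :- e) :* c :* d) refl N (δ k g) (Λ₂ k) (⅟ k) (u k)))))

  Wᵤ-up : ∀ x → 1 ≤ x → x ≤ B → Wᵤ x ≼ L x ⊕ # 12
  Wᵤ-up x p q = ≼-trans (∑-mono x (λ d a b → 𝟙-⊗≼ (coprime? d M) (w-nn d (ℕP.≤-trans b q)))) (W-up x p q)

  Wᵤ-lo : ∀ x → 1 ≤ x → x ≤ B → L x ≼ Wᵤ x ⊕ # 4 ⊗ m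
  Wᵤ-lo x p q = (lin 0 (1 · (W-lo x p q) ⊞ 1 · (noncoprime-mass M x 1≤M M≤B q) ⊞ 1 · (≡≽ e) ⊞ 2 · 1≼m) (solve 5 (λ a b c d e → b :+ κ 4 :* c :- a := d :+ κ 2 :- a :+ (c :* κ 2 :- e :+ (e :- (d :- b) :+ κ 2 :* (c :- κ 1)))) refl (L x) (Wᵤ x) m (W x) (∑ x (λ d → (# 1 ⊖ u d) ⊗ w d))))
    where
    e : ∑ x (λ d → (# 1 ⊖ u d) ⊗ w d) ≡ W x ⊖ Wᵤ x
    e = trans (∑-ext x (λ d → (solve 2 (λ a b → (κ 1 :- a) :* b := b :- a :* b) refl (u d) (w d)))) (∑-⊖ x _ _)

  ⅟-*′ : ∀ {a b} → 1 ≤ a → 1 ≤ b → ∀ x y z → z ⊗ ⅟ (a * b) ⊗ (x ⊗ y) ≡ (x ⊗ ⅟ a) ⊗ (z ⊗ (y ⊗ ⅟ b))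
  ⅟-*′ {a} {b} p q x y z = trans (cong (λ t → z ⊗ t ⊗ (x ⊗ y)) (⅟-* p q)) (solve 5 (λ a b c d e → a :* (b :* c) :* (d :* e) := d :* b :* (a :* (e :* c))) refl z (⅟ a) (⅟ b) x y)

  conv-expand : ∀ (h : ℕ → F) x → ∑ x (λ n → (h n ⊗ ⅟ n) ⊗ conv Λ Λ n) ≡ ∑ x (λ d → w d ⊗ ∑ (x ÷ d) (λ k → h (d * k) ⊗ w k))
  conv-expand h x = trans (∑-conv x Λ Λ (λ n → h n ⊗ ⅟ n)) (∑-cong x (λ d p _ → trans (sym (∑-⊗ (x ÷ d) (Λ d) _)) (trans (∑-cong (x ÷ d) (λ k q _ →
      trans (solve 4 (λ a b c d → a :* (b :* (c :* d)) := c :* d :* (a :* b)) refl (Λ d) (Λ k) (h (d * k)) (⅟ (d * k))) (⅟-*′ p q (Λ d) (Λ k) (h (d * k))))) (∑-⊗ (x ÷ d) (w d) _))))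

  Cᵤ-expand : ∀ x → Cᵤ x ≡ ∑ x (λ d → u d ⊗ (w d ⊗ Wᵤ (x ÷ d)))
  Cᵤ-expand x = trans (conv-expand u x) (∑-ext x (λ d → trans (cong (w d ⊗_) (trans (∑-ext (x ÷ d) (λ k → trans (cong (_⊗ w k) (u-* d k)) (solve 3 (λ a b c → a :* b :* c := a :* (b :* c)) refl (u d) (u k) (w k)))) (∑-⊗ (x ÷ d) (u d) _))) (solve 3 (λ a b c → a :* (b :* c) := b :* (a :* c)) refl (w d) (u d) (Wᵤ (x ÷ d)))))

  ∑-affine : ∀ (h : ℕ → F) x a b → ∑ x (λ d → h d ⊗ (w d ⊗ (a ⊖ b ⊗ L d))) ≡ a ⊗ ∑ x (λ d → h d ⊗ w d) ⊖ b ⊗ ∑ x (λ d → h d ⊗ (w d ⊗ L d))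
  ∑-affine h x a b = trans (∑-ext x (λ d → (solve 5 (λ a b c d e → a :* (b :* (c :- d :* e)) := c :* (a :* b) :- d :* (a :* (b :* e))) refl (h d) (w d) a b (L d)))) (trans (∑-⊖ x _ _) (cong₂ _⊖_ (∑-⊗ x a _) (∑-⊗ x b _)))

  -- By Mertens, `Cᵤ` is the sum of `w d Wᵤ (x ÷ d)`, about `w d (L x - L d)`; this makes
  -- `L x Wᵤ x - Qᵤ x`. The term `Qᵤ` cancels against `Vᵤ = Qᵤ + Cᵤ`, and `Wᵤ x` is again about
  -- `L x`.
  Vᵤ-bound : ∀ x → 1 ≤ x → 2 * x ≤ B → Vᵤ x ⊖ L x ⊗ L x ≲ # 144 ⊗ m ⊗ (L x ⊕ # 1)
  Vᵤ-bound x p q = up , lo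
    where
    x≤B : x ≤ B
    x≤B = ℕP.≤-trans (ℕP.m≤n*m x 2) q
    l = L x
    l≥0 : # 0 ≼ l
    l≥0 = L-nn p x≤B
    Wx = Wᵤ x
    C≼ : Cᵤ x ≼ (l ⊕ # 12) ⊗ Wx ⊖ # 1 ⊗ Qᵤ x
    C≼ = ≼-trans (≡≼ (Cᵤ-expand x)) (≼-trans (∑-mono x (λ d a b → ⊗-monoʳ (u-nn d) (⊗-monoʳ (w-nn d (ℕP.≤-trans b x≤B))
        (lin 0 (1 · (Wᵤ-up (x ÷ d) (1≤÷ a b) (ℕP.≤-trans (÷-≤-x x d) x≤B)) ⊞ 1 · (L-÷-up x d a b x≤B)) (solve 4 (λ a b c d → b :+ κ 12 :- κ 1 :* c :- a := d :+ κ 12 :- a :+ (b :- (d :+ c))) refl (Wᵤ (x ÷ d)) l (L d) (L (x ÷ d)))))))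
        (≡≼ (∑-affine u x (l ⊕ # 12) (# 1))))
    C≽ : (l ⊖ # 2 ⊖ # 4 ⊗ m) ⊗ Wx ⊖ # 1 ⊗ Qᵤ x ≼ Cᵤ x
    C≽ = ≼-trans (≡≽ (∑-affine u x (l ⊖ # 2 ⊖ # 4 ⊗ m) (# 1))) (≼-trans (∑-mono x (λ d a b → ⊗-monoʳ (u-nn d) (⊗-monoʳ (w-nn d (ℕP.≤-trans b x≤B))
        (lin 0 (1 · (Wᵤ-lo (x ÷ d) (1≤÷ a b) (ℕP.≤-trans (÷-≤-x x d) x≤B)) ⊞ 1 · (L-÷-lo x d a b q)) (solve 5 (λ a b c d e → d :- (a :- κ 2 :- κ 4 :* b :- κ 1 :* c) := d :+ κ 4 :* b :- e :+ (e :+ c :+ κ 2 :- a)) refl l m (L d) (Wᵤ (x ÷ d)) (L (x ÷ d)))))))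
        (≡≽ (Cᵤ-expand x)))
    W≼ = Wᵤ-up x p x≤B
    W≽ = Wᵤ-lo x p x≤B
    up : Vᵤ x ⊖ l ⊗ l ≼ # 144 ⊗ m ⊗ (l ⊕ # 1)
    up = (lin 0 (1 · (≡≼ (Vᵤ≡ x)) ⊞ 1 · C≼ ⊞ 1 · (⊗-monoʳ ((lin 0 (1 · l≥0 ⊞ const 12) (solve 1 (λ a → a :+ κ 12 :- κ 0 := a :- κ 0 :+ κ 12) refl l))) W≼) ⊞ 144 · (nn-⊗ (sub-nn 1≼m) l≥0) ⊞ 144 · 1≼m ⊞ 120 · l≥0) (solve 6 (λ a b c d e f → κ 144 :* c :* (b :+ κ 1) :- (a :- b :* b) := d :+ e :- a :+ ((b :+ κ 12) :* f :- κ 1 :* d :- e :+ ((b :+ κ 12) :* (b :+ κ 12) :- (b :+ κ 12) :* f :+ (κ 144 :* ((c :- κ 1) :* b :- κ 0) :+ (κ 144 :* (c :- κ 1) :+ κ 120 :* (b :- κ 0)))))) refl (Vᵤ x) l m (Qᵤ x) (Cᵤ x) Wx))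
    lo : ⊝ (# 144 ⊗ m ⊗ (l ⊕ # 1)) ≼ Vᵤ x ⊖ l ⊗ l
    lo = (lin 0 (1 · (≡≽ (Vᵤ≡ x)) ⊞ 1 · C≽ ⊞ 1 · (⊗-monoʳ l≥0 W≽) ⊞ 2 · W≼ ⊞ 4 · (⊗-monoʳ (0≼# M) W≼) ⊞ 136 · (nn-⊗ (sub-nn 1≼m) l≥0) ⊞ 96 · 1≼m ⊞ 134 · l≥0 ⊞ const 72) (solve 6 (λ a b c d e f → c :- b :* b :- :- (κ 144 :* a :* (b :+ κ 1)) := c :- (d :+ e) :+ (e :- ((b :- κ 2 :- κ 4 :* a) :* f :- κ 1 :* d) :+ (b :* (f :+ κ 4 :* a) :- b :* b :+ (κ 2 :* (b :+ κ 12 :- f) :+ (κ 4 :* (a :* (b :+ κ 12) :- a :* f) :+ (κ 136 :* ((a :- κ 1) :* b :- κ 0) :+ (κ 96 :* (a :- κ 1) :+ (κ 134 :* (b :- κ 0) :+ κ 72)))))))) refl m l (Vᵤ x) (Qᵤ x) (Cᵤ x) Wx))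

  -- One class is compared with all units by `balanced`, and all units with `L x ⊗ L x` by
  -- `Vᵤ-bound`. The coefficient of `L x` is 2 · 24 + 144 = 192 once `m` is enlarged to its square.
  selberg : ∀ {g} → Coprime g M → ∀ x → 1 ≤ x → 2 * x ≤ B → N ⊗ V g x ⊖ L x ⊗ L x ≲ # 192 ⊗ (m ⊗ m) ⊗ (L x ⊕ # 1)
  selberg {g} cg x p q = ≲-subst (solve 4 (λ a b c d → a :* b :- c :+ (c :- d :* d) := a :* b :- d :* d) refl N (V g x) (Vᵤ x) (L x)) (≲-weaken (≲-⊕ (balanced cg x p x≤B) (Vᵤ-bound x p q))
     (lin 0 (144 · (nn-⊗ (nn-⊗ (0≼# M) (sub-nn 1≼m)) (L-nn p x≤B)) ⊞ 144 · (nn-⊗ (0≼# M) (sub-nn 1≼m)) ⊞ 24 · (nn-⊗ (0≼# M) (0≼# M))) (solve 2 (λ a b → κ 192 :* (a :* a) :* (b :+ κ 1) :- (κ 24 :* (a :* a) :* (κ 1 :+ κ 2 :* b) :+ κ 144 :* a :* (b :+ κ 1)) := κ 144 :* (a :* (a :- κ 1) :* b :- κ 0) :+ (κ 144 :* (a :* (a :- κ 1) :- κ 0) :+ κ 24 :* (a :* a :- κ 0))) refl m (L x))))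
    where
    x≤B : x ≤ B
    x≤B = ℕP.≤-trans (ℕP.m≤n*m x 2) q

  C-expand : ∀ {g} → Coprime g M → ∀ x → C g x ≡ ∑ x (λ d → u d ⊗ (w d ⊗ R (g ⊘ d) (x ÷ d)))
  C-expand {g} cg x = trans (conv-expand (λ n → δ n g) x) (∑-ext x term)
    where
    term : ∀ d → w d ⊗ ∑ (x ÷ d) (λ k → δ (d * k) g ⊗ w k) ≡ u d ⊗ (w d ⊗ R (g ⊘ d) (x ÷ d))
    term d = aux (coprime? d M)
     where
     aux : (e : Dec (Coprime d M)) → w d ⊗ ∑ (x ÷ d) (λ k → δ (d * k) g ⊗ w k) ≡ 𝟙 e ⊗ (w d ⊗ R (g ⊘ d) (x ÷ d))
     aux (yes c) = trans (cong (w d ⊗_) (∑-ext (x ÷ d) (λ k → cong (_⊗ w k) (δ-⊘ k g c)))) (solve 2 (λ a b → a :* b := κ 1 :* (a :* b)) refl (w d) (R (g ⊘ d) (x ÷ d)))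
     aux (no nc) = trans (cong (w d ⊗_) (∑-0 (x ÷ d) (λ k _ _ → trans (cong (_⊗ w k) (δ-nonunit k cg nc)) (solve 1 (λ a → κ 0 :* a := κ 0) refl (w k))))) (solve 2 (λ a b → a :* κ 0 := κ 0 :* (a :* b)) refl (w d) (R (g ⊘ d) (x ÷ d)))

  R-nn : ∀ b x → x ≤ B → # 0 ≼ R b x
  R-nn b x q = ∑-nn x (λ n _ r → nn-⊗ (δ-nn n b) (w-nn n (ℕP.≤-trans r q)))

  R-mono : ∀ b {x y} → x ≤ y → y ≤ B → R b x ≼ R b y
  R-mono b p q = ∑-grow p (λ n _ r → nn-⊗ (δ-nn n b) (w-nn n (ℕP.≤-trans r q)))

  R-cong : ∀ {a b} x → a ≈ b → R a x ≡ R b x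
  R-cong x e = ∑-ext x (λ n → cong (_⊗ w n) (δ-congʳ n e))

  ∑-units-R : ∀ x → ∑ M (λ b → u b ⊗ R b x) ≡ Wᵤ x
  ∑-units-R x = trans (∑-ext M (λ b → sym (∑-⊗ x (u b) _))) (trans (∑-swap M x _) (∑-ext x (λ n → trans (∑-ext M (λ b → (solve 3 (λ a b c → a :* (b :* c) := a :* b :* c) refl (u b) (δ n b) (w n)))) (trans (∑-⊗ʳ M (w n) _) (cong (_⊗ w n) (∑-units-δ n))))))

-- Upper bounds for the primes of a class, and the inequality linking three classes.

open Log
module End (B : ℕ) (2≤B : 2 ℕ.≤ B) (lgB : LogLike B) (M : ℕ) {{M≢0 : NonZero M}} (M≤B : M ℕ.≤ B) where
  open Field
  open Sums
  open NumTh
  open Selberg B 2≤B lgB M M≤B public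

  K : F
  K = # 192 ⊗ (m ⊗ m)

  m-nn : # 0 ≼ m
  m-nn = 0≼# M

  1≼m² : # 1 ≼ m ⊗ m
  1≼m² = (lin 0 (1 · (nn-⊗ (sub-nn 1≼m) (sub-nn 1≼m)) ⊞ 2 · 1≼m) (solve 1 (λ a → a :* a :- κ 1 := (a :- κ 1) :* (a :- κ 1) :- κ 0 :+ κ 2 :* (a :- κ 1)) refl m))

  192≼K : # 192 ≼ K
  192≼K = (lin 0 (192 · 1≼m²) (solve 1 (λ a → κ 192 :* (a :* a) :- κ 192 := κ 192 :* (a :* a :- κ 1)) refl m))

  N-nn : # 0 ≼ N
  N-nn = ≼-trans 0≼1 1≼N

  private
    2x⇒x : ∀ {x} → 2 * x ≤ B → x ≤ B
    2x⇒x {x} q = ℕP.≤-trans (ℕP.m≤n*m x 2) q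

  Q≼L⊗R : ∀ b x → 1 ≤ x → x ≤ B → Q b x ≼ L x ⊗ R b x
  Q≼L⊗R b x p q = ≼-trans (∑-mono x (λ n a r → ⊗-monoʳ (δ-nn n b) (⊗-monoʳ (w-nn n (ℕP.≤-trans r q)) (L-mono a r q)))) (≡≼ (trans (∑-ext x (λ n → (solve 3 (λ a b c → a :* (b :* c) := c :* (a :* b)) refl (δ n b) (w n) (L x)))) (∑-⊗ x (L x) _)))

  C-nn : ∀ {g} → Coprime g M → ∀ x → x ≤ B → # 0 ≼ C g x
  C-nn {g} c x q = ≼-trans (∑-nn x (λ d _ r → nn-⊗ (u-nn d) (nn-⊗ (w-nn d (ℕP.≤-trans r q)) (R-nn (g ⊘ d) (x ÷ d) (ℕP.≤-trans (÷-≤-x x d) q))))) (≡≽ (C-expand c x))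

  NQ≼ : ∀ {b} → Coprime b M → ∀ x → 1 ≤ x → 2 * x ≤ B → N ⊗ Q b x ≼ L x ⊗ L x ⊕ K ⊗ (L x ⊕ # 1)
  NQ≼ {b} c x p q = (lin 0 (1 · (proj₁ (selberg c x p q)) ⊞ 1 · (≡≽ (cong (N ⊗_) (V≡Q⊕C b x))) ⊞ 1 · (nn-⊗ N-nn (C-nn c x (2x⇒x q)))) (solve 6 (λ a b c d e f → c :* c :+ d :* (c :+ κ 1) :- a :* b := d :* (c :+ κ 1) :- (a :* e :- c :* c) :+ (a :* e :- a :* (b :+ f) :+ (a :* f :- κ 0))) refl N (Q b x) (L x) K (V b x) (C b x)))

  R≼ : ∀ {b} → Coprime b M → ∀ x → 1 ≤ x → x ≤ B → R b x ≼ L x ⊕ # 12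
  R≼ {b} c x p q = ≼-trans (∑-mono x (λ n _ r → ⊗-monoˡ (w-nn n (ℕP.≤-trans r q)) (𝟙-⇒ (n ≈? b) (coprime? n M) (λ e → coprime-≈ (sym e) c)))) (Wᵤ-up x p q)

  -- ε = 1 / H, and c is the contribution of the range below n₀, where Selberg's formula is not yet effective.
  module Upper (H : F) (1≼H : # 1 ≼ H) (n₀ : ℕ) (1≤n₀ : 1 ≤ n₀) (big : # 2 ⊗ K ⊗ H ≼ L n₀) where
    ε : F
    ε = inv H
    Hε : H ⊗ ε ≡ # 1
    Hε = inv-law 1≼H
    ε-nn : # 0 ≼ ε
    ε-nn = inv-nn 1≼H

    module _ {b : ℕ} (cb : Coprime b M) where
      private
        c : F
        c = N ⊗ R b n₀
        -- A discrete integration of dQ / L. A step in `x` adds `N R (L (suc x) - L x)` to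
        -- `N R L - N Q`, and the bound `from-E` on `R`, itself a consequence of the invariant,
        -- keeps this within the growth of the right side. The outcome is twice the expected mass,
        -- the price of knowing only that `C` is nonnegative.
        E : ℕ → Set
        E x = N ⊗ R b x ⊗ L x ≼ N ⊗ Q b x ⊕ L x ⊗ ((# 1 ⊕ ε) ⊗ L x ⊕ c)

        L≥ : ∀ {x} → n₀ ≤ x → x ≤ B → # 2 ⊗ K ⊗ H ≼ L x
        L≥ p q = ≼-trans big (L-mono 1≤n₀ p q)

        1≼L : ∀ {x} → n₀ ≤ x → x ≤ B → # 1 ≼ L x
        1≼L {x} p q = (lin 0 (1 · (L≥ p q) ⊞ 2 · (nn-⊗ (sub-nn 192≼K) (sub-nn 1≼H)) ⊞ 2 · 192≼K ⊞ 384 · 1≼H ⊞ const 383) (solve 3 (λ a b c → a :- κ 1 := a :- κ 2 :* b :* c :+ (κ 2 :* ((b :- κ 192) :* (c :- κ 1) :- κ 0) :+ (κ 2 :* (b :- κ 192) :+ (κ 384 :* (c :- κ 1) :+ κ 383)))) refl (L x) K H))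

        small : ∀ {x} → n₀ ≤ x → x ≤ B → K ⊗ (L x ⊕ # 1) ≼ ε ⊗ (L x ⊗ L x)
        small {x} p q = (lin 0 (1 · (⊗-monoʳ (≼-trans (0≼# 192) 192≼K) (1≼L p q)) ⊞ 1 · (⊗-monoʳ (nn-⊗ ε-nn (≼-trans 0≼1 (1≼L p q))) (L≥ p q)) ⊞ 1 · (≡≽ (cong (# 2 ⊗ K ⊗ L x ⊗_) Hε))) (solve 4 (λ a b c d → c :* (b :* b) :- a :* (b :+ κ 1) := a :* b :- a :* κ 1 :+ (c :* b :* b :- c :* b :* (κ 2 :* a :* d) :+ (κ 2 :* a :* b :* (d :* c) :- κ 2 :* a :* b :* κ 1))) refl K (L x) ε H))

        from-E : ∀ x → n₀ ≤ x → 2 * x ≤ B → E x → N ⊗ R b x ≼ # 2 ⊗ (# 1 ⊕ ε) ⊗ L x ⊕ c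
        from-E x p q e = cancel (1≼L p (2x⇒x q)) (lin 0 (1 · e ⊞ 1 · (NQ≼ cb x (ℕP.≤-trans 1≤n₀ p) q) ⊞ 1 · (small p (2x⇒x q))) (solve 7 (λ a b c d e f g → a :* (κ 2 :* (κ 1 :+ d) :* a :+ e) :- a :* (b :* c) := b :* f :+ a :* ((κ 1 :+ d) :* a :+ e) :- b :* c :* a :+ (a :* a :+ g :* (a :+ κ 1) :- b :* f :+ (d :* (a :* a) :- g :* (a :+ κ 1)))) refl (L x) N (R b x) ε c (Q b x) K))

        E-all : ∀ t → 2 * (n₀ + t) ≤ B → E (n₀ + t)
        E-all zero q rewrite ℕP.+-identityʳ n₀ = (lin 0 (1 · (nn-⊗ (nn-⊗ l l) (≼-trans ε-nn (lin 0 (const 1) (solve 1 (λ a → κ 1 :+ a :- a := κ 1) refl ε)))) ⊞ 1 · (nn-⊗ N-nn (∑-nn n₀ (λ n a r → nn-⊗ (δ-nn n b) (nn-⊗ (w-nn n (ℕP.≤-trans r (2x⇒x q))) (L-nn a (ℕP.≤-trans r (2x⇒x q)))))))) (solve 5 (λ a b c d e → a :* d :+ c :* ((κ 1 :+ e) :* c :+ a :* b) :- a :* b :* c := c :* c :* (κ 1 :+ e) :- κ 0 :+ (a :* d :- κ 0)) refl N (R b n₀) (L n₀) (Q b n₀) ε))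
          where l = L-nn 1≤n₀ (2x⇒x q)
        E-all (suc t) q rewrite ℕP.+-suc n₀ t = step (n₀ + t) (ℕP.m≤m+n n₀ t) q (E-all t (ℕP.≤-trans (ℕP.*-monoʳ-≤ 2 (ℕP.n≤1+n (n₀ + t))) q))
          where
          step : ∀ x → n₀ ≤ x → 2 * suc x ≤ B → E x → E (suc x)
          step x p q e = (lin 0 (1 · e ⊞ 1 · (≡≼ (cong (λ t → N ⊗ t ⊗ l′) {r} refl)) ⊞ 1 · (⊗-monoʳ Δ≥0 (from-E x p q′ e)) ⊞ 1 · (nn-⊗ (≼-trans ε-nn (lin 0 (const 1) (solve 1 (λ a → κ 1 :+ a :- a := κ 1) refl ε))) (sq-nn (l′ ⊖ L x)))) (solve 10 (λ a b c d e f g h i j → a :* (e :+ f :* (g :* d)) :+ d :* ((κ 1 :+ h) :* d :+ i) :- a :* (b :+ c) :* d := a :* e :+ j :* ((κ 1 :+ h) :* j :+ i) :- a :* b :* j :+ (a :* (f :* g) :* d :- a :* c :* d :+ ((d :- j) :* (κ 2 :* (κ 1 :+ h) :* j :+ i) :- (d :- j) :* (a :* b) :+ ((κ 1 :+ h) :* ((d :- j) :* (d :- j)) :- κ 0)))) refl N (R b x) r l′ (Q b x) (δ (suc x) b) (w (suc x)) ε c (L x)))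
            where
            r = δ (suc x) b ⊗ w (suc x)
            l′ = L (suc x)
            q′ : 2 * x ≤ B
            q′ = ℕP.≤-trans (ℕP.*-monoʳ-≤ 2 (ℕP.n≤1+n x)) q
            Δ≥0 : # 0 ≼ l′ ⊖ L x
            Δ≥0 = inc-nn x (ℕP.≤-trans 1≤n₀ p) (2x⇒x q)

      R-upper : ∀ x → 1 ≤ x → 2 * x ≤ B → 2 * n₀ ≤ B → N ⊗ R b x ≼ # 2 ⊗ (# 1 ⊕ ε) ⊗ L x ⊕ m ⊗ (L n₀ ⊕ # 12)
      R-upper x p q q₀ with n₀ ≤? x
      ... | yes n₀≤x = (lin 0 (1 · (from-E x n₀≤x q (subst E (ℕP.m+[n∸m]≡n n₀≤x) (E-all (x ∸ n₀) (subst (λ t → 2 * t ≤ B) (sym (ℕP.m+[n∸m]≡n n₀≤x)) q)))) ⊞ 1 · c≼) (solve 7 (λ a b c d e f g → κ 2 :* (κ 1 :+ c) :* d :+ e :* (f :+ κ 12) :- a :* b := κ 2 :* (κ 1 :+ c) :* d :+ a :* g :- a :* b :+ (e :* (f :+ κ 12) :- a :* g)) refl N (R b x) ε (L x) m (L n₀) (R b n₀)))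
        where
        c≼ : N ⊗ R b n₀ ≼ m ⊗ (L n₀ ⊕ # 12)
        c≼ = ⊗-mono N-nn (R-nn b n₀ (2x⇒x q₀)) N≼M (R≼ cb n₀ 1≤n₀ (2x⇒x q₀))
      ... | no n₀≰x = (lin 0 (1 · (⊗-mono N-nn (R-nn b x (2x⇒x q)) N≼M (≼-trans (R-mono b (ℕP.<⇒≤ (ℕP.≰⇒> n₀≰x)) (2x⇒x q₀)) (R≼ cb n₀ 1≤n₀ (2x⇒x q₀)))) ⊞ 2 · (nn-⊗ (≼-trans ε-nn (lin 0 (const 1) (solve 1 (λ a → κ 1 :+ a :- a := κ 1) refl ε))) (L-nn p (2x⇒x q)))) (solve 6 (λ a b c d e f → κ 2 :* (κ 1 :+ c) :* d :+ e :* (f :+ κ 12) :- a :* b := e :* (f :+ κ 12) :- a :* b :+ κ 2 :* ((κ 1 :+ c) :* d :- κ 0)) refl N (R b x) ε (L x) m (L n₀)))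

    module Main (X : ℕ) (n₀≤X : n₀ ≤ X) (2X≤B : 2 * X ≤ B) (range : H ⊗ (m ⊗ (L n₀ ⊕ # 12)) ≼ L X) (Ubig : # 3 ⊗ K ⊗ H ≼ L X) where
      U : F
      U = L X
      1≤X : 1 ≤ X
      1≤X = ℕP.≤-trans 1≤n₀ n₀≤X
      X≤B : X ≤ B
      X≤B = 2x⇒x 2X≤B
      U-nn : # 0 ≼ U
      U-nn = L-nn 1≤X X≤B

      R≼3ε : ∀ {b} → Coprime b M → ∀ x → 1 ≤ x → x ≤ X → N ⊗ R b x ≼ # 2 ⊗ L x ⊕ # 3 ⊗ ε ⊗ U
      R≼3ε {b} cb x p q = (lin 0 (1 · (R-upper cb x p (ℕP.≤-trans (ℕP.*-monoʳ-≤ 2 q) 2X≤B) (ℕP.≤-trans (ℕP.*-monoʳ-≤ 2 n₀≤X) 2X≤B)) ⊞ 2 · (⊗-monoʳ ε-nn (L-mono p q X≤B)) ⊞ 1 · (⊗-monoʳ ε-nn range) ⊞ 1 · (≡≽ (cong ((m ⊗ (L n₀ ⊕ # 12)) ⊗_) Hε))) (solve 8 (λ a b c d e f g h → κ 2 :* c :+ κ 3 :* d :* e :- a :* b := κ 2 :* (κ 1 :+ d) :* c :+ f :* (g :+ κ 12) :- a :* b :+ (κ 2 :* (d :* e :- d :* c) :+ (d :* e :- d :* (h :* (f :* (g :+ κ 12))) :+ (f :* (g :+ κ 12) :* (h :* d) :- f :* (g :+ κ 12) :* κ 1)))) refl N (R b x) (L x) ε U m (L n₀) H))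

      -- When `x` grows by 1, the difference `L Wᵤ - Qᵤ` grows by `Wᵤ x` times the increment of `L`,
      -- and `Wᵤ x ≼ L x ⊕ # 12`; summing `2 L` against the increments of `L` gives the square.
      gap : ∀ x → 1 ≤ x → x ≤ B → # 2 ⊗ (L x ⊗ Wᵤ x ⊖ Qᵤ x) ≼ L x ⊗ L x ⊕ # 24 ⊗ L x
      gap (suc zero) _ q = (lin 0 (const 0) (solve 3 (λ a b c → κ 0 :* κ 0 :+ κ 24 :* κ 0 :- κ 2 :* (κ 0 :* a :- (κ 0 :+ b :* (c :* κ 0))) := κ 0) refl (Wᵤ 1) (u 1) (w 1)))
      gap (suc x@(suc _)) _ q = (lin 0 (1 · (gap x (s≤s z≤n) (ℕP.<⇒≤ q)) ⊞ 2 · (⊗-monoʳ (inc-nn x (s≤s z≤n) q) (Wᵤ-up x (s≤s z≤n) (ℕP.<⇒≤ q))) ⊞ 1 · (sq-nn (l′ ⊖ L x))) (solve 6 (λ a b c d e f → a :* a :+ κ 24 :* a :- κ 2 :* (a :* (b :+ c :* d) :- (e :+ c :* (d :* a))) := f :* f :+ κ 24 :* f :- κ 2 :* (f :* b :- e) :+ (κ 2 :* ((a :- f) :* (f :+ κ 12) :- (a :- f) :* b) :+ ((a :- f) :* (a :- f) :- κ 0))) refl l′ (Wᵤ x) (u (suc x)) (w (suc x)) (Qᵤ x) (L x)))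
        where l′ = L (suc x)

      module _ {g b : ℕ} (cg : Coprime g M) (cb : Coprime b M) {y : ℕ} (y≤X : y ≤ X) where
        private
          T : F
          T = N ⊗ R (g ⊘ b) X
          a₁ = (# 2 ⊕ # 3 ⊗ ε) ⊗ U

          -- Every unit `d` receives the general bound `2 (U - L d)`, up to `ε U`. For `d ≤ y` in
          -- the class `b` the factor `R (g ⊘ d) (X ÷ d)` is instead enlarged to `R (g ⊘ b) X`; the
          -- subtracted term records the difference of the two bounds.
          termwise : ∀ d → 1 ≤ d → d ≤ X → N ⊗ (u d ⊗ (w d ⊗ R (g ⊘ d) (X ÷ d))) ≼ u d ⊗ (w d ⊗ (a₁ ⊖ # 2 ⊗ L d)) ⊖ 𝟙 (d ≤? y) ⊗ (δ d b ⊗ (w d ⊗ (# 2 ⊗ U ⊖ T ⊖ # 2 ⊗ L d)))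
          termwise d p q = aux (coprime? d M) (d ≤? y) (d ≈? b)
            where
            wd = w-nn d (ℕP.≤-trans q X≤B)
            Rd = R (g ⊘ d) (X ÷ d)
            gen : Coprime d M → N ⊗ Rd ≼ a₁ ⊖ # 2 ⊗ L d
            gen cd = (lin 0 (1 · (R≼3ε (⊘-coprime cg cd) (X ÷ d) (1≤÷ p q) (÷-≤-x X d)) ⊞ 2 · (L-÷-up X d p q X≤B)) (solve 6 (λ a b c d e f → (κ 2 :+ κ 3 :* c) :* d :- κ 2 :* e :- a :* b := κ 2 :* f :+ κ 3 :* c :* d :- a :* b :+ κ 2 :* (d :- (f :+ e))) refl N Rd ε U (L d) (L (X ÷ d))))
            aux : (s : Dec (Coprime d M)) (t : Dec (d ≤ y)) (v : Dec (d ≈ b)) → N ⊗ (𝟙 s ⊗ (w d ⊗ Rd)) ≼ 𝟙 s ⊗ (w d ⊗ (a₁ ⊖ # 2 ⊗ L d)) ⊖ 𝟙 t ⊗ (𝟙 v ⊗ (w d ⊗ (# 2 ⊗ U ⊖ T ⊖ # 2 ⊗ L d)))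
            aux (no nc) t (yes e) = ⊥-elim (nc (coprime-≈ (sym e) cb))
            aux (no nc) t (no _) = (lin 0 (const 0) (solve 8 (λ a b c d e f g h → κ 0 :* (b :* (d :- κ 2 :* e)) :- f :* (κ 0 :* (b :* (κ 2 :* g :- h :- κ 2 :* e))) :- a :* (κ 0 :* (b :* c)) := κ 0) refl N (w d) Rd a₁ (L d) (𝟙 t) U T))
            aux (yes cd) (no _) v = (lin 0 (1 · (⊗-monoʳ wd (gen cd))) (solve 8 (λ a b c d e f g h → κ 1 :* (b :* (d :- κ 2 :* e)) :- κ 0 :* (f :* (b :* (κ 2 :* g :- h :- κ 2 :* e))) :- a :* (κ 1 :* (b :* c)) := b :* (d :- κ 2 :* e) :- b :* (a :* c)) refl N (w d) Rd a₁ (L d) (𝟙 v) U T))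
            aux (yes cd) (yes _) (no _) = (lin 0 (1 · (⊗-monoʳ wd (gen cd))) (solve 7 (λ a b c d e f g → κ 1 :* (b :* (d :- κ 2 :* e)) :- κ 1 :* (κ 0 :* (b :* (κ 2 :* f :- g :- κ 2 :* e))) :- a :* (κ 1 :* (b :* c)) := b :* (d :- κ 2 :* e) :- b :* (a :* c)) refl N (w d) Rd a₁ (L d) U T))
            aux (yes cd) (yes _) (yes e) = (lin 0 (1 · (⊗-monoʳ wd le) ⊞ 3 · (nn-⊗ wd (nn-⊗ ε-nn U-nn))) (solve 7 (λ a b c d e f g → κ 1 :* (b :* ((κ 2 :+ κ 3 :* d) :* e :- κ 2 :* f)) :- κ 1 :* (κ 1 :* (b :* (κ 2 :* e :- g :- κ 2 :* f))) :- a :* (κ 1 :* (b :* c)) := b :* g :- b :* (a :* c) :+ κ 3 :* (b :* (d :* e) :- κ 0)) refl N (w d) Rd ε U (L d) T))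
              where
              le : N ⊗ Rd ≼ T
              le = ⊗-monoʳ N-nn (≼-trans (R-mono (g ⊘ d) (÷-≤-x X d) X≤B) (≡≼ (R-cong X (≈-* {g} {g} refl (iv-cong cd e)))))

          NC≼ : N ⊗ C g X ≼ a₁ ⊗ Wᵤ X ⊖ # 2 ⊗ Qᵤ X ⊖ ((# 2 ⊗ U ⊖ T) ⊗ R b y ⊖ # 2 ⊗ Q b y)
          NC≼ = ≼-trans (≡≼ (trans (cong (N ⊗_) (C-expand cg X)) (sym (∑-⊗ X N _)))) (≼-trans (∑-mono X termwise) (≡≼ (trans (∑-⊖ X _ _) (cong₂ _⊖_ (∑-affine u X a₁ (# 2)) (trans (∑-trunc _ y≤X) (∑-affine (λ d → δ d b) y (# 2 ⊗ U ⊖ T) (# 2)))))))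

        -- Selberg's formula says that `N C g X` is about `U ⊗ U` minus `N Q g X`, while the general
        -- bounds for all `R (g ⊘ d)` add up to about `U ⊗ U` by `gap`. If the class `g` has little
        -- mass, none of these bounds can be far from sharp. So what the class `b` saves, the left
        -- side, is at most the contribution of `g` and the errors.
        sieve : (# 2 ⊗ U ⊖ N ⊗ R (g ⊘ b) X) ⊗ R b y ⊖ # 2 ⊗ Q b y ≼ U ⊗ (N ⊗ R g X) ⊕ # 4 ⊗ ε ⊗ (U ⊗ U)
        sieve = (lin 0 (1 · NC≼ ⊞ 1 · (proj₂ (selberg cg X 1≤X 2X≤B)) ⊞ 1 · (≡≼ (cong (N ⊗_) (V≡Q⊕C g X))) ⊞ 1 · (⊗-monoʳ N-nn (Q≼L⊗R g X 1≤X X≤B)) ⊞ 1 · (gap X 1≤X X≤B) ⊞ 3 · (⊗-monoʳ (nn-⊗ ε-nn U-nn) (Wᵤ-up X 1≤X X≤B)) ⊞ 1 · (⊗-monoʳ (nn-⊗ ε-nn U-nn) Ubig) ⊞ 3 · (≡≽ (cong (K ⊗ U ⊗_) Hε)) ⊞ 1 · (⊗-monoˡ (≼-trans (0≼# 192) 192≼K) 1≼U) ⊞ 1 · (⊗-monoˡ U-nn 192≼K) ⊞ 36 · (⊗-monoˡ U-nn ε≼1) ⊞ 132 · U-nn) (solve 14 (λ a b c d e f g h i j k l m n → a :* (e :* f) :+ κ 4 :* g :* (a :* a) :- ((κ 2 :* a :- b) :* c :- κ 2 :* d) := (κ 2 :+ κ 3 :* g) :* a :* i :- κ 2 :* j :-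 ((κ 2 :* a :- b) :* c :- κ 2 :* d) :- e :* h :+ (e :* l :- a :* a :- :- (k :* (a :+ κ 1)) :+ (e :* (m :+ h) :- e :* l :+ (e :* (a :* f) :- e :* m :+ (a :* a :+ κ 24 :* a :- κ 2 :* (a :* i :- j) :+ (κ 3 :* (g :* a :* (a :+ κ 12) :- g :* a :* i) :+ (g :* a :* a :- g :* a :* (κ 3 :* k :* n) :+ (κ 3 :* (k :* a :* (n :* g) :- k :* a :* κ 1) :+ (a :* k :- κ 1 :* k :+ (k :* a :- κ 192 :* a :+ (κ 36 :* (κ 1 :* a :- g :* a) :+ κ 132 :* (a :- κ 0)))))))))))) refl U T (R b y) (Q b y) N (R g X) ε (C g X) (Wᵤ X) (Qᵤ X) K (V g X) (Q g X) H))
          where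
          1≼U : # 1 ≼ U
          1≼U = (lin 0 (1 · Ubig ⊞ 3 · (nn-⊗ (sub-nn 192≼K) (sub-nn 1≼H)) ⊞ 3 · 192≼K ⊞ 576 · 1≼H ⊞ const 575) (solve 3 (λ a b c → a :- κ 1 := a :- κ 3 :* b :* c :+ (κ 3 :* ((b :- κ 192) :* (c :- κ 1) :- κ 0) :+ (κ 3 :* (b :- κ 192) :+ (κ 576 :* (c :- κ 1) :+ κ 575)))) refl U K H))
          ε≼1 : ε ≼ # 1
          ε≼1 = (lin 0 (1 · (≡≼ Hε) ⊞ 1 · (nn-⊗ ε-nn (sub-nn 1≼H))) (solve 2 (λ a b → κ 1 :- a := κ 1 :- b :* a :+ (a :* (b :- κ 1) :- κ 0)) refl ε H))

-- Heavy classes: a class without primes forces half of the units to carry almost everything.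

open Log
module Dich (B : ℕ) (2≤B : 2 ℕ.≤ B) (lgB : LogLike B) (M : ℕ) {{M≢0 : NonZero M}} (M≤B : M ℕ.≤ B) where
  open Field
  open Sums
  open NumTh
  open End B 2≤B lgB M M≤B public

  indicator-sum : ∀ {P : ℕ → Set} (d : ∀ i → Dec (P i)) n → ∃ λ c → ∑ n (λ i → 𝟙 (d i)) ≡ # c
  indicator-sum d zero = 0 , refl
  indicator-sum d (suc n) with indicator-sum d n | d (suc n)
  ... | c , e | yes _ = suc c , (≼-antisym (lin 0 (1 · (≡≼ e) ⊞ 1 · (≡≽ (#-suc c))) (solve 3 (λ a b c → b :- (a :+ κ 1) := c :- a :+ (b :- (κ 1 :+ c))) refl (∑ n (λ i → 𝟙 (d i))) (# (suc c)) (# c))) (lin 0 (1 · (≡≽ e) ⊞ 1 · (≡≼ (#-suc c))) (solve 3 (λ a b c → a :+ κ 1 :- b := a :- c :+ (κ 1 :+ c :- b)) refl (∑ n (λ i → 𝟙 (d i))) (# (suc c)) (# c))))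
  ... | c , e | no _ = c , (≼-antisym (lin 0 (1 · (≡≼ e)) (solve 2 (λ a b → b :- (a :+ κ 0) := b :- a) refl (∑ n (λ i → 𝟙 (d i))) (# c))) (lin 0 (1 · (≡≽ e)) (solve 2 (λ a b → a :+ κ 0 :- b := a :- b) refl (∑ n (λ i → 𝟙 (d i))) (# c))))

  units-count : ∀ {P : ℕ → Set} (d : ∀ i → Dec (P i)) → ∃ λ c → ∑ M (λ b → u b ⊗ 𝟙 (d b)) ≡ # c
  units-count d with indicator-sum (λ b → coprime? b M ×-dec d b) M
  ... | c , e = c , trans (∑-ext M (λ b → 𝟙-× (coprime? b M) (d b))) e

  -- counts of units are integers, so a strict inequality between them is one by at least 1
  count-dichotomy : ∀ {x y} → (∃ λ a → x ≡ # a) → (∃ λ b → y ≡ # b) → x ≼ y ⊎ y ⊕ # 1 ≼ x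
  count-dichotomy {x} {y} (a , p) (b , q) with a ≤? b
  ... | yes r = inj₁ (≼-trans (≡≼ p) (≼-trans (#-mono r) (≡≽ q)))
  ... | no r  = inj₂ (lin 0 (1 · (≡≽ p) ⊞ 1 · (≡≼ q) ⊞ 1 · (#-mono (ℕP.≰⇒> r)) ⊞ 1 · (≡≽ (#-suc b))) (solve 5 (λ a b c d e → b :- (a :+ κ 1) := b :- c :+ (d :- a :+ (c :- e :+ (e :- (κ 1 :+ d))))) refl y x (# a) (# b) (# (suc b))))

  -- With `U = k̂ L₁`, the factor `k̂` makes errors of order `m ⊗ m ⊗ L₁` a small fraction of `U`,
  -- and `H`, the inverse of `ε`, makes `64 m m ε U U` equal to `L₁ L₁`.
  k̂ H : F
  k̂ = # 72 ⊗ (m ⊗ m)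
  H = # 64 ⊗ (m ⊗ m) ⊗ (k̂ ⊗ k̂)

  1≼k̂ : # 1 ≼ k̂
  1≼k̂ = (lin 0 (72 · 1≼m² ⊞ const 71) (solve 1 (λ a → κ 72 :* (a :* a) :- κ 1 := κ 72 :* (a :* a :- κ 1) :+ κ 71) refl m))

  ≥1-⊗ : ∀ {x y} → # 1 ≼ x → # 1 ≼ y → # 1 ≼ x ⊗ y
  ≥1-⊗ {x} {y} p q = (lin 0 (1 · (nn-⊗ (sub-nn p) (sub-nn q)) ⊞ 1 · p ⊞ 1 · q) (solve 2 (λ a b → a :* b :- κ 1 := (a :- κ 1) :* (b :- κ 1) :- κ 0 :+ (a :- κ 1 :+ (b :- κ 1))) refl x y))

  1≼H : # 1 ≼ H
  1≼H = ≥1-⊗ (≥1-⊗ {# 64} (lin 0 (const 63) (solve 0 (κ 64 :- κ 1 := κ 63) refl)) 1≼m²) (≥1-⊗ 1≼k̂ 1≼k̂)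

  -- From `n₀` on Selberg's formula is effective; `x₁` is the short scale, tied to `X` by `U≡`. The
  -- absence of primes in the class `l` enters only as `Rl≼4`: prime powers alone weigh at most 4.
  record Scales : Set where
    constructor scales
    field
      n₀    : ℕ
      1≤n₀  : 1 ≤ n₀
      big   : # 2 ⊗ K ⊗ H ≼ L n₀
      X     : ℕ
      n₀≤X  : n₀ ≤ X
      2X≤B  : 2 * X ≤ B
      range : H ⊗ (m ⊗ (L n₀ ⊕ # 12)) ≼ L X
      Ubig  : # 3 ⊗ K ⊗ H ≼ L X
      x₁    : ℕ
      1≤x₁  : 1 ≤ x₁
      x₁≤X  : x₁ ≤ X
      U≡    : L X ≡ k̂ ⊗ L x₁
      L₁big : # 32 ⊗ (m ⊗ m ⊗ m ⊗ k̂) ≼ L x₁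
      l     : ℕ
      cl    : Coprime l M
      Rl≼4  : R l X ≼ # 4

  module Heavy (sc : Scales) where
    open Scales sc

    open Upper H 1≼H n₀ 1≤n₀ big
    open Main X n₀≤X 2X≤B range Ubig public

    L₁ : F
    L₁ = L x₁

    x₁≤B : x₁ ≤ B
    x₁≤B = ℕP.≤-trans x₁≤X X≤B

    private
      m³ : F
      m³ = m ⊗ m ⊗ m
      1≼m³ : # 1 ≼ m³
      1≼m³ = ≥1-⊗ 1≼m² 1≼m

      L₁≥ : # 2304 ⊗ (m ⊗ m ⊗ (m ⊗ m ⊗ m)) ≼ L₁
      L₁≥ = (lin 0 (1 · L₁big) (solve 2 (λ a b → b :- κ 2304 :* (a :* a :* (a :* a :* a)) := b :- κ 32 :* (a :* a :* a :* (κ 72 :* (a :* a)))) refl m L₁))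
      L₁≥m³ : # 2304 ⊗ m³ ≼ L₁
      L₁≥m³ = (lin 0 (1 · L₁≥ ⊞ 2304 · (nn-⊗ (sub-nn 1≼m²) (≼-trans 0≼1 1≼m³))) (solve 3 (λ a b c → b :- κ 2304 :* a := b :- κ 2304 :* (c :* c :* a) :+ κ 2304 :* ((c :* c :- κ 1) :* a :- κ 0)) refl m³ L₁ m))
      L₁≥m² : # 2304 ⊗ (m ⊗ m) ≼ L₁
      L₁≥m² = (lin 0 (1 · L₁≥m³ ⊞ 2304 · (nn-⊗ (sub-nn 1≼m) (≼-trans 0≼1 1≼m²))) (solve 2 (λ a b → b :- κ 2304 :* (a :* a) := b :- κ 2304 :* (a :* a :* a) :+ κ 2304 :* ((a :- κ 1) :* (a :* a) :- κ 0)) refl m L₁))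
      L₁≥m : # 2304 ⊗ m ≼ L₁
      L₁≥m = (lin 0 (1 · L₁≥m² ⊞ 2304 · (nn-⊗ (sub-nn 1≼m) m-nn)) (solve 2 (λ a b → b :- κ 2304 :* a := b :- κ 2304 :* (a :* a) :+ κ 2304 :* ((a :- κ 1) :* a :- κ 0)) refl m L₁))
      L₁≥2304 : # 2304 ≼ L₁
      L₁≥2304 = (lin 0 (1 · L₁≥m ⊞ 2304 · 1≼m) (solve 2 (λ a b → a :- κ 2304 := a :- κ 2304 :* b :+ κ 2304 :* (b :- κ 1)) refl L₁ m))

    L₁-nn : # 0 ≼ L₁
    L₁-nn = ≼-trans (0≼# 2304) L₁≥2304

    private
      -- 64 m² (εU²) = L₁² and 64 m² k̂ (εU) = L₁
      εU² : # 64 ⊗ (m ⊗ m) ⊗ (ε ⊗ (U ⊗ U)) ≡ L₁ ⊗ L₁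
      εU² = trans (cong (λ t → # 64 ⊗ (m ⊗ m) ⊗ (ε ⊗ (t ⊗ t))) U≡) (trans (solve 4 (λ a b c d → κ 64 :* (a :* a) :* (b :* (c :* d :* (c :* d))) := κ 64 :* (a :* a) :* (c :* c) :* b :* (d :* d)) refl m ε k̂ L₁) (trans (cong (_⊗ (L₁ ⊗ L₁)) Hε) (solve 1 (λ a → κ 1 :* (a :* a) := a :* a) refl L₁)))
      εU : # 64 ⊗ (m ⊗ m) ⊗ k̂ ⊗ (ε ⊗ U) ≡ L₁
      εU = trans (cong (λ t → # 64 ⊗ (m ⊗ m) ⊗ k̂ ⊗ (ε ⊗ t)) U≡) (trans (solve 4 (λ a b c d → κ 64 :* (a :* a) :* b :* (c :* (b :* d)) := κ 64 :* (a :* a) :* (b :* b) :* c :* d) refl m k̂ ε L₁) (trans (cong (_⊗ L₁) Hε) (solve 1 (λ a → κ 1 :* a := a) refl L₁)))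
      εU-nn : # 0 ≼ ε ⊗ U
      εU-nn = nn-⊗ ε-nn U-nn
      6mεU : # 6 ⊗ (m ⊗ (ε ⊗ U)) ≼ L₁
      6mεU = (lin 0 (1 · (≡≼ εU) ⊞ 64 · (nn-⊗ (nn-⊗ (nn-⊗ m-nn (sub-nn 1≼m)) εU-nn) (≼-trans 0≼1 1≼k̂)) ⊞ 64 · (nn-⊗ (nn-⊗ m-nn εU-nn) (sub-nn 1≼k̂)) ⊞ 58 · (nn-⊗ m-nn εU-nn)) (solve 5 (λ a b c d e → d :- κ 6 :* (a :* (b :* c)) := d :- κ 64 :* (a :* a) :* e :* (b :* c) :+ (κ 64 :* (a :* (a :- κ 1) :* (b :* c) :* e :- κ 0) :+ (κ 64 :* (a :* (b :* c) :* (e :- κ 1) :- κ 0) :+ κ 58 :* (a :* (b :* c) :- κ 0)))) refl m ε U L₁ k̂))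

    -- Within `4 L₁` of the maximum, about `2 U`, that `R≼3ε` allows.
    heavy : ℕ → Set
    heavy b = # 2 ⊗ U ⊖ # 4 ⊗ L₁ ≼ N ⊗ R b X

    heavy? : ∀ b → Dec (heavy b)
    heavy? b = _ ≼? _

    ¬heavy : ∀ {b} → ¬ heavy b → N ⊗ R b X ≼ # 2 ⊗ U ⊖ # 4 ⊗ L₁
    ¬heavy {b} nh with ≼-total (# 2 ⊗ U ⊖ # 4 ⊗ L₁) (N ⊗ R b X)
    ... | inj₁ h = ⊥-elim (nh h)
    ... | inj₂ h = h

    heavy-cong : ∀ {a b} → a ≈ b → heavy a → heavy b
    heavy-cong e h = ≼-trans h (≡≼ (cong (N ⊗_) (R-cong X e)))

    private
      -- The threshold on the short scale is low enough that half of the units must reach it, and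
      -- high enough for `sieve` to see a single such class.
      early : ℕ → Set
      early a = L₁ ≼ # 4 ⊗ (m ⊗ m) ⊗ R a x₁
      early? : ∀ a → Dec (early a)
      early? a = _ ≼? _
      ¬early : ∀ {a} → ¬ early a → # 4 ⊗ (m ⊗ m) ⊗ R a x₁ ≼ L₁
      ¬early {a} nh with ≼-total L₁ (# 4 ⊗ (m ⊗ m) ⊗ R a x₁)
      ... | inj₁ h = ⊥-elim (nh h)
      ... | inj₂ h = h

      -- `sieve` with `g = l` and `y = x₁`. If `l ⊘ a` were not heavy, the left side would be at
      -- least `2 L₁ R a x₁`, at least `L₁ L₁ / (2 m m)`. On the right, `4 N U` is linear in `L₁`,
      -- hence small by `L₁big`, and `4 ε U U` is `L₁ L₁ / (16 m m)`.
      early⇒heavy : ∀ {a} → Coprime a M → early a → heavy (l ⊘ a)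
      early⇒heavy {a} ca ea with heavy? (l ⊘ a)
      ... | yes h = h
      ... | no nh = ⊥-elim (1⋠0 (lin 4 (1 · final ⊞ 2 · (⊗-monoˡ L₁-nn L₁big) ⊞ 5 · (≥1-⊗ 1≼L₁ 1≼L₁)) (solve 3 (λ a b c → κ 5 :* (κ 0 :- κ 1) := κ 64 :* (b :* b :* b :* c :* a) :+ a :* a :- κ 8 :* (a :* a) :+ (κ 2 :* (a :* a :- κ 32 :* (b :* b :* b :* c) :* a) :+ κ 5 :* (a :* a :- κ 1))) refl L₁ m k̂)))
        where
        1≼L₁ : # 1 ≼ L₁
        1≼L₁ = ≼-trans (#-mono (s≤s z≤n)) L₁≥2304
        ra = R a x₁
        ra-nn : # 0 ≼ ra
        ra-nn = R-nn a x₁ x₁≤B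
        two : # 2 ⊗ L₁ ⊗ ra ≼ # 4 ⊗ (N ⊗ U) ⊕ # 4 ⊗ (ε ⊗ (U ⊗ U))
        two = (lin 0 (1 · (sieve cl ca x₁≤X) ⊞ 2 · (Q≼L⊗R a x₁ 1≤x₁ x₁≤B) ⊞ 1 · (⊗-monoˡ ra-nn (¬heavy nh)) ⊞ 1 · (⊗-monoʳ (nn-⊗ N-nn U-nn) Rl≼4)) (solve 8 (λ a b c d e f g h → κ 4 :* (c :* d) :+ κ 4 :* (e :* (d :* d)) :- κ 2 :* a :* b := d :* (c :* h) :+ κ 4 :* e :* (d :* d) :- ((κ 2 :* d :- c :* f) :* b :- κ 2 :* g) :+ (κ 2 :* (a :* b :- g) :+ ((κ 2 :* d :- κ 4 :* a) :* b :- c :* f :* b :+ (c :* d :* κ 4 :- c :* d :* h)))) refl L₁ ra N U ε (R (l ⊘ a) X) (Q a x₁) (R l X)))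
        NU : m ⊗ m ⊗ (N ⊗ U) ≼ m ⊗ m ⊗ m ⊗ k̂ ⊗ L₁
        NU = ≼-trans (⊗-monoʳ (nn-⊗ m-nn m-nn) (⊗-monoˡ U-nn N≼M)) (≡≼ (trans (cong (λ t → m ⊗ m ⊗ (m ⊗ t)) U≡) (solve 3 (λ a b c → a :* a :* (a :* (b :* c)) := a :* a :* a :* b :* c) refl m k̂ L₁)))
        final : # 8 ⊗ (L₁ ⊗ L₁) ≼ # 64 ⊗ (m ⊗ m ⊗ m ⊗ k̂ ⊗ L₁) ⊕ L₁ ⊗ L₁
        final = (lin 0 (16 · (⊗-monoʳ (nn-⊗ m-nn m-nn) two) ⊞ 8 · (⊗-monoʳ L₁-nn ea) ⊞ 64 · NU ⊞ 1 · (≡≼ εU²)) (solve 7 (λ a b c d e f g → κ 64 :* (b :* b :* b :* c :* a) :+ a :* a :- κ 8 :* (a :* a) := κ 16 :* (b :* b :* (κ 4 :* (e :* f) :+ κ 4 :* (g :* (f :* f))) :- b :* b :* (κ 2 :* a :* d)) :+ (κ 8 :* (a :* (κ 4 :* (b :* b) :* d) :- a :* a) :+ (κ 64 :* (b :* b :* b :* c :* a :- b :* b :* (e :* f)) :+ (a :* a :- κ 64 :* (b :* b) :* (g :* (f :* f)))))) refl L₁ m k̂ ra N U ε))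

      αₑ : F
      αₑ = ∑ M (λ b → u b ⊗ 𝟙 (early? b))

      NN : ∃ λ c → N ≡ # c
      NN = indicator-sum (λ b → coprime? b M) M

      twice : ∀ {x} → (∃ λ c → x ≡ # c) → ∃ λ c → # 2 ⊗ x ≡ # c
      twice (c , e) = 2 * c , trans (cong (# 2 ⊗_) e) (sym (#-* 2 c))

      z : F
      z = # 4 ⊗ (m ⊗ m) ⊗ (# 2 ⊗ L₁ ⊕ # 3 ⊗ ε ⊗ U)

      early-mass : # 4 ⊗ (m ⊗ m) ⊗ (N ⊗ Wᵤ x₁) ≼ αₑ ⊗ z ⊕ N ⊗ (N ⊗ L₁)
      early-mass = ≼-trans (≡≼ (trans (solve 3 (λ a b c → κ 4 :* (a :* a) :* (b :* c) := κ 4 :* (a :* a) :* b :* c) refl m N (Wᵤ x₁)) (trans (cong (# 4 ⊗ (m ⊗ m) ⊗ N ⊗_) (sym (∑-units-R x₁))) (sym (∑-⊗ M (# 4 ⊗ (m ⊗ m) ⊗ N) _)))))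
        (≼-trans (∑-mono M (λ b _ _ → ≼-trans (≡≼ (solve 4 (λ a b c d → κ 4 :* (a :* a) :* b :* (c :* d) := c :* (κ 4 :* (a :* a) :* (b :* d))) refl m N (u b) (R b x₁))) (≼-trans (𝟙-⊗-mono (coprime? b M) (λ cb → pt cb (early? b))) (≡≼ (solve 5 (λ a b c d e → a :* (b :* c :+ d :* e) := a :* b :* c :+ a :* (d :* e)) refl (u b) (𝟙 (early? b)) z N L₁)))))
        (≡≼ (trans (∑-⊕ M _ _) (cong₂ _⊕_ (∑-⊗ʳ M z _) (∑-⊗ʳ M (N ⊗ L₁) u)))))
        where
        pt : ∀ {b} → Coprime b M → (e : Dec (early b)) → # 4 ⊗ (m ⊗ m) ⊗ (N ⊗ R b x₁) ≼ 𝟙 e ⊗ z ⊕ N ⊗ L₁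
        pt {b} cb (yes _) = (lin 0 (1 · (⊗-monoʳ (nn-⊗ (0≼# 4) (nn-⊗ m-nn m-nn)) (R≼3ε cb x₁ 1≤x₁ x₁≤X)) ⊞ 1 · (nn-⊗ N-nn L₁-nn)) (solve 6 (λ a b c d e f → κ 1 :* (κ 4 :* (a :* a) :* (κ 2 :* d :+ κ 3 :* e :* f)) :+ b :* d :- κ 4 :* (a :* a) :* (b :* c) := κ 4 :* (a :* a) :* (κ 2 :* d :+ κ 3 :* e :* f) :- κ 4 :* (a :* a) :* (b :* c) :+ (b :* d :- κ 0)) refl m N (R b x₁) L₁ ε U))
        pt {b} cb (no ne) = (lin 0 (1 · (⊗-monoʳ N-nn (¬early ne))) (solve 5 (λ a b c d e → κ 0 :* d :+ b :* e :- κ 4 :* (a :* a) :* (b :* c) := b :* e :- b :* (κ 4 :* (a :* a) :* c)) refl m N (R b x₁) z L₁))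

      -- If fewer than half of the units were early, these would carry at most `(N - 1) L₁ / N` up
      -- to errors, as no class exceeds about `2 L₁ / N`. The missing `L₁ / N` is more than the
      -- other classes carry together, which is at most `N L₁ / (4 m m)`.
      early-half : N ≼ # 2 ⊗ αₑ
      early-half with count-dichotomy NN (twice (units-count early?))
      ... | inj₁ h = h
      ... | inj₂ h = ⊥-elim (1⋠0 (lin 1 (1 · s₃ ⊞ 2 · (nn-⊗ (≼-trans 0≼1 1≼m²) (sub-nn e₃)) ⊞ 2 · 1≼m²) (solve 2 (λ a b → κ 2 :* (κ 0 :- κ 1) := κ 16 :* (a :* a :* (a :* a)) :- κ 2 :* (a :* a :* b) :+ (κ 2 :* (a :* a :* (b :- (κ 8 :* (a :* a) :+ κ 1)) :- κ 0) :+ κ 2 :* (a :* a :- κ 1))) refl m L₁)))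
        where
        e₃ : # 8 ⊗ (m ⊗ m) ⊕ # 1 ≼ L₁
        e₃ = (lin 0 (1 · L₁≥m² ⊞ 2296 · 1≼m² ⊞ const 2295) (solve 2 (λ a b → b :- (κ 8 :* (a :* a) :+ κ 1) := b :- κ 2304 :* (a :* a) :+ (κ 2296 :* (a :* a :- κ 1) :+ κ 2295)) refl m L₁))
        z-nn : # 0 ≼ z
        z-nn = nn-⊗ (nn-⊗ (0≼# 4) (nn-⊗ m-nn m-nn)) (lin 0 (2 · L₁-nn ⊞ 3 · εU-nn) (solve 3 (λ a b c → κ 2 :* a :+ κ 3 :* b :* c :- κ 0 := κ 2 :* (a :- κ 0) :+ κ 3 :* (b :* c :- κ 0)) refl L₁ ε U))
        s₁ : # 8 ⊗ (m ⊗ m) ⊗ N ⊗ (L₁ ⊖ # 4 ⊗ m) ≼ (N ⊖ # 1) ⊗ z ⊕ # 2 ⊗ (N ⊗ (N ⊗ L₁))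
        s₁ = (lin 0 (2 · early-mass ⊞ 8 · (⊗-monoʳ (nn-⊗ (nn-⊗ m-nn m-nn) N-nn) (Wᵤ-lo x₁ 1≤x₁ x₁≤B)) ⊞ 1 · (⊗-monoˡ z-nn h)) (solve 6 (λ a b c d e f → (b :- κ 1) :* d :+ κ 2 :* (b :* (b :* c)) :- κ 8 :* (a :* a) :* b :* (c :- κ 4 :* a) := κ 2 :* (f :* d :+ b :* (b :* c) :- κ 4 :* (a :* a) :* (b :* e)) :+ (κ 8 :* (a :* a :* b :* (e :+ κ 4 :* a) :- a :* a :* b :* c) :+ (b :* d :- (κ 2 :* f :+ κ 1) :* d))) refl m N L₁ z (Wᵤ x₁) αₑ))
        NNL : N ⊗ (N ⊗ L₁) ≼ m ⊗ (m ⊗ L₁)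
        NNL = ⊗-mono N-nn (nn-⊗ N-nn L₁-nn) N≼M (⊗-monoˡ L₁-nn N≼M)
        -- all terms of s₁ expanded, with N replaced by m where it only helps
        s₂ : # 6 ⊗ (m ⊗ m ⊗ L₁) ≼ # 32 ⊗ (m ⊗ m ⊗ (m ⊗ m)) ⊕ # 12 ⊗ (m ⊗ m ⊗ (m ⊗ (ε ⊗ U)))
        s₂ = (lin 0 (1 · s₁ ⊞ 2 · NNL ⊞ 32 · (⊗-monoʳ (≼-trans 0≼1 1≼m³) N≼M) ⊞ 12 · (⊗-monoʳ (nn-⊗ (nn-⊗ m-nn m-nn) εU-nn) N≼M) ⊞ 12 · (nn-⊗ (nn-⊗ m-nn m-nn) εU-nn)) (solve 5 (λ a b c d e → κ 32 :* (a :* a :* (a :* a)) :+ κ 12 :* (a :* a :* (a :* (c :* d))) :- κ 6 :* (a :* a :* b) := (e :- κ 1) :* (κ 4 :* (a :* a) :* (κ 2 :* b :+ κ 3 :* c :* d)) :+ κ 2 :* (e :* (e :* b)) :- κ 8 :* (a :* a) :* e :* (b :- κ 4 :* a) :+ (κ 2 :* (a :* (a :* b) :- e :* (e :* b)) :+ (κ 32 :* (a :* a :* a :* a :- a :* a :* a :* e) :+ (κ 12 :* (a :* a :* (c :* d) :* a :- a :* a :* (c :* d) :* e) :+ κ 12 :* (a :* a :* (c :* d) :- κ 0))))) refl m L₁ ε U N))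
        s₃ : # 2 ⊗ (m ⊗ m ⊗ L₁) ≼ # 16 ⊗ (m ⊗ m ⊗ (m ⊗ m))
        s₃ = (lin 1 (1 · s₂ ⊞ 2 · (⊗-monoʳ (nn-⊗ m-nn m-nn) 6mεU)) (solve 4 (λ a b c d → κ 2 :* (κ 16 :* (a :* a :* (a :* a)) :- κ 2 :* (a :* a :* b)) := κ 32 :* (a :* a :* (a :* a)) :+ κ 12 :* (a :* a :* (a :* (c :* d))) :- κ 6 :* (a :* a :* b) :+ κ 2 :* (a :* a :* b :- a :* a :* (κ 6 :* (a :* (c :* d))))) refl m L₁ ε U))

    αₕ : F
    αₕ = ∑ M (λ b → u b ⊗ 𝟙 (heavy? b))

    light : F
    light = ∑ M (λ b → u b ⊗ ((# 1 ⊖ 𝟙 (heavy? b)) ⊗ R b X))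

    private
      heavy-half : N ≼ # 2 ⊗ αₕ
      heavy-half = (lin 0 (1 · early-half ⊞ 2 · (≼-trans (∑-mono M (λ b _ _ → 𝟙-⊗-mono (coprime? b M) (λ cb → 𝟙-⇒ (early? b) (heavy? (l ⊘ b)) (early⇒heavy cb))))
          (≡≼ (∑-units-⊘ (λ b → 𝟙 (heavy? b)) cl (λ {a} {b} e → 𝟙-cong (heavy? a) (heavy? b) (heavy-cong e) (heavy-cong (sym e))))))) (solve 3 (λ a b c → κ 2 :* b :- a := κ 2 :* c :- a :+ κ 2 :* (b :- c)) refl N αₕ αₑ))

      term-nn : ∀ b → # 0 ≼ u b ⊗ ((# 1 ⊖ 𝟙 (heavy? b)) ⊗ R b X)
      term-nn b = nn-⊗ (u-nn b) (nn-⊗ (sub-nn (𝟙≼1 (heavy? b))) (R-nn b X X≤B))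

      light-nn : # 0 ≼ light
      light-nn = ∑-nn M (λ b _ _ → term-nn b)

      total : αₕ ⊗ (# 2 ⊗ U ⊖ # 4 ⊗ L₁) ⊕ N ⊗ light ≼ N ⊗ (U ⊕ # 12)
      total = ≼-trans (≡≼ (sym (trans (∑-⊕ M _ _) (cong₂ _⊕_ (∑-⊗ʳ M (# 2 ⊗ U ⊖ # 4 ⊗ L₁) _) (∑-⊗ M N _)))))
        (≼-trans (∑-mono M (λ b _ _ → pt b (heavy? b))) (≼-trans (≡≼ (trans (∑-⊗ M N _) (cong (N ⊗_) (∑-units-R X)))) (⊗-monoʳ N-nn (Wᵤ-up X 1≤X X≤B))))
        where
        pt : ∀ b → (h : Dec (heavy b)) → u b ⊗ 𝟙 h ⊗ (# 2 ⊗ U ⊖ # 4 ⊗ L₁) ⊕ N ⊗ (u b ⊗ ((# 1 ⊖ 𝟙 h) ⊗ R b X)) ≼ N ⊗ (u b ⊗ R b X)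
        pt b (yes h) = (lin 0 (1 · (⊗-monoʳ (u-nn b) h)) (solve 5 (λ a b c d e → d :* (a :* e) :- (a :* κ 1 :* (κ 2 :* b :- κ 4 :* c) :+ d :* (a :* ((κ 1 :- κ 1) :* e))) := a :* (d :* e) :- a :* (κ 2 :* b :- κ 4 :* c)) refl (u b) U L₁ N (R b X)))
        pt b (no _) = (lin 0 (const 0) (solve 5 (λ a b c d e → d :* (a :* e) :- (a :* κ 0 :* (κ 2 :* b :- κ 4 :* c) :+ d :* (a :* ((κ 1 :- κ 0) :* e))) := κ 0) refl (u b) U L₁ N (R b X)))

      72m² : # 72 ⊗ (m ⊗ m) ⊗ L₁ ≡ U
      72m² = sym U≡

      gap-nn : # 0 ≼ # 2 ⊗ U ⊖ # 4 ⊗ L₁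
      gap-nn = (lin 0 (2 · (≡≼ 72m²) ⊞ 144 · (nn-⊗ (sub-nn 1≼m²) L₁-nn) ⊞ 140 · L₁-nn) (solve 3 (λ a b c → κ 2 :* a :- κ 4 :* b :- κ 0 := κ 2 :* (a :- κ 72 :* (c :* c) :* b) :+ (κ 144 :* ((c :* c :- κ 1) :* b :- κ 0) :+ κ 140 :* (b :- κ 0))) refl U L₁ m))

    -- Half of the units at almost `2 U / N` each already exhaust the total mass `U + 12`; what
    -- remains for the other classes is of order `L₁`.
    light≼ : light ≼ # 3 ⊗ L₁
    light≼ = cancel 1≼N (lin 1 (2 · total ⊞ 1 · (⊗-monoˡ gap-nn heavy-half) ⊞ 2 · (⊗-monoʳ N-nn L₁≥2304) ⊞ 4584 · N-nn) (solve 5 (λ a b c d e → κ 2 :* (a :* (κ 3 :* c) :- a :* b) := κ 2 :* (a :* (e :+ κ 12) :- (d :* (κ 2 :* e :- κ 4 :* c) :+ a :* b)) :+ (κ 2 :* d :* (κ 2 :* e :- κ 4 :* c) :- a :* (κ 2 :* e :- κ 4 :* c) :+ (κ 2 :* (a :* c :- a :* κ 2304) :+ κ 4584 :* (a :- κ 0)))) refl N light L₁ αₕ U))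

    -- If more than half of the units were heavy, the total would exceed `U` by about `U / N`, while
    -- the errors are of order `L₁` and `U = 72 m m L₁`.
    half : # 2 ⊗ αₕ ≡ N
    half with count-dichotomy (twice (units-count heavy?)) NN
    ... | inj₁ h = ≼-antisym h heavy-half
    ... | inj₂ h = ⊥-elim (1⋠0 (lin 30078719 (96 · (⊗-monoˡ gap-nn h) ⊞ 192 · total ⊞ 192 · (nn-⊗ N-nn light-nn) ⊞ 192 · (≡≼ 72m²) ⊞ 13824 · (nn-⊗ (nn-⊗ m-nn (sub-nn 1≼m)) L₁-nn) ⊞ 13440 · (nn-⊗ (sub-nn 1≼m) L₁-nn) ⊞ 384 · (⊗-monoˡ L₁-nn N≼M) ⊞ 2304 · N≼M ⊞ 1 · L₁≥m ⊞ 13055 · L₁≥2304) (solve 6 (λ a b c d e f → κ 30078720 :* (κ 0 :- κ 1) := κ 96 :* (κ 2 :* d :* (κ 2 :* b :- κ 4 :* c) :- (a :+ κ 1) :* (κ 2 :* b :- κ 4 :* c)) :+ (κ 192 :* (a :* (b :+ κ 12) :- (d :* (κ 2 :* b :- κ 4 :* c) :+ a :* e)) :+ (κ 192 :* (a :* e :- κ 0) :+ (κ 192 :* (b :- κ 72 :* (f :* f) :* c) :+ (κ 13824 :* (f :* (f :- κ 1) :* c :- κ 0) :+ (κ 13440 :* ((f :- κ 1) :* c :- κ 0) :+ (κ 384 :* (f :* c :- a :* c) :+ (κ 2304 :* (f :- a) :+ (c :- κ 2304 :* f :+ κ 13055 :* (c :- κ 2304)))))))))) refl N U L₁ αₕ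 light m)))

    ¬heavy⇒light : ∀ {b} → Coprime b M → ¬ heavy b → R b X ≼ # 3 ⊗ L₁
    ¬heavy⇒light {b} cb nh = ≼-trans (≡≼ e) (≼-trans (∑-term (rep-≥1 b) (rep-≤M b) (λ i _ _ → term-nn i)) light≼)
      where
      r = rep b
      e : R b X ≡ u r ⊗ ((# 1 ⊖ 𝟙 (heavy? r)) ⊗ R r X)
      e = trans (R-cong X (sym (rep-≈ b))) (trans (solve 1 (λ a → a := κ 1 :* ((κ 1 :- κ 0) :* a)) refl (R r X)) (sym (cong₂ (λ s t → s ⊗ ((# 1 ⊖ t) ⊗ R r X)) (𝟙-yes (coprime? r M) (coprime-≈ (sym (rep-≈ b)) cb)) (𝟙-no (heavy? r) (λ h → nh (heavy-cong (rep-≈ b) h))))))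

    -- `sieve` over the full range, multiplied by `N`. If neither `g` nor `g ⊘ b` were heavy, both
    -- would have mass of order `L₁`; the left side would be about `2 U N R b X - 2 N Q b X`, where
    -- `N R` is about `2 U` and `N Q` at most about `U U`. This leaves `2 U U` on the left and only
    -- smaller terms on the right.
    closed : ∀ {g b} → Coprime g M → Coprime b M → ¬ heavy g → heavy b → heavy (g ⊘ b)
    closed {g} {b} cg cb ng hb with heavy? (g ⊘ b)
    ... | yes h = h
    ... | no nh = ⊥-elim (1⋠0 (lin 156 (144 · s₄ ⊞ 34 · (≡≼ (cong (_⊗ U) 72m²)) ⊞ 1 · KU ⊞ 96 · εm ⊞ 157 · (≥1-⊗ 1≼U 1≼U)) (solve 5 (λ a b c d e → κ 157 :* (κ 0 :- κ 1) := κ 144 :* (κ 17 :* (b :* b :* c :* a) :+ κ 4 :* (d :* a) :+ κ 4 :* (b :* (e :* (a :* a))) :- κ 2 :* (a :* a)) :+ (κ 34 :* (a :* a :- κ 72 :* (b :* b) :* c :* a) :+ (a :* a :- κ 576 :* (d :* a) :+ (κ 96 :* (a :* a :- κ 6 :* (b :* (e :* (a :* a)))) :+ κ 157 :* (a :* a :- κ 1))))) refl U m L₁ K ε)))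
      where
      T = N ⊗ R (g ⊘ b) X
      rb = R b X
      rb-nn : # 0 ≼ N ⊗ rb
      rb-nn = nn-⊗ N-nn (R-nn b X X≤B)
      T≼ : T ≼ # 3 ⊗ (m ⊗ L₁)
      T≼ = ≼-trans (⊗-mono N-nn (R-nn (g ⊘ b) X X≤B) N≼M (¬heavy⇒light (⊘-coprime cg cb) nh)) (≡≼ (solve 2 (λ a b → a :* (κ 3 :* b) := κ 3 :* (a :* b)) refl m L₁))
      Rg≼ : N ⊗ (N ⊗ R g X) ≼ # 3 ⊗ (m ⊗ m ⊗ L₁)
      Rg≼ = ≼-trans (⊗-mono N-nn (nn-⊗ N-nn (R-nn g X X≤B)) N≼M (⊗-mono N-nn (R-nn g X X≤B) N≼M (¬heavy⇒light cg ng))) (≡≼ (solve 2 (λ a b → a :* (a :* (κ 3 :* b)) := κ 3 :* (a :* a :* b)) refl m L₁))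
      1≼U : # 1 ≼ U
      1≼U = (lin 0 (1 · (≡≼ 72m²) ⊞ 72 · (nn-⊗ (sub-nn 1≼m²) L₁-nn) ⊞ 72 · L₁≥2304 ⊞ const 165887) (solve 3 (λ a b c → a :- κ 1 := a :- κ 72 :* (b :* b) :* c :+ (κ 72 :* ((b :* b :- κ 1) :* c :- κ 0) :+ (κ 72 :* (c :- κ 2304) :+ κ 165887))) refl U m L₁))
      L₁U-nn : # 0 ≼ L₁ ⊗ U
      L₁U-nn = nn-⊗ L₁-nn U-nn
      Ut : # 0 ≼ # 2 ⊗ U ⊖ # 3 ⊗ (m ⊗ L₁)
      Ut = (lin 0 (2 · (≡≼ 72m²) ⊞ 144 · (nn-⊗ (nn-⊗ m-nn (sub-nn 1≼m)) L₁-nn) ⊞ 141 · (nn-⊗ m-nn L₁-nn)) (solve 3 (λ a b c → κ 2 :* a :- κ 3 :* (b :* c) :- κ 0 := κ 2 :* (a :- κ 72 :* (b :* b) :* c) :+ (κ 144 :* (b :* (b :- κ 1) :* c :- κ 0) :+ κ 141 :* (b :* c :- κ 0))) refl U m L₁))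
      prod : (# 2 ⊗ U ⊖ # 3 ⊗ (m ⊗ L₁)) ⊗ (# 2 ⊗ U ⊖ # 4 ⊗ L₁) ≼ (# 2 ⊗ U ⊖ T) ⊗ (N ⊗ rb)
      prod = ≼-trans (⊗-monoʳ Ut hb) (⊗-monoˡ rb-nn (lin 0 (1 · T≼) (solve 4 (λ a b c d → κ 2 :* a :- d :- (κ 2 :* a :- κ 3 :* (b :* c)) := κ 3 :* (b :* c) :- d) refl U m L₁ T)))
      s₄ : # 2 ⊗ (U ⊗ U) ≼ # 17 ⊗ (m ⊗ m ⊗ L₁ ⊗ U) ⊕ # 4 ⊗ (K ⊗ U) ⊕ # 4 ⊗ (m ⊗ (ε ⊗ (U ⊗ U)))
      s₄ = (lin 0 (1 · (⊗-monoʳ N-nn (sieve cg cb ℕP.≤-refl)) ⊞ 1 · prod ⊞ 2 · (NQ≼ cb X 1≤X 2X≤B) ⊞ 1 · (⊗-monoʳ U-nn Rg≼) ⊞ 4 · (⊗-monoˡ (nn-⊗ ε-nn (nn-⊗ U-nn U-nn)) N≼M) ⊞ 2 · (⊗-monoʳ (≼-trans (0≼# 192) 192≼K) 1≼U) ⊞ 14 · (nn-⊗ (nn-⊗ m-nn (sub-nn 1≼m)) L₁U-nn) ⊞ 8 · (nn-⊗ (sub-nn 1≼m) L₁U-nn) ⊞ 12 · (nn-⊗ m-nn (nn-⊗ L₁-nn L₁-nn))) (solve 10 (λ a b c d e f g h i j → κ 17 :* (b :* b :* c :* a) :+ κ 4 :* (d :* a) :+ κ 4 :* (b :* (e :* (a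 :* a))) :- κ 2 :* (a :* a) := f :* (a :* (f :* j) :+ κ 4 :* e :* (a :* a)) :- f :* ((κ 2 :* a :- g) :* h :- κ 2 :* i) :+ ((κ 2 :* a :- g) :* (f :* h) :- (κ 2 :* a :- κ 3 :* (b :* c)) :* (κ 2 :* a :- κ 4 :* c) :+ (κ 2 :* (a :* a :+ d :* (a :+ κ 1) :- f :* i) :+ (a :* (κ 3 :* (b :* b :* c)) :- a :* (f :* (f :* j)) :+ (κ 4 :* (b :* (e :* (a :* a)) :- f :* (e :* (a :* a))) :+ (κ 2 :* (d :* a :- d :* κ 1) :+ (κ 14 :* (b :* (b :- κ 1) :* (c :* a) :- κ 0) :+ (κ 8 :* ((b :- κ 1) :* (c :* a) :- κ 0) :+ κ 12 :* (b :* (c :* c) :- κ 0))))))))) refl U m L₁ K ε N T rb (Q b X) (R g X)))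
      KU : # 576 ⊗ (K ⊗ U) ≼ U ⊗ U
      KU = (lin 0 (1 · (⊗-monoˡ U-nn 576K)) (solve 2 (λ a b → b :* b :- κ 576 :* (a :* b) := b :* b :- κ 576 :* a :* b) refl K U))
        where
        576K : # 576 ⊗ K ≼ U
        576K = (lin 0 (1 · Ubig ⊞ 3 · (⊗-monoʳ (≼-trans (0≼# 192) 192≼K) H≥)) (solve 3 (λ a b c → b :- κ 576 :* a := b :- κ 3 :* a :* c :+ κ 3 :* (a :* c :- a :* κ 192)) refl K U H))
          where
          H≥ : # 192 ≼ H
          H≥ = (lin 0 (331776 · (≥1-⊗ 1≼m² (≥1-⊗ 1≼m² 1≼m²)) ⊞ 1 · (≡≽ (refl {x = H})) ⊞ const 331584) (solve 2 (λ a b → a :- κ 192 := κ 331776 :* (b :* b :* (b :* b :* (b :* b)) :- κ 1) :+ (a :- κ 64 :* (b :* b) :* (κ 72 :* (b :* b) :* (κ 72 :* (b :* b))) :+ κ 331584)) refl H m))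
      εm : # 6 ⊗ (m ⊗ (ε ⊗ (U ⊗ U))) ≼ U ⊗ U
      εm = ≼-trans (≡≼ (solve 3 (λ a b c → κ 6 :* (a :* (b :* (c :* c))) := κ 6 :* (a :* (b :* c)) :* c) refl m ε U)) (⊗-monoˡ U-nn (≼-trans 6mεU (lin 0 (1 · (≡≼ 72m²) ⊞ 72 · (nn-⊗ (sub-nn 1≼m²) L₁-nn) ⊞ 71 · L₁-nn) (solve 3 (λ a b c → b :- a := b :- κ 72 :* (c :* c) :* a :+ (κ 72 :* ((c :* c :- κ 1) :* a :- κ 0) :+ κ 71 :* (a :- κ 0))) refl L₁ U m))))

-- From a distinguished half of the units to a quadratic character.

module Chr (M : ℕ) {{M≢0 : NonZero M}} where
  open Field
  open Sums
  open NumTh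
  open Cls M

  ∑-units-* : ∀ {g} (f : ℕ → F) → Coprime g M → (∀ {a b} → a ≈ b → f a ≡ f b) → ∑ M (λ b → u b ⊗ f (g * b)) ≡ ∑ M (λ b → u b ⊗ f b)
  ∑-units-* {g} f cg hf = begin
    ∑ M (λ b → u b ⊗ f (g * b))                            ≡⟨ ∑-ext M (λ b → trans (cong (u b ⊗_) (sym (∑-class (g * b) f hf))) (sym (∑-⊗ M (u b) _))) ⟩
    ∑ M (λ b → ∑ M (λ c → u b ⊗ (δ c (g * b) ⊗ f c)))      ≡⟨ ∑-swap M M _ ⟩
    ∑ M (λ c → ∑ M (λ b → u b ⊗ (δ c (g * b) ⊗ f c)))      ≡⟨ ∑-ext M (λ c → trans (∑-ext M (λ b → trans (solve 3 (λ a b c → a :* (b :* c) := a :* b :* c) refl (u b) (δ c (g * b)) (f c)) (trans (cong (_⊗ f c) (flip b c)) (solve 3 (λ a b c → a :* b :* c := a :* c :* b) refl (u c) (δ b (c ⊘ g)) (f c)))))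
                                                                (trans (∑-⊗ M (u c ⊗ f c) _) (trans (cong ((u c ⊗ f c) ⊗_) (∑-δ (c ⊘ g))) (solve 2 (λ a b → a :* b :* κ 1 := a :* b) refl (u c) (f c))))) ⟩
    ∑ M (λ c → u c ⊗ f c)                                  ∎
    where
    open ≡-Reasoning
    flip : ∀ b c → u b ⊗ δ c (g * b) ≡ u c ⊗ δ b (c ⊘ g)
    flip b c = trans (𝟙-× (coprime? b M) (c ≈? g * b)) (trans (𝟙-cong (coprime? b M ×-dec c ≈? g * b) (coprime? c M ×-dec b ≈? c ⊘ g)
       (λ (x , y) → coprime-≈ (sym y) (coprime-* cg x) , ⊘-solve {g} {b} {c} cg (sym y)) (λ (x , y) → coprime-≈ (sym y) (⊘-coprime x cg) , sym (⊘-cancel {g} {b} {c} cg y))) (sym (𝟙-× (coprime? c M) (b ≈? c ⊘ g))))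

  -- A set of exactly half of the unit classes that contains g b⁻¹ whenever it contains b but not g
  -- is the nontrivial coset of a subgroup of index 2.
  module Coset (S : ℕ → Set) (S? : ∀ b → Dec (S b)) (S-cong : ∀ {a b} → a ≈ b → S a → S b)
    (half : # 2 ⊗ ∑ M (λ b → u b ⊗ 𝟙 (S? b)) ≡ N)
    (closed : ∀ {g b} → Coprime g M → Coprime b M → ¬ S g → S b → S (g ⊘ b)) where

    private
      s : ℕ → F
      s b = 𝟙 (S? b)

      s-cong : ∀ {a b} → a ≈ b → s a ≡ s b
      s-cong {a} {b} e = 𝟙-cong (S? a) (S? b) (S-cong e) (S-cong (sym e))

      α : F
      α = ∑ M (λ b → u b ⊗ s b)

      u1 : ∀ {b} → Coprime b M → u b ≡ # 1
      u1 {b} c = 𝟙-yes (coprime? b M) c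

      ⊘-congʳ : ∀ g {a b} → Coprime a M → a ≈ b → g ⊘ a ≈ g ⊘ b
      ⊘-congʳ g c e = ≈-* {g} {g} refl (iv-cong c e)

      strip : ∀ {b x y} → Coprime b M → u b ⊗ x ≡ u b ⊗ y → x ≡ y
      strip {b} {x} {y} c e = trans (solve 1 (λ a → a := κ 1 :* a) refl x) (trans (cong (_⊗ x) (sym (u1 c))) (trans e (trans (cong (_⊗ y) (u1 c)) (solve 1 (λ a → κ 1 :* a := a) refl y))))

      rep-coprime : ∀ {b} → Coprime b M → Coprime (rep b) M
      rep-coprime {b} c = coprime-≈ (sym (rep-≈ b)) c

      -- `closed` gives the inequality of indicators for all `b` at once; b ↦ g / b permutes the
      -- units, so both sides have the same sum and agree termwise.
      reflect : ∀ {g b} → Coprime g M → Coprime b M → ¬ S g → s b ≡ s (g ⊘ b)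
      reflect {g} {b} cg cb ng = trans (s-cong (sym (rep-≈ b))) (trans (strip (rep-coprime cb) at-rep) (s-cong (⊘-congʳ g (rep-coprime cb) (rep-≈ b))))
        where
        at-rep : u (rep b) ⊗ s (rep b) ≡ u (rep b) ⊗ s (g ⊘ rep b)
        at-rep = ∑-equal M (λ i _ _ → 𝟙-⊗-mono (coprime? i M) (λ ci → 𝟙-⇒ (S? i) (S? (g ⊘ i)) (closed cg ci ng))) (sym (∑-units-⊘ s cg s-cong)) (rep b) (rep-≥1 b) (rep-≤M b)

      -- If 1 were in `S`, any unit `b` outside would satisfy `b ⊘ 1` in `S`, that is `b` itself; so
      -- `S` would contain all units instead of half of them.
      1∉S : ¬ S 1
      1∉S s1 = 1⋠0 (lin 0 (1 · (≡≼ half) ⊞ 2 · (≡≽ (∑-ext M (λ b → all b (coprime? b M)))) ⊞ 1 · 1≼N) (solve 2 (λ a b → κ 0 :- κ 1 := b :- κ 2 :* a :+ (κ 2 :* (a :- b) :+ (b :- κ 1))) refl α N))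
        where
        all : ∀ b → (d : Dec (Coprime b M)) → 𝟙 d ⊗ s b ≡ 𝟙 d
        all b (no _) = (solve 1 (λ a → κ 0 :* a := κ 0) refl (s b))
        all b (yes c) with S? b
        ... | yes _ = (solve 0 (κ 1 :* κ 1 := κ 1) refl)
        ... | no nb = ⊥-elim (nb (S-cong (sym (⊘-solve {1} {b} {b} coprime-1 (≈-reflexive (ℕP.*-identityˡ b)))) (closed c coprime-1 nb s1)))

      s-inv : ∀ {b} → Coprime b M → s b ≡ s (1 ⊘ b)
      s-inv cb = reflect coprime-1 cb 1∉S

      s-*∉ : ∀ {g b} → Coprime g M → Coprime b M → ¬ S g → s (g * b) ≡ s b
      s-*∉ {g} {b} cg cb ng = trans (s-cong (⊘-solve {1 ⊘ b} {g * b} {g} cb′ e)) (trans (sym (reflect cg cb′ ng)) (sym (s-inv cb)))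
        where
        cb′ = ⊘-coprime coprime-1 cb
        e : (1 ⊘ b) * (g * b) ≈ g
        e = trans (≈-reflexive (trans (ℕP.*-comm (1 ⊘ b) (g * b)) (ℕP.*-assoc g b (1 ⊘ b)))) (trans (≈-* {g} {g} refl (⊘-cancel {b} {1 ⊘ b} {1} cb refl)) (≈-reflexive (ℕP.*-identityʳ g)))

      -- Multiplication by `g` in `S` sends the complement of `S` into `S`, by `s-*∉` with the
      -- factors exchanged. Both sets have `N / 2` elements, so the inclusion is an equality.
      s-*∈ : ∀ {g b} → Coprime g M → Coprime b M → S g → s (g * b) ≡ # 1 ⊖ s b
      s-*∈ {g} {b} cg cb sg = sym (trans (cong (# 1 ⊖_) (s-cong (sym (rep-≈ b)))) (trans (strip (rep-coprime cb) at-rep) (s-cong (≈-* {g} {g} refl (rep-≈ b)))))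
        where
        sums : ∑ M (λ i → u i ⊗ (# 1 ⊖ s i)) ≡ ∑ M (λ i → u i ⊗ s (g * i))
        sums = trans (∑-ext M (λ i → (solve 2 (λ a b → a :* (κ 1 :- b) := a :- a :* b) refl (u i) (s i)))) (trans (∑-⊖ M _ _) (trans (≼-antisym (lin 0 (1 · (≡≽ half)) (solve 2 (λ a b → b :- (a :- b) := κ 2 :* b :- a) refl N α)) (lin 0 (1 · (≡≼ half)) (solve 2 (λ a b → a :- b :- b := a :- κ 2 :* b) refl N α))) (sym (∑-units-* s cg s-cong))))
        pt : ∀ i → Coprime i M → # 1 ⊖ s i ≼ s (g * i)
        pt i ci with S? i
        ... | yes _ = ≼-trans (≡≼ (solve 0 (κ 1 :- κ 1 := κ 0) refl)) (𝟙-nn (S? (g * i)))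
        ... | no ni = ≡≼ (trans (solve 0 (κ 1 :- κ 0 := κ 1) refl) (sym (trans (s-cong (≈-reflexive (ℕP.*-comm g i))) (trans (s-*∉ ci cg ni) (𝟙-yes (S? g) sg)))))
        at-rep : u (rep b) ⊗ (# 1 ⊖ s (rep b)) ≡ u (rep b) ⊗ s (g * rep b)
        at-rep = ∑-equal M (λ i _ _ → 𝟙-⊗-mono (coprime? i M) (pt i)) sums (rep b) (rep-≥1 b) (rep-≤M b)

    χ : ℕ → F
    χ n = u n ⊗ (# 1 ⊖ # 2 ⊗ s n)

    χ-cong : ∀ {a b} → a ≈ b → χ a ≡ χ b
    χ-cong e = cong₂ (λ x y → x ⊗ (# 1 ⊖ # 2 ⊗ y)) (u-cong e) (s-cong e)

    χ-* : ∀ a b → χ (a * b) ≡ χ a ⊗ χ b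
    χ-* a b = trans (cong (_⊗ (# 1 ⊖ # 2 ⊗ s (a * b))) (u-* a b)) (aux (coprime? a M) (coprime? b M))
      where
      aux : (c : Dec (Coprime a M)) (d : Dec (Coprime b M)) → 𝟙 c ⊗ 𝟙 d ⊗ (# 1 ⊖ # 2 ⊗ s (a * b)) ≡ 𝟙 c ⊗ (# 1 ⊖ # 2 ⊗ s a) ⊗ (𝟙 d ⊗ (# 1 ⊖ # 2 ⊗ s b))
      aux (no _) d = (solve 4 (λ a b c d → κ 0 :* a :* (κ 1 :- κ 2 :* b) := κ 0 :* (κ 1 :- κ 2 :* c) :* (a :* (κ 1 :- κ 2 :* d))) refl (𝟙 d) (s (a * b)) (s a) (s b))
      aux (yes _) (no _) = (solve 3 (λ a b c → κ 1 :* κ 0 :* (κ 1 :- κ 2 :* a) := κ 1 :* (κ 1 :- κ 2 :* b) :* (κ 0 :* (κ 1 :- κ 2 :* c))) refl (s (a * b)) (s a) (s b))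
      aux (yes ca) (yes cb) with S? a
      ... | yes sa = trans (cong (λ t → # 1 ⊗ # 1 ⊗ (# 1 ⊖ # 2 ⊗ t)) (s-*∈ ca cb sa)) (solve 1 (λ a → κ 1 :* κ 1 :* (κ 1 :- κ 2 :* (κ 1 :- a)) := κ 1 :* (κ 1 :- κ 2 :* κ 1) :* (κ 1 :* (κ 1 :- κ 2 :* a))) refl (s b))
      ... | no na = trans (cong (λ t → # 1 ⊗ # 1 ⊗ (# 1 ⊖ # 2 ⊗ t)) (s-*∉ ca cb na)) (solve 1 (λ a → κ 1 :* κ 1 :* (κ 1 :- κ 2 :* a) := κ 1 :* (κ 1 :- κ 2 :* κ 0) :* (κ 1 :* (κ 1 :- κ 2 :* a))) refl (s b))

    χ-1 : χ 1 ≡ # 1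
    χ-1 = trans (cong₂ (λ x y → x ⊗ (# 1 ⊖ # 2 ⊗ y)) (u1 coprime-1) (𝟙-no (S? 1) 1∉S)) (solve 0 (κ 1 :* (κ 1 :- κ 2 :* κ 0) := κ 1) refl)

    χ-values : ∀ n → (χ n ≡ # 0) ⊎ (χ n ≡ # 1) ⊎ (χ n ≡ ⊝ # 1)
    χ-values n with coprime? n M | S? n
    ... | no _  | d     = inj₁ (solve 1 (λ a → κ 0 :* (κ 1 :- κ 2 :* a) := κ 0) refl (𝟙 d))
    ... | yes _ | yes _ = inj₂ (inj₂ (solve 0 (κ 1 :* (κ 1 :- κ 2 :* κ 1) := :- κ 1) refl))
    ... | yes _ | no _  = inj₂ (inj₁ (solve 0 (κ 1 :* (κ 1 :- κ 2 :* κ 0) := κ 1) refl))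

    ∑-χ : ∑ M χ ≡ # 0
    ∑-χ = trans (∑-ext M (λ b → (solve 2 (λ a b → a :* (κ 1 :- κ 2 :* b) := a :- κ 2 :* (a :* b)) refl (u b) (s b)))) (trans (∑-⊖ M _ _) (trans (cong (N ⊖_) (trans (∑-⊗ M (# 2) _) half)) (solve 1 (λ a → a :- a := κ 0) refl N)))

-- Real characters and the divisor sum of χ.

module LOne where
  open Field
  open Sums
  open NumTh

  record Quadratic (χ : ℕ → F) : Set where
    field
      mult   : ∀ a b → χ (a * b) ≡ χ a ⊗ χ b
      unit   : χ 1 ≡ # 1
      values : ∀ n → (χ n ≡ # 0) ⊎ (χ n ≡ # 1) ⊎ (χ n ≡ ⊝ # 1)

    ≲1 : ∀ n → χ n ≲ # 1
    ≲1 n with values n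
    ... | inj₁ e        = ≲-subst (sym e) ((lin 0 (const 1) (solve 0 (κ 1 :- κ 0 := κ 1) refl)) , (lin 0 (const 1) (solve 0 (κ 0 :- :- κ 1 := κ 1) refl)))
    ... | inj₂ (inj₁ e) = ≲-subst (sym e) ((lin 0 (const 0) (solve 0 (κ 1 :- κ 1 := κ 0) refl)) , (lin 0 (const 2) (solve 0 (κ 1 :- :- κ 1 := κ 2) refl)))
    ... | inj₂ (inj₂ e) = ≲-subst (sym e) ((lin 0 (const 2) (solve 0 (κ 1 :- :- κ 1 := κ 2) refl)) , (lin 0 (const 0) (solve 0 (:- κ 1 :- :- κ 1 := κ 0) refl)))
  open Quadratic

  r : (ℕ → F) → ℕ → F
  r χ = ∑-divisors χ

  -- The character with the multiples of `p` removed, needed because the divisors of `p e` prime to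
  -- `p` are summed separately. Statements on `r` are therefore proved for all such characters at
  -- once.
  drop : ℕ → (ℕ → F) → ℕ → F
  drop p χ d = (# 1 ⊖ 𝟙 (p ∣? d)) ⊗ χ d

  drop-quadratic : ∀ {p χ} → Prime p → Quadratic χ → Quadratic (drop p χ)
  drop-quadratic {p} {χ} pr q = record { mult = mul ; unit = trans (cong₂ (λ s t → (# 1 ⊖ s) ⊗ t) (𝟙-no (p ∣? 1) (λ d → ℕP.<⇒≢ (prime≥2 pr) (sym (∣1⇒≡1 d)))) (unit q)) (solve 0 ((κ 1 :- κ 0) :* κ 1 := κ 1) refl) ; values = vals }
    where
    mul : ∀ a b → drop p χ (a * b) ≡ drop p χ a ⊗ drop p χ b
    mul a b = trans (cong ((# 1 ⊖ 𝟙 (p ∣? a * b)) ⊗_) (mult q a b)) (trans (cong (_⊗ (χ a ⊗ χ b)) (ind (p ∣? a) (p ∣? b))) (solve 4 (λ a b c d → (κ 1 :- a) :* (κ 1 :- b) :* (c :* d) := (κ 1 :- a) :* c :* ((κ 1 :- b) :* d)) refl (𝟙 (p ∣? a)) (𝟙 (p ∣? b)) (χ a) (χ b)))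
      where
      ind : (c : Dec (p ∣ a)) (d : Dec (p ∣ b)) → # 1 ⊖ 𝟙 (p ∣? a * b) ≡ (# 1 ⊖ 𝟙 c) ⊗ (# 1 ⊖ 𝟙 d)
      ind (yes x) d = trans (cong (# 1 ⊖_) (𝟙-yes (p ∣? a * b) (∣-trans x (m∣m*n b)))) (solve 1 (λ a → κ 1 :- κ 1 := (κ 1 :- κ 1) :* (κ 1 :- a)) refl (𝟙 d))
      ind (no _) (yes y) = trans (cong (# 1 ⊖_) (𝟙-yes (p ∣? a * b) (∣-trans y (divides a refl)))) (solve 0 (κ 1 :- κ 1 := (κ 1 :- κ 0) :* (κ 1 :- κ 1)) refl)
      ind (no x) (no y) = trans (cong (# 1 ⊖_) (𝟙-no (p ∣? a * b) no′)) (solve 0 (κ 1 :- κ 0 := (κ 1 :- κ 0) :* (κ 1 :- κ 0)) refl)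
        where no′ : ¬ (p ∣ a * b)
              no′ d with euclidsLemma a b pr d
              ... | inj₁ e = x e
              ... | inj₂ e = y e
    vals : ∀ n → (drop p χ n ≡ # 0) ⊎ (drop p χ n ≡ # 1) ⊎ (drop p χ n ≡ ⊝ # 1)
    vals n with p ∣? n
    ... | yes _ = inj₁ (solve 1 (λ a → (κ 1 :- κ 1) :* a := κ 0) refl (χ n))
    ... | no _ with values q n
    ...   | inj₁ e        = inj₁ (trans (solve 1 (λ a → (κ 1 :- κ 0) :* a := a) refl (χ n)) e)
    ...   | inj₂ (inj₁ e) = inj₂ (inj₁ (trans (solve 1 (λ a → (κ 1 :- κ 0) :* a := a) refl (χ n)) e))
    ...   | inj₂ (inj₂ e) = inj₂ (inj₂ (trans (solve 1 (λ a → (κ 1 :- κ 0) :* a := a) refl (χ n)) e))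

  r-prime : ∀ {χ p e} → Quadratic χ → Prime p → 1 ≤ e → r χ (p * e) ≡ r (drop p χ) e ⊕ χ p ⊗ r χ e
  r-prime {χ} {p} {e} q pr 1≤e = trans (∑-divisors-prime χ pr 1≤e) (trans (∑-ext e (λ d → trans (cong (λ t → 𝟙 (d ∣? e) ⊗ (drop p χ d ⊕ t)) (mult q p d))
     (solve 4 (λ a b c d → a :* (b :+ c :* d) := a :* b :+ c :* (a :* d)) refl (𝟙 (d ∣? e)) (drop p χ d) (χ p) (χ d)))) (trans (∑-⊕ e _ _) (cong (r (drop p χ) e ⊕_) (∑-⊗ e (χ p) _))))

  r-drop-prime : ∀ {χ p e} → Prime p → 1 ≤ e → r (drop p χ) (p * e) ≡ r (drop p χ) e
  r-drop-prime {χ} {p} {e} pr 1≤e = trans (∑-divisors-prime (drop p χ) pr 1≤e) (∑-ext e (λ d → cong (𝟙 (d ∣? e) ⊗_) (trans (cong (λ t → (# 1 ⊖ 𝟙 (p ∣? d)) ⊗ drop p χ d ⊕ (# 1 ⊖ t) ⊗ χ (p * d)) (𝟙-yes (p ∣? p * d) (m∣m*n d))) (idem d (p ∣? d)))))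
    where
    idem : ∀ d (c : Dec (p ∣ d)) → (# 1 ⊖ 𝟙 c) ⊗ ((# 1 ⊖ 𝟙 c) ⊗ χ d) ⊕ (# 1 ⊖ # 1) ⊗ χ (p * d) ≡ (# 1 ⊖ 𝟙 c) ⊗ χ d
    idem d (yes _) = (solve 2 (λ a b → (κ 1 :- κ 1) :* ((κ 1 :- κ 1) :* a) :+ (κ 1 :- κ 1) :* b := (κ 1 :- κ 1) :* a) refl (χ d) (χ (p * d)))
    idem d (no _) = (solve 2 (λ a b → (κ 1 :- κ 0) :* ((κ 1 :- κ 0) :* a) :+ (κ 1 :- κ 1) :* b := (κ 1 :- κ 0) :* a) refl (χ d) (χ (p * d)))

  r-drop-same : ∀ {χ p e} → (∀ d → d ∣ e → p ∣ d → χ d ≡ # 0) → r (drop p χ) e ≡ r χ e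
  r-drop-same {χ} {p} {e} h = ∑-ext e (λ d → 𝟙-⊗-cong (d ∣? e) (λ d∣e → aux d d∣e (p ∣? d)))
    where
    aux : ∀ d → d ∣ e → (c : Dec (p ∣ d)) → (# 1 ⊖ 𝟙 c) ⊗ χ d ≡ χ d
    aux d d∣e (yes p∣d) = trans (solve 1 (λ a → (κ 1 :- κ 1) :* a := κ 0) refl (χ d)) (sym (h d d∣e p∣d))
    aux d d∣e (no _) = (solve 1 (λ a → (κ 1 :- κ 0) :* a := a) refl (χ d))

  χp≡0 : ∀ {χ p} → Quadratic χ → χ p ≡ # 0 → ∀ d → p ∣ d → χ d ≡ # 0
  χp≡0 {χ} {p} q e d (divides k refl) = trans (mult q k p) (trans (cong (χ k ⊗_) e) (solve 1 (λ a → a :* κ 0 := κ 0) refl (χ k)))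

  r-1 : ∀ {χ} → Quadratic χ → r χ 1 ≡ # 1
  r-1 {χ} q = trans (cong₂ (λ s t → # 0 ⊕ s ⊗ t) (𝟙-yes (1 ∣? 1) ∣-refl) (unit q)) (solve 0 (κ 0 :+ κ 1 :* κ 1 := κ 1) refl)

  r-p² : ∀ {χ p e} → Quadratic χ → Prime p → 1 ≤ e → r χ (p * (p * e)) ≡ (# 1 ⊕ χ p) ⊗ r (drop p χ) e ⊕ χ p ⊗ χ p ⊗ r χ e
  r-p² {χ} {p} {e} q pr 1≤e = trans (r-prime q pr (ℕP.*-mono-≤ (prime≥1 pr) 1≤e)) (trans (cong₂ (λ s t → s ⊕ χ p ⊗ t) (r-drop-prime {χ} pr 1≤e) (r-prime q pr 1≤e))
    (solve 3 (λ a b c → a :+ b :* (a :+ b :* c) := (κ 1 :+ b) :* a :+ b :* b :* c) refl (r (drop p χ) e) (χ p) (r χ e)))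

  r-nn : ∀ {χ} → Quadratic χ → ∀ n → 1 ≤ n → # 0 ≼ r χ n
  r-nn q n = go n n q ℕP.≤-refl
    where
    go : ∀ k n {χ} → Quadratic χ → n ≤ k → 1 ≤ n → # 0 ≼ r χ n
    go zero n q n≤k 1≤n = ⊥-elim (ℕP.<⇒≱ 1≤n n≤k)
    go (suc k) n {χ} q n≤k 1≤n with n ≟ 1
    ... | yes refl = ≼-trans 0≼1 (≡≽ (r-1 q))
    ... | no n≢1 = split (∃-prime-∣ n (ℕP.≤∧≢⇒< 1≤n (λ e → n≢1 (sym e))))
      where
      split : (∃ λ p → Prime p × p ∣ n) → # 0 ≼ r χ n
      split (p , pr , divides e eq) = subst (λ t → # 0 ≼ r χ t) (sym eq′) (case-χ (values q p))
        where
        eq′ : n ≡ p * e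
        eq′ = trans eq (ℕP.*-comm e p)
        1≤e : 1 ≤ e
        1≤e = proj₁ (proj₂ (≤-factor {p} {e} 1≤n (sym eq′)))
        lt : ∀ {f} → 1 ≤ f → f < p * f
        lt {f} 1≤f = ℕP.<-≤-trans (ℕP.m<m+n f (ℕP.≤-trans 1≤f (ℕP.m≤m+n f 0))) (ℕP.*-monoˡ-≤ f (prime≥2 pr))
        e≤k : e ≤ k
        e≤k = ℕP.≤-pred (ℕP.<-≤-trans (lt 1≤e) (subst (_≤ suc k) eq′ n≤k))
        case-χ : (χ p ≡ # 0) ⊎ (χ p ≡ # 1) ⊎ (χ p ≡ ⊝ # 1) → # 0 ≼ r χ (p * e)
        case-χ (inj₁ z) = ≼-trans (go k e (drop-quadratic pr q) e≤k 1≤e) (≡≽ (trans (r-prime q pr 1≤e) (trans (cong (λ t → r (drop p χ) e ⊕ t ⊗ r χ e) z) (solve 2 (λ a b → a :+ κ 0 :* b := a) refl (r (drop p χ) e) (r χ e)))))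
        case-χ (inj₂ (inj₁ z)) = ≼-trans (lin 0 (1 · (go k e (drop-quadratic pr q) e≤k 1≤e) ⊞ 1 · (go k e q e≤k 1≤e)) (solve 2 (λ a b → a :+ κ 1 :* b :- κ 0 := a :- κ 0 :+ (b :- κ 0)) refl (r (drop p χ) e) (r χ e))) (≡≽ (trans (r-prime q pr 1≤e) (cong (λ t → r (drop p χ) e ⊕ t ⊗ r χ e) z)))
        case-χ (inj₂ (inj₂ z)) with p ∣? e
        ... | no p∤e = ≡≽ (trans (r-prime q pr 1≤e) (trans (cong₂ (λ s t → s ⊕ t ⊗ r χ e) (r-drop-same {χ} {p} {e} (λ d d∣e p∣d → ⊥-elim (p∤e (∣-trans p∣d d∣e)))) z) (solve 1 (λ a → a :+ :- κ 1 :* a := κ 0) refl (r χ e))))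
        ... | yes (divides f eq₂) = ≼-trans (go k f q (ℕP.≤-trans (ℕP.<⇒≤ (lt 1≤f)) (subst (_≤ k) e≡ e≤k)) 1≤f)
               (≡≽ (trans (cong (λ t → r χ (p * t)) e≡) (trans (r-p² q pr 1≤f) (trans (cong (λ t → (# 1 ⊕ t) ⊗ r (drop p χ) f ⊕ t ⊗ t ⊗ r χ f) z) (solve 2 (λ a b → (κ 1 :+ :- κ 1) :* a :+ :- κ 1 :* :- κ 1 :* b := b) refl (r (drop p χ) f) (r χ f))))))
          where
          e≡ : e ≡ p * f
          e≡ = trans eq₂ (ℕP.*-comm f p)
          1≤f : 1 ≤ f
          1≤f = proj₁ (proj₂ (≤-factor {p} {f} 1≤e (sym e≡)))

  -- By `r-p²` a further factor `p * p` never brings the value below 1, whatever `χ p` is. The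
  -- squares are the source of positivity for L(1, χ).
  r-square : ∀ {χ} → Quadratic χ → ∀ n → 1 ≤ n → # 1 ≼ r χ (n * n)
  r-square {χ} q = prime-induction (λ n → # 1 ≼ r χ (n * n)) (≡≽ (r-1 q)) step
    where
    step : ∀ p e → Prime p → 1 ≤ e → # 1 ≼ r χ (e * e) → # 1 ≼ r χ (p * e * (p * e))
    step p e pr 1≤e ih = ≼-trans (main (values q p)) (≡≽ (trans (cong (r χ) shuffle) (r-p² q pr 1≤e²)))
      where
      1≤e² = ℕP.*-mono-≤ 1≤e 1≤e
      shuffle : p * e * (p * e) ≡ p * (p * (e * e))
      shuffle = trans (ℕP.*-assoc p e (p * e)) (cong (p *_) (trans (sym (ℕP.*-assoc e p e)) (trans (cong (_* e) (ℕP.*-comm e p)) (ℕP.*-assoc p e e))))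
      ρ = r (drop p χ) (e * e)
      ρ-nn : # 0 ≼ ρ
      ρ-nn = r-nn (drop-quadratic pr q) (e * e) 1≤e²
      main : (χ p ≡ # 0) ⊎ (χ p ≡ # 1) ⊎ (χ p ≡ ⊝ # 1) → # 1 ≼ (# 1 ⊕ χ p) ⊗ ρ ⊕ χ p ⊗ χ p ⊗ r χ (e * e)
      main (inj₁ z) rewrite z = (lin 0 (1 · (≡≽ (r-drop-same {χ} {p} {e * e} (λ d _ → χp≡0 q z d))) ⊞ 1 · ih) (solve 2 (λ a b → (κ 1 :+ κ 0) :* a :+ κ 0 :* κ 0 :* b :- κ 1 := a :- b :+ (b :- κ 1)) refl ρ (r χ (e * e))))
      main (inj₂ (inj₁ z)) rewrite z = (lin 0 (2 · ρ-nn ⊞ 1 · ih) (solve 2 (λ a b → (κ 1 :+ κ 1) :* a :+ κ 1 :* κ 1 :* b :- κ 1 := κ 2 :* (a :- κ 0) :+ (b :- κ 1)) refl ρ (r χ (e * e))))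
      main (inj₂ (inj₂ z)) rewrite z = (lin 0 (1 · ih) (solve 2 (λ a b → (κ 1 :+ :- κ 1) :* a :+ :- κ 1 :* :- κ 1 :* b :- κ 1 := b :- κ 1) refl ρ (r χ (e * e))))

-- Lower bound for L(1, χ) from a Lambert series.

module Lambert (M : ℕ) {{M≢0 : NonZero M}} where
  open Field
  open Sums
  open NumTh
  open LOne
  open Cls M using (1≤M; periodic-≲)

  module Powers (k : ℕ) (1≤k : 1 ≤ k) where
    t x κF : F
    t = ⅟ k
    x = # 1 ⊖ t
    κF = # k

    kt : κF ⊗ t ≡ # 1
    kt = ⅟-law 1≤k
    t-nn : # 0 ≼ t
    t-nn = ⅟-nn k
    x-nn : # 0 ≼ x
    x-nn = sub-nn (⅟≼1 k)
    κ-nn : # 0 ≼ κF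
    κ-nn = 0≼# k

    pw : ℕ → F
    pw zero    = # 1
    pw (suc n) = x ⊗ pw n

    -- The sum 1 + x + ... + x^(d-1), so that 1 - x^d is `s d / k`. Lambert's quotient x^d / (1 -
    -- x^d) then needs only the inverse of `s d`, a number at least 1.
    s : ℕ → F
    s zero    = # 0
    s (suc d) = # 1 ⊕ x ⊗ s d

    pw-nn : ∀ n → # 0 ≼ pw n
    pw-nn zero    = 0≼1
    pw-nn (suc n) = nn-⊗ x-nn (pw-nn n)

    pw-+ : ∀ a b → pw (a + b) ≡ pw a ⊗ pw b
    pw-+ zero    b = (solve 1 (λ a → a := κ 1 :* a) refl (pw b))
    pw-+ (suc a) b = trans (cong (x ⊗_) (pw-+ a b)) (solve 3 (λ a b c → a :* (b :* c) := a :* b :* c) refl x (pw a) (pw b))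

    pw-dec : ∀ n → pw (suc n) ≼ pw n
    pw-dec n = (lin 0 (1 · (nn-⊗ t-nn (pw-nn n))) (solve 2 (λ a b → b :- (κ 1 :- a) :* b := a :* b :- κ 0) refl t (pw n)))

    pw≼1 : ∀ n → pw n ≼ # 1
    pw≼1 zero    = ≼-refl
    pw≼1 (suc n) = ≼-trans (pw-dec n) (pw≼1 n)

    pw-anti : ∀ {a b} → a ≤ b → pw b ≼ pw a
    pw-anti {a} {b} p = ≼-trans (≡≼ (trans (cong pw (sym (ℕP.m+[n∸m]≡n p))) (pw-+ a (b ∸ a)))) (lin 0 (1 · (nn-⊗ (pw-nn a) (sub-nn (pw≼1 (b ∸ a))))) (solve 2 (λ a b → a :- a :* b := a :* (κ 1 :- b) :- κ 0) refl (pw a) (pw (b ∸ a))))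

    bernoulli : ∀ n → # 1 ⊖ # n ⊗ t ≼ pw n
    bernoulli zero    = (lin 0 (const 0) (solve 1 (λ a → κ 1 :- (κ 1 :- κ 0 :* a) := κ 0) refl t))
    bernoulli (suc n) = (lin 0 (1 · (bernoulli n) ⊞ 1 · (⊗-monoʳ t-nn (pw≼1 n)) ⊞ 1 · (≡≽ (cong (_⊗ t) (#-suc n)))) (solve 4 (λ a b c d → (κ 1 :- b) :* c :- (κ 1 :- a :* b) := c :- (κ 1 :- d :* b) :+ (b :* κ 1 :- b :* c :+ (a :* b :- (κ 1 :+ d) :* b))) refl (# (suc n)) t (pw n) (# n)))

    decay : ∀ n → pw n ⊗ (# 1 ⊕ # n ⊗ t) ≼ # 1
    decay zero    = (lin 0 (const 0) (solve 1 (λ a → κ 1 :- κ 1 :* (κ 1 :+ κ 0 :* a) := κ 0) refl t))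
    decay (suc n) = (lin 0 (1 · (decay n) ⊞ 1 · (≡≼ (cong (λ y → (# 1 ⊖ t) ⊗ pw n ⊗ (y ⊗ t)) (#-suc n))) ⊞ 1 · (nn-⊗ (pw-nn n) (nn-⊗ (0≼# n) (nn-⊗ t-nn t-nn))) ⊞ 1 · (nn-⊗ (pw-nn n) (nn-⊗ t-nn t-nn))) (solve 4 (λ a b c d → κ 1 :- (κ 1 :- a) :* b :* (κ 1 :+ c :* a) := κ 1 :- b :* (κ 1 :+ d :* a) :+ ((κ 1 :- a) :* b :* ((κ 1 :+ d) :* a) :- (κ 1 :- a) :* b :* (c :* a) :+ (b :* (d :* (a :* a)) :- κ 0 :+ (b :* (a :* a) :- κ 0)))) refl t (pw n) (# (suc n)) (# n)))

    s-nn : ∀ d → # 0 ≼ s d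
    s-nn zero    = ≼-refl
    s-nn (suc d) = (lin 0 (1 · (nn-⊗ x-nn (s-nn d)) ⊞ const 1) (solve 2 (λ a b → κ 1 :+ a :* b :- κ 0 := a :* b :- κ 0 :+ κ 1) refl x (s d)))

    1≼s : ∀ d → # 1 ≼ s (suc d)
    1≼s d = (lin 0 (1 · (nn-⊗ x-nn (s-nn d))) (solve 2 (λ a b → κ 1 :+ a :* b :- κ 1 := a :* b :- κ 0) refl x (s d)))

    s-geom : ∀ d → t ⊗ s d ≡ # 1 ⊖ pw d
    s-geom zero    = (solve 1 (λ a → a :* κ 0 := κ 1 :- κ 1) refl t)
    s-geom (suc d) = (≼-antisym (lin 0 (1 · (≡≼ (s-geom d)) ⊞ 1 · (≡≽ (cong (t ⊗_) (s-geom d)))) (solve 3 (λ a b c → κ 1 :- (κ 1 :- a) :* c :- a :* (κ 1 :+ (κ 1 :- a) :* b) := κ 1 :- c :- a :* b :+ (a :* (a :* b) :- a :* (κ 1 :- c))) refl t (s d) (pw d))) (lin 0 (1 · (≡≽ (s-geom d)) ⊞ 1 · (≡≼ (cong (t ⊗_) (s-geom d)))) (solve 3 (λ a b c → a :* (κ 1 :+ (κ 1 :- a) :* b) :- (κ 1 :- (κ 1 :- a) :* c) := a :* b :- (κ 1 :- c) :+ (a :* (κ 1 :- c) :- a :* (a :* b))) refl t (s d) (pw d))))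

    s-suc : ∀ d → s (suc d) ≡ s d ⊕ pw d
    s-suc d = (≼-antisym (lin 0 (1 · (≡≽ (s-geom d))) (solve 3 (λ a b c → b :+ c :- (κ 1 :+ (κ 1 :- a) :* b) := a :* b :- (κ 1 :- c)) refl t (s d) (pw d))) (lin 0 (1 · (≡≼ (s-geom d))) (solve 3 (λ a b c → κ 1 :+ (κ 1 :- a) :* b :- (b :+ c) := κ 1 :- c :- a :* b) refl t (s d) (pw d))))

    s-lo : ∀ n → # 2 ⊗ # n ⊖ t ⊗ # n ⊗ (# n ⊖ # 1) ≼ # 2 ⊗ s n
    s-lo zero    = (lin 0 (const 0) (solve 1 (λ a → κ 2 :* κ 0 :- (κ 2 :* κ 0 :- a :* κ 0 :* (κ 0 :- κ 1)) := κ 0) refl t))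
    s-lo (suc n) = ≼-trans (≡≼ (cong (λ y → # 2 ⊗ y ⊖ t ⊗ y ⊗ (y ⊖ # 1)) (#-suc n))) (lin 0 (2 · (≡≽ (s-suc n)) ⊞ 1 · (s-lo n) ⊞ 2 · (bernoulli n)) (solve 5 (λ a b c d e → κ 2 :* c :- (κ 2 :* (κ 1 :+ a) :- b :* (κ 1 :+ a) :* (κ 1 :+ a :- κ 1)) := κ 2 :* (c :- (d :+ e)) :+ (κ 2 :* d :- (κ 2 :* a :- b :* a :* (a :- κ 1)) :+ κ 2 :* (e :- (κ 1 :- a :* b)))) refl (# n) t (s (suc n)) (s n) (pw n)))

    -- The product consists of d (d + 1) powers of x with mean exponent d - 1/2, so this is an
    -- instance of the inequality between arithmetic and geometric means. To avoid roots it is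
    -- proved by induction from `s-lo`.
    s-product : ∀ d → # d ⊗ (# 1 ⊕ # d) ⊗ pw d ≼ s d ⊗ s (suc d)
    s-product zero    = (lin 0 (const 0) (solve 1 (λ a → κ 0 :* a :- κ 0 :* (κ 1 :+ κ 0) :* κ 1 := κ 0) refl (s 1)))
    s-product (suc d) = ≼-trans (≡≼ (cong (λ y → y ⊗ (# 1 ⊕ y) ⊗ pw (suc d)) (#-suc d))) (lin 1 (2 · (≡≽ (cong (S′ ⊗_) (s-suc (suc d)))) ⊞ 2 · (≡≽ (cong (S′ ⊗_) (s-suc d))) ⊞ 2 · (s-product d) ⊞ 1 · (⊗-monoʳ (nn-⊗ (pw-nn d) ((lin 0 (1 · (⅟≼1 k) ⊞ const 1) (solve 1 (λ a → κ 2 :- a :- κ 0 := κ 1 :- a :+ κ 1) refl t)))) (≼-trans (≡≽ (cong (λ y → # 2 ⊗ y ⊖ t ⊗ y ⊗ (y ⊖ # 1)) (#-suc d))) (s-lo (suc d)))) ⊞ 2 · (nn-⊗ (nn-⊗ (pw-nn d) t-nn) (0≼# d)) ⊞ 2 · (nn-⊗ (pw-nn d) t-nn) ⊞ 1 · (nn-⊗ (nn-⊗ (nn-⊗ (pw-nn d) t-nn) (0≼# d)) t-nn) ⊞ 1 · (nn-⊗ (nn-⊗ (nn-⊗ (nn-⊗ (pw-nn d) t-nn) (0≼# d)) t-nn) (0≼# d))) (solve 6 (λ a b c d e f → κ 2 :* (d :* e :- (κ 1 :+ a) :* (κ 1 :+ (κ 1 :+ a)) :* ((κ 1 :- b) :*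 c)) := κ 2 :* (d :* e :- d :* (d :+ (κ 1 :- b) :* c)) :+ (κ 2 :* (d :* d :- d :* (f :+ c)) :+ (κ 2 :* (f :* d :- a :* (κ 1 :+ a) :* c) :+ (c :* (κ 2 :- b) :* (κ 2 :* d) :- c :* (κ 2 :- b) :* (κ 2 :* (κ 1 :+ a) :- b :* (κ 1 :+ a) :* (κ 1 :+ a :- κ 1)) :+ (κ 2 :* (c :* b :* a :- κ 0) :+ (κ 2 :* (c :* b :- κ 0) :+ (c :* b :* a :* b :- κ 0 :+ (c :* b :* a :* b :* a :- κ 0)))))))) refl D t P S′ (s (suc (suc d))) (s d)))
      where
      D = # d
      P = pw d
      S′ = s (suc d)

    d-pw≼s : ∀ d → # d ⊗ pw d ≼ s d
    d-pw≼s zero    = (lin 0 (const 0) (solve 0 (κ 0 :- κ 0 :* κ 1 := κ 0) refl))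
    d-pw≼s (suc d) = (lin 0 (1 · (≡≼ (cong (_⊗ pw (suc d)) (#-suc d))) ⊞ 1 · (⊗-monoʳ (0≼# d) (pw-dec d)) ⊞ 1 · (d-pw≼s d) ⊞ 1 · (pw-dec d) ⊞ 1 · (≡≽ (s-suc d))) (solve 6 (λ a b c d e f → c :- a :* b := (κ 1 :+ d) :* b :- a :* b :+ (d :* e :- d :* b :+ (f :- d :* e :+ (e :- b :+ (c :- (f :+ e)))))) refl (# (suc d)) (pw (suc d)) (s (suc d)) (# d) (pw d) (s d)))

    -- x^d / (1 - x^d), and its difference with the main term k / d
    a b : ℕ → F
    a d = κF ⊗ (pw d ⊗ inv (s d))
    b d = κF ⊗ ⅟ d ⊖ a d

    si : ∀ d → 1 ≤ d → s d ⊗ inv (s d) ≡ # 1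
    si (suc d) _ = inv-law (1≼s d)

    i-nn : ∀ d → 1 ≤ d → # 0 ≼ inv (s d)
    i-nn (suc d) _ = inv-nn (1≼s d)

    a-geom : ∀ d → 1 ≤ d → a d ⊗ (# 1 ⊖ pw d) ≡ pw d
    a-geom d p = trans (cong (a d ⊗_) (sym (s-geom d))) (trans (solve 5 (λ a b c d e → a :* (b :* c) :* (d :* e) := b :* (a :* d :* (e :* c))) refl κF (pw d) (inv (s d)) t (s d)) (trans (cong (pw d ⊗_) (cong₂ _⊗_ kt (si d p))) (solve 1 (λ a → a :* (κ 1 :* κ 1) := a) refl (pw d))))

    a-nn : ∀ d → 1 ≤ d → # 0 ≼ a d
    a-nn d p = nn-⊗ κ-nn (nn-⊗ (pw-nn d) (i-nn d p))

    a≼ : ∀ d → 1 ≤ d → a d ≼ κF ⊗ pw d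
    a≼ d@(suc d′) p = ⊗-monoʳ κ-nn (lin 0 (1 · (nn-⊗ (nn-⊗ (pw-nn d) (i-nn d p)) (sub-nn (1≼s d′))) ⊞ 1 · (≡≼ (cong (pw d ⊗_) (si d p)))) (solve 3 (λ a b c → a :- a :* b := a :* b :* (c :- κ 1) :- κ 0 :+ (a :* κ 1 :- a :* (c :* b))) refl (pw d) (inv (s d)) (s d)))

    -- Since `s (suc d)` is 1 + x `s d`, the drop of x^d / `s d` is x^d divided by
    -- `s d ⊗ s (suc d)`; `s-product` bounds it by the drop of `⅟ d`. Monotonicity makes partial
    -- summation applicable to the sum of `χ b`.
    b-dec : ∀ d → 1 ≤ d → b (suc d) ≼ b d
    b-dec d p = (lin 0 (1 · (⊗-monoʳ κ-nn main)) (solve 7 (λ a b c d e f g → a :* f :- a :* (d :* g) :- (a :* b :- a :* (c :* d :* e)) := a :* (f :- b) :- a :* (d :* g :- c :* d :* e)) refl κF (⅟ (suc d)) x P i′ (⅟ d) i))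
      where
      P = pw d
      i = inv (s d)
      i′ = inv (s (suc d))
      e₁ : P ⊗ i ⊖ x ⊗ P ⊗ i′ ≡ P ⊗ i ⊗ i′
      e₁ = (≼-antisym (lin 0 (1 · (≡≽ (cong (P ⊗ i ⊗_) (si (suc d) (s≤s z≤n)))) ⊞ 1 · (≡≼ (cong (x ⊗ P ⊗ i′ ⊗_) (si d p)))) (solve 5 (λ a b c d e → a :* b :* d :- (a :* b :- c :* a :* d) := a :* b :* ((κ 1 :+ c :* e) :* d) :- a :* b :* κ 1 :+ (c :* a :* d :* κ 1 :- c :* a :* d :* (e :* b))) refl P i x i′ (s d))) (lin 0 (1 · (≡≼ (cong (P ⊗ i ⊗_) (si (suc d) (s≤s z≤n)))) ⊞ 1 · (≡≽ (cong (x ⊗ P ⊗ i′ ⊗_) (si d p)))) (solve 5 (λ a b c d e → a :* b :- c :* a :* d :- a :* b :* d := a :* b :* κ 1 :- a :* b :* ((κ 1 :+ c :* e) :* d) :+ (c :* a :* d :* (e :* b) :- c :* a :* d :* κ 1)) refl P i x i′ (s d))))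
      ii : # 0 ≼ i ⊗ i′
      ii = nn-⊗ (i-nn d p) (i-nn (suc d) (s≤s z≤n))
      e₂ : ⅟ d ⊖ ⅟ (suc d) ≡ ⅟ d ⊗ ⅟ (suc d)
      e₂ = (≼-antisym (lin 0 (1 · (≡≽ (cong (⅟ d ⊗_) (⅟-law {suc d} (s≤s z≤n)))) ⊞ 1 · (≡≼ (cong (⅟ (suc d) ⊗_) (⅟-law p))) ⊞ 1 · (≡≼ (cong ((⅟ d ⊗ ⅟ (suc d)) ⊗_) (#-suc d)))) (solve 4 (λ a b c d → a :* b :- (a :- b) := a :* (c :* b) :- a :* κ 1 :+ (b :* κ 1 :- b :* (d :* a) :+ (a :* b :* (κ 1 :+ d) :- a :* b :* c))) refl (⅟ d) (⅟ (suc d)) (# (suc d)) (# d))) (lin 0 (1 · (≡≼ (cong (⅟ d ⊗_) (⅟-law {suc d} (s≤s z≤n)))) ⊞ 1 · (≡≽ (cong (⅟ (suc d) ⊗_) (⅟-law p))) ⊞ 1 · (≡≽ (cong ((⅟ d ⊗ ⅟ (suc d)) ⊗_) (#-suc d)))) (solve 4 (λ a b c d → a :- b :- a :* b := a :* κ 1 :- a :* (c :* b) :+ (b :* (d :* a) :- b :* κ 1 :+ (a :* b :* c :- a :* b :* (κ 1 :+ d)))) refl (⅟ d) (⅟ (suc d)) (# (suc d)) (# d))))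
      q = ⅟ d ⊗ ⅟ (suc d)
      key : P ⊗ i ⊗ i′ ≼ q
      key = ≼-trans (≡≼ (sym lhs)) (≼-trans (⊗-monoʳ (nn-⊗ ii (nn-⊗ (⅟-nn d) (⅟-nn (suc d)))) (s-product d)) (≡≼ rhs))
        where
        lhs : i ⊗ i′ ⊗ q ⊗ (# d ⊗ (# 1 ⊕ # d) ⊗ P) ≡ P ⊗ i ⊗ i′
        lhs = trans (cong (λ y → i ⊗ i′ ⊗ q ⊗ (# d ⊗ y ⊗ P)) (sym (#-suc d))) (trans (solve 7 (λ a b c d e f g → a :* b :* (c :* d) :* (e :* f :* g) := g :* a :* b :* (e :* c :* (f :* d))) refl i i′ (⅟ d) (⅟ (suc d)) (# d) (# (suc d)) P) (trans (cong (P ⊗ i ⊗ i′ ⊗_) (cong₂ _⊗_ (⅟-law p) (⅟-law {suc d} (s≤s z≤n)))) (solve 3 (λ a b c → a :* b :* c :* (κ 1 :* κ 1) := a :* b :* c) refl P i i′)))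
        rhs : i ⊗ i′ ⊗ q ⊗ (s d ⊗ s (suc d)) ≡ q
        rhs = trans (solve 5 (λ a b c d e → a :* b :* c :* (d :* e) := c :* (d :* a :* (e :* b))) refl i i′ q (s d) (s (suc d))) (trans (cong (q ⊗_) (cong₂ _⊗_ (si d p) (si (suc d) (s≤s z≤n)))) (solve 1 (λ a → a :* (κ 1 :* κ 1) := a) refl q))
      main : P ⊗ i ⊖ x ⊗ P ⊗ i′ ≼ ⅟ d ⊖ ⅟ (suc d)
      main = ≼-trans (≡≼ e₁) (≼-trans key (≡≽ e₂))

    b-nn : ∀ d → 1 ≤ d → # 0 ≼ b d
    b-nn d p = (lin 0 (1 · (⊗-monoʳ κ-nn main)) (solve 4 (λ a b c d → a :* b :- a :* (c :* d) :- κ 0 := a :* b :- a :* (c :* d)) refl κF (⅟ d) (pw d) (inv (s d))))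
      where
      main : pw d ⊗ inv (s d) ≼ ⅟ d
      main = (lin 0 (1 · (⊗-monoʳ (nn-⊗ (i-nn d p) (⅟-nn d)) (d-pw≼s d)) ⊞ 1 · (≡≽ (cong (pw d ⊗ inv (s d) ⊗_) (⅟-law p))) ⊞ 1 · (≡≼ (cong (⅟ d ⊗_) (si d p)))) (solve 5 (λ a b c d e → c :- a :* b := b :* c :* e :- b :* c :* (d :* a) :+ (a :* b :* (d :* c) :- a :* b :* κ 1 :+ (c :* κ 1 :- c :* (e :* b)))) refl (pw d) (inv (s d)) (⅟ d) (# d) (s d)))

    b-1 : b 1 ≡ # 1
    b-1 = (≼-antisym (lin 0 (1 · (≡≼ (cong (κF ⊗_) ⅟-1)) ⊞ 1 · (≡≽ (cong (λ y → κF ⊗ (# 1 ⊖ t) ⊗ y) (si 1 ℕP.≤-refl))) ⊞ 1 · (≡≼ kt)) (solve 4 (λ a b c d → κ 1 :- (a :* b :- a :* ((κ 1 :- c) :* κ 1 :* d)) := a :* κ 1 :- a :* b :+ (a :* (κ 1 :- c) :* ((κ 1 :+ (κ 1 :- c) :* κ 0) :* d) :- a :* (κ 1 :- c) :* κ 1 :+ (κ 1 :- a :* c))) refl κF (⅟ 1) t (inv (s 1)))) (lin 0 (1 · (≡≽ (cong (κF ⊗_) ⅟-1)) ⊞ 1 · (≡≼ (cong (λ y → κF ⊗ (# 1 ⊖ t) ⊗ y) (si 1 ℕP.≤-refl))) ⊞ 1 · (≡≽ kt)) (solve 4 (λ a b c d → a :* b :- a :* ((κ 1 :- c) :* κ 1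 :* d) :- κ 1 := a :* b :- a :* κ 1 :+ (a :* (κ 1 :- c) :* κ 1 :- a :* (κ 1 :- c) :* ((κ 1 :+ (κ 1 :- c) :* κ 0) :* d) :+ (a :* c :- κ 1))) refl κF (⅟ 1) t (inv (s 1)))))

    a-tail : ∀ d q → 1 ≤ d → a d ⊖ ∑ q (λ j → pw (d * j)) ≡ a d ⊗ pw (d * q)
    a-tail d zero p rewrite ℕP.*-zeroʳ d = (solve 1 (λ a → a :- κ 0 := a :* κ 1) refl (a d))
    a-tail d (suc q) p = trans (cong (λ y → a d ⊖ (∑ q (λ j → pw (d * j)) ⊕ y)) e) (trans (≼-antisym (lin 0 (1 · (≡≼ (a-tail d q p)) ⊞ 1 · (≡≼ (cong (_⊗ pw (d * q)) (a-geom d p)))) (solve 4 (λ a b c d → a :* (c :* d) :- (a :- (b :+ c :* d)) := a :* d :- (a :- b) :+ (c :* d :- a :* (κ 1 :- c) :* d)) refl (a d) (∑ q (λ j → pw (d * j))) (pw d) (pw (d * q)))) (lin 0 (1 · (≡≽ (a-tail d q p)) ⊞ 1 · (≡≽ (cong (_⊗ pw (d * q)) (a-geom d p)))) (solve 4 (λ a b c d → a :- (b :+ c :* d) :- a :* (c :* d) := a :- b :- a :* d :+ (a :* (κ 1 :- c) :* d :- c :* d)) refl (a d) (∑ q (λ j → pw (d * j))) (pw d) (pw (d * q))))) (cong (a d ⊗_) (sym e)))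
      where
      e : pw (d * suc q) ≡ pw d ⊗ pw (d * q)
      e = trans (cong pw (ℕP.*-suc d q)) (pw-+ d (d * q))

  ∑-squares≼ : ∀ (f : ℕ → F) → (∀ n → 1 ≤ n → # 0 ≼ f n) → ∀ J → ∑ J (λ j → f (j * j)) ≼ ∑ (J * J) f
  ∑-squares≼ f h zero = ≼-refl
  ∑-squares≼ f h (suc J) = ⊕-mono (≼-trans (∑-squares≼ f h J) (∑-grow (ℕP.≤-trans (ℕP.*-monoʳ-≤ J (ℕP.n≤1+n J)) (ℕP.m≤n+m (J * suc J) J)) (λ i a _ → h i a))) ≼-refl

  module Bound (χ : ℕ → F) (q : Quadratic χ) (per : ∀ k → χ (M + k) ≡ χ k) (∑χ : ∑ M χ ≡ # 0) where
    𝓛 : ℕ → F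
    𝓛 y = ∑ y (λ k → χ k ⊗ ⅟ k)

    partial : ∀ z → ∑ z χ ≲ # M
    partial z = ≲-weaken (periodic-≲ χ (# 1) per (Quadratic.≲1 q) ∑χ z) (≡≼ (solve 1 (λ a → a :* κ 1 := a) refl (# M)))

    partial-shift : ∀ D z → ∑ z (λ k → χ (D + k)) ≲ # 2 ⊗ # M
    partial-shift D z = ≲-subst e (≲-weaken (≲-⊕ (partial (D + z)) (neg (partial D))) (≡≼ (solve 1 (λ a → a :+ a := κ 2 :* a) refl (# M))))
      where
      neg : ∀ {y c} → y ≲ c → ⊝ y ≲ c
      neg {y} {c} (p , r) = (lin 0 (1 · r) (solve 2 (λ a b → b :- :- a := a :- :- b) refl y c)) , (lin 0 (1 · p) (solve 2 (λ a b → :- b :- :- a := a :- b) refl c y))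
      e : ∑ (D + z) χ ⊕ ⊝ ∑ D χ ≡ ∑ z (λ k → χ (D + k))
      e = (≼-antisym (lin 0 (1 · (≡≼ (∑-+ D z χ))) (solve 3 (λ a b c → c :- (a :+ :- b) := b :+ c :- a) refl (∑ (D + z) χ) (∑ D χ) (∑ z (λ k → χ (D + k))))) (lin 0 (1 · (≡≽ (∑-+ D z χ))) (solve 3 (λ a b c → a :+ :- b :- c := a :- (b :+ c)) refl (∑ (D + z) χ) (∑ D χ) (∑ z (λ k → χ (D + k))))))

    tail : ∀ D y → D ≤ y → 𝓛 y ⊖ 𝓛 D ≲ # 2 ⊗ # M ⊗ ⅟ (suc D)
    tail D y p = subst (λ z → 𝓛 z ⊖ 𝓛 D ≲ # 2 ⊗ # M ⊗ ⅟ (suc D)) (ℕP.m+[n∸m]≡n p) (go (y ∸ D))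
      where
      go : ∀ z → 𝓛 (D + z) ⊖ 𝓛 D ≲ # 2 ⊗ # M ⊗ ⅟ (suc D)
      go zero = ≲-subst e (≲-weaken (≲-nn ≼-refl) (nn-⊗ (nn-⊗ (0≼# 2) (0≼# M)) (⅟-nn (suc D))))
        where e : # 0 ≡ 𝓛 (D + 0) ⊖ 𝓛 D
              e = trans (solve 1 (λ a → κ 0 := a :- a) refl (𝓛 D)) (cong (λ t → 𝓛 t ⊖ 𝓛 D) (sym (ℕP.+-identityʳ D)))
      go (suc z) = ≲-subst (sym e) (≲-weaken (abel-down z (λ k → χ (D + k)) (λ k → ⅟ (D + k)) (# 2 ⊗ # M) (partial-shift D) (⅟-nn (D + suc z)) (λ i p _ → ⅟-anti (ℕP.≤-trans p (ℕP.m≤n+m i D)) (ℕP.+-monoʳ-≤ D (ℕP.n≤1+n i)))) (≡≼ (cong (λ t → # 2 ⊗ # M ⊗ ⅟ t) (trans (ℕP.+-suc D 0) (cong suc (ℕP.+-identityʳ D))))))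
        where e : 𝓛 (D + suc z) ⊖ 𝓛 D ≡ ∑ (suc z) (λ k → χ (D + k) ⊗ ⅟ (D + k))
              e = (≼-antisym (lin 0 (1 · (≡≼ (∑-+ D (suc z) (λ k → χ k ⊗ ⅟ k)))) (solve 3 (λ a b c → c :- (a :- b) := b :+ c :- a) refl (𝓛 (D + suc z)) (𝓛 D) (∑ (suc z) (λ k → χ (D + k) ⊗ ⅟ (D + k))))) (lin 0 (1 · (≡≽ (∑-+ D (suc z) (λ k → χ k ⊗ ⅟ k)))) (solve 3 (λ a b c → a :- b :- c := a :- (b :+ c)) refl (𝓛 (D + suc z)) (𝓛 D) (∑ (suc z) (λ k → χ (D + k) ⊗ ⅟ (D + k))))))

    -- As k = 2 J^2, the powers x^(j^2) with j ≤ J are at least 1/2, and the series with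
    -- coefficients `r` is at least J / 2 = M + 2. This beats `M` from `∑χb` and 1 from truncation.
    -- At D = 6 k^2 the truncation error D k x^D is at most 1, since x^(2 k^2) is at most 1 / (2 k).
    J k D : ℕ
    J = 2 * M + 4
    k = 2 * (J * J)
    D = 3 * (2 * (k * k))

    private
      1≤J : 1 ≤ J
      1≤J = ℕP.≤-trans (s≤s z≤n) (ℕP.m≤n+m 4 (2 * M))
      1≤J² : 1 ≤ J * J
      1≤J² = ℕP.*-mono-≤ 1≤J 1≤J

    1≤k : 1 ≤ k
    1≤k = ℕP.≤-trans 1≤J² (ℕP.m≤n*m (J * J) 2)

    open Powers k 1≤k

    private
      k≤k² : k ≤ k * k
      k≤k² = ℕP.m≤m*n k k {{ℕ.>-nonZero 1≤k}}
      J²≤D : J * J ≤ D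
      J²≤D = ℕP.≤-trans (ℕP.m≤n*m (J * J) 2) (ℕP.≤-trans k≤k² (ℕP.≤-trans (ℕP.m≤n*m (k * k) 2) (ℕP.m≤n*m (2 * (k * k)) 3)))
      1≤D : 1 ≤ D
      1≤D = ℕP.≤-trans 1≤J² J²≤D

      ∑χb : ∀ n → 1 ≤ n → ∑ n (λ d → χ d ⊗ b d) ≲ # M
      ∑χb (suc n) _ = ≲-weaken (abel-down n χ b (# M) partial (b-nn (suc n) (s≤s z≤n)) (λ i p _ → b-dec i p)) (≡≼ (trans (cong (# M ⊗_) b-1) (solve 1 (λ a → a :* κ 1 := a) refl (# M))))

      ∑r : ∑ D (λ n → pw n ⊗ r χ n) ≡ ∑ D (λ d → χ d ⊗ ∑ (D ÷ d) (λ j → pw (d * j)))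
      ∑r = trans (∑-ext D (λ n → cong (pw n ⊗_) (∑-ext n (λ d → cong (𝟙 (d ∣? n) ⊗_) (solve 1 (λ a → a := a :* κ 1) refl (χ d)))))) (trans (∑-conv D χ (λ _ → # 1) pw) (∑-ext D (λ d → cong (χ d ⊗_) (∑-ext (D ÷ d) (λ j → (solve 1 (λ a → κ 1 :* a := a) refl (pw (d * j))))))))

      err : ∑ D (λ d → χ d ⊗ (a d ⊗ pw (d * (D ÷ d)))) ≲ # D ⊗ (κF ⊗ pw D)
      err = ≲-weaken (∑-≲ D (λ d p _ → ≲-⊗ (Quadratic.≲1 q d) (≲-nn (nn-⊗ (a-nn d p) (pw-nn (d * (D ÷ d))))))) (≼-trans (∑-mono D (λ d p _ → main d p)) (≡≼ (∑-const D (κF ⊗ pw D))))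
        where
        main : ∀ d → 1 ≤ d → # 1 ⊗ (a d ⊗ pw (d * (D ÷ d))) ≼ κF ⊗ pw D
        main d p = ≼-trans (≡≼ (solve 2 (λ a b → κ 1 :* (a :* b) := a :* b) refl (a d) (pw (d * (D ÷ d))))) (≼-trans (⊗-monoˡ (pw-nn (d * (D ÷ d))) (a≼ d p)) (≼-trans (≡≼ (trans (solve 3 (λ a b c → a :* b :* c := a :* (b :* c)) refl κF (pw d) (pw (d * (D ÷ d)))) (cong (κF ⊗_) (trans (sym (pw-+ d (d * (D ÷ d)))) (cong pw (sym (ℕP.*-suc d (D ÷ d)))))))) (⊗-monoʳ κ-nn (pw-anti (ℕP.<⇒≤ (<-suc÷ D d p))))))

      y : F
      y = pw (2 * (k * k))
      2ky : # 2 ⊗ κF ⊗ y ≼ # 1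
      2ky = (lin 0 (1 · (decay (2 * (k * k))) ⊞ 1 · (≡≽ (cong (λ z → y ⊗ (z ⊗ t)) (trans (#-* 2 (k * k)) (cong (# 2 ⊗_) (#-* k k))))) ⊞ 2 · (≡≽ (cong (y ⊗ κF ⊗_) kt)) ⊞ 1 · (pw-nn (2 * (k * k)))) (solve 4 (λ a b c d → κ 1 :- κ 2 :* a :* b := κ 1 :- b :* (κ 1 :+ c :* d) :+ (b :* (c :* d) :- b :* (κ 2 :* (a :* a) :* d) :+ (κ 2 :* (b :* a :* (a :* d) :- b :* a :* κ 1) :+ (b :- κ 0)))) refl κF y (# (2 * (k * k))) t))
      DK : # D ⊗ (κF ⊗ pw D) ≼ # 1
      DK = ≼-trans (≡≼ (trans (cong₂ (λ c d → c ⊗ (κF ⊗ d)) (trans (#-* 3 (2 * (k * k))) (cong (# 3 ⊗_) (trans (#-* 2 (k * k)) (cong (# 2 ⊗_) (#-* k k))))) pwD) (solve 2 (λ a b → κ 3 :* (κ 2 :* (a :* a)) :* (a :* (b :* (b :* b))) := κ 6 :* (a :* b :* (a :* b :* (a :* b)))) refl κF y)))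
          (lin 3 (24 · (⊗-mono v-nn (nn-⊗ v-nn v-nn) hv (⊗-mono v-nn v-nn hv hv)) ⊞ 12 · (≡≼ (trans (cong (λ z → z ⊗ (⅟ 2 ⊗ ⅟ 2)) (⅟-law {2} (s≤s z≤n))) (solve 1 (λ a → κ 1 :* (a :* a) := a :* a) refl (⅟ 2)))) ⊞ 6 · (≡≼ (trans (cong (_⊗ ⅟ 2) (⅟-law {2} (s≤s z≤n))) (solve 1 (λ a → κ 1 :* a := a) refl (⅟ 2)))) ⊞ 3 · (≡≼ (⅟-law {2} (s≤s z≤n))) ⊞ const 1) (solve 2 (λ a b → κ 4 :* (κ 1 :- κ 6 :* (a :* (a :* a))) := κ 24 :* (b :* (b :* b) :- a :* (a :* a)) :+ (κ 12 :* (b :* b :- κ 2 :* b :* (b :* b)) :+ (κ 6 :* (b :- κ 2 :* b :* b) :+ (κ 3 :* (κ 1 :- κ 2 :* b) :+ κ 1)))) refl v (⅟ 2)))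
        where
        v = κF ⊗ y
        v-nn : # 0 ≼ v
        v-nn = nn-⊗ κ-nn (pw-nn (2 * (k * k)))
        hv : v ≼ ⅟ 2
        hv = (lin 1 (1 · 2ky ⊞ 1 · (≡≽ (⅟-law {2} (s≤s z≤n)))) (solve 3 (λ a b c → κ 2 :* (c :- a :* b) := κ 1 :- κ 2 :* a :* b :+ (κ 2 :* c :- κ 1)) refl κF y (⅟ 2)))
        pwD : pw D ≡ y ⊗ (y ⊗ y)
        pwD = trans (pw-+ n (n + (n + 0))) (cong (y ⊗_) (trans (pw-+ n (n + 0)) (cong (y ⊗_) (cong pw (ℕP.+-identityʳ n)))))
          where n = 2 * (k * k)

      ∑r≥ : # J ≼ # 2 ⊗ ∑ D (λ n → pw n ⊗ r χ n)
      ∑r≥ = ≼-trans (lin 0 (1 · (⊗-monoʳ (0≼# J) half≼)) (solve 2 (λ a b → κ 2 :* (a :* b) :- a := a :* (κ 2 :* b) :- a :* κ 1) refl (# J) (pw (J * J)))) (⊗-monoʳ (0≼# 2) (≼-trans (≡≽ (∑-const J (pw (J * J))))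
          (≼-trans (∑-mono J (λ j p r≤ → ≼-trans (pw-anti (ℕP.*-mono-≤ r≤ r≤)) (lin 0 (1 · (nn-⊗ (pw-nn (j * j)) (sub-nn (r-square q j p)))) (solve 2 (λ a b → a :* b :- a := a :* (b :- κ 1) :- κ 0) refl (pw (j * j)) (r χ (j * j))))))
          (≼-trans (∑-squares≼ (λ n → pw n ⊗ r χ n) (λ n p → nn-⊗ (pw-nn n) (r-nn q n p)) J) (∑-grow J²≤D (λ n p _ → nn-⊗ (pw-nn n) (r-nn q n p)))))))
        where
        half≼ : # 1 ≼ # 2 ⊗ pw (J * J)
        half≼ = (lin 0 (2 · (bernoulli (J * J)) ⊞ 1 · (≡≼ kt) ⊞ 1 · (≡≽ (cong (_⊗ t) (#-* 2 (J * J))))) (solve 4 (λ a b c d → κ 2 :* a :- κ 1 := κ 2 :* (a :- (κ 1 :- b :* c)) :+ (κ 1 :- d :* c :+ (d :* c :- κ 2 :* b :* c))) refl (pw (J * J)) (# (J * J)) t κF))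

      -- `k 𝓛 D` splits into the sum of `χ b`, bounded by partial summation, and the sum of `χ a`.
      -- The latter is a Lambert series; expanding its geometric series and collecting by `n = d j`
      -- gives the coefficients `r χ n`.
      at-D : # 1 ≼ κF ⊗ 𝓛 D
      at-D = (lin 1 (2 · (≡≽ e₁) ⊞ 2 · (≡≽ e₂) ⊞ 2 · (proj₂ (∑χb D 1≤D)) ⊞ 2 · (proj₂ err) ⊞ 2 · DK ⊞ 1 · ∑r≥ ⊞ 1 · (≡≽ (trans (#-+ (2 * M) 4) (cong (_⊕ # 4) (#-* 2 M))))) (solve 10 (λ a b c d e f g h i j → κ 2 :* (a :* b :- κ 1) := κ 2 :* (a :* b :- (c :+ d)) :+ (κ 2 :* (d :- (e :+ f)) :+ (κ 2 :* (c :- :- g) :+ (κ 2 :* (f :- :- (h :* (a :* i))) :+ (κ 2 :* (κ 1 :- h :* (a :* i)) :+ (κ 2 :* e :- j :+ (j :- (κ 2 :* g :+ κ 4)))))))) refl κF (𝓛 D) (∑ D (λ d → χ d ⊗ b d)) (∑ D (λ d → χ d ⊗ a d)) (∑ D (λ n → pw n ⊗ r χ n)) (∑ D (λ d → χ d ⊗ (a d ⊗ pw (d * (D ÷ d))))) (# M) (# D) (pw D) (# J)))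
        where
        e₁ : κF ⊗ 𝓛 D ≡ ∑ D (λ d → χ d ⊗ b d) ⊕ ∑ D (λ d → χ d ⊗ a d)
        e₁ = trans (sym (∑-⊗ D κF _)) (trans (∑-ext D (λ d → (solve 4 (λ a b c d → a :* (b :* c) := b :* (a :* c :- d) :+ b :* d) refl κF (χ d) (⅟ d) (a d)))) (∑-⊕ D _ _))
        e₂ : ∑ D (λ d → χ d ⊗ a d) ≡ ∑ D (λ n → pw n ⊗ r χ n) ⊕ ∑ D (λ d → χ d ⊗ (a d ⊗ pw (d * (D ÷ d))))
        e₂ = trans (∑-cong D (λ d p _ → (≼-antisym (lin 0 (1 · (≡≼ (cong (χ d ⊗_) (a-tail d (D ÷ d) p)))) (solve 4 (λ a b c d → a :* c :+ a :* (b :* d) :- a :* b := a :* (b :* d) :- a :* (b :- c)) refl (χ d) (a d) (∑ (D ÷ d) (λ j → pw (d * j))) (pw (d * (D ÷ d))))) (lin 0 (1 · (≡≽ (cong (χ d ⊗_) (a-tail d (D ÷ d) p)))) (solve 4 (λ a b c d → a :* b :- (a :* c :+ a :* (b :* d)) := a :* (b :- c) :- a :* (b :* d)) refl (χ d) (a d) (∑ (D ÷ d) (λ j → pw (d * j))) (pw (d * (D ÷ d)))))))) (trans (∑-⊕ D _ _) (cong (_⊕ ∑ D (λ d → χ d ⊗ (a d ⊗ pw (d * (D ÷ d))))) (sym ∑r)))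

    L-lower : ∀ z → D ≤ z → # 1 ≼ # 2 ⊗ # k ⊗ 𝓛 z
    L-lower z p = (lin 0 (2 · at-D ⊞ 2 · (⊗-monoʳ κ-nn (proj₂ (tail D z p))) ⊞ 1 · small) (solve 5 (λ a b c d e → κ 2 :* a :* b :- κ 1 := κ 2 :* (a :* c :- κ 1) :+ (κ 2 :* (a :* (b :- c) :- a :* :- (κ 2 :* d :* e)) :+ (κ 1 :- κ 4 :* (d :* (a :* e))))) refl κF (𝓛 z) (𝓛 D) (# M) (⅟ (suc D))))
      where
      M≤k : 2 * M ≤ k
      M≤k = ℕP.≤-trans (ℕP.m≤m+n (2 * M) 4) (ℕP.≤-trans (ℕP.m≤m*n J J {{ℕ.>-nonZero 1≤J}}) (ℕP.m≤n*m (J * J) 2))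
      small : # 4 ⊗ (# M ⊗ (κF ⊗ ⅟ (suc D))) ≼ # 1
      small = ≼-trans (≡≼ (trans (solve 3 (λ a b c → κ 4 :* (a :* (b :* c)) := κ 2 :* (κ 2 :* a :* b) :* c) refl (# M) κF (⅟ (suc D))) (cong (_⊗ ⅟ (suc D)) (sym (trans (#-* 2 (2 * M * k)) (cong (# 2 ⊗_) (trans (#-* (2 * M) k) (cong (_⊗ κF) (#-* 2 M)))))))))
        (≼-trans (⊗-monoˡ (⅟-nn (suc D)) (#-mono {2 * (2 * M * k)} {suc D} (ℕP.m≤n⇒m≤1+n (ℕP.≤-trans (ℕP.*-monoʳ-≤ 2 (ℕP.*-monoˡ-≤ k M≤k)) (ℕP.m≤n*m (2 * (k * k)) 3))))) (≡≼ (⅟-law {suc D} (s≤s z≤n))))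

  -- the constants, as variables: their closed forms are expensive to compare
  L-lower′ : ∀ {J k D} → J ≡ 2 * M + 4 → k ≡ 2 * (J * J) → D ≡ 3 * (2 * (k * k)) →
    ∀ (χ : ℕ → F) (q : Quadratic χ) (per : ∀ i → χ (M + i) ≡ χ i) (∑χ : ∑ M χ ≡ # 0) → ∀ z → D ≤ z → # 1 ≼ # 2 ⊗ # k ⊗ Bound.𝓛 χ q per ∑χ z
  L-lower′ refl refl refl χ q per ∑χ = Bound.L-lower χ q per ∑χ

-- Primes in arithmetic progressions.

module Dirichlet where
  open Field
  open Sums
  open NumTh
  open Log
  open LOne

  ∑-⅟² : ∀ n → ∑ n (λ i → ⅟ i ⊗ ⅟ i) ≼ # 2
  ∑-⅟² zero = 0≼# 2
  ∑-⅟² (suc n) = (lin 0 (1 · (go n) ⊞ 1 · (⅟-nn (suc n))) (solve 2 (λ a b → κ 2 :- a := κ 2 :- (a :+ b) :+ (b :- κ 0)) refl (∑ (suc n) f) (⅟ (suc n))))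
    where
    f : ℕ → F
    f i = ⅟ i ⊗ ⅟ i
    go : ∀ n → ∑ (suc n) f ⊕ ⅟ (suc n) ≼ # 2
    go zero = ≼-trans (≡≼ (cong (λ t → # 0 ⊕ t ⊗ t ⊕ t) ⅟-1)) (lin 0 (const 0) (solve 0 (κ 2 :- (κ 0 :+ κ 1 :* κ 1 :+ κ 1) := κ 0) refl))
    go (suc n) = (lin 0 (1 · (go n) ⊞ 1 · (⊗-monoˡ (⅟-nn (suc (suc n))) (⅟-anti {suc n} (s≤s z≤n) (ℕP.n≤1+n (suc n)))) ⊞ 1 · (≡≼ (cong (⅟ (suc n) ⊗_) (⅟-law {suc (suc n)} (s≤s z≤n)))) ⊞ 1 · (≡≽ (cong (s ⊗_) (⅟-law {suc n} (s≤s z≤n)))) ⊞ 1 · (≡≽ (cong ((⅟ (suc n) ⊗ s) ⊗_) (#-suc (suc n))))) (solve 5 (λ a b c d e → κ 2 :- (a :+ b :* b :+ b) := κ 2 :- (a :+ c) :+ (c :* b :- b :* b :+ (c :* κ 1 :- c :* (d :* b) :+ (b :* (e :* c) :- b :* κ 1 :+ (c :* b :* d :- c :* b :* (κ 1 :+ e)))))) refl (∑ (suc n) f) s (⅟ (suc n)) (# (suc (suc n))) (# (suc n))))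
      where s = ⅟ (suc (suc n))

  module _ (B : ℕ) (2≤B : 2 ≤ B) (lgB : LogLike B) (M : ℕ) {{M≢0 : NonZero M}} (M≤B : M ≤ B) where
    open Dich B 2≤B lgB M M≤B
    open LogLike lgB using (inc-up)

    module Twisted (χ : ℕ → F) (q : Quadratic χ) (per : ∀ k → χ (M + k) ≡ χ k) (∑χ : ∑ M χ ≡ # 0) (X : ℕ) (1≤X : 1 ≤ X) (X≤B : X ≤ B) where
      open Lambert M
      open Bound χ q per ∑χ using (𝓛; tail; partial)

      T : F
      T = ∑ X (λ n → χ n ⊗ w n)

      private
        E : F
        E = ∑ X (λ n → χ n ⊗ ⅟ n ⊗ L n)

        E≡ : E ≡ ∑ X (λ d → χ d ⊗ w d ⊗ 𝓛 (X ÷ d))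
        E≡ = trans (Λ∗1 X (λ n → χ n ⊗ ⅟ n)) (∑-cong X (λ d p _ → trans (sym (∑-⊗ (X ÷ d) (Λ d) _)) (trans (∑-cong (X ÷ d) (λ j r _ → trans (cong₂ (λ s t → Λ d ⊗ (s ⊗ t)) (Quadratic.mult q d j) (⅟-* p r)) (solve 5 (λ a b c d e → a :* (b :* c :* (d :* e)) := b :* (a :* d) :* (c :* e)) refl (Λ d) (χ d) (χ j) (⅟ d) (⅟ j)))) (∑-⊗ (X ÷ d) (χ d ⊗ w d) _))))

        v : ℕ → F
        v n = ⅟ n ⊗ L n

        -- `L n / n` rises from 0 before it falls, so its total variation is bounded instead of
        -- using monotone weights.
        v-var : ∀ i → 1 ≤ i → i < B → v i ⊖ v (suc i) ≲ # 2 ⊗ (⅟ i ⊗ ⅟ i) ⊕ L (suc i) ⊗ ⅟ (suc i) ⊗ ⅟ i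
        v-var i p r =
          (lin 0 (1 · (nn-⊗ (⅟-nn i) (inc-nn i p r)) ⊞ 1 · (≡≼ (cong (l ⊗_) (⅟-diff i p))) ⊞ 2 · (nn-⊗ (⅟-nn i) (⅟-nn i))) (solve 4 (λ a b c d → κ 2 :* (a :* a) :+ d :* c :* a :- (a :* b :- c :* d) := a :* (d :- b) :- κ 0 :+ (d :* (a :* c) :- d :* (a :- c) :+ κ 2 :* (a :* a :- κ 0))) refl (⅟ i) (L i) s l)) ,
          (lin 0 (1 · (⊗-monoʳ (⅟-nn i) (inc-up i p r)) ⊞ 1 · (≡≽ (cong (l ⊗_) (⅟-diff i p))) ⊞ 2 · (nn-⊗ (nn-⊗ (L-nn {suc i} (s≤s z≤n) r) (⅟-nn (suc i))) (⅟-nn i))) (solve 4 (λ a b c d → a :* d :- c :* b :- :- (κ 2 :* (a :* a) :+ b :* c :* a) := a :* (κ 2 :* a) :- a :* (b :- d) :+ (b :* (a :- c) :- b :* (a :* c) :+ κ 2 :* (b :* c :* a :- κ 0))) refl (⅟ i) l s (L i)))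
          where
          l = L (suc i)
          s = ⅟ (suc i)

        E-bound : E ≲ # 10 ⊗ m
        E-bound = go X 1≤X X≤B
          where
          go : ∀ x → 1 ≤ x → x ≤ B → ∑ x (λ n → χ n ⊗ ⅟ n ⊗ L n) ≲ # 10 ⊗ m
          go (suc n) _ r = ≲-subst (trans (sym (∑-abel n χ v)) (∑-ext (suc n) (λ i → (solve 3 (λ a b c → a :* (b :* c) := a :* b :* c) refl (χ i) (⅟ i) (L i)))))
            (≲-weaken (≲-⊕ (≲-⊗ (partial (suc n)) (≲-nn (nn-⊗ (⅟-nn (suc n)) (L-nn {suc n} (s≤s z≤n) r)))) (∑-≲ n (λ i p i≤n → ≲-⊗ (partial i) (v-var i p (ℕP.<-≤-trans (s≤s i≤n) r)))))
            (≼-trans (≡≼ (cong (m ⊗ v (suc n) ⊕_) (trans (∑-⊗ n m _) (cong (m ⊗_) (trans (∑-⊕ n _ _) (cong (_⊕ ∑ n (λ i → L (suc i) ⊗ ⅟ (suc i) ⊗ ⅟ i)) (∑-⊗ n (# 2) _)))))))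
             (lin 0 (1 · (⊗-monoʳ m-nn v≼2) ⊞ 2 · (⊗-monoʳ m-nn (∑-⅟² n)) ⊞ 1 · (⊗-monoʳ m-nn (∑-L/n² n r))) (solve 4 (λ a b c d → κ 10 :* a :- (a :* b :+ a :* (κ 2 :* c :+ d)) := a :* κ 2 :- a :* b :+ (κ 2 :* (a :* κ 2 :- a :* c) :+ (a :* κ 4 :- a :* d))) refl m (v (suc n)) (∑ n (λ i → ⅟ i ⊗ ⅟ i)) (∑ n (λ i → L (suc i) ⊗ ⅟ (suc i) ⊗ ⅟ i))))))
            where
            v≼2 : v (suc n) ≼ # 2
            v≼2 = (lin 0 (1 · (⊗-monoʳ (⅟-nn (suc n)) (L≼2n-2 (suc n) (s≤s z≤n) r)) ⊞ 2 · (≡≼ (⅟-law {suc n} (s≤s z≤n))) ⊞ 2 · (⅟-nn (suc n))) (solve 3 (λ a b c → κ 2 :- a :* b := a :* (κ 2 :* c :- κ 2) :- a :* b :+ (κ 2 :* (κ 1 :- c :* a) :+ κ 2 :* (a :- κ 0))) refl (⅟ (suc n)) (L (suc n)) (# (suc n))))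

        -- By `tail` the error in `𝓛 (X ÷ d)` is of order `m d / X`. With the weight `Λ d / d` it
        -- becomes `m Λ d / X`, whose sum is controlled by Chebyshev's bound; hence 2 · 12 = 24.
        diff : ∑ X (λ d → χ d ⊗ w d ⊗ (𝓛 (X ÷ d) ⊖ 𝓛 X)) ≲ # 24 ⊗ m
        diff = ≲-weaken (∑-≲ X (λ d p r → ≲-⊗ (≲-weaken (≲-⊗ (Quadratic.≲1 q d) (≲-nn (w-nn d (ℕP.≤-trans r X≤B)))) (≡≼ (solve 1 (λ a → κ 1 :* a := a) refl (w d)))) (flip (tail (X ÷ d) X (÷-≤-x X d)))))
            (≼-trans (∑-mono X (λ d p r → term d p r)) (≼-trans (≡≼ (∑-⊗ X (# 2 ⊗ m ⊗ ⅟ X) Λ)) (≼-trans (⊗-monoʳ (nn-⊗ (nn-⊗ (0≼# 2) m-nn) (⅟-nn X)) (chebyshev X X≤B)) (≡≼ (trans (solve 3 (λ a b c → κ 2 :* a :* b :* (κ 12 :* c) := κ 24 :* a :* (c :* b)) refl m (⅟ X) (# X)) (trans (cong (# 24 ⊗ m ⊗_) (⅟-law 1≤X)) (solve 1 (λ a → κ 24 :* a :* κ 1 := κ 24 :* a) refl m)))))))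
          where
          flip : ∀ {a b c} → a ⊖ b ≲ c → b ⊖ a ≲ c
          flip {a} {b} {c} (p , r) = (lin 0 (1 · r) (solve 3 (λ a b c → c :- (a :- b) := b :- a :- :- c) refl b a c)) , (lin 0 (1 · p) (solve 3 (λ a b c → b :- c :- :- a := a :- (c :- b)) refl c b a))
          term : ∀ d → 1 ≤ d → d ≤ X → w d ⊗ (# 2 ⊗ m ⊗ ⅟ (suc (X ÷ d))) ≼ # 2 ⊗ m ⊗ ⅟ X ⊗ Λ d
          term d p r = ≼-trans (⊗-monoʳ wd (⊗-monoʳ (nn-⊗ (0≼# 2) m-nn) inv≼)) (≡≼ (trans (solve 5 (λ a b c d e → a :* b :* (κ 2 :* c :* (d :* e)) := κ 2 :* c :* e :* a :* (d :* b)) refl (Λ d) (⅟ d) m (# d) (⅟ X)) (trans (cong (# 2 ⊗ m ⊗ ⅟ X ⊗ Λ d ⊗_) (⅟-law p)) (solve 3 (λ a b c → κ 2 :* a :* b :* c :* κ 1 := κ 2 :* a :* b :* c) refl m (⅟ X) (Λ d)))))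
            where
            wd = w-nn d (ℕP.≤-trans r X≤B)
            Y = suc (X ÷ d)
            inv≼ : ⅟ Y ≼ # d ⊗ ⅟ X
            inv≼ = (lin 0 (1 · (⊗-monoʳ (nn-⊗ (⅟-nn Y) (⅟-nn X)) (≼-trans (#-mono (ℕP.<⇒≤ (<-suc÷ X d p))) (≡≼ (#-* d Y)))) ⊞ 1 · (≡≽ (cong (⅟ Y ⊗_) (⅟-law 1≤X))) ⊞ 1 · (≡≼ (cong (# d ⊗ ⅟ X ⊗_) (⅟-law {Y} (s≤s z≤n))))) (solve 5 (λ a b c d e → b :* c :- a := a :* c :* (b :* e) :- a :* c :* d :+ (a :* (d :* c) :- a :* κ 1 :+ (b :* c :* κ 1 :- b :* c :* (e :* a)))) refl (⅟ Y) (# d) (⅟ X) (# X) (# Y)))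

      -- The sum `E` of `χ n L n / n` is bounded by partial summation. By `Λ∗1` it is also the sum
      -- of `χ d w d 𝓛 (X ÷ d)`, hence `𝓛 X T` up to `diff`.
      𝓛T-bound : ⊝ (# 34 ⊗ m) ≼ 𝓛 X ⊗ T
      𝓛T-bound = (lin 0 (1 · (proj₂ E-bound) ⊞ 1 · (proj₁ diff) ⊞ 1 · (≡≽ e)) (solve 5 (λ a b c d e → b :* c :- :- (κ 34 :* a) := d :- :- (κ 10 :* a) :+ (κ 24 :* a :- e :+ (e :- (d :- c :* b)))) refl m (𝓛 X) T E (∑ X (λ d → χ d ⊗ w d ⊗ (𝓛 (X ÷ d) ⊖ 𝓛 X)))))
        where
        e : ∑ X (λ d → χ d ⊗ w d ⊗ (𝓛 (X ÷ d) ⊖ 𝓛 X)) ≡ E ⊖ T ⊗ 𝓛 X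
        e = trans (∑-ext X (λ d → (solve 4 (λ a b c d → a :* b :* (c :- d) := a :* b :* c :- a :* b :* d) refl (χ d) (w d) (𝓛 (X ÷ d)) (𝓛 X)))) (trans (∑-⊖ X _ _) (cong₂ _⊖_ (sym E≡) (∑-⊗ʳ X (𝓛 X) _)))

  private
   -- The constants as natural numbers, known only through these equations and inequalities so that
   -- they are never unfolded. The outer factors 4 come from `1≼4L2`: an exponent of at least `4 c`
   -- makes `L (2 ^ j)` at least `c`.
   record Constants (M : ℕ) : Set where
    constructor constants
    field
      kN HN KN JN lN DN j₀ j₁ : ℕ
      kN= : kN ≡ 72 * (M * M)
      HN= : HN ≡ 64 * (M * M) * (kN * kN)
      KN= : KN ≡ 192 * (M * M)
      JN= : JN ≡ 2 * M + 4
      lN= : lN ≡ 2 * (JN * JN)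
      DN= : DN ≡ 3 * (2 * (lN * lN))
      j₀= : 4 * (2 * KN * HN) ≤ j₀
      le₁ : 4 * (HN * (M * (2 * j₀ + 12))) ≤ j₁
      le₂ : 4 * (3 * KN * HN) ≤ j₁
      le₃ : 4 * (32 * (M * M * M * kN)) ≤ j₁
      le₄ : 4 * (4 * lN * M) ≤ j₁
      le₅ : DN ≤ j₁
      le₆ : j₀ ≤ j₁
      le₇ : M ≤ j₁

   module Core (M : ℕ) {{_ : NonZero M}} (l : ℕ) (cl : Coprime l M) (cs : Constants M) where
    open Constants cs
    x₁ X B n₀ : ℕ
    -- Powers of 2 make `L X = kN L x₁` an exact identity.
    x₁ = 2 ^ j₁
    X = 2 ^ (j₁ * kN)
    B = 2 * X
    n₀ = 2 ^ j₀
    1≤2^ : ∀ n → 1 ≤ 2 ^ n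
    1≤2^ n = ℕP.m^n>0 2 n
    1≤M : 1 ≤ M
    1≤M = ℕ.>-nonZero⁻¹ M
    1≤kN : 1 ≤ kN
    1≤kN = ℕP.≤-trans (ℕP.≤-trans (ℕP.*-mono-≤ 1≤M 1≤M) (ℕP.m≤n*m (M * M) 72)) (ℕP.≤-reflexive (sym kN=))
    j₁≤ : j₁ ≤ j₁ * kN
    j₁≤ = ℕP.m≤m*n j₁ kN {{ℕ.>-nonZero 1≤kN}}
    j≤X : ∀ {j} → j ≤ j₁ → j ≤ X
    j≤X p = ℕP.≤-trans p (ℕP.≤-trans j₁≤ (ℕP.<⇒≤ (n<2^n (j₁ * kN))))
    X≤B : X ≤ B
    X≤B = ℕP.m≤n*m X 2
    2≤B : 2 ≤ B
    2≤B = ℕP.*-monoʳ-≤ 2 (1≤2^ (j₁ * kN))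
    M≤B : M ≤ B
    M≤B = ℕP.≤-trans (j≤X le₇) X≤B
    n₀≤X : n₀ ≤ X
    n₀≤X = ℕP.^-monoʳ-≤ 2 (ℕP.≤-trans le₆ j₁≤)
    x₁≤X : x₁ ≤ X
    x₁≤X = ℕP.^-monoʳ-≤ 2 j₁≤

    lgB : LogLike B
    lgB = logLike B (ℕP.≤-trans (s≤s z≤n) 2≤B)
    open Dich B 2≤B lgB M M≤B hiding (1≤M)

    L-2^ : ∀ j → L (2 ^ j) ≡ # j ⊗ L 2
    L-2^ zero    = (solve 1 (λ a → κ 0 := κ 0 :* a) refl (L 2))
    L-2^ (suc j) = trans (L-* {2} {2 ^ j} (s≤s z≤n) (1≤2^ j)) (trans (cong (L 2 ⊕_) (L-2^ j)) (trans (solve 2 (λ a b → a :+ b :* a := (κ 1 :+ b) :* a) refl (L 2) (# j)) (cong (_⊗ L 2) (sym (#-suc j)))))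

    -- 4 L(2) ≥ 1, so 4 c ≤ j makes c a lower bound of L(2^j)
    L-2^≥ : ∀ {c j} → 4 * c ≤ j → # c ≼ L (2 ^ j)
    L-2^≥ {c} {j} p = (lin 3 (4 · (≡≽ (L-2^ j)) ⊞ 1 · (⊗-monoˡ (≼-trans 0≼1 (≼-trans 1≼4L2 (≼-refl))) (#-mono p)) ⊞ 1 · (≡≽ (cong (_⊗ (# 4 ⊗ L 2)) (#-* 4 c))) ⊞ 4 · (⊗-monoʳ (0≼# c) 1≼4L2)) (solve 5 (λ a b c d e → κ 4 :* (b :- a) := κ 4 :* (b :- c :* d) :+ (c :* (κ 4 :* d) :- e :* (κ 4 :* d) :+ (e :* (κ 4 :* d) :- κ 4 :* a :* (κ 4 :* d) :+ κ 4 :* (a :* (κ 4 :* d) :- a :* κ 1)))) refl (# c) (L (2 ^ j)) (# j) (L 2) (# (4 * c))))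

    kN≡ : # kN ≡ k̂
    kN≡ = trans (cong #_ kN=) (trans (#-* 72 (M * M)) (cong (# 72 ⊗_) (#-* M M)))
    KN≡ : # KN ≡ K
    KN≡ = trans (cong #_ KN=) (trans (#-* 192 (M * M)) (cong (# 192 ⊗_) (#-* M M)))
    HN≡ : # HN ≡ H
    HN≡ = trans (cong #_ HN=) (trans (#-* (64 * (M * M)) (kN * kN)) (cong₂ _⊗_ (trans (#-* 64 (M * M)) (cong (# 64 ⊗_) (#-* M M))) (trans (#-* kN kN) (cong₂ _⊗_ kN≡ kN≡))))

    big : # 2 ⊗ K ⊗ H ≼ L n₀
    big = ≼-trans (≡≼ (sym (trans (#-* (2 * KN) HN) (cong₂ _⊗_ (trans (#-* 2 KN) (cong (# 2 ⊗_) KN≡)) HN≡)))) (L-2^≥ {2 * KN * HN} j₀=)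

    U≡ : L X ≡ k̂ ⊗ L x₁
    U≡ = trans (L-2^ (j₁ * kN)) (trans (cong (_⊗ L 2) (#-* j₁ kN)) (trans (solve 3 (λ a b c → a :* b :* c := b :* (a :* c)) refl (# j₁) (# kN) (L 2)) (cong₂ _⊗_ kN≡ (sym (L-2^ j₁)))))

    L₁≼U : L x₁ ≼ L X
    L₁≼U = L-mono (1≤2^ j₁) x₁≤X X≤B

    Ubig : # 3 ⊗ K ⊗ H ≼ L X
    Ubig = ≼-trans (≡≼ (sym (trans (#-* (3 * KN) HN) (cong₂ _⊗_ (trans (#-* 3 KN) (cong (# 3 ⊗_) KN≡)) HN≡)))) (≼-trans (L-2^≥ {3 * KN * HN} le₂) L₁≼U)

    range : H ⊗ (m ⊗ (L n₀ ⊕ # 12)) ≼ L X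
    range = ≼-trans (⊗-monoʳ (≼-trans 0≼1 1≼H) (⊗-monoʳ m-nn (lin 0 (1 · (≡≼ (L-2^ j₀)) ⊞ 1 · (⊗-monoʳ (0≼# j₀) L2≼2)) (solve 3 (λ a b c → κ 2 :* b :+ κ 12 :- (a :+ κ 12) := b :* c :- a :+ (b :* κ 2 :- b :* c)) refl (L n₀) (# j₀) (L 2)))))
      (≼-trans (≡≼ (sym (trans (#-* HN (M * (2 * j₀ + 12))) (cong₂ _⊗_ HN≡ (trans (#-* M (2 * j₀ + 12)) (cong (m ⊗_) (trans (#-+ (2 * j₀) 12) (cong (_⊕ # 12) (#-* 2 j₀))))))))) (≼-trans (L-2^≥ {HN * (M * (2 * j₀ + 12))} le₁) L₁≼U))

    L₁big : # 32 ⊗ (m ⊗ m ⊗ m ⊗ k̂) ≼ L x₁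
    L₁big = ≼-trans (≡≼ (sym (trans (#-* 32 (M * M * M * kN)) (cong (# 32 ⊗_) (trans (#-* (M * M * M) kN) (cong₂ _⊗_ (trans (#-* (M * M) M) (cong (_⊗ m) (#-* M M))) kN≡)))))) (L-2^≥ {32 * (M * M * M * kN)} le₃)

    L₁big′ : # 4 ⊗ # lN ⊗ m ≼ L x₁
    L₁big′ = ≼-trans (≡≼ (sym (trans (#-* (4 * lN) M) (cong (_⊗ m) (#-* 4 lN))))) (L-2^≥ {4 * lN * M} le₄)

    -- The heavy classes have χ = -1 and carry all but `O(L x₁)` of the mass, so `- T` is close to
    -- `L X`. The lower bound for `𝓛 X` and `𝓛T-bound` keep `- T` below a constant depending on `M`
    -- only.
    refute : (∀ i → 1 ≤ i → i ≤ X → ¬ (Prime i × i % M ≡ l % M)) → ⊥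
    refute none = 1⋠0 (lin 191 (1 · lower ⊞ 1 · upper ⊞ 1 · (≡≽ U≡) ⊞ 72 · (nn-⊗ (sub-nn 1≼m²) L₁-nn) ⊞ 66 · L₁big′ ⊞ 196 · m≼lm ⊞ 192 · 1≼m) (solve 5 (λ a b c d e → κ 192 :* (κ 0 :- κ 1) := :- d :- (a :- κ 4 :* b :- κ 6 :* c) :+ (κ 68 :* (e :* b) :- :- d :+ (a :- κ 72 :* (b :* b) :* c :+ (κ 72 :* ((b :* b :- κ 1) :* c :- κ 0) :+ (κ 66 :* (c :- κ 4 :* e :* b) :+ (κ 196 :* (e :* b :- b) :+ κ 192 :* (b :- κ 1))))))) refl (L X) m (L x₁) T (# lN)))
      where
      Rl≼4 : R l X ≼ # 4
      Rl≼4 = ≼-trans (∑-mono X (λ n p r → ⊗-monoˡ (w-nn n (ℕP.≤-trans r X≤B)) (np n p r (n ≈? l) (prime? n)))) (composite-mass X X≤B)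
        where
        np : ∀ n → 1 ≤ n → n ≤ X → (a : Dec (n ≈ l)) (b : Dec (Prime n)) → 𝟙 a ≼ # 1 ⊖ 𝟙 b
        np n p r (yes e) (yes pr) = ⊥-elim (none n p r (pr , e))
        np n p r (yes _) (no _) = (lin 0 (const 0) (solve 0 (κ 1 :- κ 0 :- κ 1 := κ 0) refl))
        np n p r (no _) (yes _) = (lin 0 (const 0) (solve 0 (κ 1 :- κ 1 :- κ 0 := κ 0) refl))
        np n p r (no _) (no _) = (lin 0 (const 1) (solve 0 (κ 1 :- κ 0 :- κ 0 := κ 1) refl))
      sc : Scales
      sc = scales n₀ (1≤2^ j₀) big X n₀≤X ℕP.≤-refl range Ubig x₁ (1≤2^ j₁) x₁≤X U≡ L₁big l cl Rl≼4
      open Heavy sc hiding (X≤B; U)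
      open Chr M
      open Coset heavy heavy? heavy-cong half closed
      quad : Quadratic χ
      quad = record { mult = χ-* ; unit = χ-1 ; values = χ-values }
      per : ∀ k → χ (M + k) ≡ χ k
      per k = χ-cong (M+≈ k)
      open Twisted B 2≤B lgB M M≤B χ quad per ∑-χ X (1≤2^ (j₁ * kN)) X≤B
      open Lambert M
      open Bound χ quad per ∑-χ using (𝓛)

      light≡ : light ≡ ∑ X (λ n → u n ⊗ (# 1 ⊖ 𝟙 (heavy? n)) ⊗ w n)
      light≡ = trans (∑-ext M (λ b → trans (solve 3 (λ a b c → a :* ((κ 1 :- b) :* c) := a :* (κ 1 :- b) :* c) refl (u b) (𝟙 (heavy? b)) (R b X)) (sym (∑-⊗ X (u b ⊗ (# 1 ⊖ 𝟙 (heavy? b))) _)))) (trans (∑-swap M X _) (∑-ext X (λ n →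
          trans (∑-ext M (λ b → trans (cong (λ t → u b ⊗ (# 1 ⊖ 𝟙 (heavy? b)) ⊗ (t ⊗ w n)) (δ-sym n b)) (solve 4 (λ a b c d → a :* (κ 1 :- b) :* (c :* d) := c :* (a :* (κ 1 :- b)) :* d) refl (u b) (𝟙 (heavy? b)) (δ b n) (w n)))) (trans (∑-⊗ʳ M (w n) _) (cong (_⊗ w n) (∑-class n (λ b → u b ⊗ (# 1 ⊖ 𝟙 (heavy? b)))
            (λ {a} {b} e → cong₂ (λ s t → s ⊗ (# 1 ⊖ t)) (u-cong e) (𝟙-cong (heavy? a) (heavy? b) (heavy-cong e) (heavy-cong (sym e))))))))))

      T≡ : T ≡ # 2 ⊗ light ⊖ Wᵤ X
      T≡ = trans (∑-ext X (λ n → (solve 3 (λ a b c → a :* (κ 1 :- κ 2 :* b) :* c := κ 2 :* (a :* (κ 1 :- b) :* c) :- a :* c) refl (u n) (𝟙 (heavy? n)) (w n)))) (trans (∑-⊖ X _ _) (cong (_⊖ Wᵤ X) (trans (∑-⊗ X (# 2) _) (cong (# 2 ⊗_) (sym light≡)))))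

      lower : L X ⊖ # 4 ⊗ m ⊖ # 6 ⊗ L x₁ ≼ ⊝ T
      lower = (lin 0 (1 · (≡≼ T≡) ⊞ 2 · light≼ ⊞ 1 · (Wᵤ-lo X (1≤2^ (j₁ * kN)) X≤B)) (solve 6 (λ a b c d e f → :- d :- (a :- κ 4 :* b :- κ 6 :* c) := κ 2 :* e :- f :- d :+ (κ 2 :* (κ 3 :* c :- e) :+ (f :+ κ 4 :* b :- a))) refl (L X) m (L x₁) T light (Wᵤ X)))

      1≼lN : # 1 ≼ # lN
      1≼lN = #-mono (ℕP.≤-trans (ℕP.≤-trans (ℕP.*-mono-≤ 1≤JN 1≤JN) (ℕP.m≤n*m (JN * JN) 2)) (ℕP.≤-reflexive (sym lN=)))
        where
        1≤JN : 1 ≤ JN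
        1≤JN = ℕP.≤-trans (ℕP.≤-trans (s≤s z≤n) (ℕP.m≤n+m 4 (2 * M))) (ℕP.≤-reflexive (sym JN=))

      m≼lm : m ≼ # lN ⊗ m
      m≼lm = (lin 0 (1 · (nn-⊗ (sub-nn 1≼lN) m-nn)) (solve 2 (λ a b → b :* a :- a := (b :- κ 1) :* a :- κ 0) refl m (# lN)))

      0≼-T : # 0 ≼ ⊝ T
      0≼-T = ≼-trans (lin 0 (1 · (≡≽ U≡) ⊞ 72 · (nn-⊗ (sub-nn 1≼m²) L₁-nn) ⊞ 66 · L₁big′ ⊞ 264 · m≼lm ⊞ 260 · m-nn) (solve 4 (λ a b c d → a :- κ 4 :* b :- κ 6 :* c :- κ 0 := a :- κ 72 :* (b :* b) :* c :+ (κ 72 :* ((b :* b :- κ 1) :* c :- κ 0) :+ (κ 66 :* (c :- κ 4 :* d :* b) :+ (κ 264 :* (d :* b :- b) :+ κ 260 :* (b :- κ 0))))) refl (L X) m (L x₁) (# lN))) lower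

      -- As `- T` is nonnegative by `0≼-T`, it may be multiplied by `2 lN 𝓛 X`, which is at least 1;
      -- then `𝓛T-bound` applies.
      upper : ⊝ T ≼ # 68 ⊗ (# lN ⊗ m)
      upper = (lin 0 (1 · (nn-⊗ 0≼-T (sub-nn (L-lower′ JN= lN= DN= χ quad per ∑-χ X (j≤X le₅)))) ⊞ 1 · (⊗-monoʳ (nn-⊗ (0≼# 2) (0≼# lN)) 𝓛T-bound)) (solve 4 (λ a b c d → κ 68 :* (b :* c) :- :- a := :- a :* (κ 2 :* b :* d :- κ 1) :- κ 0 :+ (κ 2 :* b :* (d :* a) :- κ 2 :* b :* :- (κ 34 :* c))) refl T (# lN) m (𝓛 X)))

    result : ∃ λ p → Prime p × p % M ≡ l % M
    result with search (λ i → prime? i ×-dec (i % M ≟ l % M)) X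
    ... | inj₁ r    = r
    ... | inj₂ none = ⊥-elim (refute none)

  private
    existence : ∀ M {{_ : NonZero M}} l → Coprime l M → ∃ λ p → Prime p × p % M ≡ l % M
    existence M l cl = step (72 * (M * M)) refl (192 * (M * M)) refl (2 * M + 4) refl
      where
      -- The constants enter as bound variables together with their equations, so that instantiating
      -- `Core` does not normalise them.
      module _ (kN : ℕ) (kN= : kN ≡ 72 * (M * M)) (KN : ℕ) (KN= : KN ≡ 192 * (M * M)) (JN : ℕ) (JN= : JN ≡ 2 * M + 4) where
        step₃ : ∀ HN → HN ≡ 64 * (M * M) * (kN * kN) → ∀ lN → lN ≡ 2 * (JN * JN) → ∀ DN → DN ≡ 3 * (2 * (lN * lN)) → ∀ j₀ → 4 * (2 * KN * HN) ≤ j₀ →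
          ∀ c₁ → 4 * (HN * (M * (2 * j₀ + 12))) ≤ c₁ → ∀ c₂ → 4 * (3 * KN * HN) ≤ c₂ → ∀ c₃ → 4 * (32 * (M * M * M * kN)) ≤ c₃ → ∀ c₄ → 4 * (4 * lN * M) ≤ c₄ → ∃ λ p → Prime p × p % M ≡ l % M
        step₃ HN HN= lN lN= DN DN= j₀ j₀= c₁ e₁ c₂ e₂ c₃ e₃ c₄ e₄ = Core.result M l cl (constants kN HN KN JN lN DN j₀ (c₁ + (c₂ + (c₃ + (c₄ + (DN + (j₀ + M)))))) kN= HN= KN= JN= lN= DN= j₀=
          (ℕP.≤-trans e₁ (ℕP.m≤m+n c₁ _)) (ℕP.≤-trans e₂ (ℕP.≤-trans (ℕP.m≤m+n c₂ _) (ℕP.m≤n+m _ c₁))) (ℕP.≤-trans e₃ (ℕP.≤-trans (ℕP.m≤m+n c₃ _) f₂)) (ℕP.≤-trans e₄ (ℕP.≤-trans (ℕP.m≤m+n c₄ _) f₃))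
          (ℕP.≤-trans (ℕP.m≤m+n DN _) f₄) (ℕP.≤-trans (ℕP.m≤m+n j₀ M) f₅) (ℕP.≤-trans (ℕP.m≤n+m M j₀) f₅))
          where
          f₂ : c₃ + (c₄ + (DN + (j₀ + M))) ≤ c₁ + (c₂ + (c₃ + (c₄ + (DN + (j₀ + M)))))
          f₂ = ℕP.≤-trans (ℕP.m≤n+m _ c₂) (ℕP.m≤n+m _ c₁)
          f₃ : c₄ + (DN + (j₀ + M)) ≤ c₁ + (c₂ + (c₃ + (c₄ + (DN + (j₀ + M)))))
          f₃ = ℕP.≤-trans (ℕP.m≤n+m _ c₃) f₂
          f₄ : DN + (j₀ + M) ≤ c₁ + (c₂ + (c₃ + (c₄ + (DN + (j₀ + M)))))
          f₄ = ℕP.≤-trans (ℕP.m≤n+m _ c₄) f₃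
          f₅ : j₀ + M ≤ c₁ + (c₂ + (c₃ + (c₄ + (DN + (j₀ + M)))))
          f₅ = ℕP.≤-trans (ℕP.m≤n+m _ DN) f₄
        step₂ : ∀ HN → HN ≡ 64 * (M * M) * (kN * kN) → ∀ lN → lN ≡ 2 * (JN * JN) → ∃ λ p → Prime p × p % M ≡ l % M
        step₂ HN HN= lN lN= = step₃ HN HN= lN lN= _ refl _ ℕP.≤-refl _ ℕP.≤-refl _ ℕP.≤-refl _ ℕP.≤-refl _ ℕP.≤-refl
        step : ∃ λ p → Prime p × p % M ≡ l % M
        step = step₂ _ refl _ refl

  abstract
    dirichlet : ∀ M {{_ : NonZero M}} l → Coprime l M → ∃ λ p → Prime p × p % M ≡ l % M
    dirichlet = existence

-- Euler's theorem and roots of polynomials modulo a prime.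

module Roots where
  open Field
  open Sums
  open NumTh

  Π : ℕ → (ℕ → ℕ) → ℕ
  Π zero    f = 1
  Π (suc n) f = Π n f * f (suc n)

  ⟦_⟧ : {A : Set} → Dec A → ℕ
  ⟦ yes _ ⟧ = 1
  ⟦ no _ ⟧  = 0

  #⟦⟧ : {A : Set} (d : Dec A) → # ⟦ d ⟧ ≡ 𝟙 d
  #⟦⟧ (yes _) = refl
  #⟦⟧ (no _)  = refl

  Π-cong : ∀ n {f g : ℕ → ℕ} → (∀ i → 1 ≤ i → i ≤ n → f i ≡ g i) → Π n f ≡ Π n g
  Π-cong zero    h = refl
  Π-cong (suc n) h = cong₂ _*_ (Π-cong n (λ i p q → h i p (ℕP.m≤n⇒m≤1+n q))) (h (suc n) (s≤s z≤n) ℕP.≤-refl)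

  Π-* : ∀ n (f g : ℕ → ℕ) → Π n (λ i → f i * g i) ≡ Π n f * Π n g
  Π-* zero    f g = refl
  Π-* (suc n) f g = trans (cong (_* (f (suc n) * g (suc n))) (Π-* n f g)) (shuffle (Π n f) (Π n g) (f (suc n)) (g (suc n)))
    where
    shuffle : ∀ a b c d → a * b * (c * d) ≡ a * c * (b * d)
    shuffle = solve-∀

  Π-1 : ∀ n {f : ℕ → ℕ} → (∀ i → 1 ≤ i → i ≤ n → f i ≡ 1) → Π n f ≡ 1
  Π-1 zero    h = refl
  Π-1 (suc n) h = cong₂ _*_ (Π-1 n (λ i p q → h i p (ℕP.m≤n⇒m≤1+n q))) (h (suc n) (s≤s z≤n) ℕP.≤-refl)

  Π-single : ∀ {k n} (g : ℕ → ℕ) → 1 ≤ k → k ≤ n → Π n (λ c → g c ^ ⟦ c ≟ k ⟧) ≡ g k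
  Π-single {k} {zero} g p q = ⊥-elim (ℕP.<⇒≱ p q)
  Π-single {k} {suc n} g p q with suc n ≟ k
  ... | yes refl = trans (cong₂ _*_ (Π-1 n (λ i _ b → off i b)) (ℕP.^-identityʳ (g k))) (ℕP.*-identityˡ (g k))
    where
    off : ∀ i → i ≤ n → g i ^ ⟦ i ≟ suc n ⟧ ≡ 1
    off i b with i ≟ suc n
    ... | yes e = ⊥-elim (ℕP.<⇒≢ (s≤s b) e)
    ... | no _ = refl
  ... | no ne = trans (ℕP.*-identityʳ _) (Π-single g p (ℕP.≤-pred (ℕP.≤∧≢⇒< q (λ e → ne (sym e)))))

  cnt : (ℕ → ℕ) → ℕ → ℕ → ℕ
  cnt σ zero    c = 0
  cnt σ (suc n) c = cnt σ n c + ⟦ c ≟ σ (suc n) ⟧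

  #-cnt : ∀ σ n c → # cnt σ n c ≡ ∑ n (λ b → 𝟙 (c ≟ σ b))
  #-cnt σ zero    c = refl
  #-cnt σ (suc n) c = trans (#-+ (cnt σ n c) ⟦ c ≟ σ (suc n) ⟧) (cong₂ _⊕_ (#-cnt σ n c) (#⟦⟧ (c ≟ σ (suc n))))

  -- Collects the factors by the value of `σ`. When all fibres have one element, this is invariance
  -- of a product under a permutation.
  Π-fibres : ∀ n N (σ g : ℕ → ℕ) → (∀ b → 1 ≤ b → b ≤ n → 1 ≤ σ b × σ b ≤ N) → Π n (λ b → g (σ b)) ≡ Π N (λ c → g c ^ cnt σ n c)
  Π-fibres zero    N σ g h = sym (Π-1 N (λ _ _ _ → refl))
  Π-fibres (suc n) N σ g h = sym (trans (Π-cong N (λ c _ _ → ℕP.^-distribˡ-+-* (g c) (cnt σ n c) ⟦ c ≟ σ (suc n) ⟧)) (trans (Π-* N _ _)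
    (cong₂ _*_ (sym (Π-fibres n N σ g (λ b p q → h b p (ℕP.m≤n⇒m≤1+n q)))) (Π-single g (proj₁ hn) (proj₂ hn)))))
    where hn = h (suc n) (s≤s z≤n) ℕP.≤-refl

  module Euler (M : ℕ) {{M≢0 : NonZero M}} where
    open Cls M

    ≈-^ : ∀ {a b} n → a ≈ b → a ^ n ≈ b ^ n
    ≈-^ zero    e = refl
    ≈-^ (suc n) e = ≈-* e (≈-^ n e)

    ≈-1^ : ∀ {a} n → a ≈ 1 → a ^ n ≈ 1
    ≈-1^ n e = trans (≈-^ n e) (≈-reflexive (ℕP.^-zeroˡ n))

    ≈-Π : ∀ n {f g : ℕ → ℕ} → (∀ i → f i ≈ g i) → Π n f ≈ Π n g
    ≈-Π zero    h = refl
    ≈-Π (suc n) h = ≈-* (≈-Π n h) (h (suc n))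

    coprime-^ : ∀ {a} n → Coprime a M → Coprime (a ^ n) M
    coprime-^ zero    c = coprime-1
    coprime-^ (suc n) c = coprime-* c (coprime-^ n c)

    cancelʳ : ∀ {a b c} → Coprime c M → a * c ≈ b * c → a ≈ b
    cancelʳ {a} {b} {c} cc e = trans (⊘-solve {c} {a} {b * c} cc (trans (≈-reflexive (ℕP.*-comm c a)) e)) (sym (⊘-solve {c} {b} {b * c} cc (≈-reflexive (ℕP.*-comm c b))))

    private
      -- The exponent is 1 at units and 0 elsewhere, so that a product over 1, ..., M sees only the
      -- units.
      g e : ℕ → ℕ
      e b = ⟦ coprime? b M ⟧
      g b = b ^ e b

      g-unit : ∀ b → Coprime (g b) M
      g-unit b with coprime? b M
      ... | yes c = coprime-^ 1 c
      ... | no _ = coprime-1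

      Πg-unit : ∀ n → Coprime (Π n g) M
      Πg-unit zero = coprime-1
      Πg-unit (suc n) = coprime-* (Πg-unit n) (g-unit (suc n))

      sum : ℕ → ℕ
      sum zero    = 0
      sum (suc n) = sum n + e (suc n)

      Π-^ : ∀ x n → Π n (λ b → x ^ e b) ≡ x ^ sum n
      Π-^ x zero    = refl
      Π-^ x (suc n) = trans (cong (_* x ^ e (suc n)) (Π-^ x n)) (sym (ℕP.^-distribˡ-+-* x (sum n) (e (suc n))))

    units : ℕ
    units = sum M

    #-units : # units ≡ N
    #-units = go M
      where
      go : ∀ n → # sum n ≡ ∑ n u
      go zero    = refl
      go (suc n) = trans (#-+ (sum n) (e (suc n))) (cong₂ _⊕_ (go n) (#⟦⟧ (coprime? (suc n) M)))

    euler : ∀ {x} → Coprime x M → x ^ units ≈ 1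
    euler {x} cx = cancelʳ {x ^ units} {1} (Πg-unit M) (trans (≈-reflexive (trans (cong (_* Π M g) (sym (Π-^ x M))) (sym (Π-* M (λ b → x ^ e b) g)))) (trans (sym (≈-Π M pt)) (≈-reflexive (trans (trans (Π-fibres M M σ g (λ b _ _ → rep-≥1 (x * b) , rep-≤M (x * b))) (Π-cong M (λ c p q → trans (cong (g c ^_) (one c p q)) (ℕP.^-identityʳ (g c))))) (sym (ℕP.*-identityˡ (Π M g)))))))
      where
      σ : ℕ → ℕ
      σ b = rep (x * b)
      one : ∀ c → 1 ≤ c → c ≤ M → cnt σ M c ≡ 1
      one c p q = #-injective (trans (#-cnt σ M c) (trans (∑-ext M (λ b → trans (𝟙-cong (c ≟ σ b) (x * b ≈? c) (λ eq → sym (trans (≈-reflexive eq) (rep-≈ (x * b)))) (λ eq → rep-unique p q (rep-≥1 (x * b)) (rep-≤M (x * b)) (trans (sym eq) (sym (rep-≈ (x * b)))))) (δ-⊘ b c cx))) (∑-δ (c ⊘ x))))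
      pt : ∀ b → g (σ b) ≈ x ^ e b * g b
      pt b with coprime? b M | coprime? (σ b) M
      ... | yes c | yes _ = trans (≈-reflexive (ℕP.*-identityʳ (σ b))) (trans (rep-≈ (x * b)) (≈-reflexive (cong₂ _*_ (sym (ℕP.*-identityʳ x)) (sym (ℕP.*-identityʳ b)))))
      ... | yes c | no nc = ⊥-elim (nc (coprime-≈ (sym (rep-≈ (x * b))) (coprime-* cx c)))
      ... | no nc | yes c = ⊥-elim (nc (coprime-*ʳ {x} {b} (coprime-≈ (rep-≈ (x * b)) c)))
      ... | no _  | no _  = refl

  -- Monic polynomial functions in Horner form with natural coefficients, enough for division by a
  -- linear factor without a ring of polynomials.
  data Monic : ℕ → (ℕ → ℕ) → Set where
    const : ∀ {f} → (∀ x → f x ≡ 1) → Monic 0 f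
    step  : ∀ {n f} c (h : ℕ → ℕ) → Monic n h → (∀ x → f x ≡ c + x * h x) → Monic (suc n) f

  monic-^ : ∀ n → Monic n (λ x → x ^ n)
  monic-^ zero    = const (λ _ → refl)
  monic-^ (suc n) = step 0 (λ x → x ^ n) (monic-^ n) (λ _ → refl)

  monic-+ : ∀ {n h g} a → Monic (suc n) h → Monic n g → Monic (suc n) (λ x → h x + a * g x)
  monic-+ {h = h} {g} a (step c h′ mh eh) (const eg) = step (c + a) h′ mh (λ x → trans (cong₂ (λ s t → s + a * t) (eh x) (eg x)) (lemma c (x * h′ x) a))
    where
    lemma : ∀ c y a → c + y + a * 1 ≡ c + a + y
    lemma = solve-∀
  monic-+ {h = h} {g} a (step c h′ mh eh) (step c′ g′ mg eg) = step (c + a * c′) (λ x → h′ x + a * g′ x) (monic-+ a mh mg) (λ x → trans (cong₂ (λ s t → s + a * t) (eh x) (eg x)) (lemma c x (h′ x) a c′ (g′ x)))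
    where
    lemma : ∀ c x y a c′ z → c + x * y + a * (c′ + x * z) ≡ c + a * c′ + x * (y + a * z)
    lemma = solve-∀

  -- f x - f a = (x - a) g x, with the terms arranged so that no subtraction occurs
  divide : ∀ {n f} a → Monic (suc n) f → ∃ λ g → Monic n g × (∀ x → f x + a * g x ≡ f a + x * g x)
  divide {zero} {f} a (step c h (const eh) ef) = h , const eh , λ x → trans (cong₂ (λ s t → s + a * t) (trans (ef x) (cong (λ t → c + x * t) (eh x))) (eh x)) (trans (lemma c x a) (sym (cong₂ (λ s t → s + x * t) (trans (ef a) (cong (λ t → c + a * t) (eh a))) (eh x))))
    where
    lemma : ∀ c x a → c + x * 1 + a * 1 ≡ c + a * 1 + x * 1
    lemma = solve-∀
  divide {suc n} {f} a (step c h mh ef) with divide a mh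
  ... | g , mg , eg = (λ x → h x + a * g x) , monic-+ a mh mg , λ x → trans (cong (_+ a * (h x + a * g x)) (ef x)) (trans (trans (l₁ c x (h x) a (g x)) (cong (λ t → c + x * h x + a * t) (eg x))) (trans (l₂ c x (h x) a (h a) (g x)) (cong (_+ x * (h x + a * g x)) (sym (ef a)))))
    where
    l₁ : ∀ c x y a z → c + x * y + a * (y + a * z) ≡ c + x * y + a * (y + a * z)
    l₁ = solve-∀
    l₂ : ∀ c x y a w z → c + x * y + a * (w + x * z) ≡ c + a * w + x * (y + a * z)
    l₂ = solve-∀

  module PrimeMod (q : ℕ) (pr : Prime q) where
    instance
      q≢0 : NonZero q
      q≢0 = prime⇒nonZero pr
    open Cls q public
    open Euler q public

    0<q : 0 < q
    0<q = ℕP.≤-trans (s≤s z≤n) (prime≥2 pr)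

    nonzero⇒unit : ∀ {n} → ¬ (n ≈ 0) → Coprime n q
    nonzero⇒unit {n} ne = coprime-≈ (DM.m%n%n≡m%n n q) (CP.sym (prime⇒coprime pr {{ℕ.≢-nonZero (λ e → ne (trans e (sym (DM.m<n⇒m%n≡m 0<q))))}} (DM.m%n<n n q)))

    1≉0 : ¬ (1 ≈ 0)
    1≉0 e with trans (sym (DM.m<n⇒m%n≡m (prime≥2 pr))) (trans e (DM.m<n⇒m%n≡m 0<q))
    ... | ()

    unit⇒nonzero : ∀ {n} → Coprime n q → ¬ (n ≈ 0)
    unit⇒nonzero {n} c e = ¬prime[1] (subst Prime (coprime-≈ {n} {0} e c (divides 0 refl , divides 1 (sym (ℕP.*-identityˡ q)))) pr)

    -- a polynomial takes the value of a at no more other points than the quotient has roots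
    value-count : ∀ {n f} v → Monic (suc n) f → (∀ {g} → Monic n g → ∑ q (λ x → 𝟙 (g x ≈? 0)) ≼ # n) → ∑ q (λ x → 𝟙 (f x ≈? v)) ≼ # (suc n)
    value-count {n} {f} v mf ih with search (λ a → f a ≈? v) q
    ... | inj₂ none = ≼-trans (≡≼ (∑-0 q (λ x p r → 𝟙-no (f x ≈? v) (none x p r)))) (0≼# (suc n))
    ... | inj₁ (a , fa) with divide a mf
    ...   | g , mg , eg = ≼-trans (∑-mono q (λ x _ _ → pt x (f x ≈? v) (x ≈? a) (g x ≈? 0))) (≼-trans (≡≼ (∑-⊕ q _ _)) (≼-trans (⊕-mono (≡≼ (∑-δ a)) (ih mg)) (≡≽ (#-suc n))))
      where
      pt : ∀ x (s : Dec (f x ≈ v)) (t : Dec (x ≈ a)) (z : Dec (g x ≈ 0)) → 𝟙 s ≼ 𝟙 t ⊕ 𝟙 z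
      pt x (no _) t z = (lin 0 (1 · (𝟙-nn t) ⊞ 1 · (𝟙-nn z)) (solve 2 (λ a b → a :+ b :- κ 0 := a :- κ 0 :+ (b :- κ 0)) refl (𝟙 t) (𝟙 z)))
      pt x (yes _) (yes _) z = (lin 0 (1 · (𝟙-nn z)) (solve 1 (λ a → κ 1 :+ a :- κ 1 := a :- κ 0) refl (𝟙 z)))
      pt x (yes _) (no _) (yes _) = (lin 0 (const 0) (solve 0 (κ 0 :+ κ 1 :- κ 1 := κ 0) refl))
      pt x (yes fx) (no x≉a) (no gx) = ⊥-elim (x≉a (cancelʳ {x} {a} (nonzero⇒unit gx) (sym (add-cancel (trans (≈-+ {v} {f x} (sym fx) (refl {x = a * g x % q})) (trans (≈-reflexive (eg x)) (≈-+ {f a} {v} fa (refl {x = x * g x % q}))))))))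
        where
        add-cancel : ∀ {c a b} → c + a ≈ c + b → a ≈ b
        add-cancel {c} {a} {b} e = trans (sym (*M≈0 a c)) (trans (≈-reflexive (l a)) (trans (≈-+ {c + a} {c + b} {c * (q ∸ 1)} e refl) (trans (≈-reflexive (sym (l b))) (*M≈0 b c))))
          where
          l : ∀ a → a + c * q ≡ c + a + c * (q ∸ 1)
          l a = trans (cong (λ t → a + c * t) (sym (ℕP.m+[n∸m]≡n 0<q))) (l′ a c (q ∸ 1))
            where l′ : ∀ a c t → a + c * (1 + t) ≡ c + a + c * t
                  l′ = solve-∀

    roots : ∀ {n f} → Monic n f → ∑ q (λ x → 𝟙 (f x ≈? 0)) ≼ # n
    roots {zero} {f} (const ef) = ≡≼ (∑-0 q (λ x _ _ → 𝟙-no (f x ≈? 0) (λ e → 1≉0 (trans (≈-reflexive (sym (ef x))) e))))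
    roots {suc n} mf = value-count 0 mf roots

    power-count : ∀ e v → 1 ≤ e → ∑ q (λ x → 𝟙 (x ^ e ≈? v)) ≼ # e
    power-count (suc e) v _ = value-count v (monic-^ (suc e)) roots

    N≡q-1 : N ≡ # q ⊖ # 1
    N≡q-1 = trans (∑-ext q (λ x → split x (x ≈? 0) (coprime? x q))) (trans (∑-⊖ q _ _) (trans (cong₂ _⊖_ (∑-const q (# 1)) (∑-δ 0)) (solve 1 (λ a → a :* κ 1 :- κ 1 := a :- κ 1) refl (# q))))
      where
      split : ∀ x (s : Dec (x ≈ 0)) (t : Dec (Coprime x q)) → 𝟙 t ≡ # 1 ⊖ 𝟙 s
      split x (yes e) (yes c) = ⊥-elim (unit⇒nonzero c e)
      split x (yes e) (no _) = (solve 0 (κ 0 := κ 1 :- κ 1) refl)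
      split x (no ne) (yes c) = (solve 0 (κ 1 := κ 1 :- κ 0) refl)
      split x (no ne) (no nc) = ⊥-elim (nc (nonzero⇒unit ne))

    units≡ : units ≡ q ∸ 1
    units≡ = #-injective (trans #-units (trans N≡q-1 (≼-antisym (lin 0 (1 · (≡≼ (trans (cong #_ (sym (ℕP.m+[n∸m]≡n 0<q))) (#-+ 1 (q ∸ 1))))) (solve 2 (λ a b → b :- (a :- κ 1) := κ 1 :+ b :- a) refl (# q) (# (q ∸ 1)))) (lin 0 (1 · (≡≽ (trans (cong #_ (sym (ℕP.m+[n∸m]≡n 0<q))) (#-+ 1 (q ∸ 1))))) (solve 2 (λ a b → a :- κ 1 :- b := a :- (κ 1 :+ b)) refl (# q) (# (q ∸ 1)))))))

    fermat : ∀ {x} → Coprime x q → x ^ (q ∸ 1) ≈ 1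
    fermat {x} c = trans (≈-reflexive (cong (x ^_) (sym units≡))) (euler c)

    root⇒unit : ∀ {x e} → 1 ≤ e → x ^ e ≈ 1 → Coprime x q
    root⇒unit {x} {suc e} _ eq = inverse⇒coprime {x} {x ^ e} eq

    kernel : ℕ → F
    kernel d = ∑ q (λ x → 𝟙 (x ^ d ≈? 1))

    -- The power map with exponent `s` sends the q - 1 units into the roots of order `d`, and each
    -- value is taken at most `s` times; so there are at least `d` roots, and `power-count` gives at
    -- most `d`. No primitive root is needed for this.
    kernel-size : ∀ {s d} → 1 ≤ s → 1 ≤ d → s * d ≡ q ∸ 1 → kernel d ≡ # d
    kernel-size {s} {d} 1≤s 1≤d eq = ≼-antisym (power-count d 1 1≤d) (cancel (#-mono 1≤s) (≼-trans (≡≼ (trans (sym (#-* s d)) (trans (cong #_ eq) (trans (sym (trans #-units N≡q-1′)) #-units)))) main))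
      where
      N≡q-1′ : N ≡ # (q ∸ 1)
      N≡q-1′ = trans (sym #-units) (cong #_ units≡)
      main : N ≼ # s ⊗ kernel d
      main = ≼-trans (≡≼ (∑-ext q (λ y → trans (solve 1 (λ a → a := a :* κ 1) refl (u y)) (trans (cong (u y ⊗_) (sym (∑-δ (y ^ s)))) (sym (∑-⊗ q (u y) _)))))) (≼-trans (≡≼ (∑-swap q q _)) (≼-trans (∑-mono q (λ x _ _ → ≼-trans (∑-mono q (λ y _ _ → pt x y)) (≼-trans (≡≼ (∑-⊗ q (𝟙 (x ^ d ≈? 1)) _)) (⊗-monoʳ (𝟙-nn (x ^ d ≈? 1)) (power-count s x 1≤s)))))
         (≡≼ (trans (∑-⊗ʳ q (# s) _) (solve 2 (λ a b → a :* b := b :* a) refl (kernel d) (# s))))))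
        where
        pt : ∀ x y → u y ⊗ δ x (y ^ s) ≼ 𝟙 (x ^ d ≈? 1) ⊗ 𝟙 (y ^ s ≈? x)
        pt x y = aux (coprime? y q) (x ≈? y ^ s) (x ^ d ≈? 1) (y ^ s ≈? x)
          where
          aux : (a : Dec (Coprime y q)) (b : Dec (x ≈ y ^ s)) (c : Dec (x ^ d ≈ 1)) (e : Dec (y ^ s ≈ x)) → 𝟙 a ⊗ 𝟙 b ≼ 𝟙 c ⊗ 𝟙 e
          aux (no _) b c e = ≼-trans (≡≼ (solve 1 (λ a → κ 0 :* a := κ 0) refl (𝟙 b))) (nn-⊗ (𝟙-nn c) (𝟙-nn e))
          aux (yes _) (no _) c e = ≼-trans (≡≼ (solve 0 (κ 1 :* κ 0 := κ 0) refl)) (nn-⊗ (𝟙-nn c) (𝟙-nn e))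
          aux (yes a) (yes b) (yes _) (yes _) = ≼-refl
          aux (yes a) (yes b) (yes _) (no ne) = ⊥-elim (ne (sym b))
          aux (yes a) (yes b) (no nc) e = ⊥-elim (nc (trans (≈-^ d b) (trans (≈-reflexive (trans (ℕP.^-*-assoc y s d) (cong (y ^_) eq))) (fermat a))))

-- Incidences between lines and groups of roots of unity.

module Incid (q : ℕ) (pr : Prime q) where
  open Field
  open Sums
  open NumTh
  open Roots
  open PrimeMod q pr

  Class : (ℕ → F) → Set
  Class f = ∀ {a b} → a ≈ b → f a ≡ f b

  neg : ℕ → ℕ
  neg z = z * (q ∸ 1)

  +neg : ∀ z y → z + (y + neg z) ≈ y
  +neg z y = trans (≈-reflexive (trans (l z y (q ∸ 1)) (cong (λ t → y + z * t) (ℕP.m+[n∸m]≡n 0<q)))) (*M≈0 y z)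
    where
    l : ∀ z y t → z + (y + z * t) ≡ y + z * (1 + t)
    l = solve-∀

  +-cancel : ∀ z {a b} → z + a ≈ z + b → a ≈ b
  +-cancel z {a} {b} e = trans (sym (l a)) (trans (≈-+ {z + a} {z + b} {neg z} e refl) (l b))
    where
    l : ∀ a → z + a + neg z ≈ a
    l a = trans (≈-reflexive (ℕP.+-assoc z a (neg z))) (+neg z a)

  ∑-shift : ∀ {f} → Class f → ∀ z → ∑ q (λ c → f (z + c)) ≡ ∑ q f
  ∑-shift {f} hf z = begin
    ∑ q (λ c → f (z + c))                        ≡⟨ ∑-ext q (λ c → sym (∑-class (z + c) f hf)) ⟩
    ∑ q (λ c → ∑ q (λ k → δ k (z + c) ⊗ f k))    ≡⟨ ∑-swap q q _ ⟩
    ∑ q (λ k → ∑ q (λ c → δ k (z + c) ⊗ f k))    ≡⟨ ∑-ext q (λ k → trans (∑-⊗ʳ q (f k) _) (trans (cong (_⊗ f k) (trans (∑-ext q (λ c → 𝟙-cong (k ≈? z + c) (c ≈? k + neg z)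
          (λ e → +-cancel z (trans (sym e) (sym (+neg z k)))) (λ e → sym (trans (≈-+ {z} {z} refl e) (+neg z k))))) (∑-δ (k + neg z)))) (solve 1 (λ a → κ 1 :* a := a) refl (f k)))) ⟩
    ∑ q f                                        ∎
    where open ≡-Reasoning

  ∑-scale : ∀ {f w} → Class f → Coprime w q → ∑ q (λ c → f (w * c)) ≡ ∑ q f
  ∑-scale {f} {w} hf cw = begin
    ∑ q (λ c → f (w * c))                        ≡⟨ ∑-ext q (λ c → sym (∑-class (w * c) f hf)) ⟩
    ∑ q (λ c → ∑ q (λ k → δ k (w * c) ⊗ f k))    ≡⟨ ∑-swap q q _ ⟩
    ∑ q (λ k → ∑ q (λ c → δ k (w * c) ⊗ f k))    ≡⟨ ∑-ext q (λ k → trans (∑-⊗ʳ q (f k) _) (trans (cong (_⊗ f k) (trans (∑-ext q (λ c → trans (δ-sym k (w * c)) (δ-⊘ c k cw))) (∑-δ (k ⊘ w)))) (solve 1 (λ a → κ 1 :* a := a) refl (f k)))) ⟩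
    ∑ q f                                        ∎
    where open ≡-Reasoning

  module Count (e d : ℕ) (1≤e : 1 ≤ e) (1≤d : 1 ≤ d) where
    E G : ℕ → F
    E x = 𝟙 (x ^ e ≈? 1)
    G y = 𝟙 (y ^ d ≈? 1)

    E-class : Class E
    E-class {a} {b} eq = 𝟙-cong (a ^ e ≈? 1) (b ^ e ≈? 1) (trans (sym (≈-^ e eq))) (trans (≈-^ e eq))
    G-class : Class G
    G-class {a} {b} eq = 𝟙-cong (a ^ d ≈? 1) (b ^ d ≈? 1) (trans (sym (≈-^ d eq))) (trans (≈-^ d eq))
    E-nn : ∀ x → # 0 ≼ E x
    E-nn x = 𝟙-nn (x ^ e ≈? 1)
    G-nn : ∀ x → # 0 ≼ G x
    G-nn x = 𝟙-nn (x ^ d ≈? 1)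

    nE nG nP : F
    nE = ∑ q E
    nG = ∑ q G
    nP = nE ⊗ nG

    -- The expected value for a random line is `nE nG / q`; `Φ` measures the squared deviation,
    -- scaled by `q`.
    I : ℕ → ℕ → F
    I c c′ = ∑ q (λ x → E x ⊗ G (c * x + c′))

    private
      Q : F
      Q = # q

      ∑∑ : (ℕ → ℕ → F) → F
      ∑∑ f = ∑ q (λ c → ∑ q (λ c′ → f c c′))

      ∑∑-ext : ∀ {f g} → (∀ c c′ → f c c′ ≡ g c c′) → ∑∑ f ≡ ∑∑ g
      ∑∑-ext h = ∑-ext q (λ c → ∑-ext q (λ c′ → h c c′))
      ∑∑-⊗ : ∀ k f → ∑∑ (λ c c′ → k ⊗ f c c′) ≡ k ⊗ ∑∑ f
      ∑∑-⊗ k f = trans (∑-ext q (λ c → ∑-⊗ q k _)) (∑-⊗ q k _)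
      ∑∑-⊕ : ∀ f g → ∑∑ (λ c c′ → f c c′ ⊕ g c c′) ≡ ∑∑ f ⊕ ∑∑ g
      ∑∑-⊕ f g = trans (∑-ext q (λ c → ∑-⊕ q _ _)) (∑-⊕ q _ _)
      ∑∑-const : ∀ k → ∑∑ (λ _ _ → k) ≡ Q ⊗ Q ⊗ k
      ∑∑-const k = trans (∑-ext q (λ c → ∑-const q k)) (trans (∑-const q (Q ⊗ k)) (solve 2 (λ a b → a :* (a :* b) := a :* a :* b) refl Q k))
      ∑∑-∑ : ∀ (f : ℕ → ℕ → ℕ → F) → ∑∑ (λ c c′ → ∑ q (λ x → f c c′ x)) ≡ ∑ q (λ x → ∑∑ (λ c c′ → f c c′ x))
      ∑∑-∑ f = trans (∑-ext q (λ c → ∑-swap q q _)) (∑-swap q q _)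

      first : ∑∑ I ≡ Q ⊗ nP
      first = trans (∑∑-∑ _) (trans (∑-ext q (λ x → trans (∑∑-⊗ (E x) (λ c c′ → G (c * x + c′))) (cong (E x ⊗_) (trans (∑-ext q (λ c → ∑-shift G-class (c * x))) (∑-const q nG))))) (trans (∑-⊗ʳ q (Q ⊗ nG) E) (solve 3 (λ a b c → a :* (b :* c) := b :* (a :* c)) refl nE Q nG)))

      pair : ℕ → ℕ → F
      pair x x′ = ∑∑ (λ c c′ → G (c * x + c′) ⊗ G (c * x′ + c′))

      pair-same : ∀ x → pair x x ≡ Q ⊗ nG
      pair-same x = trans (∑-ext q (λ c → trans (∑-ext q (λ c′ → idem (c * x + c′))) (∑-shift G-class (c * x)))) (∑-const q nG)
        where
        idem : ∀ z → G z ⊗ G z ≡ G z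
        idem z with z ^ d ≈? 1
        ... | yes _ = (solve 0 (κ 1 :* κ 1 := κ 1) refl)
        ... | no _ = (solve 0 (κ 0 :* κ 0 := κ 0) refl)

      -- For distinct `x` and `x′` the values `c x + c′` and `c x′ + c′` determine the line and are
      -- independent: a shift by `c x` and a scaling by the unit `x′ - x` separate the two sums.
      pair-diff : ∀ x x′ → ¬ (x ≈ x′) → pair x x′ ≡ nG ⊗ nG
      pair-diff x x′ ne = begin
        pair x x′                                                  ≡⟨ ∑-ext q (λ c → trans (∑-ext q (λ c′ → cong (λ t → G (c * x + c′) ⊗ t) (G-class (rel c c′)))) (∑-shift {λ t → G t ⊗ G (w * c + t)} (λ {a} {b} eq → cong₂ _⊗_ (G-class eq) (G-class (≈-+ {w * c} {w * c} refl eq))) (c * x))) ⟩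
        ∑ q (λ c → ∑ q (λ t → G t ⊗ G (w * c + t)))                ≡⟨ ∑-swap q q _ ⟩
        ∑ q (λ t → ∑ q (λ c → G t ⊗ G (w * c + t)))                ≡⟨ ∑-ext q (λ t → trans (∑-⊗ q (G t) _) (cong (G t ⊗_) (trans (∑-scale {λ z → G (z + t)} (λ {a} {b} eq → G-class (≈-+ {a} {b} {t} eq refl)) cw) (trans (∑-ext q (λ z → cong G (ℕP.+-comm z t))) (∑-shift G-class t))))) ⟩
        ∑ q (λ t → G t ⊗ nG)                                       ≡⟨ ∑-⊗ʳ q nG G ⟩
        nG ⊗ nG                                                    ∎
        where
        open ≡-Reasoning
        w = x′ + neg x
        cw : Coprime w q
        cw = nonzero⇒unit (λ e0 → ne (sym (trans (sym (+neg x x′)) (trans (≈-+ {x} {x} refl e0) (≈-reflexive (ℕP.+-identityʳ x))))))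
        rel : ∀ c c′ → c * x′ + c′ ≈ w * c + (c * x + c′)
        rel c c′ = trans (≈-+ {c * x′} {w * c + c * x} (trans (≈-* {c} {c} refl (sym (trans (≈-reflexive (ℕP.+-comm w x)) (+neg x x′)))) (≈-reflexive (l c w x))) refl) (≈-reflexive (ℕP.+-assoc (w * c) (c * x) c′))
          where l : ∀ c w x → c * (w + x) ≡ w * c + c * x
                l = solve-∀

      second : ∑∑ (λ c c′ → I c c′ ⊗ I c c′) ≼ Q ⊗ nP ⊕ nP ⊗ nP
      second = ≼-trans (≡≼ expand) (≼-trans (∑-mono q (λ x a b → ∑-mono q (λ x′ a′ b′ → pt x x′ a b a′ b′))) (≡≼ total))
        where
        expand : ∑∑ (λ c c′ → I c c′ ⊗ I c c′) ≡ ∑ q (λ x → ∑ q (λ x′ → E x ⊗ E x′ ⊗ pair x x′))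
        expand = trans (∑∑-ext (λ c c′ → trans (sym (∑-⊗ʳ q (I c c′) _)) (∑-ext q (λ x → sym (∑-⊗ q (E x ⊗ G (c * x + c′)) _))))) (trans (∑∑-∑ _) (∑-ext q (λ x → trans (∑∑-∑ _) (∑-ext q (λ x′ → trans (∑∑-ext (λ c c′ → (solve 4 (λ a b c d → a :* b :* (c :* d) := a :* c :* (b :* d)) refl (E x) (G (c * x + c′)) (E x′) (G (c * x′ + c′))))) (∑∑-⊗ (E x ⊗ E x′) _))))))
        nG-nn : # 0 ≼ nG
        nG-nn = ∑-nn q (λ i _ _ → G-nn i)
        pt : ∀ x x′ → 1 ≤ x → x ≤ q → 1 ≤ x′ → x′ ≤ q → E x ⊗ E x′ ⊗ pair x x′ ≼ 𝟙 (x′ ≟ x) ⊗ (E x ⊗ (Q ⊗ nG)) ⊕ E x ⊗ (E x′ ⊗ (nG ⊗ nG))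
        pt x x′ a b a′ b′ = aux (x′ ≟ x)
          where
          aux : (s : Dec (x′ ≡ x)) → E x ⊗ E x′ ⊗ pair x x′ ≼ 𝟙 s ⊗ (E x ⊗ (Q ⊗ nG)) ⊕ E x ⊗ (E x′ ⊗ (nG ⊗ nG))
          aux (yes refl) = ≼-trans (≡≼ (cong (E x ⊗ E x ⊗_) (pair-same x))) (lin 0 (1 · (nn-⊗ (nn-⊗ (E-nn x) (sub-nn (𝟙≼1 (x ^ e ≈? 1)))) (nn-⊗ (0≼# q) nG-nn)) ⊞ 1 · (nn-⊗ (E-nn x) (nn-⊗ (E-nn x) (nn-⊗ nG-nn nG-nn)))) (solve 3 (λ a b c → κ 1 :* (a :* (b :* c)) :+ a :* (a :* (c :* c)) :- a :* a :* (b :* c) := a :* (κ 1 :- a) :* (b :* c) :- κ 0 :+ (a :* (a :* (c :* c)) :- κ 0)) refl (E x) Q nG))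
          aux (no ne) = ≡≼ (trans (cong (E x ⊗ E x′ ⊗_) (pair-diff x x′ (λ eq → ne (sym (rep-unique a b a′ b′ eq))))) (solve 4 (λ a b c d → a :* b :* (c :* c) := κ 0 :* (a :* (d :* c)) :+ a :* (b :* (c :* c))) refl (E x) (E x′) nG Q))
        total : ∑ q (λ x → ∑ q (λ x′ → 𝟙 (x′ ≟ x) ⊗ (E x ⊗ (Q ⊗ nG)) ⊕ E x ⊗ (E x′ ⊗ (nG ⊗ nG)))) ≡ Q ⊗ nP ⊕ nP ⊗ nP
        total = trans (∑-cong q (λ x a b → trans (∑-⊕ q _ _) (cong₂ _⊕_ (∑-pick (λ _ → E x ⊗ (Q ⊗ nG)) a b) (trans (∑-⊗ q (E x) _) (cong (E x ⊗_) (∑-⊗ʳ q (nG ⊗ nG) E)))))) (trans (∑-⊕ q _ _) (trans (cong₂ _⊕_ (∑-⊗ʳ q (Q ⊗ nG) E) (∑-⊗ʳ q (nE ⊗ (nG ⊗ nG)) E)) (solve 3 (λ a b c → a :* (b :* c) :+ a :* (a :* (c :* c)) := b :* (a :* c) :+ a :* c :* (a :* c)) refl nE Q nG)))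

      Φ : ℕ → ℕ → F
      Φ c c′ = (Q ⊗ I c c′ ⊖ nP) ⊗ (Q ⊗ I c c′ ⊖ nP)

      variance : ∑∑ Φ ≼ Q ⊗ Q ⊗ Q ⊗ nP
      variance = ≼-trans (≡≼ (trans (∑∑-ext (λ c c′ → (solve 3 (λ a b c → (a :* b :- c) :* (a :* b :- c) := a :* a :* (b :* b) :+ (:- (κ 2 :* a :* c) :* b :+ c :* c)) refl Q (I c c′) nP))) (trans (∑∑-⊕ _ _) (cong₂ _⊕_ (∑∑-⊗ (Q ⊗ Q) _) (trans (∑∑-⊕ _ _) (cong₂ _⊕_ (trans (∑∑-⊗ (⊝ (# 2 ⊗ Q ⊗ nP)) I) (cong (⊝ (# 2 ⊗ Q ⊗ nP) ⊗_) first)) (∑∑-const (nP ⊗ nP))))))))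
        (lin 0 (1 · (⊗-monoʳ (nn-⊗ (0≼# q) (0≼# q)) second)) (solve 3 (λ a b c → a :* a :* a :* c :- (a :* a :* b :+ (:- (κ 2 :* a :* c) :* (a :* c) :+ a :* a :* (c :* c))) := a :* a :* (a :* c :+ c :* c) :- a :* a :* b) refl Q (∑∑ (λ c c′ → I c c′ ⊗ I c c′)) nP))

      I-class : ∀ {c₁ c₂ c₁′ c₂′} → c₁ ≈ c₂ → c₁′ ≈ c₂′ → I c₁ c₁′ ≡ I c₂ c₂′
      I-class {c₁} {c₂} p r = ∑-ext q (λ x → cong (E x ⊗_) (G-class (≈-+ {c₁ * x} {c₂ * x} (≈-* {c₁} {c₂} {x} p refl) r)))

      Φ-class : ∀ {c₁ c₂ c₁′ c₂′} → c₁ ≈ c₂ → c₁′ ≈ c₂′ → Φ c₁ c₁′ ≡ Φ c₂ c₂′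
      Φ-class p r = cong (λ t → (Q ⊗ t ⊖ nP) ⊗ (Q ⊗ t ⊖ nP)) (I-class p r)

      Φ-nn : ∀ c c′ → # 0 ≼ Φ c c′
      Φ-nn c c′ = sq-nn (Q ⊗ I c c′ ⊖ nP)

      pow-* : ∀ x y n → (x * y) ^ n ≡ x ^ n * y ^ n
      pow-* x y zero    = refl
      pow-* x y (suc n) = trans (cong (x * y *_) (pow-* x y n)) (l x y (x ^ n) (y ^ n))
        where l : ∀ x y a b → x * y * (a * b) ≡ x * a * (y * b)
              l = solve-∀

      root-* : ∀ n {x} y → x ^ n ≈ 1 → (x * y) ^ n ≈ y ^ n
      root-* n {x} y e = trans (≈-reflexive (pow-* x y n)) (trans (≈-* {x ^ n} {1} {y ^ n} e refl) (≈-reflexive (ℕP.*-identityˡ (y ^ n))))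

      -- Multiplying the variable by an `e`-th root of unity permutes those roots, and multiplying
      -- the whole line by a `d`-th root of unity does not affect whether its values are `d`-th
      -- roots.
      orbit : ∀ c c′ {x y} → x ^ e ≈ 1 → y ^ d ≈ 1 → I (c * y * x) (c′ * y) ≡ I c c′
      orbit c c′ {v} {y} ev ey = trans (∑-ext q (λ x → cong₂ _⊗_ (sym (E* x)) (G* x))) (∑-scale {λ x → E x ⊗ G (c * x + c′)} (λ {a} {b} eq → cong₂ _⊗_ (E-class eq) (G-class (≈-+ {c * a} {c * b} (≈-* {c} {c} refl eq) refl))) (root⇒unit 1≤e ev))
        where
        E* : ∀ x → E (v * x) ≡ E x
        E* x = 𝟙-cong ((v * x) ^ e ≈? 1) (x ^ e ≈? 1) (trans (sym (root-* e x ev))) (trans (root-* e x ev))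
        G* : ∀ x → G (c * y * v * x + c′ * y) ≡ G (c * (v * x) + c′)
        G* x = trans (cong G (l c y v x c′)) (𝟙-cong ((y * (c * (v * x) + c′)) ^ d ≈? 1) ((c * (v * x) + c′) ^ d ≈? 1) (trans (sym (root-* d (c * (v * x) + c′) ey))) (trans (root-* d (c * (v * x) + c′) ey)))
          where l : ∀ c y v x c′ → c * y * v * x + c′ * y ≡ y * (c * (v * x) + c′)
                l = solve-∀

      1≼n : ∀ k → # 1 ≼ ∑ q (λ x → 𝟙 (x ^ k ≈? 1))
      1≼n k = ≼-trans (≡≽ (𝟙-yes (1 ^ k ≈? 1) (≈-1^ {1} k refl))) (∑-term {1} {q} ℕP.≤-refl 0<q (λ i _ _ → 𝟙-nn (i ^ k ≈? 1)))

      -- The `nE nG` lines of the orbit are distinct because `c` and `c′` are units, and `Φ` is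
      -- constant on them; so one large deviation would occur `nP` times in the variance.
      spread : ∀ {c c′} → Coprime c q → Coprime c′ q → nP ⊗ Φ c c′ ≼ ∑∑ Φ
      spread {c} {c′} uc uc′ = ≼-trans (≡≼ e₁) (≼-trans (∑-mono q (λ y _ _ → ≼-trans (𝟙-⊗-mono (y ^ d ≈? 1) (λ ey → inner y ey)) (𝟙-⊗≼ (y ^ d ≈? 1) (∑-nn q (λ c₁ _ _ → Φ-nn c₁ (c′ * y)))))) (≡≼ e₂))
        where
        e₁ : nP ⊗ Φ c c′ ≡ ∑ q (λ y → G y ⊗ ∑ q (λ x → E x ⊗ Φ c c′))
        e₁ = sym (trans (∑-ext q (λ y → cong (G y ⊗_) (∑-⊗ʳ q (Φ c c′) E))) (trans (∑-⊗ʳ q (nE ⊗ Φ c c′) G) (solve 3 (λ a b c → a :* (b :* c) := b :* a :* c) refl nG nE (Φ c c′))))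
        inner : ∀ y → y ^ d ≈ 1 → ∑ q (λ x → E x ⊗ Φ c c′) ≼ ∑ q (λ c₁ → Φ c₁ (c′ * y))
        inner y ey = ≼-trans (∑-mono q (λ x _ _ → ≼-trans (𝟙-⊗-mono (x ^ e ≈? 1) (λ ex → ≡≽ (cong (λ t → (Q ⊗ t ⊖ nP) ⊗ (Q ⊗ t ⊖ nP)) (orbit c c′ ex ey)))) (𝟙-⊗≼ (x ^ e ≈? 1) (Φ-nn (c * y * x) (c′ * y))))) (≡≼ (∑-scale {λ c₁ → Φ c₁ (c′ * y)} (λ eq → Φ-class eq refl) (coprime-* uc (root⇒unit 1≤d ey))))
        e₂ : ∑ q (λ y → ∑ q (λ c₁ → Φ c₁ (c′ * y))) ≡ ∑∑ Φ
        e₂ = trans (∑-scale {λ t → ∑ q (λ c₁ → Φ c₁ t)} (λ eq → ∑-ext q (λ c₁ → Φ-class {c₁} {c₁} refl eq)) uc′) (∑-swap q q _)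

    -- The variance over all lines is at most `nP` times the cube of `q`, and the orbit divides out
    -- `nP`. This square root cancellation for every single line stands in for estimates of Jacobi
    -- sums.
    incidence : ∀ {c c′} → Coprime c q → Coprime c′ q → (# q ⊗ I c c′ ⊖ nP) ⊗ (# q ⊗ I c c′ ⊖ nP) ≼ # q ⊗ # q ⊗ # q
    incidence {c} {c′} uc uc′ = cancel 1≼nP (≼-trans (spread uc uc′) (≼-trans variance (≡≼ (solve 2 (λ a b → a :* a :* a :* b := b :* (a :* a :* a)) refl (# q) nP))))
      where
      1≼nP : # 1 ≼ nP
      1≼nP = (lin 0 (1 · (nn-⊗ (sub-nn (1≼n e)) (sub-nn (1≼n d))) ⊞ 1 · (1≼n e) ⊞ 1 · (1≼n d)) (solve 2 (λ a b → a :* b :- κ 1 := (a :- κ 1) :* (b :- κ 1) :- κ 0 :+ (a :- κ 1 :+ (b :- κ 1))) refl nE nG))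

-- Solving the congruence modulo one prime.

module Local (q : ℕ) (pr : Prime q) where
  open Field
  open Sums
  open NumTh
  open Roots
  open PrimeMod q pr
  open Incid q pr

  ^-∣ : ∀ {x m n} → x ^ m ≈ 1 → m ∣ n → x ^ n ≈ 1
  ^-∣ {x} {m} e (divides k refl) = trans (≈-reflexive (trans (cong (x ^_) (ℕP.*-comm k m)) (sym (ℕP.^-*-assoc x m k)))) (≈-1^ k e)

  ^-gcd : ∀ {x m n} → x ^ m ≈ 1 → x ^ n ≈ 1 → x ^ gcd m n ≈ 1
  ^-gcd {x} {m} {n} em en with Bézout.identity (gcd-GCD m n)
  ... | Bézout.+- a b eq = trans (sym (drop (b * n) (^-∣ {x} {n} en (n∣m*n b)))) (trans (≈-reflexive (cong (x ^_) eq)) (^-∣ {x} {m} em (n∣m*n a)))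
    where
    drop : ∀ k → x ^ k ≈ 1 → x ^ (gcd m n + k) ≈ x ^ gcd m n
    drop k e = trans (≈-reflexive (ℕP.^-distribˡ-+-* x (gcd m n) k)) (trans (≈-* {x ^ gcd m n} refl e) (≈-reflexive (ℕP.*-identityʳ _)))
  ... | Bézout.-+ a b eq = trans (sym (drop (a * m) (^-∣ {x} {m} em (n∣m*n a)))) (trans (≈-reflexive (cong (x ^_) eq)) (^-∣ {x} {n} en (n∣m*n b)))
    where
    drop : ∀ k → x ^ k ≈ 1 → x ^ (gcd m n + k) ≈ x ^ gcd m n
    drop k e = trans (≈-reflexive (ℕP.^-distribˡ-+-* x (gcd m n) k)) (trans (≈-* {x ^ gcd m n} refl e) (≈-reflexive (ℕP.*-identityʳ _)))

  module _ {s d : ℕ} (1≤s : 1 ≤ s) (1≤d : 1 ≤ d) (sd : s * d ≡ q ∸ 1) where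

    -- Exact order `d`, tested at the maximal proper divisors of `d` only.
    Primitive : ℕ → Set
    Primitive x = x ^ d ≈ 1 × (∀ r → Prime r → r ∣ d → ¬ (x ^ (d ÷ r) ≈ 1))

    private
      div : ∀ {r} → Prime r → r ∣ d → d ≡ r * (d ÷ r)
      div {r} pr (divides k eq) = trans eq (trans (ℕP.*-comm k r) (cong (r *_) (sym (trans (cong (_÷ r) (trans eq (ℕP.*-comm k r))) (*÷ r k (prime≥1 pr))))))

    order-exact : ∀ {x t} → Primitive x → 1 ≤ t → t < d → ¬ (x ^ t ≈ 1)
    order-exact {x} {t} (xd , prim) 1≤t t<d xt with gcd[m,n]∣n t d
    ... | divides h eq = split h eq
      where
      g = gcd t d
      xg : x ^ g ≈ 1
      xg = ^-gcd {x} {t} {d} xt xd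
      g≤t : g ≤ t
      g≤t = proj₂ (∣-≤ 1≤t (gcd[m,n]∣m t d))
      split : ∀ h → d ≡ h * g → ⊥
      split zero eq = ℕP.<⇒≢ 1≤d (sym eq)
      split (suc zero) eq = ℕP.<⇒≱ t<d (ℕP.≤-trans (ℕP.≤-reflexive (trans eq (ℕP.*-identityˡ g))) g≤t)
      split h@(suc (suc _)) eq with ∃-prime-∣ h (s≤s (s≤s z≤n))
      ... | r , rp , divides h′ eh = prim r rp (∣-trans (divides h′ eh) (divides g (trans eq (ℕP.*-comm h g)))) (^-∣ {x} {g} xg (divides h′ (trans (cong (_÷ r) (trans eq (trans (cong (_* g) eh) (l h′ r g)))) (*÷ r (h′ * g) (prime≥1 rp)))))
        where l : ∀ h′ r g → h′ * r * g ≡ r * (h′ * g)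
              l = solve-∀

    private
      lt : ∀ {x j k} → Primitive x → 1 ≤ j → k ≤ d → j < k → x ^ j ≈ x ^ k → ⊥
      lt {x} {j} {k} px a b′ j<k e = order-exact {x} {k ∸ j} px (ℕP.m<n⇒0<n∸m j<k) (ℕP.<-≤-trans (ℕP.∸-monoʳ-< a (ℕP.<⇒≤ j<k)) b′) (sym (cancelʳ {1} {x ^ (k ∸ j)} (coprime-^ j (root⇒unit 1≤d (proj₁ px))) (trans (≈-reflexive (ℕP.*-identityˡ (x ^ j))) (trans e (≈-reflexive (trans (cong (x ^_) (sym (ℕP.m∸n+n≡m (ℕP.<⇒≤ j<k)))) (ℕP.^-distribˡ-+-* x (k ∸ j) j)))))))

    powers-distinct : ∀ {x j k} → Primitive x → 1 ≤ j → j ≤ d → 1 ≤ k → k ≤ d → x ^ j ≈ x ^ k → j ≡ k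
    powers-distinct {x} {j} {k} px a b a′ b′ e with ℕP.<-cmp j k
    ... | tri≈ _ eq _  = eq
    ... | tri< j<k _ _ = ⊥-elim (lt {x} {j} {k} px a b′ j<k e)
    ... | tri> _ _ k<j = ⊥-elim (lt {x} {k} {j} px a′ b k<j (sym e))

    -- Otherwise the `d` distinct powers of `x` together with `y` would be `d + 1` roots of order
    -- `d`, against `kernel-size`.
    generates : ∀ {x y} → Primitive x → y ^ d ≈ 1 → ∃ λ k → k ≤ d × x ^ k ≈ y
    generates {x} {y} px yd with search (λ k → k ≤? d ×-dec x ^ k ≈? y) d
    ... | inj₁ (k , k≤d , e) = k , k≤d , e
    ... | inj₂ none = ⊥-elim (1⋠0 (lin 0 (1 · le ⊞ 1 · (≡≼ (kernel-size 1≤s 1≤d sd))) (solve 2 (λ a b → κ 0 :- κ 1 := b :- (a :+ κ 1) :+ (a :- b)) refl (# d) (kernel d))))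
      where
      f : ℕ → F
      f z = ∑ d (λ k → δ z (x ^ k))
      le : # d ⊕ # 1 ≼ kernel d
      le = ≼-trans (≡≼ (sym tot)) (∑-mono q (λ z _ _ → pt z))
        where
        tot : ∑ q (λ z → f z ⊕ δ z y) ≡ # d ⊕ # 1
        tot = trans (∑-⊕ q _ _) (cong₂ _⊕_ (trans (∑-swap q d _) (trans (∑-ext d (λ k → ∑-δ (x ^ k))) (trans (∑-const d (# 1)) (solve 1 (λ a → a :* κ 1 := a) refl (# d))))) (∑-δ y))
        pt : ∀ z → f z ⊕ δ z y ≼ 𝟙 (z ^ d ≈? 1)
        pt z = aux (z ^ d ≈? 1) (z ≈? y) (search (λ k → hit? k) d)
          where
          hit : ℕ → Set
          hit k = (1 ≤ k × k ≤ d) × z ≈ x ^ k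
          hit? : ∀ k → Dec (hit k)
          hit? k = (1 ≤? k ×-dec k ≤? d) ×-dec z ≈? x ^ k
          zero-sum : (∀ k → 1 ≤ k → k ≤ d → ¬ (z ≈ x ^ k)) → f z ≡ # 0
          zero-sum h = ∑-0 d (λ k a b → 𝟙-no (z ≈? x ^ k) (h k a b))
          f≼1 : (∃ hit) ⊎ (∀ k → 1 ≤ k → k ≤ d → ¬ hit k) → f z ≼ # 1
          f≼1 (inj₂ h) = ≼-trans (≡≼ (zero-sum (λ k a b e → h k a b ((a , b) , e)))) 0≼1
          f≼1 (inj₁ (k , (a , b) , e)) = ≡≼ (trans (∑-single a b (λ i a′ b′ ne → 𝟙-no (z ≈? x ^ i) (λ e′ → ne (powers-distinct {x} {i} {k} px a′ b′ a b (trans (sym e′) e))))) (𝟙-yes (z ≈? x ^ k) e))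
          aux : (s : Dec (z ^ d ≈ 1)) (t : Dec (z ≈ y)) → (∃ hit) ⊎ (∀ k → 1 ≤ k → k ≤ d → ¬ hit k) → f z ⊕ 𝟙 t ≼ 𝟙 s
          aux (no nz) (yes e) _ = ⊥-elim (nz (trans (≈-^ d e) yd))
          aux (no nz) (no _) _ = (lin 0 (1 · (≡≼ (zero-sum (λ k _ _ e → nz (trans (≈-^ d e) (trans (≈-reflexive (trans (ℕP.^-*-assoc x k d) (trans (cong (x ^_) (ℕP.*-comm k d)) (sym (ℕP.^-*-assoc x d k))))) (≈-1^ k (proj₁ px)))))))) (solve 1 (λ a → κ 0 :- (a :+ κ 0) := κ 0 :- a) refl (f z)))
          aux (yes _) (yes e) _ = (lin 0 (1 · (≡≼ (zero-sum (λ k a b e′ → none k a b (b , trans (sym e′) e))))) (solve 1 (λ a → κ 1 :- (a :+ κ 1) := κ 0 :- a) refl (f z)))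
          aux (yes _) (no _) h = (lin 0 (1 · (f≼1 h)) (solve 1 (λ a → κ 1 :- (a :+ κ 0) := κ 1 :- a) refl (f z)))

    module Solve (w : ℕ) (1≤w : 1 ≤ w) (ω≼w : ∑ d (λ r → 𝟙 (prime? r) ⊗ 𝟙 (r ∣? d)) ≼ # w) (rough : ∀ r → Prime r → r ∣ d → 2 * w ≤ r)
      (large : 16 * ((1 + w) * (1 + w)) * (q * q * q) ≤ d * d * (d * d)) where

      private
        Q D W ρ : F
        Q = # q
        D = # d
        W = # w
        -- The error allowed in each of the at most 1 + w incidence counts; together they use a
        -- quarter of `D ⊗ D`. The hypothesis `large` says that the cube of `q` is at most the
        -- square of `ρ`.
        ρ = D ⊗ D ⊗ ⅟ (4 * (1 + w))

        ρ-eq : # 4 ⊗ (# 1 ⊕ W) ⊗ ρ ≡ D ⊗ D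
        ρ-eq = trans (cong (_⊗ ρ) (sym (trans (#-* 4 (1 + w)) (cong (# 4 ⊗_) (#-+ 1 w))))) (trans (solve 3 (λ a b c → a :* (b :* b :* c) := b :* b :* (a :* c)) refl (# (4 * (1 + w))) D (⅟ (4 * (1 + w)))) (trans (cong (D ⊗ D ⊗_) (⅟-law {4 * (1 + w)} (s≤s z≤n))) (solve 1 (λ a → a :* a :* κ 1 := a :* a) refl D)))

        ρ-nn : # 0 ≼ ρ
        ρ-nn = nn-⊗ (nn-⊗ (0≼# d) (0≼# d)) (⅟-nn (4 * (1 + w)))

        q³≼ρ² : Q ⊗ Q ⊗ Q ≼ ρ ⊗ ρ
        q³≼ρ² = cancel 1≼c (≼-trans (≡≼ (sym (trans (#-* (16 * ((1 + w) * (1 + w))) (q * q * q)) (cong₂ _⊗_ (trans (#-* 16 ((1 + w) * (1 + w))) (cong (# 16 ⊗_) (trans (#-* (1 + w) (1 + w)) (cong₂ _⊗_ (#-+ 1 w) (#-+ 1 w))))) (trans (#-* (q * q) q) (cong (_⊗ Q) (#-* q q))))))) (≼-trans (#-mono large) (≡≼ (trans (#-* (d * d) (d * d)) (trans (cong₂ _⊗_ (#-* d d) (#-* d d)) (trans (cong₂ _⊗_ (sym ρ-eq) (sym ρ-eq)) (solve 2 (λ a b → κ 4 :* (κ 1 :+ a) :* b :* (κ 4 :* (κ 1 :+ a) :* b) := κ 16 :* ((κ 1 :+ a) :* (κ 1 :+ a)) :* (b :* b)) refl W ρ)))))))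
          where
          1≼c : # 1 ≼ # 16 ⊗ ((# 1 ⊕ W) ⊗ (# 1 ⊕ W))
          1≼c = (lin 0 (32 · (0≼# w) ⊞ 16 · (nn-⊗ (0≼# w) (0≼# w)) ⊞ const 15) (solve 1 (λ a → κ 16 :* ((κ 1 :+ a) :* (κ 1 :+ a)) :- κ 1 := κ 32 :* (a :- κ 0) :+ (κ 16 :* (a :* a :- κ 0) :+ κ 15)) refl W))

        module At (e f : ℕ) (1≤e : 1 ≤ e) (1≤f : 1 ≤ f) (fe : f * e ≡ q ∸ 1) {c c′ : ℕ} (uc : Coprime c q) (uc′ : Coprime c′ q) where
          open Count e d 1≤e 1≤d
          nP≡ : nP ≡ # e ⊗ D
          nP≡ = cong₂ _⊗_ (kernel-size {f} {e} 1≤f 1≤e fe) (kernel-size 1≤s 1≤d sd)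
          near : # q ⊗ I c c′ ⊖ # e ⊗ D ≲ ρ
          near = subst (λ t → Q ⊗ I c c′ ⊖ t ≲ ρ) nP≡ (sq-cancel ρ-nn (≼-trans (incidence uc uc′) q³≼ρ²) , lower)
            where
            z = Q ⊗ I c c′ ⊖ nP
            lower : ⊝ ρ ≼ z
            lower = (lin 0 (1 · (sq-cancel {⊝ z} ρ-nn (≼-trans (≡≼ (solve 1 (λ a → :- a :* :- a := a :* a) refl z)) (≼-trans (incidence uc uc′) q³≼ρ²)))) (solve 2 (λ a b → b :- :- a := a :- :- b) refl ρ z))

      module _ {c c′ : ℕ} (uc : Coprime c q) (uc′ : Coprime c′ q) where
        private
          open Count
          G₁ : ℕ → F
          G₁ x = 𝟙 ((c * x + c′) ^ d ≈? 1)
          E₁ : ℕ → ℕ → F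
          E₁ e x = 𝟙 (x ^ e ≈? 1)
          c₁ : ℕ → F
          c₁ r = 𝟙 (prime? r) ⊗ 𝟙 (r ∣? d)
          J : ℕ → F
          J e = ∑ q (λ x → E₁ e x ⊗ G₁ x)
          -- A union bound over the maximal proper divisors of `d`: it is positive only if `x` has
          -- exact order `d` and lies on the line, because every prime `r` with `x ^ (d ÷ r) ≈ 1`
          -- subtracts as much as the first term can give.
          term : ℕ → F
          term x = E₁ d x ⊗ G₁ x ⊖ ∑ d (λ r → c₁ r ⊗ (E₁ (d ÷ r) x ⊗ G₁ x))

          c₁-nn : ∀ r → # 0 ≼ c₁ r
          c₁-nn r = nn-⊗ (𝟙-nn (prime? r)) (𝟙-nn (r ∣? d))

          sum≡ : ∑ q term ≡ J d ⊖ ∑ d (λ r → c₁ r ⊗ J (d ÷ r))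
          sum≡ = trans (∑-⊖ q _ _) (cong (J d ⊖_) (trans (∑-swap q d _) (∑-ext d (λ r → ∑-⊗ q (c₁ r) _))))

          per-r : ∀ r → c₁ r ⊗ (# 2 ⊗ W ⊗ (Q ⊗ J (d ÷ r))) ≼ c₁ r ⊗ (D ⊗ D ⊕ # 2 ⊗ W ⊗ ρ)
          per-r r = aux (prime? r) (r ∣? d)
            where
            aux : (a : Dec (Prime r)) (b : Dec (r ∣ d)) → 𝟙 a ⊗ 𝟙 b ⊗ (# 2 ⊗ W ⊗ (Q ⊗ J (d ÷ r))) ≼ 𝟙 a ⊗ 𝟙 b ⊗ (D ⊗ D ⊕ # 2 ⊗ W ⊗ ρ)
            aux (no _) b = (lin 0 (const 0) (solve 6 (λ a b c d e f → κ 0 :* a :* (e :* e :+ κ 2 :* b :* f) :- κ 0 :* a :* (κ 2 :* b :* (c :* d)) := κ 0) refl (𝟙 b) W Q (J (d ÷ r)) D ρ))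
            aux (yes _) (no _) = (lin 0 (const 0) (solve 5 (λ a b c d e → κ 1 :* κ 0 :* (d :* d :+ κ 2 :* a :* e) :- κ 1 :* κ 0 :* (κ 2 :* a :* (b :* c)) := κ 0) refl W Q (J (d ÷ r)) D ρ))
            aux (yes rp) (yes r∣d) = ⊗-monoʳ (nn-⊗ 0≼1 0≼1) (lin 0 (1 · (⊗-monoʳ (nn-⊗ (0≼# 2) (0≼# w)) (proj₁ near)) ⊞ 1 · (⊗-monoˡ (0≼# d) small)) (solve 6 (λ a b c d e f → d :* d :+ κ 2 :* a :* e :- κ 2 :* a :* (b :* c) := κ 2 :* a :* e :- κ 2 :* a :* (b :* c :- f :* d) :+ (d :* d :- κ 2 :* a :* f :* d)) refl W Q (J e) D ρ (# e)))
              where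
              e = d ÷ r
              d≡ = div rp r∣d
              1≤e : 1 ≤ e
              1≤e = proj₁ (proj₂ (≤-factor {r} {e} 1≤d (sym d≡)))
              open At e (s * r) 1≤e (ℕP.*-mono-≤ 1≤s (prime≥1 rp)) (trans (ℕP.*-assoc s r e) (trans (cong (s *_) (sym d≡)) sd)) uc uc′
              small : # 2 ⊗ W ⊗ # e ≼ D
              small = ≼-trans (≡≼ (sym (trans (#-* (2 * w) e) (cong (_⊗ # e) (#-* 2 w))))) (#-mono (ℕP.≤-trans (ℕP.*-monoˡ-≤ e (rough r rp r∣d)) (ℕP.≤-reflexive (sym d≡))))

          -- After scaling by `q`, the count for `d` is about `D D` and the count for `d ÷ r` about
          -- `D D / r`. There are at most `w` primes `r`, each at least `2 w`, so these take half of
          -- the main term, and the errors `(1 + w) ρ` take a quarter.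
          positive : ¬ (∑ q term ≼ # 0)
          positive h = 1⋠0 (lin 0 (2 · fin ⊞ 1 · (≡≽ (cong (W ⊗_) ρ-eq)) ⊞ 1 · 1≼WDD) (solve 3 (λ a b c → κ 0 :- κ 1 := κ 2 :* (κ 0 :- κ 2 :* a :* (κ 1 :+ a) :* b) :+ (a :* (κ 4 :* (κ 1 :+ a) :* b) :- a :* (c :* c) :+ (a :* (c :* c) :- κ 1))) refl W ρ D))
            where
            S = ∑ d (λ r → c₁ r ⊗ J (d ÷ r))
            sumr : # 2 ⊗ W ⊗ (Q ⊗ S) ≼ W ⊗ (D ⊗ D ⊕ # 2 ⊗ W ⊗ ρ)
            sumr = ≼-trans (≡≼ (trans (solve 3 (λ a b c → κ 2 :* a :* (b :* c) := κ 2 :* a :* b :* c) refl W Q S) (trans (sym (∑-⊗ d (# 2 ⊗ W ⊗ Q) _)) (∑-ext d (λ r → (solve 4 (λ a b c d → κ 2 :* a :* b :* (c :* d) := c :* (κ 2 :* a :* (b :* d))) refl W Q (c₁ r) (J (d ÷ r))))))))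
              (≼-trans (∑-mono d (λ r _ _ → per-r r)) (≼-trans (≡≼ (∑-⊗ʳ d (D ⊗ D ⊕ # 2 ⊗ W ⊗ ρ) c₁)) (⊗-monoˡ (lin 0 (1 · (nn-⊗ (0≼# d) (0≼# d)) ⊞ 2 · (nn-⊗ (0≼# w) ρ-nn)) (solve 3 (λ a b c → a :* a :+ κ 2 :* b :* c :- κ 0 := a :* a :- κ 0 :+ κ 2 :* (b :* c :- κ 0)) refl D W ρ)) ω≼w)))
            open At d s 1≤d 1≤s sd uc uc′
            fin : # 2 ⊗ W ⊗ (# 1 ⊕ W) ⊗ ρ ≼ # 0
            fin = (lin 0 (1 · sumr ⊞ 2 · (⊗-monoʳ (nn-⊗ (0≼# w) (0≼# q)) (≼-trans (≡≽ sum≡) h)) ⊞ 2 · (⊗-monoʳ (0≼# w) (proj₂ near)) ⊞ 1 · (≡≼ (cong (W ⊗_) ρ-eq))) (solve 6 (λ a b c d e f → κ 0 :- κ 2 :* a :* (κ 1 :+ a) :* b := a :* (e :* e :+ κ 2 :* a :* b) :- κ 2 :* a :* (c :* d) :+ (κ 2 :* (a :* c :* κ 0 :- a :* c :* (f :- d)) :+ (κ 2 :* (a :* (c :* f :- e :* e) :- a :* :- b) :+ (a :* (e :* e) :- a :* (κ 4 :* (κ 1 :+ a) :* b))))) refl W ρ Q S D (J d)))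
            1≼WDD : # 1 ≼ W ⊗ (D ⊗ D)
            1≼WDD = ≼-trans (#-mono (ℕP.*-mono-≤ 1≤w (ℕP.*-mono-≤ 1≤d 1≤d))) (≡≼ (trans (#-* w (d * d)) (cong (W ⊗_) (#-* d d))))

          extract : ∀ x → ¬ (term x ≼ # 0) → Primitive x × (c * x + c′) ^ d ≈ 1
          extract x h = aux (x ^ d ≈? 1) ((c * x + c′) ^ d ≈? 1) refl refl
            where
            S-nn : # 0 ≼ ∑ d (λ r → c₁ r ⊗ (E₁ (d ÷ r) x ⊗ G₁ x))
            S-nn = ∑-nn d (λ r _ _ → nn-⊗ (c₁-nn r) (nn-⊗ (𝟙-nn (x ^ (d ÷ r) ≈? 1)) (𝟙-nn ((c * x + c′) ^ d ≈? 1))))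
            S₀ = ∑ d (λ r → c₁ r ⊗ (E₁ (d ÷ r) x ⊗ G₁ x))
            aux : (a : Dec (x ^ d ≈ 1)) (b : Dec ((c * x + c′) ^ d ≈ 1)) → E₁ d x ≡ 𝟙 a → G₁ x ≡ 𝟙 b → Primitive x × (c * x + c′) ^ d ≈ 1
            aux (no _) b ea eb = ⊥-elim (h (lin 0 (1 · (≡≼ (cong (_⊗ G₁ x) ea)) ⊞ 1 · S-nn) (solve 3 (λ a b c → κ 0 :- (a :* b :- c) := κ 0 :* b :- a :* b :+ (c :- κ 0)) refl (E₁ d x) (G₁ x) S₀)))
            aux (yes _) (no _) ea eb = ⊥-elim (h (lin 0 (1 · (≡≼ (cong (E₁ d x ⊗_) eb)) ⊞ 1 · S-nn) (solve 3 (λ a b c → κ 0 :- (a :* b :- c) := a :* κ 0 :- a :* b :+ (c :- κ 0)) refl (E₁ d x) (G₁ x) S₀)))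
            aux (yes xd) (yes yd) ea eb = (xd , prim) , yd
              where
              prim : ∀ r → Prime r → r ∣ d → ¬ (x ^ (d ÷ r) ≈ 1)
              prim r rp r∣d xe = h (lin 0 (1 · (≡≼ (cong₂ _⊗_ ea eb)) ⊞ 1 · (≼-trans (≡≽ t1) (∑-term (prime≥1 rp) (proj₂ (∣-≤ 1≤d r∣d)) (λ i _ _ → nn-⊗ (c₁-nn i) (nn-⊗ (𝟙-nn (x ^ (d ÷ i) ≈? 1)) (𝟙-nn ((c * x + c′) ^ d ≈? 1))))))) (solve 3 (λ a b c → κ 0 :- (a :* b :- c) := κ 1 :* κ 1 :- a :* b :+ (c :- κ 1)) refl (E₁ d x) (G₁ x) S₀))
                where
                t1 : c₁ r ⊗ (E₁ (d ÷ r) x ⊗ G₁ x) ≡ # 1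
                t1 = trans (cong₂ _⊗_ (cong₂ _⊗_ (𝟙-yes (prime? r) rp) (𝟙-yes (r ∣? d) r∣d)) (cong₂ _⊗_ (𝟙-yes (x ^ (d ÷ r) ≈? 1) xe) eb)) (solve 0 (κ 1 :* κ 1 :* (κ 1 :* κ 1) := κ 1) refl)

        primitive-on-line : ∃ λ x → Primitive x × (c * x + c′) ^ d ≈ 1
        primitive-on-line with search (λ x → ¬? (term x ≼? (# 0))) q
        ... | inj₁ (x , h) = x , extract x h
        ... | inj₂ none = ⊥-elim (positive (≼-trans (∑-mono q (λ x p r → decidable-stable (term x ≼? (# 0)) (none x p r))) (≡≼ (∑-0 q (λ _ _ _ → refl)))))

      solve-local : ∀ a → Coprime a q → ∃ λ x → ∃ λ k → Coprime x q × x ^ d ≈ 1 × x ^ k * x ≈ a + x ^ k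
      solve-local a ca = x , d ∸ k₀ , root⇒unit 1≤d (proj₁ px) , proj₁ px , final
        where
        -- The line is (x - 1) / a. A point on it of the form x^k₀ gives x^(d - k₀) (x - 1) ≡ a.
        c = iv a
        c′ = neg c
        uc : Coprime c q
        uc = coprime-*ʳ {a} {c} (coprime-≈ (sym (iv-law ca)) coprime-1)
        uc′ : Coprime c′ q
        uc′ = coprime-* uc (nonzero⇒unit (λ e → 1≉0 (trans (sym (≈-reflexive (ℕP.+-identityʳ 1))) (trans (≈-+ {1} {1} {0} {q ∸ 1} refl (sym e)) (trans (≈-reflexive (trans (ℕP.m+[n∸m]≡n 0<q) (sym (ℕP.+-identityʳ q)))) (M+≈ 0))))))
        sol = primitive-on-line uc uc′
        x = proj₁ sol
        px = proj₁ (proj₂ sol)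
        y = c * x + c′
        gen = generates {x} {y} px (proj₂ (proj₂ sol))
        k₀ = proj₁ gen
        k₀≤d = proj₁ (proj₂ gen)
        xk : x ^ k₀ ≈ y
        xk = proj₂ (proj₂ gen)
        ay : a * y + 1 ≈ x
        ay = trans (≈-+ {a * y} {x + (q ∸ 1)} {1} (trans (≈-reflexive (l a c x (q ∸ 1))) (≈-+ {a * c * x} {x} (trans (≈-* {a * c} {1} {x} (iv-law ca) refl) (≈-reflexive (ℕP.*-identityˡ x))) (trans (≈-* {a * c} {1} {q ∸ 1} (iv-law ca) refl) (≈-reflexive (ℕP.*-identityˡ (q ∸ 1)))))) refl)
             (trans (≈-reflexive (trans (ℕP.+-assoc x (q ∸ 1) 1) (trans (cong (x +_) (ℕP.m∸n+n≡m 0<q)) (ℕP.+-comm x q)))) (M+≈ x))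
          where l : ∀ a c x t → a * (c * x + c * t) ≡ a * c * x + a * c * t
                l = solve-∀
        z = x ^ (d ∸ k₀)
        zy : z * y ≈ 1
        zy = trans (≈-* {z} {z} refl (sym xk)) (trans (≈-reflexive (trans (sym (ℕP.^-distribˡ-+-* x (d ∸ k₀) k₀)) (cong (x ^_) (ℕP.m∸n+n≡m k₀≤d)))) (proj₁ px))
        final : z * x ≈ a + z
        final = trans (≈-* {z} {z} refl (sym ay)) (trans (≈-reflexive (l z a y)) (≈-+ {a * (z * y)} {a} {z} (trans (≈-* {a} {a} refl zy) (≈-reflexive (ℕP.*-identityʳ a))) refl))
          where l : ∀ z a y → z * (a * y + 1) ≡ a * (z * y) + z
                l = solve-∀

-- From local solutions to totients in a class.

module Global where
  open Field
  open Sums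
  open NumTh
  open Roots
  open Dirichlet
  open import Data.Integer as ℤ using (ℤ; +_)
  import Data.Integer.Properties as ℤP
  import Data.Integer.DivMod as ℤD
  import Data.Integer.Divisibility.Signed as ℤS
  open import Data.Integer.Tactic.RingSolver using () renaming (solve-∀ to ℤ-solve-∀)

  length-filter : ∀ {P : ℕ → Set} (P? : ∀ i → Dec (P i)) n → # length (filter P? (map suc (upTo n))) ≡ ∑ n (λ i → 𝟙 (P? i))
  length-filter P? zero = refl
  length-filter P? (suc n) = trans (cong (λ l → # length (filter P? (map suc l))) (sym (LP.upTo-∷ʳ n))) (trans (cong (λ l → # length (filter P? l)) (LP.map-++ suc (upTo n) [ n ])) (trans (cong (λ l → # length l) (LP.filter-++ P? (map suc (upTo n)) [ suc n ])) (trans (cong #_ (LP.length-++ (filter P? (map suc (upTo n))))) (trans (#-+ _ _) (cong₂ _⊕_ (length-filter P? n) (last (P? (suc n)) refl))))))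
    where
    last : (d : Dec _) → P? (suc n) ≡ d → # length (filter P? [ suc n ]) ≡ 𝟙 (P? (suc n))
    last d e with P? (suc n)
    ... | yes _ = refl
    ... | no _  = refl

  φ-prime-power : ∀ {p} → Prime p → ∀ k → φ (p ^ suc k) ≡ p ^ k * (p ∸ 1)
  φ-prime-power {p} pr k = #-injective (trans (length-filter (λ i → coprime? i n) n) (trans (∑-ext n pt) (trans (∑-⊖ n _ _) (trans (cong₂ _⊖_ (∑-const n (# 1)) (trans (∑-ext n (λ i → (solve 1 (λ a → a := a :* κ 1) refl (𝟙 (p ∣? i))))) (trans (∑-multiples n p (λ _ → # 1) (prime≥1 pr)) (trans (∑-const (n ÷ p) (# 1)) (cong (λ t → # t ⊗ # 1) (*÷ p (p ^ k) (prime≥1 pr))))))) arith))))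
    where
    n = p ^ suc k
    coprime-power : ∀ {i} → ¬ (p ∣ i) → ∀ j → Coprime i (p ^ j)
    coprime-power p∤i zero (_ , d∣1) = ∣1⇒≡1 d∣1
    coprime-power {i} p∤i (suc j) {d} (d∣i , d∣pj) = coprime-power p∤i j (d∣i , coprime-divisor {d} {p} cop d∣pj)
      where
      cop : Coprime d p
      cop {e} (e∣d , e∣p) with prime⇒irreducible pr e∣p
      ... | inj₁ r = r
      ... | inj₂ refl = ⊥-elim (p∤i (∣-trans e∣d d∣i))
    pt : ∀ i → 𝟙 (coprime? i n) ≡ # 1 ⊖ 𝟙 (p ∣? i)
    pt i with p ∣? i
    ... | yes p∣i = trans (𝟙-no (coprime? i n) (λ c → ℕP.<⇒≢ (prime≥2 pr) (sym (c (p∣i , m∣m*n (p ^ k)))))) (solve 0 (κ 0 := κ 1 :- κ 1) refl)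
    ... | no p∤i = trans (𝟙-yes (coprime? i n) (coprime-power p∤i (suc k))) (solve 0 (κ 1 := κ 1 :- κ 0) refl)
    arith : # n ⊗ # 1 ⊖ # (p ^ k) ⊗ # 1 ≡ # (p ^ k * (p ∸ 1))
    arith = (≼-antisym (lin 0 (1 · (≡≼ (#-* p (p ^ k))) ⊞ 1 · (≡≽ (#-* (p ^ k) (p ∸ 1))) ⊞ 1 · (≡≼ (cong (# (p ^ k) ⊗_) (trans (cong #_ (sym (ℕP.m+[n∸m]≡n (prime≥1 pr)))) (#-+ 1 (p ∸ 1)))))) (solve 5 (λ a b c d e → c :- (a :* κ 1 :- b :* κ 1) := d :* b :- a :+ (c :- b :* e :+ (b :* (κ 1 :+ e) :- b :* d))) refl (# n) (# (p ^ k)) (# (p ^ k * (p ∸ 1))) (# p) (# (p ∸ 1)))) (lin 0 (1 · (≡≽ (#-* p (p ^ k))) ⊞ 1 · (≡≼ (#-* (p ^ k) (p ∸ 1))) ⊞ 1 · (≡≽ (cong (# (p ^ k) ⊗_) (trans (cong #_ (sym (ℕP.m+[n∸m]≡n (prime≥1 pr)))) (#-+ 1 (p ∸ 1)))))) (solve 5 (λ a b c d e → a :* κ 1 :- b :* κ 1 :- c := a :- d :* b :+ (b :* e :- c :+ (b :* d :- b :* (κ 1 :+ e)))) refl (# n) (# (p ^ k)) (# (p ^ k * (p ∸ 1))) (# p) (# (p ∸ 1)))))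

  infix 4 _≡_⟨_⟩
  _≡_⟨_⟩ : ℕ → ℕ → (m : ℕ) → .{{NonZero m}} → Set
  a ≡ b ⟨ m ⟩ = a % m ≡ b % m

  ≡⇒∣ : ∀ {a b m} {{_ : NonZero m}} → a ≤ b → a ≡ b ⟨ m ⟩ → m ∣ b ∸ a
  ≡⇒∣ {a} {b} {m} a≤b e = divides (b / m ∸ a / m) (trans (cong₂ _∸_ (DM.m≡m%n+[m/n]*n b m) (trans (DM.m≡m%n+[m/n]*n a m) (cong (_+ a / m * m) e))) (trans (ℕP.[m+n]∸[m+o]≡n∸o (b % m) (b / m * m) (a / m * m)) (sym (ℕP.*-distribʳ-∸ m (b / m) (a / m)))))

  ∣⇒≡ : ∀ {a b m} {{_ : NonZero m}} → a ≤ b → m ∣ b ∸ a → a ≡ b ⟨ m ⟩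
  ∣⇒≡ {a} {b} {m} a≤b d = sym (trans (cong (_% m) (sym (ℕP.m+[n∸m]≡n a≤b))) (DM.%-remove-+ʳ a d))

  ∣-coprime : ∀ {m n c} → Coprime m n → m ∣ c → n ∣ c → m * n ∣ c
  ∣-coprime {m} {n} {c} cop (divides k refl) n∣ with coprime-divisor (CP.sym cop) (subst (n ∣_) (ℕP.*-comm k m) n∣)
  ... | divides j refl = divides j (l j n m)
    where l : ∀ j n m → j * n * m ≡ j * (m * n)
          l = solve-∀

  ≡-combine : ∀ {a b m n} {{_ : NonZero m}} {{_ : NonZero n}} {{_ : NonZero (m * n)}} → Coprime m n → a ≡ b ⟨ m ⟩ → a ≡ b ⟨ n ⟩ → a ≡ b ⟨ m * n ⟩
  ≡-combine {a} {b} cop e f with ℕP.≤-total a b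
  ... | inj₁ p = ∣⇒≡ p (∣-coprime cop (≡⇒∣ p e) (≡⇒∣ p f))
  ... | inj₂ p = sym (∣⇒≡ p (∣-coprime cop (≡⇒∣ p (sym e)) (≡⇒∣ p (sym f))))

  crt : ∀ {m n} {{_ : NonZero m}} {{_ : NonZero n}} → Coprime m n → ∀ x y → ∃ λ z → z ≡ x ⟨ m ⟩ × z ≡ y ⟨ n ⟩
  crt {m} {n} cop x y = x + m * t , DM.%-remove-+ʳ x (m∣m*n t) , lemma
    where
    open Cls n
    t = (y + x * (n ∸ 1)) * iv m
    mt : m * t ≈ y + x * (n ∸ 1)
    mt = ⊘-cancel {m} {t} {y + x * (n ∸ 1)} cop refl
    lemma : x + m * t ≈ y
    lemma = trans (≈-+ {x} {x} refl mt) (trans (≈-reflexive (trans (l x y (n ∸ 1)) (cong (λ u → y + x * u) (ℕP.m+[n∸m]≡n 1≤M)))) (*M≈0 y x))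
      where l : ∀ x y t → x + (y + x * t) ≡ y + x * (1 + t)
            l = solve-∀

  pow-period : ∀ {m D x k l} {{_ : NonZero m}} {{_ : NonZero D}} → x ^ D ≡ 1 ⟨ m ⟩ → k ≡ l ⟨ D ⟩ → x ^ k ≡ x ^ l ⟨ m ⟩
  pow-period {m} {D} {x} {k} {l} xD e = trans (red k) (trans (cong (λ t → x ^ t % m) e) (sym (red l)))
    where
    open Cls m
    open Euler m
    red : ∀ k → x ^ k ≈ x ^ (k % D)
    red k = trans (≈-reflexive (trans (cong (x ^_) (DM.m≡m%n+[m/n]*n k D)) (trans (ℕP.^-distribˡ-+-* x (k % D) (k / D * D)) (cong (λ t → x ^ (k % D) * t) (trans (cong (x ^_) (ℕP.*-comm (k / D) D)) (sym (ℕP.^-*-assoc x D (k / D))))))))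
      (trans (≈-* {x ^ (k % D)} refl (≈-1^ (k / D) xD)) (≈-reflexive (ℕP.*-identityʳ (x ^ (k % D)))))

  -- eqn says x^k (x - 1) ≡ a, without subtraction
  record Sol (m : ℕ) .{{_ : NonZero m}} (a D : ℕ) : Set where
    field
      x k    : ℕ
      unit   : Coprime x m
      period : x ^ D ≡ 1 ⟨ m ⟩
      eqn    : x ^ k * x ≡ a + x ^ k ⟨ m ⟩

  coprime-prod : ∀ {x m n} → Coprime x m → Coprime x n → Coprime x (m * n)
  coprime-prod {x} {m} {n} p r {d} (d∣x , d∣mn) = r (d∣x , coprime-divisor {d} {m} (λ (e∣d , e∣m) → p (∣-trans e∣d d∣x , e∣m)) d∣mn)

  -- The exponent matters only modulo the period of `x`, so it is glued modulo `D` and `E`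
  -- independently of the gluing of `x` modulo `m` and `n`; this is where coprime periods are used.
  combine : ∀ {m n a D E} {{_ : NonZero m}} {{_ : NonZero n}} {{_ : NonZero (m * n)}} {{_ : NonZero D}} {{_ : NonZero E}} →
    Coprime m n → Coprime D E → Sol m a D → Sol n a E → Sol (m * n) a (D * E)
  combine {m} {n} {a} {D} {E} cop copD S T = record
    { x = x ; k = k
    ; unit = coprime-prod (Cls.coprime-≈ m (sym xm) S.unit) (Cls.coprime-≈ n (sym xn) T.unit)
    ; period = ≡-combine cop (trans (cong (_% m) (sym (ℕP.^-*-assoc x D E))) (Euler.≈-1^ m E (trans (Euler.≈-^ m D xm) S.period)))
                             (trans (cong (λ t → x ^ t % n) (ℕP.*-comm D E)) (trans (cong (_% n) (sym (ℕP.^-*-assoc x E D))) (Euler.≈-1^ n D (trans (Euler.≈-^ n E xn) T.period))))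
    ; eqn = ≡-combine cop (transfer S xm kD) (transfer T xn kE) }
    where
    module S = Sol S
    module T = Sol T
    x-sol = crt cop S.x T.x
    x = proj₁ x-sol
    xm = proj₁ (proj₂ x-sol)
    xn = proj₂ (proj₂ x-sol)
    k-sol = crt copD S.k T.k
    k = proj₁ k-sol
    kD = proj₁ (proj₂ k-sol)
    kE = proj₂ (proj₂ k-sol)
    transfer : ∀ {m D} {{_ : NonZero m}} {{_ : NonZero D}} (S : Sol m a D) → x ≡ Sol.x S ⟨ m ⟩ → k ≡ Sol.k S ⟨ D ⟩ → x ^ k * x ≡ a + x ^ k ⟨ m ⟩
    transfer {m} {D} S xm kD = trans (≈-* {x ^ k} {Sol.x S ^ Sol.k S} {x} {Sol.x S} pw xm) (trans (Sol.eqn S) (≈-+ {a} {a} refl (sym pw)))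
      where
      open Cls m
      pw : x ^ k ≈ Sol.x S ^ Sol.k S
      pw = trans (Euler.≈-^ m k xm) (pow-period {m} {D} {Sol.x S} {k} {Sol.k S} (Sol.period S) kD)

  coprime-^ʳ : ∀ {x m} s → Coprime x m → Coprime x (m ^ s)
  coprime-^ʳ zero    c (_ , d∣1) = ∣1⇒≡1 d∣1
  coprime-^ʳ (suc s) c = coprime-prod c (coprime-^ʳ s c)

  2^≢0 : ∀ s → NonZero (2 ^ s)
  2^≢0 s = ℕ.>-nonZero (ℕP.m^n>0 2 s)

  -- Instead of the exact order of 1 + 2 t, a power of 2 is taken as period, coprime to the odd
  -- periods at the odd primes.
  base : ∀ s t → Sol (2 ^ s) {{2^≢0 s}} (2 * t) (2 ^ s)
  base s t = record { x = 1 + 2 * t ; k = 0 ; unit = coprime-^ʳ s odd′ ; period = per ; eqn = cong (_%′ (2 ^ s)) (l t) }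
    where
    instance
      nz : NonZero (2 ^ s)
      nz = 2^≢0 s
    _%′_ : ℕ → (n : ℕ) → .{{NonZero n}} → ℕ
    _%′_ = _%_
    l : ∀ t → 1 * (1 + 2 * t) ≡ 2 * t + 1
    l = solve-∀
    odd′ : Coprime (1 + 2 * t) 2
    odd′ {e} (e∣x , e∣2) = ∣1⇒≡1 (∣m+n∣m⇒∣n (subst (e ∣_) (ℕP.+-comm 1 (2 * t)) e∣x) (∣-trans e∣2 (m∣m*n t)))
    -- (1 + 2^(j+1) z)² = 1 + 2^(j+2) (z + 2^j z²)
    power : ∀ j → ∃ λ z → (1 + 2 * t) ^ (2 ^ j) ≡ 1 + 2 ^ suc j * z
    power zero = t , ℕP.*-identityʳ (1 + 2 * t)
    power (suc j) with power j
    ... | z , e = z + 2 ^ j * (z * z) , trans (cong ((1 + 2 * t) ^_) (ℕP.*-comm 2 (2 ^ j))) (trans (sym (ℕP.^-*-assoc (1 + 2 * t) (2 ^ j) 2)) (trans (cong (_^ 2) e) (sq (2 ^ j) z)))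
      where
      sq : ∀ p z → (1 + 2 * p * z) ^ 2 ≡ 1 + 2 * (2 * p) * (z + p * (z * z))
      sq p z = trans (cong ((1 + 2 * p * z) *_) (ℕP.*-identityʳ (1 + 2 * p * z))) (sq′ p z)
        where sq′ : ∀ p z → (1 + 2 * p * z) * (1 + 2 * p * z) ≡ 1 + 2 * (2 * p) * (z + p * (z * z))
              sq′ = solve-∀
    per : (1 + 2 * t) ^ (2 ^ s) ≡ 1 ⟨ 2 ^ s ⟩
    per with power s
    ... | z , e = trans (cong (_%′ (2 ^ s)) (trans e (l′ (2 ^ s) z))) (DM.%-remove-+ʳ 1 {2 ^ s * (2 * z)} {2 ^ s} (m∣m*n {2 ^ s} (2 * z)))
      where l′ : ∀ p z → 1 + 2 * p * z ≡ 1 + p * (2 * z)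
            l′ = solve-∀

  record Locally (q d : ℕ) : Set where
    field
      prime : Prime q
      odd   : Coprime q 2
      1≤d   : 1 ≤ d
      d-odd : Coprime d 2
      solvable : ∀ a → Sol q {{prime⇒nonZero prime}} a d

  Realised : ℕ → ℕ → ℕ → Set
  Realised M t B = ∃ λ τ → B ≤ τ × IsTotient τ × (∃ λ j → + τ ≡ + (2 * t) ℤ.+ j ℤ.* + M)

  module Realise (M : ℕ) {{nzM : NonZero M}} (t E : ℕ) (1≤E : 1 ≤ E) (S : Sol M (2 * t) E) (B : ℕ) where
    open Cls M
    open Euler M
    private
      module S = Sol S
      instance
        nzE : NonZero E
        nzE = ℕ.>-nonZero 1≤E
      -- A multiple of the period leaves the congruence intact, and `p ^ K`, at least `2 ^ K`,
      -- exceeds `B`.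
      K = S.k + B * E

      l : ∀ a b → a * b + a ≡ a * (b + 1)
      l = solve-∀
      l′ : ∀ a c t → a + c + c * t ≡ a + c * (1 + t)
      l′ = solve-∀

      cancel-+ : ∀ {a b c} → a + c ≈ b + c → a ≈ b
      cancel-+ {a} {b} {c} e = trans (sym (r a)) (trans (≈-+ {a + c} {b + c} {c * (M ∸ 1)} e refl) (r b))
        where
        r : ∀ a → a + c + c * (M ∸ 1) ≈ a
        r a = trans (≈-reflexive (trans (l′ a c (M ∸ 1)) (cong (λ t → a + c * t) (ℕP.m+[n∸m]≡n 1≤M)))) (*M≈0 a c)

      value : ∀ p → Prime p → p ≈ S.x → ∃ λ τ → B ≤ τ × IsTotient τ × τ ≈ 2 * t
      value p pr p≡x = p ^ K * (p ∸ 1) , large , (p ^ suc K , ℕP.m^n>0 p {{prime⇒nonZero pr}} (suc K) , φ-prime-power pr K) , congruence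
        where
        1≤p-1 : 1 ≤ p ∸ 1
        1≤p-1 = ℕP.∸-monoˡ-≤ 1 (prime≥2 pr)
        large : B ≤ p ^ K * (p ∸ 1)
        large = ℕP.≤-trans (ℕP.≤-trans (ℕP.≤-trans (ℕP.m≤m*n B E) (ℕP.m≤n+m (B * E) S.k)) (ℕP.≤-trans (ℕP.<⇒≤ (n<2^n K)) (ℕP.^-monoˡ-≤ K (prime≥2 pr)))) (ℕP.m≤m*n (p ^ K) (p ∸ 1) {{ℕ.>-nonZero 1≤p-1}})
        pK : p ^ K ≈ S.x ^ S.k
        pK = trans (≈-^ K p≡x) (pow-period {M} {E} {S.x} {K} {S.k} S.period (DM.%-remove-+ʳ S.k {B * E} {E} (n∣m*n B)))
        whole : p ^ K * p ≈ 2 * t + p ^ K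
        whole = trans (≈-* {p ^ K} {S.x ^ S.k} {p} {S.x} pK p≡x) (trans S.eqn (≈-+ {2 * t} {2 * t} refl (sym pK)))
        congruence : p ^ K * (p ∸ 1) ≈ 2 * t
        congruence = cancel-+ {p ^ K * (p ∸ 1)} {2 * t} {p ^ K} (trans (≈-reflexive (trans (l (p ^ K) (p ∸ 1)) (cong (p ^ K *_) (ℕP.m∸n+n≡m (prime≥1 pr))))) whole)

      split : ∀ n → + n ≡ + (n % M) ℤ.+ + (n / M) ℤ.* + M
      split n = trans (cong +_ (DM.m≡m%n+[m/n]*n n M)) (trans (ℤP.pos-+ (n % M) _) (cong (λ u → + (n % M) ℤ.+ u) (ℤP.pos-* (n / M) M)))

      rearrange : ∀ r a b m → r ℤ.+ a ℤ.* m ≡ (r ℤ.+ b ℤ.* m) ℤ.+ (a ℤ.- b) ℤ.* m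
      rearrange = ℤ-solve-∀

      to-ℤ : (∃ λ τ → B ≤ τ × IsTotient τ × τ ≈ 2 * t) → Realised M t B
      to-ℤ (τ , B≤τ , it , e) = τ , B≤τ , it , + (τ / M) ℤ.- + (2 * t / M) ,
        trans (split τ) (trans (cong (λ r → + r ℤ.+ + (τ / M) ℤ.* + M) e) (trans (rearrange (+ (2 * t % M)) (+ (τ / M)) (+ (2 * t / M)) (+ M)) (cong (λ u → u ℤ.+ (+ (τ / M) ℤ.- + (2 * t / M)) ℤ.* + M) (sym (split (2 * t))))))

      from-prime : (∃ λ p → Prime p × p % M ≡ S.x % M) → Realised M t B
      from-prime (p , pr , e) = to-ℤ (value p pr e)

    abstract
      realised : Realised M t B
      realised = from-prime (dirichlet M S.x S.unit)

  module _ (M : ℕ) {{_ : NonZero M}} (2∣M : 2 ∣ M) (every : ∀ t B → Realised M t B) where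
    private
      rearrange₁ : ∀ x y → (x ℤ.+ y) ℤ.- y ≡ x
      rearrange₁ = ℤ-solve-∀

      rearrange₂ : ∀ r j c m → (r ℤ.+ j ℤ.* m) ℤ.- (r ℤ.+ c ℤ.* m) ≡ (j ℤ.- c) ℤ.* m
      rearrange₂ = ℤ-solve-∀

      even-rest : ∀ {a r c} → a ≡ + r ℤ.+ c ℤ.* + M → (+ 2) ℤS.∣ a → 2 ∣ r
      even-rest {a} {r} {c} a≡ 2∣a = ℤS.∣⇒∣ᵤ (subst (λ u → (+ 2) ℤS.∣ u) (trans (cong (λ u → u ℤ.- c ℤ.* + M) a≡) (rearrange₁ (+ r) (c ℤ.* + M))) (ℤS.∣m∣n⇒∣m-n 2∣a (ℤS.∣n⇒∣m*n c (ℤS.∣ᵤ⇒∣ 2∣M))))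

      shift : ∀ {a r c t B} → a ≡ + r ℤ.+ c ℤ.* + M → r ≡ 2 * t → Realised M t B → ∃ λ τ → B ≤ τ × IsTotient τ × ((+ τ) ≡ a [mod M ])
      shift {a} {r} {c} a≡ r≡ (τ , B≤τ , it , j , e) = τ , B≤τ , it , ℤS.∣⇒∣ᵤ (ℤS.divides (j ℤ.- c) (trans (cong₂ ℤ._-_ (trans e (cong (λ u → + u ℤ.+ j ℤ.* + M) (sym r≡))) a≡) (rearrange₂ (+ r) j c (+ M))))

      from-half : ∀ {a r c} → a ≡ + r ℤ.+ c ℤ.* + M → 2 ∣ r → InfManyTotientsIn a M
      from-half {a} {r} {c} a≡ (divides t e) B = shift {a} {r} {c} {t} a≡ (trans e (ℕP.*-comm t 2)) (every t B)

    -- As `M` is even, the remainder of an even integer modulo `M` is even, so it suffices to reach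
    -- the natural targets `2 t`.
    in-even-class : ∀ a → (+ 2) ℤS.∣ a → InfManyTotientsIn a M
    in-even-class a 2∣a = from-half {a} {a ℤ.%ℕ M} {a ℤ./ℕ M} a≡ (even-rest {a} {a ℤ.%ℕ M} {a ℤ./ℕ M} a≡ 2∣a)
      where a≡ = ℤD.a≡a%ℕn+[a/ℕn]*n a M

  module _ (ord : ℕ → ℕ) where
    Compatible : ℕ → ℕ → Set
    Compatible q q′ = Coprime q q′ × Coprime (ord q) (ord q′)

    module _ (s : ℕ) where
      private
        P D : List ℕ → ℕ
        P []       = 2 ^ s
        P (q ∷ qs) = q * P qs
        D []       = 2 ^ s
        D (q ∷ qs) = ord q * D qs

        pos : ∀ {qs} → All (λ q → Locally q (ord q)) qs → 1 ≤ P qs × 1 ≤ D qs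
        pos []       = ℕP.m^n>0 2 s , ℕP.m^n>0 2 s
        pos (A ∷ As) = ℕP.*-mono-≤ (prime≥1 (Locally.prime A)) (proj₁ (pos As)) , ℕP.*-mono-≤ (Locally.1≤d A) (proj₂ (pos As))

        cops : ∀ {q qs} → Locally q (ord q) → All (Compatible q) qs → Coprime q (P qs) × Coprime (ord q) (D qs)
        cops A [] = coprime-^ʳ s (Locally.odd A) , coprime-^ʳ s (Locally.d-odd A)
        cops A ((c , c′) ∷ cs) = coprime-prod c (proj₁ (cops A cs)) , coprime-prod c′ (proj₂ (cops A cs))

        system : ∀ t {qs} (As : All (λ q → Locally q (ord q)) qs) → AllPairs Compatible qs → Sol (P qs) {{ℕ.>-nonZero (proj₁ (pos As))}} (2 * t) (D qs)
        system t [] [] = base s t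
        system t {q ∷ qs} (A ∷ As) (c ∷ cs) = combine {{prime⇒nonZero (Locally.prime A)}} {{ℕ.>-nonZero (proj₁ (pos As))}} {{ℕ.>-nonZero (proj₁ (pos (A ∷ As)))}} {{ℕ.>-nonZero (Locally.1≤d A)}} {{ℕ.>-nonZero (proj₂ (pos As))}}
          (proj₁ (cops A c)) (proj₂ (cops A c)) (Locally.solvable A (2 * t)) (system t As cs)

        P≡ : ∀ qs → P qs ≡ 2 ^ s * product qs
        P≡ []       = sym (ℕP.*-identityʳ (2 ^ s))
        P≡ (q ∷ qs) = trans (cong (q *_) (P≡ qs)) (l q (2 ^ s) (product qs))
          where l : ∀ a b c → a * (b * c) ≡ b * (a * c)
                l = solve-∀

        infinitely : ∀ {qs} (As : All (λ q → Locally q (ord q)) qs) → AllPairs Compatible qs → ∀ t B → Realised (2 ^ s * product qs) t B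
        infinitely {qs} As cs t B = subst (λ M → Realised M t B) (P≡ qs) (Realise.realised (P qs) {{ℕ.>-nonZero (proj₁ (pos As))}} t (D qs) (proj₂ (pos As)) (system t As cs) B)

      in-class : ∀ {qs} → All (λ q → Locally q (ord q)) qs → AllPairs Compatible qs → 1 ≤ s → ∀ a → (+ 2) ℤS.∣ a → InfManyTotientsIn a (2 ^ s * product qs)
      in-class {qs} As cs 1≤s = in-even-class (2 ^ s * product qs) {{ℕ.>-nonZero (subst (1 ≤_) (P≡ qs) (proj₁ (pos As)))}} (∣-trans (pow 1≤s) (m∣m*n (product qs))) (infinitely As cs)
        where
        pow : ∀ {s} → 1 ≤ s → 2 ∣ 2 ^ s
        pow {suc s} _ = m∣m*n (2 ^ s)

    good-product : ∀ {qs} → All (λ q → Locally q (ord q)) qs → AllPairs Compatible qs → Good (product qs)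
    good-product As cs s 1≤s a 2∣a = in-class s As cs 1≤s a (ℤS.∣ᵤ⇒∣ 2∣a)

-- Second moment of the smooth part of an integer.

module Smooth (τ : ℕ) where
  open Field
  open Sums
  open NumTh

  H-2^ : ∀ k → ∑ (2 ^ k) ⅟ ≼ # 1 ⊕ # k
  H-2^ zero    = ≼-trans (≡≼ (cong (# 0 ⊕_) ⅟-1)) (lin 0 (const 0) (solve 0 (κ 1 :+ κ 0 :- (κ 0 :+ κ 1) := κ 0) refl))
  H-2^ (suc k) = ≼-trans (≡≼ (cong (λ t → ∑ t ⅟) (cong (n +_) (ℕP.+-identityʳ n)))) (lin 0 (1 · (≡≼ (∑-+ n n ⅟)) ⊞ 1 · (H-2^ k) ⊞ 1 · block ⊞ 1 · (≡≽ (#-suc k))) (solve 5 (λ a b c d e → κ 1 :+ b :- a := c :+ d :- a :+ (κ 1 :+ e :- c :+ (κ 1 :- d :+ (b :- (κ 1 :+ e))))) refl (∑ (n + n) ⅟) (# (suc k)) (∑ n ⅟) (∑ n (λ i → ⅟ (n + i))) (# k)))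
    where
    n = 2 ^ k
    1≤n = ℕP.m^n>0 2 k
    block : ∑ n (λ i → ⅟ (n + i)) ≼ # 1
    block = ≼-trans (∑-mono n (λ i _ _ → ⅟-anti 1≤n (ℕP.m≤m+n n i))) (≡≼ (trans (∑-const n (⅟ n)) (⅟-law 1≤n)))

  T : ℕ
  T = 2 ^ τ

  -- τ at the primes up to T, so that L n ≥ log₂ of the T-smooth part of n
  ℓ : ℕ → F
  ℓ p = # τ ⊗ 𝟙 (p ≤? T)

  ℓ-nn : ∀ p → # 0 ≼ ℓ p
  ℓ-nn p = nn-⊗ (0≼# τ) (𝟙-nn (p ≤? T))

  ℓ≼ : ∀ p → ℓ p ≼ # τ
  ℓ≼ p = (lin 0 (1 · (⊗-monoʳ (0≼# τ) (𝟙≼1 (p ≤? T)))) (solve 2 (λ a b → a :- a :* b := a :* κ 1 :- a :* b) refl (# τ) (𝟙 (p ≤? T))))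

  open Arith ℓ public

  L-nn : ∀ n → # 0 ≼ L n
  L-nn n = go (fac n)
    where
    go : ∀ ps → # 0 ≼ sumℓ ps
    go []       = ≼-refl
    go (p ∷ ps) = (lin 0 (1 · (ℓ-nn p) ⊞ 1 · (go ps)) (solve 2 (λ a b → a :+ b :- κ 0 := a :- κ 0 :+ (b :- κ 0)) refl (ℓ p) (sumℓ ps)))

  Λ-nn : ∀ n → # 0 ≼ Λ n
  Λ-nn n with fac n
  ... | []     = ≼-refl
  ... | p ∷ ps = nn-⊗ (𝟙-nn (All.all? (_≟ p) ps)) (ℓ-nn p)

  Λ-small : ∀ n → 1 ≤ n → (Λ n ≡ # 0) ⊎ (∃ λ p → Prime p × p ≤ T × p ∣ n)
  Λ-small n 1≤n with fac n in eq | fac-prime n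
  ... | []     | _ = inj₁ refl
  ... | p ∷ ps | pp ∷ _ with p ≤? T
  ...   | yes p≤T = inj₂ (p , pp , p≤T , ∈-fac-∣ 1≤n (subst (p ∈_) (sym eq) (here refl)))
  ...   | no _ = inj₁ (solve 2 (λ a b → a :* (b :* κ 0) := κ 0) refl (𝟙 (All.all? (_≟ p) ps)) (# τ))

  module Weighted (y : ℕ) (g : ℕ → F) (g-nn : ∀ n → # 0 ≼ g n) where
    v : ℕ → F
    v d = Λ d ⊗ ⅟ d ⊗ g d

    v-nn : ∀ d → # 0 ≼ v d
    v-nn d = nn-⊗ (nn-⊗ (Λ-nn d) (⅟-nn d)) (g-nn d)

    at : ℕ → F
    at p = ∑ y (λ d → 𝟙 (p ∣? d) ⊗ v d)

    -- The substitution `d = p k` of a geometric series, now with a weight. For the additive weight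
    -- `L` the shifted value `L (p k)` exceeds `L k` by at most `τ`, so the recursion closes in
    -- `Moments`.
    at-step : ∀ {p} → Prime p → # p ⊗ at p ≼ # τ ⊗ g p ⊕ ∑ (y ÷ p) (λ k → 𝟙 (p ∣? k) ⊗ (Λ k ⊗ ⅟ k ⊗ g (p * k)))
    at-step {p} pr = ≼-trans (≡≼ (trans (cong (# p ⊗_) (∑-multiples y p v 1≤p)) (trans (sym (∑-⊗ (y ÷ p) (# p) _)) (trans (∑-cong (y ÷ p) pw) (∑-⊕ (y ÷ p) _ _))))) (⊕-mono (first (y ÷ p)) ≼-refl)
      where
      1≤p = prime≥1 pr
      pw : ∀ k → 1 ≤ k → k ≤ y ÷ p → # p ⊗ v (p * k) ≡ 𝟙 (k ≟ 1) ⊗ (L p ⊗ (⅟ k ⊗ g (p * k))) ⊕ 𝟙 (p ∣? k) ⊗ (Λ k ⊗ ⅟ k ⊗ g (p * k))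
      pw k 1≤k _ = trans (cong₂ (λ s t → # p ⊗ (s ⊗ t ⊗ g (p * k))) (Λ-step pr 1≤k) (⅟-* 1≤p 1≤k)) (trans (solve 8 (λ a b c d e f g h → a :* ((b :* c :+ d :* e) :* (f :* g) :* h) := a :* f :* (b :* (c :* (g :* h)) :+ d :* (e :* g :* h))) refl (# p) (𝟙 (k ≟ 1)) (L p) (𝟙 (p ∣? k)) (Λ k) (⅟ p) (⅟ k) (g (p * k))) (trans (cong (_⊗ (𝟙 (k ≟ 1) ⊗ (L p ⊗ (⅟ k ⊗ g (p * k))) ⊕ 𝟙 (p ∣? k) ⊗ (Λ k ⊗ ⅟ k ⊗ g (p * k)))) (⅟-law 1≤p)) (one _)))
        where one : ∀ z → # 1 ⊗ z ≡ z
              one z = (solve 1 (λ a → κ 1 :* a := a) refl z)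
      Lp≼ : L p ≼ # τ
      Lp≼ = ≼-trans (≡≼ (L-prime pr)) (ℓ≼ p)
      first : ∀ z → ∑ z (λ k → 𝟙 (k ≟ 1) ⊗ (L p ⊗ (⅟ k ⊗ g (p * k)))) ≼ # τ ⊗ g p
      first zero    = nn-⊗ (0≼# τ) (g-nn p)
      first (suc z) = ≼-trans (≡≼ (trans (∑-pick (λ k → L p ⊗ (⅟ k ⊗ g (p * k))) ℕP.≤-refl (s≤s z≤n)) (cong₂ (λ s t → L p ⊗ (s ⊗ g t)) ⅟-1 (ℕP.*-identityʳ p)))) (lin 0 (1 · (⊗-monoˡ (g-nn p) Lp≼)) (solve 3 (λ a b c → c :* b :- a :* (κ 1 :* b) := c :* b :- a :* b) refl (L p) (g p) (# τ)))

    -- Only primes up to `T` carry mass, and the sum of 1 / (p - 1) over them is at most a harmonic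
    -- sum up to 2^τ, hence 1 + τ.
    total≼ : ∀ c → (∀ {p} → Prime p → p ≤ T → at p ≼ c ⊗ ⅟ (p ∸ 1)) → # 0 ≼ c → ∑ y v ≼ c ⊗ (# 1 ⊕ # τ)
    total≼ c hc c-nn = ≼-trans (∑-mono y pointwise) (≼-trans (≡≼ (∑-swap y T _)) (≼-trans (∑-mono T perprime) (≼-trans (≡≼ (∑-⊗ T c _)) (⊗-monoʳ c-nn (≼-trans (shift T (ℕP.m^n>0 2 τ)) (H-2^ τ))))))
      where
      t : ℕ → ℕ → F
      t d p = 𝟙 (prime? p) ⊗ (𝟙 (p ∣? d) ⊗ v d)
      t-nn : ∀ d p → # 0 ≼ t d p
      t-nn d p = nn-⊗ (𝟙-nn (prime? p)) (nn-⊗ (𝟙-nn (p ∣? d)) (v-nn d))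
      pointwise : ∀ d → 1 ≤ d → d ≤ y → v d ≼ ∑ T (t d)
      pointwise d a b with Λ-small d a
      ... | inj₁ z = ≼-trans (≡≼ (trans (cong (λ s → s ⊗ ⅟ d ⊗ g d) z) (solve 2 (λ a b → κ 0 :* a :* b := κ 0) refl (⅟ d) (g d)))) (∑-nn T (λ p _ _ → t-nn d p))
      ... | inj₂ (p , pp , p≤T , p∣d) = ≼-trans (≡≼ (trans (solve 1 (λ a → a := κ 1 :* (κ 1 :* a)) refl (v d)) (sym (cong₂ _⊗_ (𝟙-yes (prime? p) pp) (cong (_⊗ v d) (𝟙-yes (p ∣? d) p∣d)))))) (∑-term (prime≥1 pp) p≤T (λ p _ _ → t-nn d p))
      perprime : ∀ p → 1 ≤ p → p ≤ T → ∑ y (λ d → t d p) ≼ c ⊗ ⅟ (p ∸ 1)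
      perprime p a b = ≼-trans (≡≼ (∑-⊗ y (𝟙 (prime? p)) _)) (≼-trans (𝟙-⊗-mono (prime? p) (λ pp → hc pp b)) (𝟙-⊗≼ (prime? p) (nn-⊗ c-nn (⅟-nn (p ∸ 1)))))
      shift : ∀ n → 1 ≤ n → ∑ n (λ p → ⅟ (p ∸ 1)) ≼ ∑ n ⅟
      shift (suc n) _ = ≼-trans (≡≼ (trans (∑-+ 1 n (λ p → ⅟ (p ∸ 1))) (solve 1 (λ a → κ 0 :+ κ 0 :+ a := a) refl (∑ n ⅟)))) (∑-grow (ℕP.n≤1+n n) (λ i _ _ → ⅟-nn i))

  module Moments (y : ℕ) where
    private
      module One = Weighted y (λ _ → # 1) (λ _ → 0≼1)
      module Log₁ = Weighted y L L-nn

      from-step : ∀ {p c S} → Prime p → # p ⊗ S ≼ c ⊕ S → S ≼ c ⊗ ⅟ (p ∸ 1)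
      from-step {p} pr h = go p (prime≥2 pr) h
        where
        go : ∀ q {c S} → 2 ≤ q → # q ⊗ S ≼ c ⊕ S → S ≼ c ⊗ ⅟ (q ∸ 1)
        go (suc q) {c} {S} (s≤s 1≤q) h = cancel (#-mono 1≤q) (lin 0 (1 · h ⊞ 1 · (≡≽ (cong (_⊗ S) (#-suc q))) ⊞ 1 · (≡≽ (cong (c ⊗_) (⅟-law 1≤q)))) (solve 5 (λ a b c d e → a :* (c :* d) :- a :* b := c :+ b :- e :* b :+ (e :* b :- (κ 1 :+ a) :* b :+ (c :* (a :* d) :- c :* κ 1))) refl (# q) S c (⅟ q) (# (suc q))))

      grow : ∀ p (f : ℕ → F) → (∀ d → # 0 ≼ f d) → ∑ (y ÷ p) (λ k → 𝟙 (p ∣? k) ⊗ f k) ≼ ∑ y (λ k → 𝟙 (p ∣? k) ⊗ f k)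
      grow p f nn = ∑-grow (÷-≤-x y p) (λ d _ _ → nn-⊗ (𝟙-nn (p ∣? d)) (nn d))

      one-at : ∀ {p} → Prime p → One.at p ≼ # τ ⊗ ⅟ (p ∸ 1)
      one-at {p} pr = from-step pr (lin 0 (1 · (One.at-step pr) ⊞ 1 · (grow p One.v One.v-nn)) (solve 4 (λ a b c d → c :+ b :- a :* b := c :* κ 1 :+ d :- a :* b :+ (b :- d)) refl (# p) (One.at p) (# τ) (∑ (y ÷ p) (λ k → 𝟙 (p ∣? k) ⊗ One.v k))))

      one-at≼τ : ∀ {p} → Prime p → One.at p ≼ # τ
      one-at≼τ {p} pr = ≼-trans (one-at pr) (lin 0 (1 · (⊗-monoʳ (0≼# τ) (⅟≼1 (p ∸ 1)))) (solve 2 (λ a b → a :- a :* b := a :* κ 1 :- a :* b) refl (# τ) (⅟ (p ∸ 1))))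

      log-at : ∀ {p} → Prime p → Log₁.at p ≼ # 2 ⊗ (# τ ⊗ # τ) ⊗ ⅟ (p ∸ 1)
      log-at {p} pr = from-step pr (lin 0 (1 · (Log₁.at-step pr) ⊞ 1 · (⊗-monoʳ (0≼# τ) Lp≼) ⊞ 1 · Z≼ ⊞ 1 · (⊗-monoʳ (0≼# τ) (one-at≼τ pr))) (solve 6 (λ a b c d e f → κ 2 :* (c :* c) :+ b :- a :* b := c :* d :+ e :- a :* b :+ (c :* c :- c :* d :+ (c :* f :+ b :- e :+ (c :* c :- c :* f)))) refl (# p) (Log₁.at p) (# τ) (L p) Z (One.at p)))
        where
        Lp≼ : L p ≼ # τ
        Lp≼ = ≼-trans (≡≼ (L-prime pr)) (ℓ≼ p)
        Z = ∑ (y ÷ p) (λ k → 𝟙 (p ∣? k) ⊗ (Λ k ⊗ ⅟ k ⊗ L (p * k)))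
        Z≼ : Z ≼ # τ ⊗ One.at p ⊕ Log₁.at p
        Z≼ = ≼-trans (∑-mono (y ÷ p) (λ k a _ → ≼-trans (⊗-monoʳ (𝟙-nn (p ∣? k)) (⊗-monoʳ (nn-⊗ (Λ-nn k) (⅟-nn k)) (≼-trans (≡≼ (L-* (prime≥1 pr) a)) (⊕-mono Lp≼ ≼-refl)))) (≡≼ (solve 5 (λ a b c d e → a :* (b :* c :* (d :+ e)) := d :* (a :* (b :* c :* κ 1)) :+ a :* (b :* c :* e)) refl (𝟙 (p ∣? k)) (Λ k) (⅟ k) (# τ) (L k)))))
          (≼-trans (≡≼ (trans (∑-⊕ (y ÷ p) _ _) (cong (_⊕ ∑ (y ÷ p) (λ k → 𝟙 (p ∣? k) ⊗ Log₁.v k)) (∑-⊗ (y ÷ p) (# τ) _)))) (⊕-mono (⊗-monoʳ (0≼# τ) (grow p One.v One.v-nn)) (grow p Log₁.v Log₁.v-nn)))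

      t = # τ

      E≼ : ∑ y One.v ≼ t ⊗ (# 1 ⊕ t)
      E≼ = One.total≼ t (λ pr _ → one-at pr) (0≼# τ)

      A≼ : ∑ y Log₁.v ≼ # 2 ⊗ (t ⊗ t) ⊗ (# 1 ⊕ t)
      A≼ = Log₁.total≼ (# 2 ⊗ (t ⊗ t)) (λ pr _ → log-at pr) (nn-⊗ (0≼# 2) (nn-⊗ (0≼# τ) (0≼# τ)))

      E-nn : # 0 ≼ ∑ y One.v
      E-nn = ∑-nn y (λ d _ _ → One.v-nn d)

      conv-nn : ∀ n → # 0 ≼ conv Λ Λ n
      conv-nn n = ∑-nn n (λ d _ _ → nn-⊗ (𝟙-nn (d ∣? n)) (nn-⊗ (Λ-nn d) (Λ-nn (n ÷ d))))

      conv≼ : ∑ y (λ n → ⅟ n ⊗ conv Λ Λ n) ≼ ∑ y One.v ⊗ ∑ y One.v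
      conv≼ = ≼-trans (≡≼ (trans (∑-conv y Λ Λ ⅟) (∑-cong y (λ d p _ → trans (cong (Λ d ⊗_) (trans (∑-cong (y ÷ d) (λ k r _ → trans (cong (Λ k ⊗_) (⅟-* p r)) (solve 3 (λ a b c → a :* (b :* c) := b :* (a :* c :* κ 1)) refl (Λ k) (⅟ d) (⅟ k)))) (∑-⊗ (y ÷ d) (⅟ d) _))) (solve 3 (λ a b c → a :* (b :* c) := a :* b :* κ 1 :* c) refl (Λ d) (⅟ d) (∑ (y ÷ d) One.v))))))
        (≼-trans (∑-mono y (λ d _ _ → ⊗-monoʳ (One.v-nn d) (∑-grow (÷-≤-x y d) (λ i _ _ → One.v-nn i)))) (≡≼ (∑-⊗ʳ y (∑ y One.v) One.v)))

      Λ₂≼ : ∑ y (λ e → Λ₂ e ⊗ ⅟ e) ≼ # 2 ⊗ (t ⊗ t) ⊗ (# 1 ⊕ t) ⊕ t ⊗ (# 1 ⊕ t) ⊗ (t ⊗ (# 1 ⊕ t))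
      Λ₂≼ = ≼-trans (≡≼ (trans (∑-ext y (λ e → (solve 4 (λ a b c d → (a :* b :+ c) :* d := a :* d :* b :+ d :* c) refl (Λ e) (L e) (conv Λ Λ e) (⅟ e)))) (∑-⊕ y _ _))) (⊕-mono A≼ (≼-trans conv≼ (⊗-mono E-nn E-nn E≼ E≼)))

    -- The square of `L` is the divisor sum of `Λ₂`, so the moment is at most the harmonic sum times
    -- the sum of `Λ₂ e / e`. The latter is bounded by a polynomial of degree 4 in `τ`,
    -- independently of `y`.
    second-moment : ∑ y (λ n → ⅟ n ⊗ (L n ⊗ L n)) ≼ ∑ y ⅟ ⊗ (# 2 ⊗ (t ⊗ t) ⊗ (# 1 ⊕ t) ⊕ t ⊗ (# 1 ⊕ t) ⊗ (t ⊗ (# 1 ⊕ t)))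
    second-moment = ≼-trans (≡≼ (Λ₂∗1 y ⅟)) (≼-trans (∑-mono y (λ e p _ → ⊗-monoʳ (Λ₂-nn e) (≼-trans (≡≼ (trans (∑-cong (y ÷ e) (λ j r _ → ⅟-* p r)) (∑-⊗ (y ÷ e) (⅟ e) ⅟))) (⊗-monoʳ (⅟-nn e) (∑-grow (÷-≤-x y e) (λ i _ _ → ⅟-nn i))))))
      (≼-trans (≡≼ (trans (∑-ext y (λ e → (solve 3 (λ a b c → a :* (b :* c) := c :* (a :* b)) refl (Λ₂ e) (⅟ e) (∑ y ⅟)))) (∑-⊗ y (∑ y ⅟) _))) (⊗-monoʳ (∑-nn y (λ i _ _ → ⅟-nn i)) Λ₂≼)))
      where
      Λ₂-nn : ∀ e → # 0 ≼ Λ₂ e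
      Λ₂-nn e = ≼-trans (≡≼ (solve 0 (κ 0 := κ 0 :+ κ 0) refl)) (⊕-mono (nn-⊗ (Λ-nn e) (L-nn e)) (conv-nn e))

-- Doubly exponential blocks of primes.

module Block where
  open Field
  open Sums
  open NumTh
  open Roots
  open Global

  -- The primes between lo u = 2^(2^u) and hi u = lo (u + 1) share the smoothness bound T u.
  lo hi τ T w : ℕ → ℕ
  lo u = 2 ^ (2 ^ u)
  hi u = lo (suc u)
  τ u = 3 * u + 8
  T u = 2 ^ τ u
  w u = 2 ^ suc u

  smooth rough count : ℕ → List ℕ → ℕ
  smooth t [] = 1
  smooth t (p ∷ ps) with p ≤? t
  ... | yes _ = p * smooth t ps
  ... | no _  = smooth t ps
  rough t [] = 1
  rough t (p ∷ ps) with p ≤? t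
  ... | yes _ = rough t ps
  ... | no _  = p * rough t ps
  count t [] = 0
  count t (p ∷ ps) with p ≤? t
  ... | yes _ = suc (count t ps)
  ... | no _  = count t ps

  smooth*rough : ∀ t ps → smooth t ps * rough t ps ≡ product ps
  smooth*rough t [] = refl
  smooth*rough t (p ∷ ps) with p ≤? t
  ... | yes _ = trans (ℕP.*-assoc p _ _) (cong (p *_) (smooth*rough t ps))
  ... | no _  = trans (l (smooth t ps) p (rough t ps)) (cong (p *_) (smooth*rough t ps))
    where l : ∀ a b c → a * (b * c) ≡ b * (a * c)
          l = solve-∀

  smooth≤ : ∀ t ps → smooth t ps ≤ t ^ count t ps
  smooth≤ t [] = ℕP.≤-refl
  smooth≤ t (p ∷ ps) with p ≤? t
  ... | yes p≤t = ℕP.*-mono-≤ p≤t (smooth≤ t ps)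
  ... | no _    = smooth≤ t ps

  rough-prime : ∀ t ps → All Prime ps → ∀ r → Prime r → r ∣ rough t ps → t < r
  rough-prime t [] [] r rp d = ⊥-elim (ℕP.<⇒≢ (prime≥2 rp) (sym (∣1⇒≡1 d)))
  rough-prime t (p ∷ ps) (a ∷ as) r rp d with p ≤? t
  ... | yes _ = rough-prime t ps as r rp d
  ... | no p≰t with euclidsLemma p (rough t ps) rp d
  ...   | inj₁ r∣p = subst (t <_) (sym (prime-∣-prime rp a r∣p)) (ℕP.≰⇒> p≰t)
  ...   | inj₂ r∣  = rough-prime t ps as r rp r∣

  sumℓ-count : ∀ k ps → Smooth.sumℓ k ps ≡ # (k * count (2 ^ k) ps)
  sumℓ-count k [] = sym (cong #_ (ℕP.*-zeroʳ k))
  sumℓ-count k (p ∷ ps) with p ≤? 2 ^ k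
  ... | yes _ = trans (cong (# k ⊗ # 1 ⊕_) (sumℓ-count k ps)) (trans (solve 2 (λ a b → a :* κ 1 :+ b := a :+ b) refl (# k) (# (k * c))) (trans (sym (#-+ k (k * c))) (cong #_ (sym (ℕP.*-suc k c)))))
    where c = count (2 ^ k) ps
  ... | no _ = trans (cong (# k ⊗ # 0 ⊕_) (sumℓ-count k ps)) (solve 2 (λ a b → a :* κ 0 :+ b := b) refl (# k) (# (k * count (2 ^ k) ps)))

  -- With `ℓ` constantly 1, `Λ` is the indicator of prime powers and `L` counts prime factors with
  -- multiplicity, of which there are at most log₂ d.
  ω≼ : ∀ d → 1 ≤ d → ∃ λ k → 2 ^ k ≤ d × ∑ d (λ r → 𝟙 (prime? r) ⊗ 𝟙 (r ∣? d)) ≼ # k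
  ω≼ d 1≤d with Ω d 1≤d
    where
    open Arith (λ _ → # 1)
    Ω : ∀ n → 1 ≤ n → ∃ λ k → 2 ^ k ≤ n × L n ≡ # k
    Ω = prime-induction _ (0 , ℕP.≤-refl , refl) λ p e pr 1≤e (k , b , eq) → suc k , ℕP.*-mono-≤ (prime≥2 pr) b , trans (L-* (prime≥1 pr) 1≤e) (trans (cong₂ _⊕_ (L-prime pr) eq) (sym (#-suc k)))
  ... | k , b , eq = k , b , ≼-trans (∑-mono d (λ r p _ → pt r p)) (≡≼ (trans (Λ-divisors d 1≤d) eq))
    where
    open Arith (λ _ → # 1)
    Λ-nn : ∀ n → # 0 ≼ Λ n
    Λ-nn n with fac n
    ... | []     = ≼-refl
    ... | p ∷ ps = nn-⊗ (𝟙-nn (All.all? (_≟ p) ps)) 0≼1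
    pt : ∀ r → 1 ≤ r → 𝟙 (prime? r) ⊗ 𝟙 (r ∣? d) ≼ 𝟙 (r ∣? d) ⊗ Λ r
    pt r _ with prime? r
    ... | yes rp = ≡≼ (trans (solve 1 (λ a → κ 1 :* a := a :* κ 1) refl (𝟙 (r ∣? d))) (cong (𝟙 (r ∣? d) ⊗_) (sym (trans (Λ-prime rp) (L-prime rp)))))
    ... | no _ = ≼-trans (≡≼ (solve 1 (λ a → κ 0 :* a := κ 0) refl (𝟙 (r ∣? d)))) (nn-⊗ (𝟙-nn (r ∣? d)) (Λ-nn r))

  -- The smooth part of `q - 1` is at most `2 ^ (τ u * count)`. If `q` in the block is not bad, the
  -- eighth power of its smooth part is therefore at most `lo u`, hence at most `q`.
  bad : ℕ → ℕ → Set
  bad u q = 2 ^ u ≤ 8 * (τ u * count (T u) (fac (q ∸ 1)))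

  growth : ∀ u → 6 ≤ u → (u + 6) * 4 < 2 ^ u
  growth u p = subst (λ v → (v + 6) * 4 < 2 ^ v) (ℕP.m+[n∸m]≡n p) (go (u ∸ 6))
    where
    go : ∀ k → (6 + k + 6) * 4 < 2 ^ (6 + k)
    go zero = ℕP.≤ᵇ⇒≤ 49 64 _
    go (suc k) = ℕP.≤-trans (ℕP.≤-trans (ℕP.≤-reflexive (cong suc (l k))) (ℕP.+-mono-≤ (go k) (ℕP.≤-trans (ℕP.m≤m+n 4 _) (ℕP.<⇒≤ (ℕP.≤-<-trans (ℕP.≤-reflexive (l′ k)) (go k)))))) (ℕP.≤-reflexive (trans (l″ (2 ^ (6 + k))) (cong (2 ^_) (sym (ℕP.+-suc 6 k)))))
      where
      l : ∀ k → (6 + suc k + 6) * 4 ≡ (6 + k + 6) * 4 + 4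
      l = solve-∀
      l′ : ∀ k → 4 + (44 + k * 4) ≡ (6 + k + 6) * 4
      l′ = solve-∀
      l″ : ∀ a → a + a ≡ 2 * a
      l″ = solve-∀

  -- If the claim failed, q^4 ≤ 16 s^4 d^4 would give q ≤ c^2 s^4 W^2. Squaring and inserting s^8 ≤
  -- q would give q ≤ (c W)^4, against the last hypothesis.
  power-gap : ∀ {q s d W c} → 1 ≤ q → q ≤ 2 * (s * d) → s ^ 8 ≤ q → (2 * 2 * (2 * 2)) ≤ c → (c * W) ^ 4 < q → c * (W * W) * (q * q * q) ≤ d * d * (d * d)
  power-gap {q} {s} {d} {W} {c} 1≤q q≤ s⁸≤q 16≤c big with c * (W * W) * (q * q * q) ≤? d * d * (d * d)
  ... | yes p = p
  ... | no p = ⊥-elim (ℕP.<⇒≱ big (ℕP.≤-trans step₃ (ℕP.≤-reflexive (l₄ c W))))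
    where
    lt = ℕP.<⇒≤ (ℕP.≰⇒> p)
    S = s * s * (s * s)
    instance
      q≢0 : NonZero q
      q≢0 = ℕ.>-nonZero 1≤q
      q³≢0 : NonZero (q * q * q)
      q³≢0 = ℕ.>-nonZero (ℕP.*-mono-≤ (ℕP.*-mono-≤ 1≤q 1≤q) 1≤q)
    step₁ : q * (q * q * q) ≤ c * c * (S * (W * W)) * (q * q * q)
    step₁ = ℕP.≤-trans (ℕP.≤-reflexive (l₁ q)) (ℕP.≤-trans (ℕP.*-mono-≤ (ℕP.*-mono-≤ q≤ q≤) (ℕP.*-mono-≤ q≤ q≤)) (ℕP.≤-trans (ℕP.≤-reflexive (l₂ 2 s d)) (ℕP.≤-trans (ℕP.*-mono-≤ 16≤c (ℕP.*-monoʳ-≤ S lt)) (ℕP.≤-reflexive (l₃ c S W (q * q * q))))))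
      where
      l₁ : ∀ q → q * (q * q * q) ≡ q * q * (q * q)
      l₁ = solve-∀
      l₂ : ∀ t s d → t * (s * d) * (t * (s * d)) * (t * (s * d) * (t * (s * d))) ≡ t * t * (t * t) * (s * s * (s * s) * (d * d * (d * d)))
      l₂ = solve-∀
      l₃ : ∀ c S W Q → c * (S * (c * (W * W) * Q)) ≡ c * c * (S * (W * W)) * Q
      l₃ = solve-∀
    step₂ : q ≤ c * c * (S * (W * W))
    step₂ = ℕP.*-cancelʳ-≤ q _ (q * q * q) step₁
    step₃ : q ≤ c * c * (c * c) * (W * W * (W * W))
    step₃ = ℕP.*-cancelʳ-≤ q _ q (ℕP.≤-trans (ℕP.*-mono-≤ step₂ step₂) (ℕP.≤-trans (ℕP.≤-reflexive (l c s W)) (ℕP.*-monoʳ-≤ (c * c * (c * c) * (W * W * (W * W))) (ℕP.≤-trans (ℕP.≤-reflexive (l′ s)) s⁸≤q))))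
      where
      l : ∀ c s W → c * c * (s * s * (s * s) * (W * W)) * (c * c * (s * s * (s * s) * (W * W))) ≡ c * c * (c * c) * (W * W * (W * W)) * (s * s * (s * s) * (s * s * (s * s)))
      l = solve-∀
      l′ : ∀ s → s * s * (s * s) * (s * s * (s * s)) ≡ s * (s * (s * (s * (s * (s * (s * (s * 1)))))))
      l′ = solve-∀
    l₄ : ∀ c W → c * c * (c * c) * (W * W * (W * W)) ≡ c * W * (c * W * (c * W * (c * W * 1)))
    l₄ = solve-∀

  module AtPrime {u q : ℕ} (6≤u : 6 ≤ u) (pr : Prime q) (lo≤q : lo u ≤ q) (q<hi : q < hi u) (nb : ¬ bad u q) where
    n = q ∸ 1
    ps = fac n
    s = smooth (T u) ps
    d = rough (T u) ps
    1≤n : 1 ≤ n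
    1≤n = ℕP.∸-monoˡ-≤ 1 (prime≥2 pr)
    sd : s * d ≡ n
    sd = trans (smooth*rough (T u) ps) (fac-product 1≤n)
    1≤s : 1 ≤ s
    1≤s = proj₁ (proj₁ (≤-factor {s} {d} 1≤n sd))
    1≤d : 1 ≤ d
    1≤d = proj₁ (proj₂ (≤-factor {s} {d} 1≤n sd))
    d≤n : d ≤ n
    d≤n = proj₂ (proj₂ (≤-factor {s} {d} 1≤n sd))
    q≡ : q ≡ 1 + n
    q≡ = sym (ℕP.m+[n∸m]≡n (prime≥1 pr))
    64≤2^u : 64 ≤ 2 ^ u
    64≤2^u = ℕP.^-monoʳ-≤ 2 6≤u
    q≢2 : q ≢ 2
    q≢2 e = ℕP.<⇒≱ (ℕP.<-≤-trans (n<2^n 2) (ℕP.^-monoʳ-≤ 2 (ℕP.≤-trans (ℕP.≤ᵇ⇒≤ 2 64 _) 64≤2^u))) (ℕP.≤-trans lo≤q (ℕP.≤-reflexive e))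
    odd-of : q ≢ 2 → Coprime q 2
    odd-of ne {e} (e∣q , e∣2) with prime⇒irreducible pr e∣q | prime⇒irreducible prime[2] e∣2
    ... | inj₁ r | _ = r
    ... | _ | inj₁ r = r
    ... | inj₂ r | inj₂ r′ = ⊥-elim (ne (trans (sym r) r′))
    2≤T : 2 ≤ T u
    2≤T = ℕP.^-monoʳ-≤ 2 {1} {τ u} (ℕP.≤-trans (s≤s z≤n) (ℕP.m≤n+m 8 (3 * u)))
    rough-r : ∀ r → Prime r → r ∣ d → T u < r
    rough-r = rough-prime (T u) ps (fac-prime n)
    d-odd : Coprime d 2
    d-odd {e} (e∣d , e∣2) with prime⇒irreducible prime[2] e∣2
    ... | inj₁ r = r
    ... | inj₂ refl = ⊥-elim (ℕP.<⇒≱ (rough-r 2 prime[2] e∣d) 2≤T)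
    s⁸≤q : s ^ 8 ≤ q
    s⁸≤q = ℕP.≤-trans (ℕP.^-monoˡ-≤ 8 (smooth≤ (T u) ps)) (ℕP.≤-trans (ℕP.≤-reflexive (trans (ℕP.^-*-assoc (T u) c 8) (trans (ℕP.^-*-assoc 2 (τ u) (c * 8)) (cong (2 ^_) (l (τ u) c))))) (ℕP.≤-trans (ℕP.^-monoʳ-≤ 2 (ℕP.<⇒≤ (ℕP.≰⇒> nb))) lo≤q))
      where
      c = count (T u) ps
      l : ∀ a c → a * (c * 8) ≡ 8 * (a * c)
      l = solve-∀
    q≤2sd : q ≤ 2 * (s * d)
    q≤2sd = subst (λ t → q ≤ 2 * t) (sym sd) (ℕP.≤-trans (ℕP.≤-reflexive q≡) (ℕP.≤-trans (ℕP.+-monoˡ-≤ n 1≤n) (ℕP.≤-reflexive (cong (n +_) (sym (ℕP.+-identityʳ n))))))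
    W≤ : 1 + w u ≤ 2 ^ (2 + u)
    W≤ = ℕP.≤-trans (ℕP.+-monoˡ-≤ (w u) (ℕP.m^n>0 2 (suc u))) (ℕP.≤-reflexive (cong (w u +_) (sym (ℕP.+-identityʳ (w u)))))
    cW≤ : ∀ c → c ≡ 2 ^ 4 → ∀ e → e ≡ 4 + (2 + u) → c * (1 + w u) ≤ 2 ^ e
    cW≤ c c≡ e e≡ = ℕP.≤-trans (ℕP.*-monoʳ-≤ c W≤) (ℕP.≤-reflexive (trans (cong (_* 2 ^ (2 + u)) c≡) (trans (sym (ℕP.^-distribˡ-+-* 2 4 (2 + u))) (cong (2 ^_) (sym e≡)))))
    big : ∀ c → c ≡ 2 ^ 4 → (c * (1 + w u)) ^ 4 < q
    big c c≡ = ℕP.≤-<-trans (ℕP.^-monoˡ-≤ 4 (cW≤ c c≡ (u + 6) (l u))) (ℕP.<-≤-trans (ℕP.≤-<-trans (ℕP.≤-reflexive (ℕP.^-*-assoc 2 (u + 6) 4)) (ℕP.^-monoʳ-< 2 ℕP.≤-refl (growth u 6≤u))) lo≤q)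
      where l : ∀ u → u + 6 ≡ 4 + (2 + u)
            l = solve-∀
    large : 16 * ((1 + w u) * (1 + w u)) * (q * q * q) ≤ d * d * (d * d)
    large = power-gap {q} {s} {d} {1 + w u} {16} (prime≥1 pr) q≤2sd s⁸≤q ℕP.≤-refl (big 16 refl)
    ω≼w : ∑ d (λ r → 𝟙 (prime? r) ⊗ 𝟙 (r ∣? d)) ≼ # w u
    ω≼w = bound (ω≼ d 1≤d)
      where
      bound : (∃ λ k → 2 ^ k ≤ d × ∑ d (λ r → 𝟙 (prime? r) ⊗ 𝟙 (r ∣? d)) ≼ # k) → ∑ d (λ r → 𝟙 (prime? r) ⊗ 𝟙 (r ∣? d)) ≼ # w u
      bound (k , 2^k≤d , h) = ≼-trans h (#-mono (ℕP.<⇒≤ (pow-reflect (ℕP.≤-<-trans 2^k≤d (ℕP.≤-<-trans (ℕP.≤-trans d≤n (ℕP.m∸n≤m q 1)) q<hi)))))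
        where
        pow-reflect : ∀ {a b} → 2 ^ a < 2 ^ b → a < b
        pow-reflect {a} {b} lt = ℕP.≰⇒> (λ b≤a → ℕP.<⇒≱ lt (ℕP.^-monoʳ-≤ 2 b≤a))
    2w≤ : ∀ r → Prime r → r ∣ d → 2 * w u ≤ r
    2w≤ r rp r∣d = ℕP.≤-trans (ℕP.^-monoʳ-≤ 2 {2 + u} {τ u} (ℕP.≤-trans (ℕP.+-mono-≤ {2} {8} (ℕP.≤ᵇ⇒≤ 2 8 _) (ℕP.m≤n*m u 3)) (ℕP.≤-reflexive (ℕP.+-comm 8 (3 * u))))) (ℕP.<⇒≤ (rough-r r rp r∣d))
    solvable : ∀ a → Sol q {{prime⇒nonZero pr}} a d
    solvable a = aux (a ≈? 0)
      where
      open PrimeMod q pr hiding (u)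
      open Local q pr
      open Solve {s} {d} 1≤s 1≤d sd (w u) (ℕP.m^n>0 2 (suc u)) ω≼w 2w≤ large
      aux : Dec (a ≈ 0) → Sol q {{prime⇒nonZero pr}} a d
      -- The class 0 is not a unit and needs a solution of its own: x = 1 makes x - 1 vanish.
      aux (yes e) = record { x = 1 ; k = 0 ; unit = coprime-1 ; period = ≈-1^ {1} d refl ; eqn = sym (≈-+ {a} {0} {1} e refl) }
      aux (no ne) = local (solve-local a (nonzero⇒unit ne))
        where
        local : _ → Sol q {{prime⇒nonZero pr}} a d
        local (x , k , cx , per , eqn) = record { x = x ; k = k ; unit = cx ; period = per ; eqn = eqn }
    locally : Locally q d
    locally = record { prime = pr ; odd = odd-of q≢2 ; 1≤d = 1≤d ; d-odd = d-odd ; solvable = solvable }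

  blk-ex : ∀ q → 2 ≤ q → ∃ λ u → lo u ≤ q × q < hi u
  blk-ex q 2≤q = go q (ℕP.<-trans (n<2^n q) (ℕP.^-monoʳ-< 2 ℕP.≤-refl (ℕP.<-trans (ℕP.n<1+n q) (n<2^n (suc q)))))
    where
    go : ∀ k → q < hi k → ∃ λ u → lo u ≤ q × q < hi u
    go zero h = 0 , 2≤q , h
    go (suc k) h with lo (suc k) ≤? q
    ... | yes p = suc k , p , h
    ... | no p  = go k (ℕP.≰⇒> p)

  blk : ℕ → ℕ
  blk q with 2 ≤? q
  ... | yes p = proj₁ (blk-ex q p)
  ... | no _  = 0

  blk-lo : ∀ {q} → 2 ≤ q → lo (blk q) ≤ q
  blk-lo {q} h with 2 ≤? q
  ... | yes p = proj₁ (proj₂ (blk-ex q p))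
  ... | no p = ⊥-elim (p h)

  blk-hi : ∀ {q} → 2 ≤ q → q < hi (blk q)
  blk-hi {q} h with 2 ≤? q
  ... | yes p = proj₂ (proj₂ (blk-ex q p))
  ... | no p = ⊥-elim (p h)

  -- All its prime factors exceed the bound of the block of `q`, so two orders can share only large
  -- primes.
  ord : ℕ → ℕ
  ord q = rough (T (blk q)) (fac (q ∸ 1))

  ord-∣ : ∀ {q} → 2 ≤ q → ord q ∣ q ∸ 1
  ord-∣ {q} h = divides (smooth (T (blk q)) (fac (q ∸ 1))) (sym (trans (smooth*rough (T (blk q)) (fac (q ∸ 1))) (fac-product (ℕP.∸-monoˡ-≤ 1 h))))

  ord-positive : ∀ {q} → 2 ≤ q → 1 ≤ ord q
  ord-positive h = proj₁ (∣-≤ (ℕP.∸-monoˡ-≤ 1 h) (ord-∣ h))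

  common-prime : ∀ {q q′} → 2 ≤ q → 2 ≤ q′ → ¬ Coprime (ord q) (ord q′) → ∃ λ r → T (blk q) < r × T (blk q′) < r × r ∣ q ∸ 1 × r ∣ q′ ∸ 1
  common-prime {q} {q′} a b nc with ¬coprime⇒prime (ord-positive a) nc
  ... | r , rp , r∣ , r∣′ = r , rough-prime _ (fac (q ∸ 1)) (fac-prime (q ∸ 1)) r rp r∣ , rough-prime _ (fac (q′ ∸ 1)) (fac-prime (q′ ∸ 1)) r rp r∣′ , ∣-trans r∣ (ord-∣ a) , ∣-trans r∣′ (ord-∣ b)

-- Convergent reciprocal sums of the excluded moduli.

module Tails where
  open Field
  open Sums
  open NumTh
  open Block

  tail-sq : ∀ Y → 1 ≤ Y → ∀ x → ∑ x (λ j → 𝟙 (Y <? j) ⊗ (⅟ j ⊗ ⅟ j)) ≼ ⅟ Y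
  tail-sq Y 1≤Y x = ≼-trans (∑-grow (ℕP.m≤n+m x Y) (λ j _ _ → nn-⊗ (𝟙-nn (Y <? j)) (nn-⊗ (⅟-nn j) (⅟-nn j)))) (≼-trans (≡≼ (trans (∑-+ Y x _) (cong (_⊕ ∑ x (λ i → 𝟙 (Y <? Y + i) ⊗ (⅟ (Y + i) ⊗ ⅟ (Y + i)))) (∑-0 Y (λ j _ j≤Y → trans (cong (_⊗ (⅟ j ⊗ ⅟ j)) (𝟙-no (Y <? j) (ℕP.≤⇒≯ j≤Y))) (solve 1 (λ a → κ 0 :* (a :* a) := κ 0) refl (⅟ j)))))))
    (lin 0 (1 · (go x) ⊞ 1 · (⅟-nn (Y + x))) (solve 3 (λ a b c → b :- (κ 0 :+ a) := b :- c :- a :+ (c :- κ 0)) refl (∑ x f) (⅟ Y) (⅟ (Y + x)))))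
    where
    f : ℕ → F
    f i = 𝟙 (Y <? Y + i) ⊗ (⅟ (Y + i) ⊗ ⅟ (Y + i))
    go : ∀ t → ∑ t f ≼ ⅟ Y ⊖ ⅟ (Y + t)
    go zero rewrite ℕP.+-identityʳ Y = (lin 0 (const 0) (solve 1 (λ a → a :- a :- κ 0 := κ 0) refl (⅟ Y)))
    go (suc t) rewrite ℕP.+-suc Y t = (lin 0 (1 · (go t) ⊞ 1 · (𝟙-⊗≼ (Y <? n′) (nn-⊗ (⅟-nn n′) (⅟-nn n′))) ⊞ 1 · (⊗-monoˡ (⅟-nn n′) (⅟-anti 1≤n (ℕP.n≤1+n n))) ⊞ 1 · (≡≼ (cong (⅟ n ⊗_) (⅟-law {n′} (s≤s z≤n)))) ⊞ 1 · (≡≽ (cong (⅟ n′ ⊗_) (⅟-law 1≤n))) ⊞ 1 · (≡≽ (cong ((⅟ n ⊗ ⅟ n′) ⊗_) (#-suc n)))) (solve 7 (λ a b c d e f g → d :- c :- (a :+ b :* (c :* c)) := d :- e :- a :+ (c :* c :- b :* (c :* c) :+ (e :* c :- c :* c :+ (e :* κ 1 :- e :* (f :* c) :+ (c :* (g :* e) :- c :* κ 1 :+ (e :* c :* f :- e :* c :* (κ 1 :+ g))))))) refl (∑ t f) (𝟙 (Y <? n′)) (⅟ n′) (⅟ Y) (⅟ n) (# n′) (# n)))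
      where
      n = Y + t
      n′ = suc (Y + t)
      1≤n : 1 ≤ n
      1≤n = ℕP.≤-trans 1≤Y (ℕP.m≤m+n Y t)

  bad? : ∀ u q → Dec (bad u q)
  bad? u q = 2 ^ u ≤? _

  b : ℕ → ℕ → F
  b u q = 𝟙 (lo u ≤? q) ⊗ 𝟙 (bad? u q)

  -- The condition `2 ≤ q` keeps out `q = 1`, where `q ∸ 1` is 0 and divisible by everything.
  dv : ℕ → ℕ → F
  dv r q = 𝟙 (2 ≤? q) ⊗ 𝟙 (r ∣? q ∸ 1)

  c : ℕ → ℕ → ℕ → ℕ → F
  c u q q′ r = 𝟙 (T u <? r) ⊗ (dv r q ⊗ dv r q′)

  b-nn : ∀ u q → # 0 ≼ b u q
  b-nn u q = nn-⊗ (𝟙-nn (lo u ≤? q)) (𝟙-nn (bad? u q))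

  b≼1 : ∀ u q → b u q ≼ # 1
  b≼1 u q = ≼-trans (𝟙-⊗≼ (lo u ≤? q) (𝟙-nn (bad? u q))) (𝟙≼1 (bad? u q))

  dv-nn : ∀ r q → # 0 ≼ dv r q
  dv-nn r q = nn-⊗ (𝟙-nn (2 ≤? q)) (𝟙-nn (r ∣? q ∸ 1))

  dv≼1 : ∀ r q → dv r q ≼ # 1
  dv≼1 r q = ≼-trans (𝟙-⊗≼ (2 ≤? q) (𝟙-nn (r ∣? q ∸ 1))) (𝟙≼1 (r ∣? q ∸ 1))

  c-nn : ∀ u q q′ r → # 0 ≼ c u q q′ r
  c-nn u q q′ r = nn-⊗ (𝟙-nn (T u <? r)) (nn-⊗ (dv-nn r q) (dv-nn r q′))

  c≼1 : ∀ u q q′ r → c u q q′ r ≼ # 1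
  c≼1 u q q′ r = ≼-trans (𝟙-⊗≼ (T u <? r) (nn-⊗ (dv-nn r q) (dv-nn r q′))) (≼-trans (⊗-mono (dv-nn r q) (dv-nn r q′) (dv≼1 r q) (dv≼1 r q′)) (lin 0 (const 0) (solve 0 (κ 1 :- κ 1 :* κ 1 := κ 0) refl)))

  -- Reciprocal sums of the moduli excluded at level `u`: the bad `q`, and the products `q * q′`
  -- weighted by the number of large `r` dividing both `q ∸ 1` and `q′ ∸ 1`. They run over integers
  -- up to `hi u`, whose harmonic sum is only of order `2 ^ u`.
  S₂ S₃ S : ℕ → F
  S₂ u = ∑ (hi u) (λ q → b u q ⊗ ⅟ q)
  S₃ u = ∑ (hi u) (λ q → ∑ (hi u) (λ q′ → ∑ (hi u) (λ r → c u q q′ r ⊗ ⅟ (q * q′))))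
  S u = S₂ u ⊕ S₃ u

  -- Passes from `q` to `n = q - 1`, where the conditions on divisors live; the term `q = 1` has to
  -- vanish.
  ∑-pred : ∀ y {f g : ℕ → F} → f 1 ≡ # 0 → (∀ n → 1 ≤ n → f (suc n) ≼ g n) → (∀ n → # 0 ≼ g n) → ∑ y f ≼ ∑ y g
  ∑-pred zero    _ _ _ = ≼-refl
  ∑-pred (suc y) {f} {g} z h nn = ≼-trans (≡≼ (trans (∑-+ 1 y f) (cong (λ t → # 0 ⊕ t ⊕ ∑ y (λ i → f (suc i))) z))) (≼-trans (≡≼ (solve 1 (λ a → κ 0 :+ κ 0 :+ a := a) refl (∑ y (λ i → f (suc i))))) (≼-trans (∑-mono y (λ n p _ → h n p)) (∑-grow (ℕP.n≤1+n y) (λ n _ _ → nn n))))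

  ⅟-suc≼ : ∀ n → 1 ≤ n → ⅟ (suc n) ≼ ⅟ n
  ⅟-suc≼ n p = ⅟-anti p (ℕP.n≤1+n n)

  module Bounds (u : ℕ) where
    private
      U x t h : F
      U = # (2 ^ u)
      x = # u ⊕ # 12
      t = # τ u
      h = ∑ (hi u) ⅟
      1≼U : # 1 ≼ U
      1≼U = #-mono (ℕP.m^n>0 2 u)
      U-nn = 0≼# (2 ^ u)
      t≡ : t ≡ # 3 ⊗ # u ⊕ # 8
      t≡ = trans (#-+ (3 * u) 8) (cong (_⊕ # 8) (#-* 3 u))
      h-nn : # 0 ≼ h
      h-nn = ∑-nn (hi u) (λ i _ _ → ⅟-nn i)
      h≼ : h ≼ # 3 ⊗ U
      h≼ = (lin 0 (1 · (Smooth.H-2^ (τ u) (2 ^ suc u)) ⊞ 1 · (≡≼ (#-* 2 (2 ^ u))) ⊞ 1 · 1≼U) (solve 3 (λ a b c → κ 3 :* b :- a := κ 1 :+ c :- a :+ (κ 2 :* b :- c :+ (b :- κ 1))) refl h U (# (2 * 2 ^ u))))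
      open Smooth (τ u) using (L; module Moments)
      L≡ : ∀ n → L n ≡ # (τ u * count (T u) (fac n))
      L≡ n = sumℓ-count (τ u) (fac n)
      M₂ : F
      M₂ = # 2 ⊗ (t ⊗ t) ⊗ (# 1 ⊕ t) ⊕ t ⊗ (# 1 ⊕ t) ⊗ (t ⊗ (# 1 ⊕ t))
      lo>1 : ¬ (lo u ≤ 1)
      lo>1 p = ℕP.<⇒≱ (ℕP.^-monoʳ-≤ 2 (ℕP.m^n>0 2 u)) p

      -- Chebyshev's inequality for the second moment: a bad `q` has `U ≼ # 8 ⊗ L (q ∸ 1)`, so its
      -- indicator times `U ⊗ U` is at most 64 times the square of `L`.
      S₂≼ : U ⊗ U ⊗ S₂ u ≼ # 64 ⊗ (h ⊗ M₂)
      S₂≼ = ≼-trans (≡≼ (sym (∑-⊗ (hi u) (U ⊗ U) _))) (≼-trans (∑-pred (hi u) {λ q → U ⊗ U ⊗ (b u q ⊗ ⅟ q)} {λ n → # 64 ⊗ (⅟ n ⊗ (L n ⊗ L n))} (trans (cong (λ s → U ⊗ U ⊗ (s ⊗ 𝟙 (bad? u 1) ⊗ ⅟ 1)) (𝟙-no (lo u ≤? 1) lo>1)) (solve 3 (λ a b c → a :* a :* (κ 0 :* b :* c) := κ 0) refl U (𝟙 (bad? u 1)) (⅟ 1))) pt (λ n → nn-⊗ (0≼# 64) (nn-⊗ (⅟-nn n) (sq-nn (L n))))) (≼-trans (≡≼ (∑-⊗ (hi u) (# 64) _)) (⊗-monoʳ (0≼# 64) (Moments.second-moment (hi u)))))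
        where
        pt : ∀ n → 1 ≤ n → U ⊗ U ⊗ (b u (suc n) ⊗ ⅟ (suc n)) ≼ # 64 ⊗ (⅟ n ⊗ (L n ⊗ L n))
        pt n p = ≼-trans (⊗-monoʳ (nn-⊗ U-nn U-nn) (⊗-mono (b-nn u (suc n)) (⅟-nn (suc n)) (𝟙-⊗≼ (lo u ≤? suc n) (𝟙-nn (bad? u (suc n)))) (⅟-suc≼ n p))) (≼-trans (≡≼ (solve 3 (λ a b c → a :* a :* (b :* c) := b :* (c :* (a :* a))) refl U (𝟙 (bad? u (suc n))) (⅟ n))) (≼-trans (𝟙-⊗-mono (bad? u (suc n)) {y = # 64 ⊗ (⅟ n ⊗ (L n ⊗ L n))} (λ bd → main bd)) (𝟙-⊗≼ (bad? u (suc n)) (nn-⊗ (0≼# 64) (nn-⊗ (⅟-nn n) (sq-nn (L n)))))))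
          where
          main : bad u (suc n) → ⅟ n ⊗ (U ⊗ U) ≼ # 64 ⊗ (⅟ n ⊗ (L n ⊗ L n))
          main bd = ≼-trans (⊗-monoʳ (⅟-nn n) (⊗-mono U-nn U-nn U≼ U≼)) (≡≼ (solve 2 (λ a b → a :* (κ 8 :* b :* (κ 8 :* b)) := κ 64 :* (a :* (b :* b))) refl (⅟ n) (L n)))
            where
            U≼ : U ≼ # 8 ⊗ L n
            U≼ = ≼-trans (#-mono bd) (≡≼ (trans (#-* 8 _) (cong (# 8 ⊗_) (sym (L≡ n)))))

      x-nn : # 12 ≼ x
      x-nn = (lin 0 (1 · (0≼# u)) (solve 1 (λ a → a :+ κ 12 :- κ 12 := a :- κ 0) refl (# u)))

      M₂≼ : M₂ ≼ # 100 ⊗ (x ⊗ x ⊗ (x ⊗ x))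
      M₂≼ = (lin 1 (4 · (⊗-mono tt-nn 0≼1t tt≼ 1t≼) ⊞ 2 · (⊗-mono (nn-⊗ tt-nn 0≼1t) 0≼1t (⊗-mono tt-nn 0≼1t tt≼ 1t≼) 1t≼) ⊞ 9 · (nn-⊗ (nn-⊗ 0≼x (nn-⊗ 0≼x 0≼x)) (sub-nn x-nn)) ⊞ 29 · (nn-⊗ (nn-⊗ 0≼x 0≼x) (nn-⊗ 0≼x 0≼x))) (solve 2 (λ a b → κ 2 :* (κ 100 :* (b :* b :* (b :* b)) :- (κ 2 :* (a :* a) :* (κ 1 :+ a) :+ a :* (κ 1 :+ a) :* (a :* (κ 1 :+ a)))) := κ 4 :* (κ 3 :* b :* (κ 3 :* b) :* (κ 3 :* b) :- a :* a :* (κ 1 :+ a)) :+ (κ 2 :* (κ 3 :* b :* (κ 3 :* b) :* (κ 3 :* b) :* (κ 3 :* b) :- a :* a :* (κ 1 :+ a) :* (κ 1 :+ a)) :+ (κ 9 :* (b :* (b :* b) :* (b :- κ 12) :- κ 0) :+ κ 29 :* (b :* b :* (b :* b) :- κ 0)))) refl t x))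
        where
        0≼x : # 0 ≼ x
        0≼x = ≼-trans (0≼# 12) x-nn
        t-nn : # 0 ≼ t
        t-nn = 0≼# (τ u)
        tt-nn : # 0 ≼ t ⊗ t
        tt-nn = nn-⊗ t-nn t-nn
        0≼1t : # 0 ≼ # 1 ⊕ t
        0≼1t = (lin 0 (1 · t-nn ⊞ const 1) (solve 1 (λ a → κ 1 :+ a :- κ 0 := a :- κ 0 :+ κ 1) refl t))
        t≼ : t ≼ # 3 ⊗ x
        t≼ = (lin 0 (1 · (≡≼ t≡) ⊞ const 28) (solve 2 (λ a b → κ 3 :* (b :+ κ 12) :- a := κ 3 :* b :+ κ 8 :- a :+ κ 28) refl t (# u)))
        1t≼ : # 1 ⊕ t ≼ # 3 ⊗ x
        1t≼ = (lin 0 (1 · (≡≼ t≡) ⊞ const 27) (solve 2 (λ a b → κ 3 :* (b :+ κ 12) :- (κ 1 :+ a) := κ 3 :* b :+ κ 8 :- a :+ κ 27) refl t (# u)))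
        tt≼ : t ⊗ t ≼ # 3 ⊗ x ⊗ (# 3 ⊗ x)
        tt≼ = ⊗-mono t-nn t-nn t≼ t≼

      dv-sum : ∀ r → 1 ≤ r → ∑ (hi u) (λ q → dv r q ⊗ ⅟ q) ≼ ⅟ r ⊗ h
      dv-sum r p = ≼-trans (∑-pred (hi u) {g = λ n → 𝟙 (r ∣? n) ⊗ ⅟ n} (trans (cong (λ s → s ⊗ 𝟙 (r ∣? 0) ⊗ ⅟ 1) (𝟙-no (2 ≤? 1) (λ { (s≤s ()) }))) (solve 2 (λ a b → κ 0 :* a :* b := κ 0) refl (𝟙 (r ∣? 0)) (⅟ 1))) (λ n a → ⊗-mono (dv-nn r (suc n)) (⅟-nn (suc n)) (𝟙-⊗≼ (2 ≤? suc n) (𝟙-nn (r ∣? n))) (⅟-suc≼ n a)) (λ n → nn-⊗ (𝟙-nn (r ∣? n)) (⅟-nn n)))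
        (≼-trans (≡≼ (trans (∑-multiples (hi u) r ⅟ p) (trans (∑-cong (hi u ÷ r) (λ k a _ → ⅟-* p a)) (∑-⊗ (hi u ÷ r) (⅟ r) ⅟)))) (⊗-monoʳ (⅟-nn r) (∑-grow (÷-≤-x (hi u) r) (λ i _ _ → ⅟-nn i))))

      -- For fixed `r` the sums over `q` and `q′` separate, each at most `h / r`; the reciprocal
      -- squares beyond `T u` add up to at most `⅟ (T u)`.
      S₃≼ : S₃ u ≼ h ⊗ h ⊗ ⅟ (T u)
      S₃≼ = ≼-trans (≡≼ e) (≼-trans (∑-mono (hi u) (λ r p _ → ≼-trans (⊗-monoʳ (𝟙-nn (T u <? r)) (⊗-mono (dvs-nn r) (dvs-nn r) (dv-sum r p) (dv-sum r p))) (≡≼ (solve 3 (λ a b c → a :* (b :* c :* (b :* c)) := c :* c :* (a :* (b :* b))) refl (𝟙 (T u <? r)) (⅟ r) h)))) (≼-trans (≡≼ (∑-⊗ (hi u) (h ⊗ h) _)) (⊗-monoʳ (nn-⊗ h-nn h-nn) (tail-sq (T u) (ℕP.m^n>0 2 (τ u)) (hi u)))))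
        where
        n = hi u
        d : ℕ → F
        d r = ∑ n (λ q → dv r q ⊗ ⅟ q)
        dvs-nn : ∀ r → # 0 ≼ d r
        dvs-nn r = ∑-nn n (λ q _ _ → nn-⊗ (dv-nn r q) (⅟-nn q))
        e : S₃ u ≡ ∑ n (λ r → 𝟙 (T u <? r) ⊗ (d r ⊗ d r))
        e = trans (∑-cong n (λ q a _ → trans (∑-cong n (λ q′ a′ _ → ∑-ext n (λ r → trans (cong (c u q q′ r ⊗_) (⅟-* a a′)) (solve 5 (λ a b c d e → a :* (b :* c) :* (d :* e) := a :* (b :* d) :* (c :* e)) refl (𝟙 (T u <? r)) (dv r q) (dv r q′) (⅟ q) (⅟ q′))))) (trans (∑-swap n n _) (∑-ext n (λ r → ∑-⊗ n (𝟙 (T u <? r) ⊗ (dv r q ⊗ ⅟ q)) _))))) (trans (∑-swap n n _) (∑-ext n (λ r → trans (∑-ext n (λ q → (solve 4 (λ a b c d → a :* (b :* c) :* d := a :* d :* (b :* c)) refl (𝟙 (T u <? r)) (dv r q) (⅟ q) (d r)))) (trans (∑-⊗ n (𝟙 (T u <? r) ⊗ d r) _) (solve 2 (λ a b → a :* b :* b := a :* (b :* b)) refl (𝟙 (T u <? r)) (d r))))))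

      T≡ : # T u ≡ # 256 ⊗ (U ⊗ U ⊗ U)
      T≡ = trans (cong #_ (trans (ℕP.^-distribˡ-+-* 2 (3 * u) 8) (ℕP.*-comm (2 ^ (3 * u)) 256))) (trans (#-* 256 (2 ^ (3 * u))) (cong (# 256 ⊗_) (trans (cong #_ cube) (trans (#-* (2 ^ u * 2 ^ u) (2 ^ u)) (cong (_⊗ U) (#-* (2 ^ u) (2 ^ u)))))))
        where
        cube : 2 ^ (3 * u) ≡ 2 ^ u * 2 ^ u * 2 ^ u
        cube = trans (ℕP.^-distribˡ-+-* 2 u (u + (u + 0))) (trans (cong (2 ^ u *_) (trans (ℕP.^-distribˡ-+-* 2 u (u + 0)) (cong (λ v → 2 ^ u * 2 ^ v) (ℕP.+-identityʳ u)))) (sym (ℕP.*-assoc (2 ^ u) (2 ^ u) (2 ^ u))))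

    -- The moment bound 100 x^4 and the harmonic bound `3 U` give 64 · 3 · 100 = 19200 for the bad
    -- primes. As `T u` is 256 times the cube of `U`, the pairs add at most 1.
    S-bound : U ⊗ S u ≼ # 19201 ⊗ (x ⊗ x ⊗ (x ⊗ x))
    S-bound = (lin 0 (1 · s₂ ⊞ 1 · s₃ ⊞ 1 · 1≼x⁴) (solve 4 (λ a b c d → κ 19201 :* (d :* d :* (d :* d)) :- a :* (b :+ c) := κ 19200 :* (d :* d :* (d :* d)) :- a :* b :+ (κ 1 :- a :* c :+ (d :* d :* (d :* d) :- κ 1))) refl U (S₂ u) (S₃ u) x))
      where
      X⁴ = x ⊗ x ⊗ (x ⊗ x)
      1≼x : # 1 ≼ x
      1≼x = ≼-trans (#-mono (s≤s z≤n)) x-nn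
      ≥1 : ∀ {a b} → # 1 ≼ a → # 1 ≼ b → # 1 ≼ a ⊗ b
      ≥1 p q = ≼-trans (≡≼ (solve 0 (κ 1 := κ 1 :* κ 1) refl)) (⊗-mono 0≼1 0≼1 p q)
      1≼x⁴ : # 1 ≼ X⁴
      1≼x⁴ = ≥1 (≥1 1≼x 1≼x) (≥1 1≼x 1≼x)
      M₂-nn : # 0 ≼ M₂
      M₂-nn = ≼-trans (≡≼ (solve 0 (κ 0 := κ 0 :+ κ 0) refl)) (⊕-mono (nn-⊗ (nn-⊗ (0≼# 2) (nn-⊗ tn tn)) tn′) (nn-⊗ (nn-⊗ tn tn′) (nn-⊗ tn tn′)))
        where
        tn = 0≼# (τ u)
        tn′ : # 0 ≼ # 1 ⊕ t
        tn′ = (lin 0 (1 · tn ⊞ const 1) (solve 1 (λ a → κ 1 :+ a :- κ 0 := a :- κ 0 :+ κ 1) refl t))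
      s₂ : U ⊗ S₂ u ≼ # 19200 ⊗ X⁴
      s₂ = cancel 1≼U (lin 0 (1 · S₂≼ ⊞ 64 · (⊗-mono h-nn M₂-nn h≼ M₂≼)) (solve 5 (λ a b c d e → a :* (κ 19200 :* c) :- a :* (a :* b) := κ 64 :* (d :* e) :- a :* a :* b :+ κ 64 :* (κ 3 :* a :* (κ 100 :* c) :- d :* e)) refl U (S₂ u) X⁴ h M₂))
      ti = ⅟ (T u)
      s₃ : U ⊗ S₃ u ≼ # 1
      s₃ = (lin 255 (256 · (⊗-monoʳ U-nn S₃≼) ⊞ 256 · (⊗-monoʳ (nn-⊗ U-nn (⅟-nn (T u))) (⊗-mono h-nn h-nn h≼ h≼)) ⊞ 9 · (≡≼ (⅟-law {T u} (ℕP.m^n>0 2 (τ u)))) ⊞ 9 · (≡≽ (cong (_⊗ ti) T≡)) ⊞ const 247) (solve 5 (λ a b c d e → κ 256 :* (κ 1 :- a :* b) := κ 256 :* (a :* (c :* c :* d) :- a :* b) :+ (κ 256 :* (a :* d :* (κ 3 :* a :* (κ 3 :* a)) :- a :* d :* (c :* c)) :+ (κ 9 :* (κ 1 :- e :* d) :+ (κ 9 :* (e :* d :- κ 256 :* (a :* a :* a) :* d) :+ κ 247)))) refl U (S₃ u) h ti (# T u)))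

  -- A telescoping majorant: `g u - g (suc u)` is at least v^4 / 2^u with v = u + 12. This amounts
  -- to 3 v^4 ≥ 2 (v + 1)^4, and the shift 12 makes it true from u = 0 on.
  g : ℕ → F
  g u = # 4 ⊗ ((# u ⊕ # 12) ⊗ (# u ⊕ # 12) ⊗ ((# u ⊕ # 12) ⊗ (# u ⊕ # 12))) ⊗ ⅟ (2 ^ u)

  private
    ⅟2^ : ∀ u → ⅟ (2 ^ u) ≡ # 2 ⊗ ⅟ (2 ^ suc u)
    ⅟2^ u = sym (trans (cong (# 2 ⊗_) (⅟-* {2} {2 ^ u} (s≤s z≤n) (ℕP.m^n>0 2 u))) (trans (solve 2 (λ a b → κ 2 :* (a :* b) := κ 2 :* a :* b) refl (⅟ 2) (⅟ (2 ^ u))) (trans (cong (_⊗ ⅟ (2 ^ u)) (⅟-law {2} (s≤s z≤n))) (solve 1 (λ a → κ 1 :* a := a) refl (⅟ (2 ^ u))))))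

  S≼g : ∀ u → S u ≼ # 19201 ⊗ (g u ⊖ g (suc u))
  S≼g u = ≼-trans (cancel (#-mono (ℕP.m^n>0 2 u)) (lin 0 (1 · (Bounds.S-bound u) ⊞ 19201 · (≡≽ (cong (X⁴ ⊗_) (⅟-law (ℕP.m^n>0 2 u))))) (solve 4 (λ a b c d → a :* (κ 19201 :* (c :* d)) :- a :* b := κ 19201 :* c :- a :* b :+ κ 19201 :* (c :* (a :* d) :- c :* κ 1)) refl U (S u) X⁴ i)))
    (⊗-monoʳ (0≼# 19201) (≼-trans (≡≼ (cong (X⁴ ⊗_) (⅟2^ u))) (≼-trans main (≡≼ (sym (cong₂ _⊖_ (cong (# 4 ⊗ X⁴ ⊗_) (⅟2^ u)) (cong (λ y → # 4 ⊗ ((y ⊕ # 12) ⊗ (y ⊕ # 12) ⊗ ((y ⊕ # 12) ⊗ (y ⊕ # 12))) ⊗ i′) (#-suc u))))))))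
    where
    U = # (2 ^ u)
    i = ⅟ (2 ^ u)
    i′ = ⅟ (2 ^ suc u)
    v = # u
    X⁴ = (v ⊕ # 12) ⊗ (v ⊕ # 12) ⊗ ((v ⊕ # 12) ⊗ (v ⊕ # 12))
    i-nn = ⅟-nn (2 ^ suc u)
    vi : # 0 ≼ v ⊗ i′
    vi = nn-⊗ (0≼# u) i-nn
    vvi : # 0 ≼ v ⊗ (v ⊗ i′)
    vvi = nn-⊗ (0≼# u) vi
    vvvi : # 0 ≼ v ⊗ (v ⊗ (v ⊗ i′))
    vvvi = nn-⊗ (0≼# u) vvi
    main : X⁴ ⊗ (# 2 ⊗ i′) ≼ # 4 ⊗ X⁴ ⊗ (# 2 ⊗ i′) ⊖ # 4 ⊗ ((# 1 ⊕ v ⊕ # 12) ⊗ (# 1 ⊕ v ⊕ # 12) ⊗ ((# 1 ⊕ v ⊕ # 12) ⊗ (# 1 ⊕ v ⊕ # 12))) ⊗ i′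
    main = (lin 0 (10172 · i-nn ⊞ 6320 · vi ⊞ 1128 · vvi ⊞ 80 · vvvi ⊞ 2 · (nn-⊗ (0≼# u) vvvi)) (solve 2 (λ a b → κ 4 :* ((a :+ κ 12) :* (a :+ κ 12) :* ((a :+ κ 12) :* (a :+ κ 12))) :* (κ 2 :* b) :- κ 4 :* ((κ 1 :+ a :+ κ 12) :* (κ 1 :+ a :+ κ 12) :* ((κ 1 :+ a :+ κ 12) :* (κ 1 :+ a :+ κ 12))) :* b :- (a :+ κ 12) :* (a :+ κ 12) :* ((a :+ κ 12) :* (a :+ κ 12)) :* (κ 2 :* b) := κ 10172 :* (b :- κ 0) :+ (κ 6320 :* (a :* b :- κ 0) :+ (κ 1128 :* (a :* (a :* b) :- κ 0) :+ (κ 80 :* (a :* (a :* (a :* b)) :- κ 0) :+ κ 2 :* (a :* (a :* (a :* (a :* b))) :- κ 0))))) refl v i′))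

  g-nn : ∀ u → # 0 ≼ g u
  g-nn u = nn-⊗ (nn-⊗ (0≼# 4) (nn-⊗ (nn-⊗ n n) (nn-⊗ n n))) (⅟-nn (2 ^ u))
    where
    n : # 0 ≼ # u ⊕ # 12
    n = (lin 0 (1 · (0≼# u) ⊞ const 12) (solve 1 (λ a → a :+ κ 12 :- κ 0 := a :- κ 0 :+ κ 12) refl (# u)))

  ∑S≼ : ∀ a n → ∑ n (λ i → S (a + i)) ≼ # 19201 ⊗ g (suc a)
  ∑S≼ a n = ≼-trans (∑-mono n (λ i _ _ → S≼g (a + i))) (≼-trans (≡≼ (trans (∑-⊗ n (# 19201) _) (cong (# 19201 ⊗_) tele))) (⊗-monoʳ (0≼# 19201) (lin 0 (1 · (g-nn (suc (a + n)))) (solve 2 (λ a b → a :- (a :- b) := b :- κ 0) refl (g (suc a)) (g (suc (a + n)))))))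
    where
    tele : ∑ n (λ i → g (a + i) ⊖ g (suc (a + i))) ≡ g (suc a) ⊖ g (suc (a + n))
    tele = trans (∑-ext n (λ i → trans (solve 2 (λ a b → a :- b := :- b :- :- a) refl (g (a + i)) (g (suc (a + i)))) (cong (λ t → (⊝ g t) ⊖ (⊝ g (a + i))) (sym (ℕP.+-suc a i))))) (trans (∑-tele n (λ i → ⊝ g (a + i))) (trans (cong₂ (λ s t → (⊝ g s) ⊖ (⊝ g t)) (ℕP.+-suc a n) (trans (ℕP.+-suc a 0) (cong suc (ℕP.+-identityʳ a)))) (solve 2 (λ a b → :- a :- :- b := b :- a) refl (g (suc (a + n))) (g (suc a)))))

  -- The quotient v^5 / 2^u with v = u + 12 is largest at u = 0, and 4 · 12^5 = 995328. The
  -- resulting decay like 1 / v suffices to choose cut-offs.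
  g≼ : ∀ u → (# u ⊕ # 12) ⊗ g u ≼ # 995328
  g≼ u = (lin 0 (4 · (⊗-monoˡ (⅟-nn (2 ^ u)) (fifth u)) ⊞ 1 · (≡≼ (refl {x = y ⊗ g u})) ⊞ 995328 · (≡≼ (⅟-law (ℕP.m^n>0 2 u)))) (solve 4 (λ a b c d → κ 995328 :- a :* b := κ 4 :* (κ 248832 :* d :* c :- a :* a :* (a :* a :* a) :* c) :+ (a :* (κ 4 :* (a :* a :* (a :* a)) :* c) :- a :* b :+ κ 995328 :* (κ 1 :- d :* c))) refl y (g u) (⅟ (2 ^ u)) (# (2 ^ u))))
    where
    y = # u ⊕ # 12
    fifth : ∀ u → (# u ⊕ # 12) ⊗ (# u ⊕ # 12) ⊗ ((# u ⊕ # 12) ⊗ (# u ⊕ # 12) ⊗ (# u ⊕ # 12)) ≼ # 248832 ⊗ # (2 ^ u)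
    fifth zero = (lin 0 (const 0) (solve 0 (κ 248832 :* κ 1 :- (κ 0 :+ κ 12) :* (κ 0 :+ κ 12) :* ((κ 0 :+ κ 12) :* (κ 0 :+ κ 12) :* (κ 0 :+ κ 12)) := κ 0) refl))
    fifth (suc u) = ≼-trans (≡≼ (cong (λ y → (y ⊕ # 12) ⊗ (y ⊕ # 12) ⊗ ((y ⊕ # 12) ⊗ (y ⊕ # 12) ⊗ (y ⊕ # 12))) (#-suc u))) (lin 0 (248832 · (≡≽ (#-* 2 (2 ^ u))) ⊞ 2 · (fifth u) ⊞ 64555 · n ⊞ 12590 · (nn-⊗ n n) ⊞ 1190 · (nn-⊗ n (nn-⊗ n n)) ⊞ 55 · (nn-⊗ n (nn-⊗ n (nn-⊗ n n))) ⊞ 1 · (nn-⊗ n (nn-⊗ n (nn-⊗ n (nn-⊗ n n)))) ⊞ const 126371) (solve 3 (λ a b c → κ 248832 :* b :- (κ 1 :+ a :+ κ 12) :* (κ 1 :+ a :+ κ 12) :* ((κ 1 :+ a :+ κ 12) :* (κ 1 :+ a :+ κ 12) :* (κ 1 :+ a :+ κ 12)) := κ 248832 :* (b :- κ 2 :* c) :+ (κ 2 :* (κ 248832 :* c :- (a :+ κ 12) :* (a :+ κ 12) :* ((a :+ κ 12) :* (a :+ κ 12) :* (a :+ κ 12))) :+ (κ 64555 :* (a :- κ 0) :+ (κ 12590 :* (a :* a :- κ 0) :+ (κ 1190 :* (a :* (a :* a) :- κ 0) :+ (κ 55 :* (a :* (a :* (a :* a)) :- κ 0) :+ (a :* (a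 :* (a :* (a :* a))) :- κ 0 :+ κ 126371))))))) refl v (# (2 * 2 ^ u)) (# (2 ^ u))))
      where
      v = # u
      n = 0≼# u

  private
    tail-cut′ : ∀ A a₀ → ∃ λ a → a₀ ≤ a × # A ⊗ (# 19201 ⊗ g (suc a)) ≼ # 1
    tail-cut′ A a₀ = a , ℕP.m≤m+n a₀ _ , cancel 1≼y (lin 0 (1 · (⊗-monoʳ (nn-⊗ (0≼# A) (0≼# 19201)) (g≼ (suc a))) ⊞ 1 · big) (solve 3 (λ a b c → a :* κ 1 :- a :* (b :* (κ 19201 :* c)) := b :* κ 19201 :* κ 995328 :- b :* κ 19201 :* (a :* c) :+ (a :- b :* (κ 19201 :* κ 995328))) refl y (# A) (g (suc a))))
      where
      a = a₀ + A * (19201 * 995328)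
      y = # (suc a) ⊕ # 12
      1≼y : # 1 ≼ y
      1≼y = (lin 0 (1 · (0≼# (suc a)) ⊞ const 11) (solve 1 (λ a → a :+ κ 12 :- κ 1 := a :- κ 0 :+ κ 11) refl (# (suc a))))
      big : # A ⊗ (# 19201 ⊗ # 995328) ≼ y
      big = (lin 0 (1 · (≡≽ (#-suc a)) ⊞ 1 · (≡≽ (#-+ a₀ (A * (19201 * 995328)))) ⊞ 1 · (0≼# a₀) ⊞ 1 · (≡≽ (trans (#-* A (19201 * 995328)) (cong (# A ⊗_) (#-* 19201 995328)))) ⊞ const 13) (solve 5 (λ a b c d e → b :+ κ 12 :- a :* (κ 19201 :* κ 995328) := b :- (κ 1 :+ c) :+ (c :- (d :+ e) :+ (d :- κ 0 :+ (e :- a :* (κ 19201 :* κ 995328) :+ κ 13)))) refl (# A) (# (suc a)) (# a) (# a₀) (# (A * (19201 * 995328)))))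

  abstract
    tail-cut : ∀ A a₀ → ∃ λ a → a₀ ≤ a × # A ⊗ (# 19201 ⊗ g (suc a)) ≼ # 1
    tail-cut = tail-cut′

-- Sieving the progression 1 modulo P.

module Density where
  open Field
  open Sums
  open NumTh
  open Block
  open Tails
  open Global

  total : ℕ → (ℕ → ℕ) → ℕ
  total zero    k = 0
  total (suc n) k = total n k + k (suc n)

  square-part : ℕ → ℕ → ℕ → F
  square-part y z m = ∑ z (λ j → 𝟙 (y <? j) ⊗ 𝟙 (j * j ∣? m))

  bad-part pair-part block-part : ℕ → ℕ → F
  bad-part u m = ∑ (hi u) (λ q → b u q ⊗ 𝟙 (q ∣? m))
  pair-part u m = ∑ (hi u) (λ q → ∑ (hi u) (λ q′ → ∑ (hi u) (λ r → c u q q′ r ⊗ 𝟙 (q * q′ ∣? m))))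
  block-part u m = bad-part u m ⊕ pair-part u m

  block-size : ℕ → ℕ
  block-size u = total (hi u) (λ _ → 1) + total (hi u) (λ _ → total (hi u) (λ _ → total (hi u) (λ _ → 1)))

  module Progression (P : ℕ) {{P≢0 : NonZero P}} where
    open Cls P using (_≈_; _≈?_; δ; δ-nn; δ-congˡ; δ-⊘; δ-nonunit; _⊘_; ∑-δ; periodic-≲; M+≈; coprime-1) renaming (1≤M to 1≤P)

    class-count : ∀ g z → # P ⊗ ∑ z (λ k → δ k g) ⊖ # z ≲ # P ⊗ # P
    class-count g z = ≲-subst (split z) (periodic-≲ (λ k → # P ⊗ δ k g ⊖ # 1) (# P) (λ k → cong (λ s → # P ⊗ s ⊖ # 1) (δ-congˡ g (M+≈ k))) bound
        (trans (split P) (trans (cong (λ s → # P ⊗ s ⊖ # P) (∑-δ g)) (solve 1 (λ a → a :* κ 1 :- a := κ 0) refl (# P)))) z)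
      where
      split : ∀ z → ∑ z (λ k → # P ⊗ δ k g ⊖ # 1) ≡ # P ⊗ ∑ z (λ k → δ k g) ⊖ # z
      split z = trans (∑-⊖ z _ _) (cong₂ _⊖_ (∑-⊗ z (# P) _) (trans (∑-const z (# 1)) (solve 1 (λ a → a :* κ 1 := a) refl (# z))))
      bound : ∀ k → # P ⊗ δ k g ⊖ # 1 ≲ # P
      bound k = (lin 0 (1 · (⊗-monoʳ (0≼# P) (𝟙≼1 (k ≈? g))) ⊞ const 1) (solve 2 (λ a b → a :- (a :* b :- κ 1) := a :* κ 1 :- a :* b :+ κ 1) refl (# P) (δ k g))) , (lin 0 (1 · (nn-⊗ (0≼# P) (δ-nn k g)) ⊞ 1 · (#-mono 1≤P)) (solve 2 (λ a b → a :* b :- κ 1 :- :- a := a :* b :- κ 0 :+ (a :- κ 1)) refl (# P) (δ k g)))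

    module Upto (x : ℕ) where
      E : (ℕ → F) → F
      E f = ∑ x (λ m → δ m 1 ⊗ f m)

      E-⊕ : ∀ f g → E (λ m → f m ⊕ g m) ≡ E f ⊕ E g
      E-⊕ f g = trans (∑-ext x (λ m → (solve 3 (λ a b c → a :* (b :+ c) := a :* b :+ a :* c) refl (δ m 1) (f m) (g m)))) (∑-⊕ x _ _)

      Counts : F → F → Set
      Counts ρ ε = ∀ D → 1 ≤ D → E (λ m → 𝟙 (D ∣? m)) ≼ ρ ⊗ ⅟ D ⊕ ε

      private
        E-multiples : ∀ D → 1 ≤ D → E (λ m → 𝟙 (D ∣? m)) ≡ ∑ (x ÷ D) (λ k → δ (D * k) 1)
        E-multiples D p = trans (∑-ext x (λ m → (solve 2 (λ a b → a :* b := b :* a) refl (δ m 1) (𝟙 (D ∣? m))))) (∑-multiples x D (λ m → δ m 1) p)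

        ÷≼ : ∀ D → 1 ≤ D → # (x ÷ D) ≼ # x ⊗ ⅟ D
        ÷≼ D p = cancel (#-mono p) (lin 0 (1 · (#-mono (÷-≤ D p ℕP.≤-refl)) ⊞ 1 · (≡≽ (#-* D (x ÷ D))) ⊞ 1 · (≡≽ (cong (# x ⊗_) (⅟-law p)))) (solve 5 (λ a b c d e → a :* (c :* d) :- a :* b := c :- e :+ (e :- a :* b :+ (c :* (a :* d) :- c :* κ 1))) refl (# D) (# (x ÷ D)) (# x) (⅟ D) (# (D * (x ÷ D)))))

      -- Ignoring the progression loses a factor `P` but leaves no error term, so it can be summed
      -- over arbitrarily many `D`.
      coarse : Counts (# x) (# 0)
      coarse D p = ≼-trans (≡≼ (E-multiples D p)) (≼-trans (∑-mono (x ÷ D) (λ k _ _ → 𝟙≼1 (D * k ≈? 1))) (≼-trans (≡≼ (∑-const (x ÷ D) (# 1))) (lin 0 (1 · (÷≼ D p)) (solve 3 (λ a b c → b :* c :+ κ 0 :- a :* κ 1 := b :* c :- a) refl (# (x ÷ D)) (# x) (⅟ D)))))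

      -- Keeps the factor `⅟ P` at the price of an error `P` for each `D`. A `D` that shares a
      -- factor with `P` divides no `m ≈ 1`.
      fine : Counts (# x ⊗ ⅟ P) (# P)
      fine D p = ≼-trans (≡≼ (E-multiples D p)) (aux (coprime? D P))
        where
        aux : Dec (Coprime D P) → ∑ (x ÷ D) (λ k → δ (D * k) 1) ≼ # x ⊗ ⅟ P ⊗ ⅟ D ⊕ # P
        aux (no nc) = ≼-trans (≡≼ (∑-0 (x ÷ D) (λ k _ _ → δ-nonunit k coprime-1 nc))) (lin 0 (1 · (nn-⊗ (nn-⊗ (0≼# x) (⅟-nn P)) (⅟-nn D)) ⊞ 1 · (0≼# P)) (solve 4 (λ a b c d → a :* b :* c :+ d :- κ 0 := a :* b :* c :- κ 0 :+ (d :- κ 0)) refl (# x) (⅟ P) (⅟ D) (# P)))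
        aux (yes cop) = ≼-trans (≡≼ (∑-ext (x ÷ D) (λ k → δ-⊘ k 1 cop))) (cancel (#-mono 1≤P) (lin 0 (1 · (proj₁ (class-count (1 ⊘ D) (x ÷ D))) ⊞ 1 · (÷≼ D p) ⊞ 1 · (≡≽ (cong ((# x ⊗ ⅟ D) ⊗_) (⅟-law 1≤P)))) (solve 6 (λ a b c d e f → a :* (c :* d :* e :+ a) :- a :* b := a :* a :- (a :* b :- f) :+ (c :* e :- f :+ (c :* e :* (a :* d) :- c :* e :* κ 1))) refl (# P) s (# x) (⅟ P) (⅟ D) (# (x ÷ D)))))
          where s = ∑ (x ÷ D) (λ k → δ k (1 ⊘ D))

      module Mean {ρ ε : F} (counts : Counts ρ ε) (ε-nn : # 0 ≼ ε) where
        -- Here `s` is a reciprocal sum of moduli and `k` the number of moduli, each of which pays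
        -- the error `ε` once.
        Bound : (ℕ → F) → F → ℕ → Set
        Bound f s k = E f ≼ ρ ⊗ s ⊕ ε ⊗ # k

        bound-⊕ : ∀ {f g s t k l} → Bound f s k → Bound g t l → Bound (λ m → f m ⊕ g m) (s ⊕ t) (k + l)
        bound-⊕ {f} {g} {s} {t} {k} {l} p r = ≼-trans (≡≼ (E-⊕ f g)) (lin 0 (1 · p ⊞ 1 · r ⊞ 1 · (≡≽ (cong (ε ⊗_) (#-+ k l)))) (solve 9 (λ a b c d e f g h i → c :* (d :+ e) :+ f :* g :- (a :+ b) := c :* d :+ f :* h :- a :+ (c :* e :+ f :* i :- b :+ (f :* g :- f :* (h :+ i)))) refl (E f) (E g) ρ s t ε (# (k + l)) (# k) (# l)))

        bound-∑ : ∀ n {f : ℕ → ℕ → F} {s : ℕ → F} {k : ℕ → ℕ} → (∀ i → 1 ≤ i → Bound (f i) (s i) (k i)) → Bound (λ m → ∑ n (λ i → f i m)) (∑ n s) (total n k)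
        bound-∑ zero    h = ≼-trans (≡≼ (∑-0 x (λ m _ _ → (solve 1 (λ a → a :* κ 0 := κ 0) refl (δ m 1))))) (lin 0 (const 0) (solve 2 (λ a b → a :* κ 0 :+ b :* κ 0 :- κ 0 := κ 0) refl ρ ε))
        bound-∑ (suc n) {f} {s} {k} h = bound-⊕ {λ m → ∑ n (λ i → f i m)} {f (suc n)} {∑ n s} {s (suc n)} {total n k} {k (suc n)} (bound-∑ n h) (h (suc n) (s≤s z≤n))

        bound-∣ : ∀ {w} D → 1 ≤ D → # 0 ≼ w → w ≼ # 1 → Bound (λ m → w ⊗ 𝟙 (D ∣? m)) (w ⊗ ⅟ D) 1
        bound-∣ {w} D p w-nn w≼1 = ≼-trans (≡≼ (trans (∑-ext x (λ m → (solve 3 (λ a b c → a :* (b :* c) := b :* (a :* c)) refl (δ m 1) w (𝟙 (D ∣? m))))) (∑-⊗ x w _))) (lin 0 (1 · (⊗-monoʳ w-nn (counts D p)) ⊞ 1 · (⊗-monoˡ ε-nn w≼1)) (solve 5 (λ a b c d e → c :* (a :* d) :+ e :* κ 1 :- a :* b := a :* (c :* d :+ e) :- a :* b :+ (κ 1 :* e :- a :* e)) refl w e ρ (⅟ D) ε))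
          where e = E (λ m → 𝟙 (D ∣? m))

        bound-squares : ∀ y z → Bound (square-part y z) (∑ z (λ j → 𝟙 (y <? j) ⊗ ⅟ (j * j))) (total z (λ _ → 1))
        bound-squares y z = bound-∑ z {λ j m → 𝟙 (y <? j) ⊗ 𝟙 (j * j ∣? m)} (λ j p → bound-∣ {𝟙 (y <? j)} (j * j) (ℕP.*-mono-≤ p p) (𝟙-nn (y <? j)) (𝟙≼1 (y <? j)))

        bound-block : ∀ u → Bound (block-part u) (S u) (block-size u)
        bound-block u = bound-⊕ {bad-part u} {pair-part u} {S₂ u} {S₃ u} {total (hi u) (λ _ → 1)}
          (bound-∑ (hi u) {λ q m → b u q ⊗ 𝟙 (q ∣? m)} (λ q p → bound-∣ q p (b-nn u q) (b≼1 u q)))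
          (bound-∑ (hi u) {λ q m → ∑ (hi u) (λ q′ → ∑ (hi u) (λ r → c u q q′ r ⊗ 𝟙 (q * q′ ∣? m)))} (λ q p → bound-∑ (hi u) {λ q′ m → ∑ (hi u) (λ r → c u q q′ r ⊗ 𝟙 (q * q′ ∣? m))} (λ q′ p′ → bound-∑ (hi u) {λ r m → c u q q′ r ⊗ 𝟙 (q * q′ ∣? m)} (λ r _ → bound-∣ (q * q′) (ℕP.*-mono-≤ p p′) (c-nn u q q′ r) (c≼1 u q q′ r)))))

  squares≼ : ∀ y z → 1 ≤ y → ∑ z (λ j → 𝟙 (y <? j) ⊗ ⅟ (j * j)) ≼ ⅟ y
  squares≼ y z 1≤y = ≼-trans (≡≼ (∑-cong z (λ j p _ → cong (𝟙 (y <? j) ⊗_) (⅟-* p p)))) (tail-sq y 1≤y z)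

  lo-mono : ∀ {u v} → u ≤ v → lo u ≤ lo v
  lo-mono p = ℕP.^-monoʳ-≤ 2 (ℕP.^-monoʳ-≤ 2 p)

  n≤lo : ∀ n → n ≤ lo n
  n≤lo n = ℕP.<⇒≤ (ℕP.<-trans (n<2^n n) (n<2^n (2 ^ n)))

  blk-≥ : ∀ {q a} → 2 ≤ q → lo (suc a) ≤ q → suc a ≤ blk q
  blk-≥ 2≤q h = ℕP.≮⇒≥ (λ lt → ℕP.<⇒≱ (blk-hi 2≤q) (ℕP.≤-trans (lo-mono lt) h))

  square-part-nn : ∀ y z m → # 0 ≼ square-part y z m
  square-part-nn y z m = ∑-nn z (λ j _ _ → nn-⊗ (𝟙-nn (y <? j)) (𝟙-nn (j * j ∣? m)))

  bad-part-nn : ∀ u m → # 0 ≼ bad-part u m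
  bad-part-nn u m = ∑-nn (hi u) (λ q _ _ → nn-⊗ (b-nn u q) (𝟙-nn (q ∣? m)))

  pair-part-nn : ∀ u m → # 0 ≼ pair-part u m
  pair-part-nn u m = ∑-nn (hi u) (λ q _ _ → ∑-nn (hi u) (λ q′ _ _ → ∑-nn (hi u) (λ r _ _ → nn-⊗ (c-nn u q q′ r) (𝟙-nn (q * q′ ∣? m)))))

  block-part-nn : ∀ u m → # 0 ≼ block-part u m
  block-part-nn u m = (lin 0 (1 · (bad-part-nn u m) ⊞ 1 · (pair-part-nn u m)) (solve 2 (λ a b → a :+ b :- κ 0 := a :- κ 0 :+ (b :- κ 0)) refl (bad-part u m) (pair-part u m)))

  private
    both : ∀ {A B : Set} (d : Dec A) (e : Dec B) → A → B → 𝟙 d ⊗ 𝟙 e ≡ # 1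
    both d e p r = trans (cong₂ _⊗_ (𝟙-yes d p) (𝟙-yes e r)) (solve 0 (κ 1 :* κ 1 := κ 1) refl)

    product≡1 : ∀ {p r} → p ≡ # 1 → r ≡ # 1 → p ⊗ r ≡ # 1
    product≡1 p r = trans (cong₂ _⊗_ p r) (solve 0 (κ 1 :* κ 1 := κ 1) refl)

  square-part-hit : ∀ {y z m j} → y < j → j ≤ z → j * j ∣ m → # 1 ≼ square-part y z m
  square-part-hit {y} {z} {m} {j} p r d = ≼-trans (≡≽ (both (y <? j) (j * j ∣? m) p d)) (∑-term (ℕP.≤-trans (s≤s z≤n) p) r (λ j _ _ → nn-⊗ (𝟙-nn (y <? j)) (𝟙-nn (j * j ∣? m))))

  bad-part-hit : ∀ {u m q} → 1 ≤ q → lo u ≤ q → q < hi u → bad u q → q ∣ m → # 1 ≼ bad-part u m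
  bad-part-hit {u} {m} {q} 1≤q l h bd d = ≼-trans (≡≽ (product≡1 (both (lo u ≤? q) (bad? u q) l bd) (𝟙-yes (q ∣? m) d))) (∑-term 1≤q (ℕP.<⇒≤ h) (λ q _ _ → nn-⊗ (b-nn u q) (𝟙-nn (q ∣? m))))

  pair-part-hit : ∀ {u m q q′ r} → 2 ≤ q → 2 ≤ q′ → q ≤ hi u → q′ ≤ hi u → T u < r → r ∣ q ∸ 1 → r ∣ q′ ∸ 1 → q * q′ ∣ m → # 1 ≼ pair-part u m
  pair-part-hit {u} {m} {q} {q′} {r} 2≤q 2≤q′ q≤ q′≤ T<r r∣ r∣′ d = ≼-trans (≡≽ (product≡1 (product≡1 (𝟙-yes (T u <? r) T<r) (product≡1 (both (2 ≤? q) (r ∣? q ∸ 1) 2≤q r∣) (both (2 ≤? q′) (r ∣? q′ ∸ 1) 2≤q′ r∣′))) (𝟙-yes (q * q′ ∣? m) d)))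
    (≼-trans (∑-term {f = f q q′} (proj₁ r-bounds) (ℕP.≤-trans (proj₂ r-bounds) (ℕP.≤-trans (ℕP.m∸n≤m q 1) q≤)) (λ r _ _ → f-nn q q′ r))
      (≼-trans (∑-term {f = λ q′ → ∑ (hi u) (f q q′)} (ℕP.<⇒≤ 2≤q′) q′≤ (λ q′ _ _ → ∑-nn (hi u) (λ r _ _ → f-nn q q′ r)))
        (∑-term {f = λ q → ∑ (hi u) (λ q′ → ∑ (hi u) (f q q′))} (ℕP.<⇒≤ 2≤q) q≤ (λ q _ _ → ∑-nn (hi u) (λ q′ _ _ → ∑-nn (hi u) (λ r _ _ → f-nn q q′ r))))))
    where
    f : ℕ → ℕ → ℕ → F
    f q q′ r = c u q q′ r ⊗ 𝟙 (q * q′ ∣? m)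
    f-nn : ∀ q q′ r → # 0 ≼ f q q′ r
    f-nn q q′ r = nn-⊗ (c-nn u q q′ r) (𝟙-nn (q * q′ ∣? m))
    r-bounds : 1 ≤ r × r ≤ q ∸ 1
    r-bounds = ∣-≤ (ℕP.∸-monoˡ-≤ 1 2≤q) r∣

  -- The excess is at least 1 as soon as m has a repeated prime factor, a prime factor q with q - 1 too smooth, or two prime factors with orders that are not coprime.
  module Sieve (P : ℕ) {{P≢0 : NonZero P}} (a b x : ℕ) where
    -- `Y` bounds the primes absorbed by `P`. The early moduli, up to `z` and to block `b`, are
    -- counted by `fine`; the late ones by `coarse`, so their reciprocal sum must be a small
    -- multiple of `⅟ P`, which 1 / z = 1 / (16 P) respects.
    Y z : ℕ
    Y = lo (suc a)
    z = 16 * P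

    early late excess : ℕ → F
    early m = square-part Y z m ⊕ ∑ (b ∸ a) (λ i → block-part (a + i) m)
    late m = square-part z x m ⊕ ∑ x (λ i → block-part (b + i) m)
    excess m = early m ⊕ late m

    private
      blocks-nn : ∀ n a m → # 0 ≼ ∑ n (λ i → block-part (a + i) m)
      blocks-nn n a m = ∑-nn n (λ i _ _ → block-part-nn (a + i) m)

      s₁ s₂ t₁ t₂ : ℕ → F
      s₁ m = square-part Y z m
      s₂ m = square-part z x m
      t₁ m = ∑ (b ∸ a) (λ i → block-part (a + i) m)
      t₂ m = ∑ x (λ i → block-part (b + i) m)

    excess-nn : ∀ m → # 0 ≼ excess m
    excess-nn m = (lin 0 (1 · (square-part-nn Y z m) ⊞ 1 · (square-part-nn z x m) ⊞ 1 · (blocks-nn (b ∸ a) a m) ⊞ 1 · (blocks-nn x b m)) (solve 4 (λ a b c d → a :+ b :+ (c :+ d) :- κ 0 := a :- κ 0 :+ (c :- κ 0 :+ (b :- κ 0 :+ (d :- κ 0)))) refl (s₁ m) (t₁ m) (s₂ m) (t₂ m)))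

    square-excess : ∀ {m j} → 1 ≤ m → m ≤ x → Y < j → j * j ∣ m → # 1 ≼ excess m
    square-excess {m} {j} 1≤m m≤x Y<j d = aux (j ≤? z)
      where
      j≤x : j ≤ x
      j≤x = ℕP.≤-trans (proj₂ (∣-≤ 1≤m (∣-trans (m∣m*n j) d))) m≤x
      aux : Dec (j ≤ z) → # 1 ≼ excess m
      aux (yes p) = (lin 0 (1 · (square-part-hit {Y} {z} Y<j p d) ⊞ 1 · (square-part-nn z x m) ⊞ 1 · (blocks-nn (b ∸ a) a m) ⊞ 1 · (blocks-nn x b m)) (solve 4 (λ a b c d → a :+ b :+ (c :+ d) :- κ 1 := a :- κ 1 :+ (c :- κ 0 :+ (b :- κ 0 :+ (d :- κ 0)))) refl (s₁ m) (t₁ m) (s₂ m) (t₂ m)))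
      aux (no p) = (lin 0 (1 · (square-part-hit {z} {x} (ℕP.≰⇒> p) j≤x d) ⊞ 1 · (square-part-nn Y z m) ⊞ 1 · (blocks-nn (b ∸ a) a m) ⊞ 1 · (blocks-nn x b m)) (solve 4 (λ a b c d → a :+ b :+ (c :+ d) :- κ 1 := c :- κ 1 :+ (a :- κ 0 :+ (b :- κ 0 :+ (d :- κ 0)))) refl (s₁ m) (t₁ m) (s₂ m) (t₂ m)))

    block-excess : ∀ {u} m → suc a ≤ u → u ≤ x → # 1 ≼ block-part u m → # 1 ≼ excess m
    block-excess {u} m a<u u≤x h = aux (u ≤? b)
      where
      term : ∀ n c → c < u → u ≤ c + n → # 1 ≼ ∑ n (λ i → block-part (c + i) m)
      term n c c<u u≤ = ≼-trans h (≼-trans (≡≼ (cong (λ v → block-part v m) (sym (ℕP.m+[n∸m]≡n (ℕP.<⇒≤ c<u))))) (∑-term (ℕP.m<n⇒0<n∸m c<u) (ℕP.≤-trans (ℕP.∸-monoˡ-≤ c u≤) (ℕP.≤-reflexive (ℕP.m+n∸m≡n c n))) (λ i _ _ → block-part-nn (c + i) m)))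
      aux : Dec (u ≤ b) → # 1 ≼ excess m
      aux (yes p) = (lin 0 (1 · (term (b ∸ a) a a<u (ℕP.≤-trans p (ℕP.m≤n+m∸n b a))) ⊞ 1 · (square-part-nn Y z m) ⊞ 1 · (square-part-nn z x m) ⊞ 1 · (blocks-nn x b m)) (solve 4 (λ a b c d → a :+ b :+ (c :+ d) :- κ 1 := b :- κ 1 :+ (a :- κ 0 :+ (c :- κ 0 :+ (d :- κ 0)))) refl (s₁ m) (t₁ m) (s₂ m) (t₂ m)))
      aux (no p) = (lin 0 (1 · (term x b (ℕP.≰⇒> p) (ℕP.≤-trans u≤x (ℕP.m≤n+m x b))) ⊞ 1 · (square-part-nn Y z m) ⊞ 1 · (square-part-nn z x m) ⊞ 1 · (blocks-nn (b ∸ a) a m)) (solve 4 (λ a b c d → a :+ b :+ (c :+ d) :- κ 1 := d :- κ 1 :+ (a :- κ 0 :+ (c :- κ 0 :+ (b :- κ 0)))) refl (s₁ m) (t₁ m) (s₂ m) (t₂ m)))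

    open Cls P using (_≈_; _≈?_; coprime-≈; coprime-1)

    module Survivor (8≤a : 8 ≤ a) (P-div : ∀ p → 1 ≤ p → p ≤ Y → p ∣ P) {m : ℕ} (1≤m : 1 ≤ m) (m≤x : m ≤ x) (m≈1 : m ≈ 1) (small : ¬ (# 1 ≼ excess m)) where
      -- An `m ≈ 1` is prime to `P`, and every prime up to `Y` divides `P`.
      Y<q : ∀ {q} → Prime q → q ∣ m → Y < q
      Y<q {q} pr d = ℕP.≰⇒> (λ q≤Y → ℕP.<⇒≢ (prime≥2 pr) (sym (coprime-≈ {1} {m} (sym m≈1) coprime-1 (d , P-div q (prime≥1 pr) q≤Y))))

      a<blk : ∀ {q} → Prime q → q ∣ m → suc a ≤ blk q
      a<blk pr d = blk-≥ (prime≥2 pr) (ℕP.<⇒≤ (Y<q pr d))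

      blk≤x : ∀ {q} → Prime q → q ∣ m → blk q ≤ x
      blk≤x {q} pr d = ℕP.≤-trans (n≤lo (blk q)) (ℕP.≤-trans (blk-lo (prime≥2 pr)) (ℕP.≤-trans (proj₂ (∣-≤ 1≤m d)) m≤x))

      m-odd : Odd m
      m-odd d = ℕP.<⇒≱ (Y<q prime[2] d) (ℕP.≤-trans (ℕP.≤-trans (ℕP.≤ᵇ⇒≤ 2 8 _) (ℕP.≤-trans 8≤a (ℕP.n≤1+n a))) (n≤lo (suc a)))

      not-bad : ∀ {q} → Prime q → q ∣ m → ¬ bad (blk q) q
      not-bad {q} pr d bd = small (block-excess m (a<blk pr d) (blk≤x pr d) (lin 0 (1 · (bad-part-hit {blk q} {m} {q} (prime≥1 pr) (blk-lo (prime≥2 pr)) (blk-hi (prime≥2 pr)) bd d) ⊞ 1 · (pair-part-nn (blk q) m)) (solve 2 (λ a b → a :+ b :- κ 1 := a :- κ 1 :+ (b :- κ 0)) refl (bad-part (blk q) m) (pair-part (blk q) m))))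

      solvable-at : ∀ {q} → Prime q → q ∣ m → Locally q (ord q)
      solvable-at {q} pr d = AtPrime.locally {blk q} {q} (ℕP.≤-trans (ℕP.≤ᵇ⇒≤ 6 8 _) (ℕP.≤-trans 8≤a (ℕP.<⇒≤ (a<blk pr d)))) pr (blk-lo (prime≥2 pr)) (blk-hi (prime≥2 pr)) (not-bad pr d)

      -- The pair is charged to the block of the larger prime, whose range `hi` contains both; a
      -- common prime factor of the orders exceeds the bound `T` of that block and divides both
      -- `q ∸ 1` and `q′ ∸ 1`.
      coprime-ord : ∀ {q q′} → Prime q → Prime q′ → q′ ≤ q → q * q′ ∣ m → Coprime (ord q) (ord q′)
      coprime-ord {q} {q′} pr pr′ le d = aux (coprime? (ord q) (ord q′))
        where
        q∣m : q ∣ m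
        q∣m = ∣-trans (m∣m*n q′) d
        contra : (∃ λ r → T (blk q) < r × T (blk q′) < r × r ∣ q ∸ 1 × r ∣ q′ ∸ 1) → ⊥
        contra (r , T<r , _ , r∣ , r∣′) = small (block-excess m (a<blk pr q∣m) (blk≤x pr q∣m) (lin 0 (1 · (bad-part-nn (blk q) m) ⊞ 1 · (pair-part-hit {blk q} {m} {q} {q′} {r} (prime≥2 pr) (prime≥2 pr′) q≤ (ℕP.≤-trans le q≤) T<r r∣ r∣′ d)) (solve 2 (λ a b → a :+ b :- κ 1 := a :- κ 0 :+ (b :- κ 1)) refl (bad-part (blk q) m) (pair-part (blk q) m))))
          where
          q≤ : q ≤ hi (blk q)
          q≤ = ℕP.<⇒≤ (blk-hi (prime≥2 pr))
        aux : Dec (Coprime (ord q) (ord q′)) → Coprime (ord q) (ord q′)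
        aux (yes p) = p
        aux (no nc) = ⊥-elim (contra (common-prime (prime≥2 pr) (prime≥2 pr′) nc))

      compatible : ∀ {q q′} → Prime q → Prime q′ → q * q′ ∣ m → Compatible ord q q′
      compatible {q} {q′} pr pr′ d = coprime-primes , aux (ℕP.≤-total q q′)
        where
        q≢q′ : q ≢ q′
        q≢q′ refl = small (square-excess 1≤m m≤x (Y<q pr (∣-trans (m∣m*n q) d)) d)
        coprime-primes : Coprime q q′
        coprime-primes {e} (e∣q , e∣q′) = prime-coprime (prime⇒irreducible pr e∣q) e∣q′
          where
          prime-coprime : (e ≡ 1) ⊎ (e ≡ q) → e ∣ q′ → e ≡ 1
          prime-coprime (inj₁ e≡1) _ = e≡1
          prime-coprime (inj₂ refl) h = ⊥-elim (q≢q′ (prime-∣-prime pr pr′ h))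
        aux : (q ≤ q′) ⊎ (q′ ≤ q) → Coprime (ord q) (ord q′)
        aux (inj₁ le) = CP.sym (coprime-ord pr′ pr le (subst (_∣ m) (ℕP.*-comm q q′) d))
        aux (inj₂ le) = coprime-ord pr pr′ le d

      pairs : ∀ {qs} → All Prime qs → product qs ∣ m → AllPairs (Compatible ord) qs
      pairs [] _ = []
      pairs {q ∷ qs} (pr ∷ prs) d = All.tabulate (λ q′∈ → compatible pr (All.lookup prs q′∈) (∣-trans (*-monoʳ-∣ q (∈-∣-product q′∈)) d)) ∷ pairs prs (∣-trans (n∣m*n q) d)

      m-good : Good m
      m-good = subst Good (fac-product 1≤m) (good-product ord (All.tabulate (λ q∈ → solvable-at (All.lookup (fac-prime m) q∈) (∈-fac-∣ 1≤m q∈))) (pairs (fac-prime m) (subst (_∣ m) (sym (fac-product 1≤m)) ∣-refl)))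

-- Choice of the cut-offs and the density bound.

module Final where
  open Field
  open Sums
  open NumTh
  open Block
  open Tails
  open Global
  open Density

  module Choice (P : ℕ) {{P≢0 : NonZero P}} (a b : ℕ) (8≤a : 8 ≤ a) (P-div : ∀ p → 1 ≤ p → p ≤ lo (suc a) → p ∣ P)
    (cut₁ : # 8 ⊗ (# 19201 ⊗ g (suc a)) ≼ # 1) (cut₂ : # (16 * P) ⊗ (# 19201 ⊗ g (suc b)) ≼ # 1) where

    open Cls P using (_≈_; _≈?_; δ) renaming (1≤M to 1≤P)
    open Progression P

    -- `C` is the number of early moduli. Their errors in `fine` and the boundary error of the
    -- progression itself amount to `P (C + 1)`, which from `X₀` on is at most x / (8 P).
    C X₀ : ℕ
    C = total (16 * P) (λ _ → 1) + total (b ∸ a) (λ i → block-size (a + i))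
    X₀ = 8 * (P * (P * suc C))

    module _ (x : ℕ) (X₀≤x : X₀ ≤ x) where
      open Sieve P a b x
      open Upto x

      private
        s₁ s₂ t₁ t₂ G₁ G₂ : F
        s₁ = ∑ z (λ j → 𝟙 (Y <? j) ⊗ ⅟ (j * j))
        t₁ = ∑ (b ∸ a) (λ i → S (a + i))
        s₂ = ∑ x (λ j → 𝟙 (z <? j) ⊗ ⅟ (j * j))
        t₂ = ∑ x (λ i → S (b + i))
        G₁ = # 19201 ⊗ g (suc a)
        G₂ = # 19201 ⊗ g (suc b)

        early≼ : E early ≼ # x ⊗ ⅟ P ⊗ (s₁ ⊕ t₁) ⊕ # P ⊗ # C
        early≼ = bound-⊕ {square-part Y z} {λ m → ∑ (b ∸ a) (λ i → block-part (a + i) m)} {s₁} {t₁} {total z (λ _ → 1)} (bound-squares Y z) (bound-∑ (b ∸ a) {λ i → block-part (a + i)} (λ i _ → bound-block (a + i)))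
          where open Mean fine (0≼# P)

        late≼ : E late ≼ # x ⊗ (s₂ ⊕ t₂) ⊕ # 0 ⊗ # (total x (λ _ → 1) + total x (λ i → block-size (b + i)))
        late≼ = bound-⊕ {square-part z x} {λ m → ∑ x (λ i → block-part (b + i) m)} {s₂} {t₂} {total x (λ _ → 1)} (bound-squares z x) (bound-∑ x {λ i → block-part (b + i)} (λ i _ → bound-block (b + i)))
          where open Mean coarse ≼-refl

        8≤Y : 8 ≤ Y
        8≤Y = ℕP.≤-trans (ℕP.≤-trans 8≤a (ℕP.n≤1+n a)) (n≤lo (suc a))
        1≤Y : 1 ≤ Y
        1≤Y = ℕP.≤-trans (s≤s z≤n) 8≤Y
        1≤z : 1 ≤ z
        1≤z = ℕP.*-mono-≤ {1} {16} (s≤s z≤n) 1≤P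

        -- Both parts are at most 1/8: the squares because of 8 ≤ Y, the blocks by `cut₁`.
        early-mass : # 4 ⊗ (s₁ ⊕ t₁) ≼ # 1
        early-mass = (lin 1 (8 · (squares≼ Y z 1≤Y) ⊞ 8 · (∑S≼ a (b ∸ a)) ⊞ 1 · cut₁ ⊞ 8 · (⅟-anti (s≤s z≤n) 8≤Y) ⊞ 1 · (≡≼ (⅟-law {8} (s≤s z≤n)))) (solve 5 (λ a b c d e → κ 2 :* (κ 1 :- κ 4 :* (a :+ b)) := κ 8 :* (c :- a) :+ (κ 8 :* (d :- b) :+ (κ 1 :- κ 8 :* d :+ (κ 8 :* (e :- c) :+ (κ 1 :- κ 8 :* e))))) refl s₁ t₁ (⅟ Y) G₁ (⅟ 8)))

        16P : # z ≡ # 16 ⊗ # P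
        16P = #-* 16 P

        late-mass : # 8 ⊗ # P ⊗ (s₂ ⊕ t₂) ≼ # 1
        late-mass = (lin 1 (16 · (⊗-monoʳ (0≼# P) (squares≼ z x 1≤z)) ⊞ 16 · (⊗-monoʳ (0≼# P) (∑S≼ b x)) ⊞ 1 · cut₂ ⊞ 1 · (≡≽ (cong (_⊗ G₂) 16P)) ⊞ 1 · (≡≼ (⅟-law 1≤z)) ⊞ 1 · (≡≽ (cong (_⊗ ⅟ z) 16P))) (solve 6 (λ a b c d e f → κ 2 :* (κ 1 :- κ 8 :* a :* (b :+ c)) := κ 16 :* (a :* d :- a :* b) :+ (κ 16 :* (a :* e :- a :* c) :+ (κ 1 :- f :* e :+ (f :* e :- κ 16 :* a :* e :+ (κ 1 :- f :* d :+ (f :* d :- κ 16 :* a :* d)))))) refl (# P) s₂ t₂ (⅟ z) G₂ (# z)))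

        large : # 8 ⊗ (# P ⊗ (# P ⊗ (# 1 ⊕ # C))) ≼ # x
        large = ≼-trans (≡≼ (sym (trans (#-* 8 _) (cong (# 8 ⊗_) (trans (#-* P _) (cong (# P ⊗_) (trans (#-* P (suc C)) (cong (# P ⊗_) (#-suc C))))))))) (#-mono X₀≤x)

      survivor? : ∀ m → Dec (m ≈ 1 × ¬ (# 1 ≼ excess m))
      survivor? m = (m ≈? 1) ×-dec ¬? ((# 1) ≼? excess m)

      private
        A B : F
        A = ∑ x (λ m → δ m 1)
        B = E excess

        survived : ℕ
        survived = length (filter survivor? (map suc (upTo x)))

        pointwise : ∀ m → δ m 1 ⊖ δ m 1 ⊗ excess m ≼ 𝟙 (survivor? m)
        pointwise m = aux (m ≈? 1) ((# 1) ≼? excess m)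
          where
          e = excess m
          aux : (d : Dec (m ≈ 1)) (d′ : Dec (# 1 ≼ e)) → 𝟙 d ⊖ 𝟙 d ⊗ e ≼ 𝟙 (d ×-dec ¬? d′)
          aux (yes _) (yes p) = (lin 0 (1 · p) (solve 1 (λ a → κ 0 :- (κ 1 :- κ 1 :* a) := a :- κ 1) refl e))
          aux (yes _) (no _)  = (lin 0 (1 · (excess-nn m)) (solve 1 (λ a → κ 1 :- (κ 1 :- κ 1 :* a) := a :- κ 0) refl e))
          aux (no _)  _       = (lin 0 (const 0) (solve 1 (λ a → κ 0 :- (κ 0 :- κ 0 :* a) := κ 0) refl e))

        A-B≼ : A ⊖ B ≼ # survived
        A-B≼ = ≼-trans (≡≼ (sym (∑-⊖ x (λ m → δ m 1) (λ m → δ m 1 ⊗ excess m)))) (≼-trans (∑-mono x (λ m _ _ → pointwise m)) (≡≽ (length-filter survivor? x)))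

        B≼ : # 8 ⊗ (# P ⊗ B) ≼ # 3 ⊗ # x ⊕ # 8 ⊗ (# P ⊗ (# P ⊗ # C))
        B≼ = (lin 0 (8 · (≡≼ (cong (# P ⊗_) (E-⊕ early late))) ⊞ 8 · (⊗-monoʳ (0≼# P) early≼) ⊞ 8 · (⊗-monoʳ (0≼# P) (≼-trans late≼ drop)) ⊞ 8 · (≡≼ (cong ((# x ⊗ m₁) ⊗_) (⅟-law 1≤P))) ⊞ 2 · (⊗-monoʳ (0≼# x) early-mass) ⊞ 1 · (⊗-monoʳ (0≼# x) late-mass)) (solve 9 (λ a b c d e f g h i → κ 3 :* c :+ κ 8 :* (a :* (a :* d)) :- κ 8 :* (a :* b) := κ 8 :* (a :* (e :+ f) :- a :* b) :+ (κ 8 :* (a :* (c :* g :* h :+ a :* d) :- a :* e) :+ (κ 8 :* (a :* (c :* i) :- a :* f) :+ (κ 8 :* (c :* h :* κ 1 :- c :* h :* (a :* g)) :+ (κ 2 :* (c :* κ 1 :- c :* (κ 4 :* h)) :+ (c :* κ 1 :- c :* (κ 8 :* a :* i))))))) refl (# P) B (# x) (# C) (E early) (E late) (⅟ P) m₁ m₂))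
          where
          m₁ m₂ : F
          m₁ = s₁ ⊕ t₁
          m₂ = s₂ ⊕ t₂
          drop : ∀ {r} → # x ⊗ m₂ ⊕ # 0 ⊗ r ≼ # x ⊗ m₂
          drop {r} = (lin 0 (const 0) (solve 3 (λ a b c → a :* b :- (a :* b :+ κ 0 :* c) := κ 0) refl (# x) m₂ r))

        -- The progression has about x / P members. Early moduli remove at most x / (4 P), late ones
        -- x / (8 P), and the errors take another x / (8 P), so x / (2 P) members survive.
        many : # x ≼ # 2 ⊗ # P ⊗ # survived
        many = (lin 3 (8 · (⊗-monoʳ (0≼# P) A-B≼) ⊞ 8 · (proj₂ (class-count 1 x)) ⊞ 1 · B≼ ⊞ 1 · large) (solve 6 (λ a b c d e f → κ 4 :* (κ 2 :* b :* c :- a) := κ 8 :* (b :* c :- b :* (d :- e)) :+ (κ 8 :* (b :* d :- a :- :- (b :* b)) :+ (κ 3 :* a :+ κ 8 :* (b :* (b :* f)) :- κ 8 :* (b :* e) :+ (a :- κ 8 :* (b :* (b :* (κ 1 :+ f))))))) refl (# x) (# P) (# survived) A B (# C)))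

      survivors : Σ (List ℕ) λ ms → Unique ms × All (λ m → 1 ≤ m × m ≤ x × (Odd m × Good m)) ms × 1 * x ≤ 2 * P * length ms
      survivors = filter survivor? (map suc (upTo x)) , UniqueP.filter⁺ survivor? (UniqueP.map⁺ ℕP.suc-injective (UniqueP.upTo⁺ x)) ,
          All.zipWith admit (AllP.all-filter survivor? (map suc (upTo x)) , AllP.filter⁺ survivor? (AllP.map⁺ {P = λ m → 1 ≤ m × m ≤ x} (All.map (λ lt → s≤s z≤n , lt) (AllP.all-upTo x)))) ,
          ℕP.≤-trans (ℕP.≤-reflexive (ℕP.*-identityˡ x)) (#-reflect (≼-trans many (≡≽ (trans (#-* (2 * P) survived) (cong (_⊗ # survived) (#-* 2 P))))))
        where
        admit : ∀ {m} → (m ≈ 1 × ¬ (# 1 ≼ excess m)) × (1 ≤ m × m ≤ x) → 1 ≤ m × m ≤ x × (Odd m × Good m)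
        admit ((m≈1 , small) , 1≤m , m≤x) = 1≤m , m≤x , Survivor.m-odd 8≤a P-div 1≤m m≤x m≈1 small , Survivor.m-good 8≤a P-div 1≤m m≤x m≈1 small

  with-late-cut : ∀ a → 8 ≤ a → # 8 ⊗ (# 19201 ⊗ g (suc a)) ≼ # 1 → ∀ P → 1 ≤ P → (∀ p → 1 ≤ p → p ≤ lo (suc a) → p ∣ P) →
    (∃ λ b → a ≤ b × # (16 * P) ⊗ (# 19201 ⊗ g (suc b)) ≼ # 1) → PositiveLowerDensity (λ m → Odd m × Good m)
  with-late-cut a 8≤a cut₁ P 1≤P P-div (b , _ , cut₂) = 1 , 2 * P , s≤s z≤n , ℕP.*-mono-≤ {1} {2} (s≤s z≤n) 1≤P , Choice.X₀ P {{P≢0}} a b 8≤a P-div cut₁ cut₂ , Choice.survivors P {{P≢0}} a b 8≤a P-div cut₁ cut₂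
    where P≢0 = ℕ.>-nonZero 1≤P

  ≤⇒∣! : ∀ n p → 1 ≤ p → p ≤ n → p ∣ n !
  ≤⇒∣! n (suc p) _ p≤n = ∣-trans (m∣m*n (p !)) (m≤n⇒m!∣n! p≤n)

  with-early-cut : (∃ λ a → 8 ≤ a × # 8 ⊗ (# 19201 ⊗ g (suc a)) ≼ # 1) → PositiveLowerDensity (λ m → Odd m × Good m)
  with-early-cut (a , 8≤a , cut₁) = with-late-cut a 8≤a cut₁ P (ℕP.1≤n! (lo (suc a))) (≤⇒∣! (lo (suc a))) (tail-cut (16 * P) a)
    where P = lo (suc a) !

theorem3 : PositiveLowerDensity (λ m → Odd m × Good m)
theorem3 = Final.with-early-cut (Tails.tail-cut 8 8)
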